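{- Let $m \in \{3,5,7,11\}$, and let $k_m = 5$ if $m=3$ and $k_m = m-2$ if $m>3$. Let $\ell$ be an odd prime such that $$\ell^{k_m-2} \equiv -1 + \epsilon_{m,\ell}\, \ell^{\frac{k_m-3}{2}} \pmod m$$ for some $\epsilon_{m,\ell} \in \{\pm1\}$. Then $$\overline{p}\left(m \ell^2 n\right) \equiv 0 \pmod m$$ for every positive integer $n$ prime to $\ell$ such that $\left(\frac{(-1)^{\frac{k_m-1}{2}}n}{\ell}\right) = \epsilon_{m,\ell}$.
   Context: $\overline{p}(n)$ denotes the number of overpartitions of $n$; its generating function is $\sum_{n\ge0}\overline{p}(n)q^n=\prod_{n\ge1}\frac{1+q^n}{1-q^n}$. $\left(\frac{\cdot}{\ell}\right)$ is the Legendre symbol. -}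

module Defs where

open import Data.Nat as ℕ using (ℕ; zero; suc; _+_; _*_; _∸_; _≤ᵇ_; _≡ᵇ_)
open import Data.Nat.DivMod using (_/_; _%_)
open import Data.Bool using (Bool; true; false; if_then_else_)
open import Data.List using (List; map; upTo)
open import Data.Nat.ListAction using (sum)
open import Data.Bool.ListAction using (any)
open import Data.Integer as ℤ using (ℤ; +_; -[1+_]; _%ℕ_)

-- opCoeff k n = coefficient of q^n in  ∏_{j=1}^{k} (1+q^j)/(1-q^j).
-- Since (1+q^j)/(1-q^j) = 1 + 2 q^j + 2 q^{2j} + ..., multiplying by the
-- k+1-st factor gives the recursion below (t = multiplicity of part k+1).
opCoeff : ℕ → ℕ → ℕ
opCoeff zero zero = 1
opCoeff zero (suc n) = 0
opCoeff (suc k) n =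
  opCoeff k n +
  2 * sum (map (λ i → if (suc i * suc k) ≤ᵇ n
                        then opCoeff k (n ∸ suc i * suc k)
                        else 0)
               (upTo n))

-- Number of overpartitions of n: the coefficient of q^n in
-- ∏_{j≥1} (1+q^j)/(1-q^j); factors with j > n do not affect it.
overpartition : ℕ → ℕ
overpartition n = opCoeff n n

-- Legendre symbol (a / p) for p an (odd) prime:
-- 0 if p ∣ a, 1 if a is a nonzero square mod p, -1 otherwise.
-- (Value for p = 0 is junk and never used.)
legendre : ℤ → ℕ → ℤ
legendre a zero = + 0
legendre a (suc p) with a %ℕ suc p
... | zero = + 0
... | suc r =
  if any (λ x → ((x * x) % suc p) ≡ᵇ suc r) (upTo (suc p))
  then + 1 else -[1+ 0 ]

kOf : ℕ → ℕ
kOf m = if m ≡ᵇ 3 then 5 else m ∸ 2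

-- Modulo m, up to the sign (-1)^n, the generating function of p̄(m n) is θ E, where θ = Σ q^{s²} and E is θ⁴,
-- θ² or an Eisenstein series: with D = q d/dq, Ramanujan-type equations turn 1 - D^{m-1}, which extracts the
-- exponents divisible by m, into a polynomial identity. The coefficients c(n) of θ E are sums over the integral
-- binary quadratic forms (a , b , c) of discriminant n and 4n with a < 0 < c, weighted by c, c³ or χ₋₄(a).
-- Forms of discriminant ℓ²D are counted through the index ℓ sublattices on which ℓ² divides them; this leaves sums
-- over forms of discriminant D that are negative at (1 , 0) and positive at (j , ℓ), which Euclid's algorithm on
-- (j , ℓ) evaluates. The outcome is the Hecke relation c(ℓ²n) = (1 + ℓ^{k-2} - ε ℓ^{(k-3)/2}) c(n) for ℓ ∤ n, and
-- the hypothesis says that the factor vanishes modulo m.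
module Submission where

import Data.Nat.Divisibility as ND
import Data.Integer.Divisibility.Signed as ZD
import Data.Integer.Divisibility as Zu
import Data.Bool.Properties as BoolP
import Data.List.Relation.Unary.All as All
import Data.List.Relation.Unary.Unique.Propositional.Properties as Uniq
import Algebra.Solver.Ring
import Data.Nat.Coprimality as CP

-- With `x` = θ⁴ and `y` = θ(-q)⁴, every derivative of 1/θ is 1/θ times a polynomial in `P` = Dθ/θ,
-- `x`, `y`. Here `P` is only quasimodular and has to be eliminated. Fermat does this: `D^m` acts as
-- `D` modulo m, and comparing the two on 1/θ and on x/y forces P ≡ K and H ≡ 1 for forms `K` and
-- `H` of weights m + 1 and m - 1 in `x`, `y`. What remains is a finite computation with polynomials
-- over ℤ/m. Two obstacles shape the counting of forms. If n is a square, forms that vanish at an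
-- integral vector leave boundary terms; these are absorbed into modified sums (`H0`, `H1`, `H3`),
-- which then satisfy the Hecke relation exactly.

module N where
 open import Data.Nat public
 open import Data.Nat.Properties public

module Z where
 open import Data.Integer public
 open import Data.Integer.Properties public

module Prelude where
 open import Data.Nat public using (ℕ; zero; suc; z≤n; s≤s)
 open import Data.Integer public using (ℤ; +_; -[1+_]; _+_; _*_; _-_; -_; ∣_∣; _<_; _<?_; _≟_; +<+; -<+; _^_) renaming (0ℤ to 0#; 1ℤ to 1#)
 open import Data.Product public using (∃; _×_; _,_) renaming (proj₁ to fst; proj₂ to snd)
 open import Data.Sum public using (_⊎_) renaming (inj₁ to inl; inj₂ to inr)
 open import Data.Empty public using (⊥; ⊥-elim)
 open import Function public using (_∘_; id)
 open import Data.Nat.DivMod public using (_/_; _%_; m≡m%n+[m/n]*n; m%n<n; [m+kn]%n≡m%n; m<n⇒m%n≡m; m*n/n≡m; n%1≡0)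
 open import Data.Nat.Induction public using (<-rec)
 open import Data.Nat.Primality public using (Prime)
 open import Data.Nat.Coprimality public using (Coprime; prime⇒coprime)
 open import Data.Integer.DivMod public using (_%ℕ_; _/ℕ_; n%ℕd<d; a≡a%ℕn+[a/ℕn]*n)
 open import Algebra.Bundles public using (CommutativeRing)
 open import Relation.Nullary public using (¬_; Dec; yes; no)
 open import Relation.Nullary.Decidable public using (_×-dec_; ¬?; decidable-stable)
 open import Relation.Binary.PropositionalEquality public using (_≡_; _≢_; refl; sym; trans; cong; subst) renaming (cong₂ to cong2; subst₂ to subst2)
 open import Data.Integer.Tactic.RingSolver public using () renaming (solve-∀ to ring)
 open import Data.Nat.Tactic.RingSolver public using () renaming (solve-∀ to ringN!)

 infixr 5 _&_
 _&_ : {A : Set} {x y z : A} -> x ≡ y -> y ≡ z -> x ≡ z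
 _&_ = trans

 0<s : ∀ {n} -> 1 N.≤ suc n
 0<s = s≤s z≤n

 0<≡ : ∀ {x y} -> x ≡ y -> 0# < x -> 0# < y
 0<≡ = subst (0# <_)

 ≡<0 : ∀ {x y} -> x ≡ y -> x < 0# -> y < 0#
 ≡<0 = subst (_< 0#)

-- Finite sums over sets given by a predicate.

module Sums where
 open Prelude public
 open import Data.List using (List; []; _∷_; _++_; map; upTo; filter)
 open import Data.List.Membership.Propositional using (_∈_)
 open import Data.List.Membership.Propositional.Properties using (∈-map⁺; ∈-map⁻; ∈-++⁺ˡ; ∈-++⁺ʳ; ∈-++⁻; ∈-filter⁺; ∈-filter⁻; ∈-upTo⁺; ∈-upTo⁻; ∈-∃++)
 open import Data.List.Relation.Unary.Any using (here; there)
 open import Data.List.Relation.Unary.All using ([]; _∷_)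
 open import Data.List.Relation.Unary.AllPairs using ([]; _∷_)
 open import Data.List.Relation.Unary.Unique.Propositional using (Unique)
 open import Relation.Binary.PropositionalEquality using (module ≡-Reasoning)

 private variable
  A B C : Set

 sumL : List A -> (A -> ℤ) -> ℤ
 sumL []       v = 0#
 sumL (x ∷ xs) v = v x + sumL xs v

 -- A finite set is a predicate with a duplicate-free list of its members. By `∑-same` two lists for
 -- the same predicate give the same sum, so nothing later depends on the order or on the box from
 -- which the members were filtered.
 record Enum {A : Set} (P : A -> Set) : Set where
  no-eta-equality
  field
   elems    : List A
   unique   : Unique elems
   sound    : ∀ x -> x ∈ elems -> P x
   complete : ∀ x -> P x -> x ∈ elems
 open Enum public

 abstract
  -- Opaque, so that the large boxes behind the enumerations are never evaluated; outside the
  -- abstract blocks `∑-elems` is the only way back to the list.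
  ∑ : {P : A -> Set} -> Enum P -> (A -> ℤ) -> ℤ
  ∑ F v = sumL (elems F) v

  ∑-elems : {P : A -> Set} (F : Enum P) (v : A -> ℤ) -> ∑ F v ≡ sumL (elems F) v
  ∑-elems F v = refl

 sumL-cong : (xs : List A) {v w : A -> ℤ} -> (∀ x -> x ∈ xs -> v x ≡ w x) -> sumL xs v ≡ sumL xs w
 sumL-cong []       h = refl
 sumL-cong (x ∷ xs) h = cong2 _+_ (h x (here refl)) (sumL-cong xs (\ y m -> h y (there m)))

 sumL-++ : (xs ys : List A) (v : A -> ℤ) -> sumL (xs ++ ys) v ≡ sumL xs v + sumL ys v
 sumL-++ []       ys v = sym (Z.+-identityˡ _)
 sumL-++ (x ∷ xs) ys v = cong (\ z -> v x + z) (sumL-++ xs ys v) & sym (Z.+-assoc (v x) _ _)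

 sumL-map : (f : A -> B) (xs : List A) (v : B -> ℤ) -> sumL (map f xs) v ≡ sumL xs (v ∘ f)
 sumL-map f []       v = refl
 sumL-map f (x ∷ xs) v = cong (\ z -> v (f x) + z) (sumL-map f xs v)

 sumL-+ : (xs : List A) (v w : A -> ℤ) -> sumL xs (\ x -> v x + w x) ≡ sumL xs v + sumL xs w
 sumL-+ []       v w = refl
 sumL-+ (x ∷ xs) v w = cong (\ z -> (v x + w x) + z) (sumL-+ xs v w) &
  lemma (v x) (w x) (sumL xs v) (sumL xs w) where
  lemma : ∀ a b c d -> (a + b) + (c + d) ≡ (a + c) + (b + d)
  lemma = ring

 sumL-* : (xs : List A) (k : ℤ) (v : A -> ℤ) -> sumL xs (\ x -> k * v x) ≡ k * sumL xs v
 sumL-* []       k v = sym (Z.*-zeroʳ k)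
 sumL-* (x ∷ xs) k v = cong (\ z -> k * v x + z) (sumL-* xs k v) & sym (Z.*-distribˡ-+ k (v x) _)

 sumL-0 : (xs : List A) -> sumL xs (\ _ -> 0#) ≡ 0#
 sumL-0 []       = refl
 sumL-0 (x ∷ xs) = Z.+-identityˡ _ & sumL-0 xs

 sumL-swap : (xs : List A) (ys : List B) (v : A -> B -> ℤ) ->
  sumL xs (\ x -> sumL ys (v x)) ≡ sumL ys (\ y -> sumL xs (\ x -> v x y))
 sumL-swap []       ys v = sym (sumL-0 ys)
 sumL-swap (x ∷ xs) ys v = cong (\ z -> sumL ys (v x) + z) (sumL-swap xs ys v) &
  sym (sumL-+ ys (v x) _)

 module _ {P : A -> Set} (F : Enum P) where
  abstract
   ∑-cong : {v w : A -> ℤ} -> (∀ x -> P x -> v x ≡ w x) -> ∑ F v ≡ ∑ F w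
   ∑-cong h = sumL-cong (elems F) (\ x m -> h x (sound F x m))
   ∑-+ : (v w : A -> ℤ) -> ∑ F (\ x -> v x + w x) ≡ ∑ F v + ∑ F w
   ∑-+ = sumL-+ (elems F)
   ∑-* : (k : ℤ) (v : A -> ℤ) -> ∑ F (\ x -> k * v x) ≡ k * ∑ F v
   ∑-* = sumL-* (elems F)
   ∑-*ʳ : (k : ℤ) (v : A -> ℤ) -> ∑ F (\ x -> v x * k) ≡ ∑ F v * k
   ∑-*ʳ k v = ∑-cong (\ x _ -> Z.*-comm (v x) k) & ∑-* k v & Z.*-comm k _
   ∑-neg : (v : A -> ℤ) -> ∑ F (\ x -> - v x) ≡ - ∑ F v
   ∑-neg v = ∑-cong (\ x _ -> sym (Z.-1*i≡-i (v x))) & (∑-* -[1+ 0 ] v) & Z.-1*i≡-i (∑ F v)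
   ∑-- : (v w : A -> ℤ) -> ∑ F (\ x -> v x - w x) ≡ ∑ F v - ∑ F w
   ∑-- v w = ∑-+ v _ & cong (_+_ (∑ F v)) (∑-neg w)
   ∑-0 : {v : A -> ℤ} -> (∀ x -> P x -> v x ≡ 0#) -> ∑ F v ≡ 0#
   ∑-0 h = ∑-cong h & sumL-0 (elems F)

 abstract
  ∑-swap : {P : A -> Set} {Q : B -> Set} (F : Enum P) (G : Enum Q) (v : A -> B -> ℤ) ->
   ∑ F (\ x -> ∑ G (v x)) ≡ ∑ G (\ y -> ∑ F (\ x -> v x y))
  ∑-swap F G = sumL-swap (elems F) (elems G)

 private
  ∉-All≢ : {x : A} {xs : List A} -> All.All (x ≢_) xs -> ¬ (x ∈ xs)
  ∉-All≢ (p ∷ ps) (here refl) = p refl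
  ∉-All≢ (p ∷ ps) (there m)   = ∉-All≢ ps m

  unique-middle : (xs : List A) {y : A} {ys : List A} -> Unique (xs ++ y ∷ ys) ->
   Unique (xs ++ ys) × (∀ z -> z ∈ xs ++ ys -> z ≢ y)
  unique-middle []       (p ∷ u) = u , \ { z m refl -> ∉-All≢ p m }
  unique-middle (x ∷ xs) {y} {ys} (p ∷ u) with unique-middle xs u
  ... | u' , n = All.tabulate (\ {z} m -> \ { refl -> ∉-All≢ p (weaken z m) }) ∷ u' ,
   \ { z (here refl) refl -> ∉-All≢ p (∈-++⁺ʳ xs (here refl)) ; z (there m) -> n z m } where
   weaken : ∀ z -> z ∈ xs ++ ys -> z ∈ xs ++ y ∷ ys
   weaken z m with ∈-++⁻ xs m
   ... | inl l = ∈-++⁺ˡ l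
   ... | inr r = ∈-++⁺ʳ xs (there r)

  remove : (xs : List A) {y z : A} {ys : List A} -> z ∈ xs ++ y ∷ ys -> z ≢ y -> z ∈ xs ++ ys
  remove xs m n with ∈-++⁻ xs m
  ... | inl l           = ∈-++⁺ˡ l
  ... | inr (here refl) = ⊥-elim (n refl)
  ... | inr (there r)   = ∈-++⁺ʳ xs r

  include : (xs : List A) {y z : A} {ys : List A} -> z ∈ xs ++ ys -> z ∈ xs ++ y ∷ ys
  include xs m with ∈-++⁻ xs m
  ... | inl l = ∈-++⁺ˡ l
  ... | inr r = ∈-++⁺ʳ xs (there r)

 -- Induction on `xs`: the image of the head is cut out of `ys`. Absence of duplicates on both sides
 -- is what makes the two remaining lists satisfy the hypotheses again.
 sumL-bij : (xs : List A) (ys : List B) -> Unique xs -> Unique ys -> (φ : A -> B) (ψ : B -> A)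
  (v : A -> ℤ) (w : B -> ℤ) ->
  (∀ x -> x ∈ xs -> φ x ∈ ys × ψ (φ x) ≡ x × w (φ x) ≡ v x) ->
  (∀ y -> y ∈ ys -> ψ y ∈ xs × φ (ψ y) ≡ y) ->
  sumL xs v ≡ sumL ys w
 sumL-bij []       []       _ _ φ ψ v w to from = refl
 sumL-bij []       (y ∷ ys) _ _ φ ψ v w to from with () ← fst (from y (here refl))
 sumL-bij (x ∷ xs) ys (p ∷ ux) uy φ ψ v w to from with to x (here refl)
 ... | φx∈ , ψφx , wv with ∈-∃++ φx∈
 ... | ys1 , ys2 , refl with unique-middle ys1 uy
 ... | uy' , fresh = begin
  v x + sumL xs v                             ≡⟨ cong2 _+_ (sym wv) rec ⟩
  w (φ x) + sumL (ys1 ++ ys2) w               ≡⟨ cong (_+_ (w (φ x))) (sumL-++ ys1 ys2 w) ⟩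
  w (φ x) + (sumL ys1 w + sumL ys2 w)       ≡⟨ shuffle (w (φ x)) (sumL ys1 w) (sumL ys2 w) ⟩
  sumL ys1 w + (w (φ x) + sumL ys2 w)       ≡⟨ sym (sumL-++ ys1 (φ x ∷ ys2) w) ⟩
  sumL (ys1 ++ φ x ∷ ys2) w                     ∎ where
  open ≡-Reasoning
  shuffle : ∀ a b c -> a + (b + c) ≡ b + (a + c)
  shuffle = ring
  rec : sumL xs v ≡ sumL (ys1 ++ ys2) w
  rec = sumL-bij xs (ys1 ++ ys2) ux uy' φ ψ v w
   (\ z m -> remove ys1 (fst (to z (there m)))
     (\ e -> ∉-All≢ p (subst (_∈ xs)
      (sym (fst (snd (to z (there m)))) & cong ψ e & ψφx) m))
    , snd (to z (there m)))
   (\ y m -> drop-x y m (from y (include ys1 m)) , snd (from y (include ys1 m))) where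
   drop-x : ∀ y -> y ∈ ys1 ++ ys2 -> ψ y ∈ x ∷ xs × φ (ψ y) ≡ y -> ψ y ∈ xs
   drop-x y m (there r , _) = r
   drop-x y m (here e , φψ) = ⊥-elim (fresh y m (sym φψ & cong φ e))

 abstract
  ∑-reindex : {P : A -> Set} {Q : B -> Set} (F : Enum P) (G : Enum Q) (φ : A -> B) (ψ : B -> A) ->
   {v : A -> ℤ} {w : B -> ℤ} ->
   (∀ x -> P x -> Q (φ x)) -> (∀ y -> Q y -> P (ψ y)) ->
   (∀ x -> P x -> ψ (φ x) ≡ x) -> (∀ y -> Q y -> φ (ψ y) ≡ y) ->
   (∀ x -> P x -> w (φ x) ≡ v x) ->
   ∑ F v ≡ ∑ G w
  ∑-reindex F G φ ψ to from ψφ φψ val =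
   sumL-bij (elems F) (elems G) (unique F) (unique G) φ ψ _ _
    (\ x m -> let p = sound F x m in complete G (φ x) (to x p) , ψφ x p , val x p)
    (\ y m -> let q = sound G y m in complete F (ψ y) (from y q) , φψ y q)

 ∑-same : {P Q : A -> Set} (F : Enum P) (G : Enum Q) {v : A -> ℤ} ->
  (∀ x -> P x -> Q x) -> (∀ x -> Q x -> P x) -> ∑ F v ≡ ∑ G v
 ∑-same F G to from = ∑-reindex F G id id to from (\ _ _ -> refl) (\ _ _ -> refl) (\ _ _ -> refl)

 ∑-empty : {P : A -> Set} (F : Enum P) {v : A -> ℤ} -> (∀ x -> ¬ P x) -> ∑ F v ≡ 0#
 ∑-empty F n = ∑-0 F (\ x p -> ⊥-elim (n x p))

 infixl 5 _↾_
 _↾_ : {P R : A -> Set} -> Enum P -> (∀ x -> Dec (R x)) -> Enum (\ x -> P x × R x)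
 elems    (F ↾ R?)            = filter R? (elems F)
 unique   (F ↾ R?)            = Uniq.filter⁺ R? (unique F)
 sound    (F ↾ R?) x m        = let m' , r = ∈-filter⁻ R? {xs = elems F} m in sound F x m' , r
 complete (F ↾ R?) x (p , r)  = ∈-filter⁺ R? (complete F x p) r

 convert : {P Q : A -> Set} -> Enum P -> (∀ x -> P x -> Q x) -> (∀ x -> Q x -> P x) -> Enum Q
 elems    (convert F to from)     = elems F
 unique   (convert F to from)     = unique F
 sound    (convert F to from) x m = to x (sound F x m)
 complete (convert F to from) x q = complete F x (from x q)

 within : {P R : A -> Set} -> Enum P -> (∀ x -> Dec (R x)) -> (∀ x -> R x -> P x) -> Enum R
 within F R? sub = convert (F ↾ R?) (\ _ -> snd) (\ x r -> sub x r , r)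

 𝟙 : {X : Set} -> Dec X -> ℤ
 𝟙 (yes _) = 1#
 𝟙 (no _)  = 0#

 𝟙-yes : {X : Set} (d : Dec X) -> X -> 𝟙 d ≡ 1#
 𝟙-yes (yes _) _ = refl
 𝟙-yes (no n)  x = ⊥-elim (n x)

 𝟙-no : {X : Set} (d : Dec X) -> ¬ X -> 𝟙 d ≡ 0#
 𝟙-no (yes x) n = ⊥-elim (n x)
 𝟙-no (no _)  _ = refl

 𝟙-cong : {X Y : Set} (d : Dec X) (e : Dec Y) -> (X -> Y) -> (Y -> X) -> 𝟙 d ≡ 𝟙 e
 𝟙-cong (yes x) e f g = sym (𝟙-yes e (f x))
 𝟙-cong (no n)  e f g = sym (𝟙-no e (n ∘ g))

 sumL-filter : {R : A -> Set} (R? : ∀ x -> Dec (R x)) (xs : List A) (v : A -> ℤ) ->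
  sumL (filter R? xs) v ≡ sumL xs (\ x -> 𝟙 (R? x) * v x)
 sumL-filter R? []       v = refl
 sumL-filter R? (x ∷ xs) v with R? x
 ... | yes _ = cong2 _+_ (sym (Z.*-identityˡ (v x))) (sumL-filter R? xs v)
 ... | no _  = sumL-filter R? xs v & sym (Z.+-identityˡ _)

 abstract
  ∑-𝟙 : {P R : A -> Set} (F : Enum P) (R? : ∀ x -> Dec (R x)) {v : A -> ℤ} ->
   ∑ (F ↾ R?) v ≡ ∑ F (\ x -> 𝟙 (R? x) * v x)
  ∑-𝟙 F R? = sumL-filter R? (elems F) _

 ∑-split : {P R : A -> Set} (F : Enum P) (R? : ∀ x -> Dec (R x)) {v : A -> ℤ} ->
  ∑ F v ≡ ∑ (F ↾ R?) v + ∑ (F ↾ (¬? ∘ R?)) v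
 ∑-split F R? {v} = sym ((cong2 _+_ (∑-𝟙 F R?) (∑-𝟙 F (¬? ∘ R?))) &
  sym (∑-+ F _ _) & ∑-cong F (\ x _ -> pointwise x)) where
  pointwise : ∀ x -> 𝟙 (R? x) * v x + 𝟙 (¬? (R? x)) * v x ≡ v x
  pointwise x with R? x
  ... | yes _ = Z.+-identityʳ _ & Z.*-identityˡ (v x)
  ... | no _  = Z.+-identityˡ _ & Z.*-identityˡ (v x)

 -- The tool behind every later count of forms: a set is cut by the sign of an integer attached to
 -- its members, and pieces of different sets are then matched with each other.
 ∑-sign : {P : A -> Set} (F : Enum P) (z : A -> ℤ) {v : A -> ℤ} ->
  ∑ F v ≡ ∑ (F ↾ \ x -> 0# <? z x) v + ∑ (F ↾ \ x -> z x ≟ 0#) v + ∑ (F ↾ \ x -> z x <? 0#) v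
 ∑-sign F z {v} = sym ((cong2 _+_ (cong2 _+_ (∑-𝟙 F (\ x -> 0# <? z x)) (∑-𝟙 F (\ x -> z x ≟ 0#)))
         (∑-𝟙 F (\ x -> z x <? 0#))) &
  cong (Z._+ ∑ F (\ x -> 𝟙 (z x <? 0#) * v x)) (sym (∑-+ F _ _)) &
  sym (∑-+ F _ _) & ∑-cong F (\ x _ -> pointwise (z x) (v x))) where
  pointwise : ∀ k u -> 𝟙 (0# <? k) * u + 𝟙 (k ≟ 0#) * u + 𝟙 (k <? 0#) * u ≡ u
  pointwise (+ zero)  u = Z.+-identityʳ _ & Z.+-identityˡ _ & Z.*-identityˡ u
  pointwise (+ suc n) u = Z.+-identityʳ _ & Z.+-identityʳ _ & Z.*-identityˡ u
  pointwise -[1+ n ]  u = Z.+-identityˡ _ & Z.*-identityˡ u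

 module _ {P : A -> Set} {R : A -> B -> Set} where
  private
   pairs : (xs : List A) -> (∀ x -> x ∈ xs -> Enum (R x)) -> List (A × B)
   pairs []       G = []
   pairs (x ∷ xs) G = map (x ,_) (elems (G x (here refl))) ++ pairs xs (\ y m -> G y (there m))
   pairs⁻ : ∀ xs G {z} -> z ∈ pairs xs G -> fst z ∈ xs × R (fst z) (snd z)
   pairs⁻ (x ∷ xs) G m with ∈-++⁻ (map (x ,_) (elems (G x (here refl)))) m
   ... | inl l with ∈-map⁻ (x ,_) l
   ... | y , y∈ , refl = here refl , sound (G x (here refl)) y y∈
   pairs⁻ (x ∷ xs) G m | inr r = let a , b = pairs⁻ xs _ r in there a , b
   pairs⁺ : ∀ xs G {x y} -> x ∈ xs -> R x y -> (x , y) ∈ pairs xs G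
   pairs⁺ (x ∷ xs) G (here refl) r = ∈-++⁺ˡ (∈-map⁺ (x ,_) (complete (G x (here refl)) _ r))
   pairs⁺ (x ∷ xs) G (there m)   r = ∈-++⁺ʳ (map (x ,_) (elems (G x (here refl)))) (pairs⁺ xs _ m r)
   pairs-unique : ∀ xs G -> Unique xs -> Unique (pairs xs G)
   pairs-unique []       G u       = []
   pairs-unique (x ∷ xs) G (p ∷ u) = Uniq.++⁺
    (Uniq.map⁺ (cong snd) (unique (G x (here refl)))) (pairs-unique xs _ u)
    \ { (l , r) -> let _ , _ , e = ∈-map⁻ (x ,_) l in
       ∉-All≢ p (subst (_∈ xs) (cong fst e) (fst (pairs⁻ xs _ r))) }
   sumL-pairs : ∀ xs (G : ∀ x -> P x -> Enum (R x)) (s : ∀ x -> x ∈ xs -> P x) (v : A × B -> ℤ)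
    (h : A -> ℤ) -> (∀ x (p : P x) -> h x ≡ sumL (elems (G x p)) (\ y -> v (x , y))) ->
    sumL (pairs xs (\ x m -> G x (s x m))) v ≡ sumL xs h
   sumL-pairs []       G s v h e = refl
   sumL-pairs (x ∷ xs) G s v h e = sumL-++ (map (x ,_) (elems (G x (s x (here refl))))) _ v &
    (cong2 _+_ (sumL-map (x ,_) (elems (G x (s x (here refl)))) v & sym (e x (s x (here refl))))
     (sumL-pairs xs G (\ y m -> s y (there m)) v h e))

  _▹_ : Enum P -> (∀ x -> P x -> Enum (R x)) -> Enum (\ z -> P (fst z) × R (fst z) (snd z))
  elems    (F ▹ G)           = pairs (elems F) (\ x m -> G x (sound F x m))
  unique   (F ▹ G)           = pairs-unique (elems F) _ (unique F)
  sound    (F ▹ G) z m       = let a , b = pairs⁻ (elems F) _ m in sound F _ a , b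
  complete (F ▹ G) z (p , r) = pairs⁺ (elems F) _ (complete F _ p) r

  abstract
   ∑-▹ : (F : Enum P) (G : ∀ x -> P x -> Enum (R x)) (v : A × B -> ℤ) (h : A -> ℤ) ->
    (∀ x p -> h x ≡ ∑ (G x p) (\ y -> v (x , y))) -> ∑ (F ▹ G) v ≡ ∑ F h
   ∑-▹ F G v h e = sumL-pairs (elems F) G (sound F) v h e

 below : (n : ℕ) -> Enum (\ i -> i N.< n)
 elems    (below n)     = upTo n
 unique   (below n)     = Uniq.upTo⁺ n
 sound    (below n) _ m = ∈-upTo⁻ m
 complete (below n) _ p = ∈-upTo⁺ p

 single : (a : A) -> Enum (\ x -> x ≡ a)
 elems    (single a)        = a ∷ []
 unique   (single a)        = [] ∷ []
 sound    (single a) x (here e) = e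
 complete (single a) x e    = here e

 abstract
  ∑-single : {P : A -> Set} (F : Enum P) {v : A -> ℤ} (a : A) -> P a -> (∀ x -> P x -> x ≡ a) -> ∑ F v ≡ v a
  ∑-single F {v} a pa only = ∑-same F (single a) only (\ { x refl -> pa }) & Z.+-identityʳ (v a)

 absBelow : (N : ℕ) -> Enum (\ z -> Z.∣ z ∣ N.≤ N)
 elems (absBelow N) = map +_ (upTo (suc N)) ++ map -[1+_] (upTo N)
 unique (absBelow N) = Uniq.++⁺ (Uniq.map⁺ Z.+-injective (Uniq.upTo⁺ (suc N))) (Uniq.map⁺ Z.-[1+-injective (Uniq.upTo⁺ N))
  \ { (l , r) -> clash {xs = upTo (suc N)} {ys = upTo N} (∈-map⁻ +_ l) (∈-map⁻ -[1+_] r) } where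
  clash : ∀ {z} {xs ys : List ℕ} -> ∃ (\ x -> x ∈ xs × z ≡ + x) -> ∃ (\ y -> y ∈ ys × z ≡ -[1+ y ]) -> ⊥
  clash (_ , _ , refl) (_ , _ , ())
 sound (absBelow N) z m with ∈-++⁻ (map +_ (upTo (suc N))) m
 ... | inl l with ∈-map⁻ +_ l
 ... | x , x∈ , refl = N.≤-pred (∈-upTo⁻ x∈)
 sound (absBelow N) z m | inr r with ∈-map⁻ -[1+_] r
 ... | x , x∈ , refl = ∈-upTo⁻ x∈
 complete (absBelow N) (+ n)    p = ∈-++⁺ˡ (∈-map⁺ +_ (∈-upTo⁺ (s≤s p)))
 complete (absBelow N) -[1+ n ] p = ∈-++⁺ʳ (map +_ (upTo (suc N))) (∈-map⁺ -[1+_] (∈-upTo⁺ p))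

 abstract
  ∑-below-suc : (n : ℕ) (v : ℕ -> ℤ) -> ∑ (below (suc n)) v ≡ v 0 + ∑ (below n) (v ∘ suc)
  ∑-below-suc n v = cong (_+_ (v 0)) (cong (\ xs -> sumL xs v) (sym (map-applyUpTo id suc n)) &
   sumL-map suc (upTo n) v)
   where open import Data.List.Properties using (map-applyUpTo)

 abstract
  ∑-below-last : (n : ℕ) (v : ℕ -> ℤ) -> ∑ (below (suc n)) v ≡ ∑ (below n) v + v n
  ∑-below-last zero    v = Z.+-identityʳ (v 0) & sym (Z.+-identityˡ (v 0))
  ∑-below-last (suc n) v = begin
   ∑ (below (suc (suc n))) v                                 ≡⟨ ∑-below-suc (suc n) v ⟩
   v 0 + ∑ (below (suc n)) (v ∘ suc)                       ≡⟨ cong (_+_ (v 0)) (∑-below-last n (v ∘ suc)) ⟩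
   v 0 + (∑ (below n) (v ∘ suc) + v (suc n))             ≡⟨ sym (Z.+-assoc (v 0) _ _) ⟩
   v 0 + ∑ (below n) (v ∘ suc) + v (suc n)               ≡⟨ cong (Z._+ v (suc n)) (sym (∑-below-suc n v)) ⟩
   ∑ (below (suc n)) v + v (suc n)                         ∎
   where open ≡-Reasoning

 ∑-drop : {P R : A -> Set} (F : Enum P) (R? : ∀ x -> Dec (R x)) {v : A -> ℤ} ->
  (∀ x -> P x -> ¬ R x -> v x ≡ 0#) -> ∑ F v ≡ ∑ (F ↾ R?) v
 ∑-drop F R? z = ∑-split F R? & cong (_+_ (∑ (F ↾ R?) _)) (∑-0 (F ↾ (¬? ∘ R?)) (\ { x (p , n) -> z x p n })) & Z.+-identityʳ _

 ∑-below-zero : (v : ℕ -> ℤ) -> ∑ (below zero) v ≡ 0#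
 ∑-below-zero v = ∑-empty (below zero) (\ _ ())

 ∑-bij : {P : A -> Set} {Q : B -> Set} (F : Enum P) (G : Enum Q) (φ : A -> B) {v : A -> ℤ} {w : B -> ℤ} ->
  (∀ x -> P x -> Q (φ x)) -> (∀ x y -> φ x ≡ φ y -> x ≡ y) ->
  (∀ y -> Q y -> ∃ \ x -> P x × φ x ≡ y) -> (∀ x -> P x -> w (φ x) ≡ v x) ->
  ∑ F v ≡ ∑ G w
 ∑-bij F G φ {v} {w} to inj onto val = ∑-cong F (\ x p -> sym (val x p)) &
  ∑-elems F (w ∘ φ) & sym (sumL-map φ (elems F) w) & sumL-bij (map φ (elems F)) (elems G) (Uniq.map⁺ (\ {x} {y} -> inj x y) (unique F)) (unique G) id id w w
   (\ y m -> let x , x∈ , e = ∈-map⁻ φ m in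
    subst (_∈ elems G) (sym e) (complete G (φ x) (to x (sound F x x∈))) , refl , refl)
   (\ y m -> let x , p , e = onto y (sound G y m) in subst (_∈ map φ (elems F)) e (∈-map⁺ φ (complete F x p)) , refl) &
  sym (∑-elems G w)

-- Formal power series over ℤ and modulo m.

module PowerSeries where
 open Sums public
 open import Data.Maybe using (Maybe; just; nothing)
 open import Level using (0ℓ)
 open import Algebra.Solver.Ring.AlmostCommutativeRing using (AlmostCommutativeRing; fromCommutativeRing; _-Raw-AlmostCommutative⟶_)
 open import Relation.Binary.PropositionalEquality using (module ≡-Reasoning)

 Series : Set
 Series = ℕ -> ℤ

 infix  4 _≐_
 infixl 6 _⊕_
 infixl 7 _⊛_
 infix  8 ⊝_

 _≐_ : Series -> Series -> Set
 f ≐ g = ∀ n -> f n ≡ g n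

 tail : Series -> Series
 tail f n = f (suc n)

 _⊕_ _⊛_ : Series -> Series -> Series
 (f ⊕ g) n = f n + g n
 (f ⊛ g) zero    = f 0 * g 0
 (f ⊛ g) (suc n) = f 0 * g (suc n) + (tail f ⊛ g) n

 ⊝_ : Series -> Series
 (⊝ f) n = - f n

 κ : ℤ -> Series
 κ k zero    = k
 κ k (suc n) = 0#

 scale : ℤ -> Series -> Series
 scale k f n = k * f n

 0-⊛ : ∀ {f} g -> (∀ n -> f n ≡ 0#) -> ∀ n -> (f ⊛ g) n ≡ 0#
 0-⊛ g h zero    = cong (_* g 0) (h 0) & Z.*-zeroˡ (g 0)
 0-⊛ g h (suc n) = cong2 _+_ (cong (_* g (suc n)) (h 0) & Z.*-zeroˡ (g (suc n)))
  (0-⊛ g (h ∘ suc) n) & refl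

 κ-⊛ : ∀ k f -> κ k ⊛ f ≐ scale k f
 κ-⊛ k f zero    = refl
 κ-⊛ k f (suc n) = cong (_+_ (k * f (suc n))) (0-⊛ f (\ _ -> refl) n) & Z.+-identityʳ _

 ⊛-cong≐ : ∀ {f f' g g'} -> f ≐ f' -> g ≐ g' -> f ⊛ g ≐ f' ⊛ g'
 ⊛-cong≐ p q zero    = cong2 _*_ (p 0) (q 0)
 ⊛-cong≐ p q (suc n) = cong2 _+_ (cong2 _*_ (p 0) (q (suc n))) (⊛-cong≐ (p ∘ suc) q n)

 scale-⊛ : ∀ k f g -> scale k f ⊛ g ≐ scale k (f ⊛ g)
 scale-⊛ k f g zero    = Z.*-assoc k (f 0) (g 0)
 scale-⊛ k f g (suc n) = cong2 _+_ (Z.*-assoc k (f 0) (g (suc n))) (scale-⊛ k (tail f) g n) &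
  sym (Z.*-distribˡ-+ k _ _)

 ⊛-distribʳ≐ : ∀ h f g -> (f ⊕ g) ⊛ h ≐ (f ⊛ h) ⊕ (g ⊛ h)
 ⊛-distribʳ≐ h f g zero    = Z.*-distribʳ-+ (h 0) (f 0) (g 0)
 ⊛-distribʳ≐ h f g (suc n) = cong (_+_ ((f 0 + g 0) * h (suc n))) (⊛-distribʳ≐ h (tail f) (tail g) n) &
  lemma (f 0) (g 0) (h (suc n)) ((tail f ⊛ h) n) ((tail g ⊛ h) n) where
  lemma : ∀ a b c x y -> (a + b) * c + (x + y) ≡ (a * c + x) + (b * c + y)
  lemma = ring

 ⊛-sucʳ : ∀ f g n -> (f ⊛ g) (suc n) ≡ (f ⊛ tail g) n + f (suc n) * g 0
 ⊛-sucʳ f g zero    = refl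
 ⊛-sucʳ f g (suc n) = cong (_+_ (f 0 * g (suc (suc n)))) (⊛-sucʳ (tail f) g n) &
  sym (Z.+-assoc (f 0 * g (suc (suc n))) _ _)

 ⊛-comm≐ : ∀ f g -> f ⊛ g ≐ g ⊛ f
 ⊛-comm≐ f g zero    = Z.*-comm (f 0) (g 0)
 ⊛-comm≐ f g (suc n) = cong2 _+_ (Z.*-comm (f 0) (g (suc n))) (⊛-comm≐ (tail f) g n) &
  Z.+-comm (g (suc n) * f 0) _ & sym (⊛-sucʳ g f n)

 ⊛-assoc≐ : ∀ f g h -> (f ⊛ g) ⊛ h ≐ f ⊛ (g ⊛ h)
 ⊛-assoc≐ f g h zero    = Z.*-assoc (f 0) (g 0) (h 0)
 ⊛-assoc≐ f g h (suc n) = begin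
  f 0 * g 0 * h (suc n) + (tail (f ⊛ g) ⊛ h) n
   ≡⟨ cong (_+_ (f 0 * g 0 * h (suc n))) (⊛-distribʳ≐ h (scale (f 0) (tail g)) (tail f ⊛ g) n) ⟩
  f 0 * g 0 * h (suc n) + ((scale (f 0) (tail g) ⊛ h) n + ((tail f ⊛ g) ⊛ h) n)
   ≡⟨ cong (_+_ (f 0 * g 0 * h (suc n))) (cong2 _+_ (scale-⊛ (f 0) (tail g) h n) (⊛-assoc≐ (tail f) g h n)) ⟩
  f 0 * g 0 * h (suc n) + (f 0 * (tail g ⊛ h) n + (tail f ⊛ (g ⊛ h)) n)
   ≡⟨ lemma (f 0) (g 0) (h (suc n)) ((tail g ⊛ h) n) ((tail f ⊛ (g ⊛ h)) n) ⟩
  f 0 * (g 0 * h (suc n) + (tail g ⊛ h) n) + (tail f ⊛ (g ⊛ h)) n ∎ where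
  open ≡-Reasoning
  lemma : ∀ a b c x y -> a * b * c + (a * x + y) ≡ a * (b * c + x) + y
  lemma = ring

 ⊛-identityˡ≐ : ∀ f -> κ 1# ⊛ f ≐ f
 ⊛-identityˡ≐ f n = κ-⊛ 1# f n & Z.*-identityˡ (f n)

 -- The modulus 0 is allowed and means equality. One ring of series and one solver therefore serve
 -- both the exact identities (`C0`) and the congruences.
 record Cong (m : ℕ) (a b : ℤ) : Set where
  constructor cong-by
  field
   quotient : ℤ
   equation : a - b ≡ quotient * + m
 open Cong public

 module Congruence (m : ℕ) where
  ≡C : ∀ {a b} -> a ≡ b -> Cong m a b
  ≡C {a} refl = cong-by 0# (Z.+-inverseʳ a)

  Cong-sym : ∀ {a b} -> Cong m a b -> Cong m b a
  Cong-sym {a} {b} (cong-by q e) = cong-by (- q) (lemma a b & cong -_ e & Z.neg-distribˡ-* q (+ m)) where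
   lemma : ∀ a b -> b - a ≡ - (a - b)
   lemma = ring

  Cong-trans : ∀ {a b c} -> Cong m a b -> Cong m b c -> Cong m a c
  Cong-trans {a} {b} {c} (cong-by q e) (cong-by r k) =
   cong-by (q + r) (lemma a b c & cong2 _+_ e k & sym (Z.*-distribʳ-+ (+ m) q r)) where
   lemma : ∀ a b c -> a - c ≡ (a - b) + (b - c)
   lemma = ring

  Cong-+ : ∀ {a b c d} -> Cong m a b -> Cong m c d -> Cong m (a + c) (b + d)
  Cong-+ {a} {b} {c} {d} (cong-by q e) (cong-by r k) =
   cong-by (q + r) (lemma a b c d & cong2 _+_ e k & sym (Z.*-distribʳ-+ (+ m) q r)) where
   lemma : ∀ a b c d -> (a + c) - (b + d) ≡ (a - b) + (c - d)
   lemma = ring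

  Cong-* : ∀ {a b c d} -> Cong m a b -> Cong m c d -> Cong m (a * c) (b * d)
  Cong-* {a} {b} {c} {d} (cong-by q e) (cong-by r k) =
   cong-by (q * c + b * r) (lemma a b c d & cong2 (\ u v -> u * c + b * v) e k & lemma2 q c b r (+ m)) where
   lemma : ∀ a b c d -> (a * c) - (b * d) ≡ (a - b) * c + b * (c - d)
   lemma = ring
   lemma2 : ∀ q c b r m -> q * m * c + b * (r * m) ≡ (q * c + b * r) * m
   lemma2 = ring

  Cong-neg : ∀ {a b} -> Cong m a b -> Cong m (- a) (- b)
  Cong-neg {a} {b} (cong-by q e) = cong-by (- q) (lemma a b & cong -_ e & Z.neg-distribˡ-* q (+ m)) where
   lemma : ∀ a b -> (- a) - (- b) ≡ - (a - b)
   lemma = ring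

  infix 4 _≈_
  -- A record and not the bare family of congruences, so that `f` and `g` can be inferred from a
  -- proof.
  record _≈_ (f g : Series) : Set where
   constructor mk≈
   field coeff : ∀ n -> Cong m (f n) (g n)
  open _≈_ public

  lift : ∀ {f g} -> f ≐ g -> f ≈ g
  lift e = mk≈ (\ n -> ≡C (e n))

  ⊛-cong : ∀ {f f' g g'} -> f ≈ f' -> g ≈ g' -> f ⊛ g ≈ f' ⊛ g'
  ⊛-cong {f} {f'} {g} {g'} p q = mk≈ (go f f' (coeff p)) where
   go : ∀ f f' -> (∀ n -> Cong m (f n) (f' n)) -> ∀ n -> Cong m ((f ⊛ g) n) ((f' ⊛ g') n)
   go f f' p zero    = Cong-* (p 0) (coeff q 0)
   go f f' p (suc n) = Cong-+ (Cong-* (p 0) (coeff q (suc n))) (go (tail f) (tail f') (p ∘ suc) n)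

  seriesRing : CommutativeRing 0ℓ 0ℓ
  seriesRing = record
   { Carrier = Series ; _≈_ = _≈_ ; _+_ = _⊕_ ; _*_ = _⊛_ ; -_ = ⊝_ ; 0# = κ 0# ; 1# = κ 1#
   ; isCommutativeRing = record
    { isRing = record
     { +-isAbelianGroup = record
      { isGroup = record
       { isMonoid = record
        { isSemigroup = record
         { isMagma = record
          { isEquivalence = record
           { refl  = lift (\ _ -> refl)
           ; sym   = \ p -> mk≈ (\ n -> Cong-sym (coeff p n))
           ; trans = \ p q -> mk≈ (\ n -> Cong-trans (coeff p n) (coeff q n)) }
          ; ∙-cong = \ p q -> mk≈ (\ n -> Cong-+ (coeff p n) (coeff q n)) }
         ; assoc = \ f g h -> lift (\ n -> Z.+-assoc (f n) (g n) (h n)) }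
        ; identity = (\ f -> lift (\ { zero -> Z.+-identityˡ (f 0) ; (suc n) -> Z.+-identityˡ (f (suc n)) }))
              , (\ f -> lift (\ { zero -> Z.+-identityʳ (f 0) ; (suc n) -> Z.+-identityʳ (f (suc n)) })) }
       ; inverse = (\ f -> lift (\ { zero -> Z.+-inverseˡ (f 0) ; (suc n) -> Z.+-inverseˡ (f (suc n)) }))
            , (\ f -> lift (\ { zero -> Z.+-inverseʳ (f 0) ; (suc n) -> Z.+-inverseʳ (f (suc n)) }))
       ; ⁻¹-cong = \ p -> mk≈ (\ n -> Cong-neg (coeff p n)) }
      ; comm = \ f g -> lift (\ n -> Z.+-comm (f n) (g n)) }
     ; *-cong = ⊛-cong
     ; *-assoc = \ f g h -> lift (⊛-assoc≐ f g h)
     ; *-identity = (\ f -> lift (⊛-identityˡ≐ f))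
            , (\ f -> lift (\ n -> (⊛-comm≐ f (κ 1#) n) & (⊛-identityˡ≐ f n)))
     ; distrib = (\ f g h -> lift (\ n -> (⊛-comm≐ f (g ⊕ h) n) & (⊛-distribʳ≐ f g h n) &
             cong2 _+_ (⊛-comm≐ g f n) (⊛-comm≐ h f n)))
          , (\ h f g -> lift (⊛-distribʳ≐ h f g)) }
    ; *-comm = \ f g -> lift (⊛-comm≐ f g) } }

  almost : AlmostCommutativeRing 0ℓ 0ℓ
  almost = fromCommutativeRing seriesRing

  private
   constants : CommutativeRing.rawRing Z.+-*-commutativeRing -Raw-AlmostCommutative⟶ almost
   constants = record
    { ⟦_⟧ = κ
    ; +-homo = \ a b -> lift (\ { zero -> refl ; (suc n) -> refl })
    ; *-homo = \ a b -> lift (\ { zero -> refl ; (suc n) -> sym (κ-⊛ a (κ b) (suc n) & Z.*-zeroʳ a) })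
    ; -‿homo = \ a -> lift (\ { zero -> refl ; (suc n) -> refl })
    ; 0-homo = lift (\ _ -> refl)
    ; 1-homo = lift (\ _ -> refl) }
   decide : ∀ a b -> Maybe (κ a ≈ κ b)
   decide a b with a ≟ b
   ... | yes refl = just (lift (\ _ -> refl))
   ... | no _     = nothing

  module Solver = Algebra.Solver.Ring (CommutativeRing.rawRing Z.+-*-commutativeRing) almost constants decide

  infixr 5 _>>_ _»_

  _>>_ : ∀ {a b c} -> Cong m a b -> Cong m b c -> Cong m a c
  _>>_ = Cong-trans

  _»_ : ∀ {f g h} -> f ≈ g -> g ≈ h -> f ≈ h
  _»_ = CommutativeRing.trans seriesRing

  ⊛-congˡ : ∀ f {g h} -> g ≈ h -> f ⊛ g ≈ f ⊛ h
  ⊛-congˡ f = CommutativeRing.*-cong seriesRing (CommutativeRing.refl seriesRing {f})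

  # : ∀ {n} -> ℕ -> Solver.Polynomial n
  # k = Solver.con (+ k)

 module C0 = Congruence 0

 exact : ∀ {f g} -> f C0.≈ g -> f ≐ g
 exact {f} {g} p n = let cong-by q e = C0.coeff p n in
  Z.i-j≡0⇒i≡j (f n) (g n) (e & Z.*-zeroʳ q)

 reduce : ∀ m {f g} -> f C0.≈ g -> Congruence._≈_ m f g
 reduce m p = Congruence.lift m (exact p)

 -- The derivation q d/dq, and the substitutions q ↦ −q and q ↦ q².
 D tw dil : Series -> Series
 D f n = + n * f n
 tw f zero    = f 0
 tw f (suc n) = - tw (tail f) n
 dil f zero          = f 0
 dil f (suc zero)    = 0#
 dil f (suc (suc n)) = dil (tail f) n

 D-⊛ : ∀ f g -> D (f ⊛ g) ≐ (D f ⊛ g) ⊕ (f ⊛ D g)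
 D-⊛ f g zero = lemma (f 0 * g 0) (f 0) (g 0) where
  lemma : ∀ a b c -> + 0 * a ≡ (+ 0 * b) * c + b * (+ 0 * c)
  lemma = ring
 D-⊛ f g (suc n) = begin
  + suc n * (f 0 * g (suc n) + (tail f ⊛ g) n)
   ≡⟨ cong (_* (f 0 * g (suc n) + (tail f ⊛ g) n)) (Z.pos-+ 1 n) ⟩
  (1# + + n) * (f 0 * g (suc n) + (tail f ⊛ g) n)
   ≡⟨ lemma (+ n) (f 0) (g (suc n)) ((tail f ⊛ g) n) ⟩
  f 0 * ((1# + + n) * g (suc n)) + (+ n * (tail f ⊛ g) n + (tail f ⊛ g) n)
   ≡⟨ cong2 (\ u v -> f 0 * (u * g (suc n)) + (v + (tail f ⊛ g) n)) (sym (Z.pos-+ 1 n)) (D-⊛ (tail f) g n) ⟩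
  f 0 * (+ suc n * g (suc n)) + (((D (tail f) ⊛ g) n + (tail f ⊛ D g) n) + (tail f ⊛ g) n)
   ≡⟨ lemma2 (f 0 * (+ suc n * g (suc n))) ((D (tail f) ⊛ g) n) ((tail f ⊛ D g) n) ((tail f ⊛ g) n) (f 0) (g (suc n)) ⟩
  ((+ 0 * f 0) * g (suc n) + ((D (tail f) ⊛ g) n + (tail f ⊛ g) n)) + (f 0 * (+ suc n * g (suc n)) + (tail f ⊛ D g) n)
   ≡⟨ cong (\ u -> ((+ 0 * f 0) * g (suc n) + u) + (f 0 * (+ suc n * g (suc n)) + (tail f ⊛ D g) n))
      (sym (⊛-distribʳ≐ g (D (tail f)) (tail f) n) & (⊛-cong≐ tail-D (\ _ -> refl) n)) ⟩
  ((+ 0 * f 0) * g (suc n) + (tail (D f) ⊛ g) n) + (f 0 * (+ suc n * g (suc n)) + (tail f ⊛ D g) n) ∎ where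
  open ≡-Reasoning
  lemma : ∀ n a b c -> (1# + n) * (a * b + c) ≡ a * ((1# + n) * b) + (n * c + c)
  lemma = ring
  lemma2 : ∀ a b c d x y -> a + ((b + c) + d) ≡ ((+ 0 * x) * y + (b + d)) + (a + c)
  lemma2 = ring
  tail-D : D (tail f) ⊕ tail f ≐ tail (D f)
  tail-D k = h (+ k) (f (suc k)) & cong (_* f (suc k)) (sym (Z.pos-+ 1 k)) where
   h : ∀ k a -> k * a + a ≡ (1# + k) * a
   h = ring

 D-⊕ : ∀ f g -> D (f ⊕ g) ≐ D f ⊕ D g
 D-⊕ f g n = Z.*-distribˡ-+ (+ n) (f n) (g n)

 D-κ : ∀ k -> D (κ k) ≐ κ 0#
 D-κ k zero    = Z.*-zeroˡ k
 D-κ k (suc n) = Z.*-zeroʳ (+ suc n)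

 tw-cong : ∀ {f g} -> f ≐ g -> tw f ≐ tw g
 tw-cong e zero    = e 0
 tw-cong e (suc n) = cong -_ (tw-cong (e ∘ suc) n)

 tw-⊕ : ∀ f g -> tw (f ⊕ g) ≐ tw f ⊕ tw g
 tw-⊕ f g zero    = refl
 tw-⊕ f g (suc n) = cong -_ (tw-⊕ (tail f) (tail g) n) & Z.neg-distrib-+ (tw (tail f) n) _

 tw-scale : ∀ k f -> tw (scale k f) ≐ scale k (tw f)
 tw-scale k f zero    = refl
 tw-scale k f (suc n) = cong -_ (tw-scale k (tail f) n) & Z.neg-distribʳ-* k _

 tw-⊛ : ∀ f g -> tw (f ⊛ g) ≐ tw f ⊛ tw g
 tw-⊛ f g zero    = refl
 tw-⊛ f g (suc n) = begin
  - tw (tail (f ⊛ g)) n                                      ≡⟨ cong -_ (tw-⊕ (scale (f 0) (tail g)) (tail f ⊛ g) n) ⟩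
  - (tw (scale (f 0) (tail g)) n + tw (tail f ⊛ g) n)        ≡⟨ cong -_ (cong2 _+_ (tw-scale (f 0) (tail g) n) (tw-⊛ (tail f) g n)) ⟩
  - (f 0 * tw (tail g) n + (tw (tail f) ⊛ tw g) n)           ≡⟨ lemma (f 0) (tw (tail g) n) ((tw (tail f) ⊛ tw g) n) ⟩
  f 0 * - tw (tail g) n + -[1+ 0 ] * (tw (tail f) ⊛ tw g) n  ≡⟨ cong (_+_ (f 0 * - tw (tail g) n)) (sym (scale-⊛ -[1+ 0 ] (tw (tail f)) (tw g) n)) ⟩
  f 0 * - tw (tail g) n + (scale -[1+ 0 ] (tw (tail f)) ⊛ tw g) n
   ≡⟨ cong (_+_ (f 0 * - tw (tail g) n)) (⊛-cong≐ (\ k -> Z.-1*i≡-i (tw (tail f) k)) (\ _ -> refl) n) ⟩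
  f 0 * - tw (tail g) n + (tail (tw f) ⊛ tw g) n             ∎ where
  open ≡-Reasoning
  lemma : ∀ a b c -> - (a * b + c) ≡ a * (- b) + -[1+ 0 ] * c
  lemma = ring

 tw-D : ∀ f -> tw (D f) ≐ D (tw f)
 tw-D f n = go n f (\ k -> + k) where
  go : ∀ n f (c : ℕ -> ℤ) -> tw (\ k -> c k * f k) n ≡ c n * tw f n
  go zero    f c = refl
  go (suc n) f c = cong -_ (go n (tail f) (c ∘ suc)) & Z.neg-distribʳ-* (c (suc n)) _

 tw-tw : ∀ f -> tw (tw f) ≐ f
 tw-tw f zero    = refl
 tw-tw f (suc n) = cong -_ (tw-cong (\ k -> sym (Z.-1*i≡-i (tw (tail f) k))) n &
  (tw-scale -[1+ 0 ] (tw (tail f)) n) & Z.-1*i≡-i (tw (tw (tail f)) n)) &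
  Z.neg-involutive _ & tw-tw (tail f) n

 dil-cong : ∀ {f g} -> f ≐ g -> dil f ≐ dil g
 dil-cong e zero          = e 0
 dil-cong e (suc zero)    = refl
 dil-cong e (suc (suc n)) = dil-cong (e ∘ suc) n

 dil-⊕ : ∀ f g -> dil (f ⊕ g) ≐ dil f ⊕ dil g
 dil-⊕ f g zero          = refl
 dil-⊕ f g (suc zero)    = refl
 dil-⊕ f g (suc (suc n)) = dil-⊕ (tail f) (tail g) n

 dil-scale : ∀ k f -> dil (scale k f) ≐ scale k (dil f)
 dil-scale k f zero          = refl
 dil-scale k f (suc zero)    = sym (Z.*-zeroʳ k)
 dil-scale k f (suc (suc n)) = dil-scale k (tail f) n

 dil-⊛ : ∀ f g -> dil (f ⊛ g) ≐ dil f ⊛ dil g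
 dil-⊛ f g zero       = refl
 dil-⊛ f g (suc zero) = lemma (f 0) (g 0) where
  lemma : ∀ a b -> + 0 ≡ a * + 0 + + 0 * b
  lemma = ring
 dil-⊛ f g (suc (suc n)) = begin
  dil (tail (f ⊛ g)) n                                       ≡⟨ dil-⊕ (scale (f 0) (tail g)) (tail f ⊛ g) n ⟩
  dil (scale (f 0) (tail g)) n + dil (tail f ⊛ g) n          ≡⟨ cong2 _+_ (dil-scale (f 0) (tail g) n) (dil-⊛ (tail f) g n) ⟩
  f 0 * dil (tail g) n + (dil (tail f) ⊛ dil g) n            ≡⟨ cong (_+_ (f 0 * dil (tail g) n)) (lemma (dil g (suc n)) _) ⟩
  f 0 * dil (tail g) n + (0# * dil g (suc n) + (dil (tail f) ⊛ dil g) n) ∎ where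
  open ≡-Reasoning
  lemma : ∀ a b -> b ≡ + 0 * a + b
  lemma = ring

 D-dil : ∀ f -> D (dil f) ≐ scale (+ 2) (dil (D f))
 D-dil f n = cong (\ z -> + z * dil f n) (sym (N.+-identityʳ n)) & go n f 0 refl & cong (_*_ (+ 2)) (dil-cong (\ k -> cong (\ z -> + z * f k) (N.+-identityʳ k)) n) where
  -- `dil` advances by taking the tail of `f`; `c` counts the coefficients already consumed, so that
  -- the weight of the current head is still known.
  go : ∀ n f c -> n ≡ n -> (+ (n N.+ 2 N.* c)) * dil f n ≡ + 2 * dil (\ k -> + (k N.+ c) * f k) n
  go zero f c _ = cong (_* f 0) (Z.pos-* 2 c) & Z.*-assoc (+ 2) (+ c) (f 0)
  go (suc zero) f c _ = Z.*-zeroʳ (+ suc (2 N.* c))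
  go (suc (suc n)) f c _ = cong (\ z -> + z * dil (tail f) n) (nat n c) &
   go n (tail f) (suc c) refl &
    cong (_*_ (+ 2)) (dil-cong (\ k -> cong (\ z -> + z * f (suc k)) (N.+-suc k c)) n) where
   nat : ∀ n c -> suc (suc n) N.+ 2 N.* c ≡ n N.+ 2 N.* suc c
   nat n c = sym (N.+-suc (suc n) (2 N.* c)) & sym (N.+-suc n (suc (2 N.* c))) &
    cong (n N.+_) (sym (N.*-suc 2 c))

 ⊛-∑ : ∀ f g n -> (f ⊛ g) n ≡ ∑ (below (suc n)) (\ k -> f k * g (n N.∸ k))
 ⊛-∑ f g zero    = sym (∑-below-suc 0 (\ k -> f k * g (0 N.∸ k)) &
  cong (_+_ (f 0 * g 0)) (∑-below-zero _) & Z.+-identityʳ _)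
 ⊛-∑ f g (suc n) = cong (_+_ (f 0 * g (suc n))) (⊛-∑ (tail f) g n) &
  sym (∑-below-suc (suc n) (\ k -> f k * g (suc n N.∸ k)))

 -- Coefficients of products of counting series in the shape on which the later bijections act: a
 -- splitting of n with one solution on each side.
 ⊛-∑∑ : {A B : Set} {P : ℕ -> A -> Set} {Q : ℕ -> B -> Set} (F : ∀ k -> Enum (P k)) (G : ∀ k -> Enum (Q k))
  (v : A -> ℤ) (w : B -> ℤ) (n : ℕ) ->
  ((\ k -> ∑ (F k) v) ⊛ (\ k -> ∑ (G k) w)) n ≡
  ∑ (below (suc n) ▹ (\ k _ -> F k ▹ (\ _ _ -> G (n N.∸ k)))) (\ z -> v (fst (snd z)) * w (snd (snd z)))
 ⊛-∑∑ {A} {B} F G v w n = (⊛-∑ _ _ n) & sym (∑-▹ (below (suc n)) (\ k _ -> F k ▹ (\ _ _ -> G (n N.∸ k))) (\ z -> term (snd z)) _ inner) where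
  term : A × B -> ℤ
  term z = v (fst z) * w (snd z)
  inner : ∀ k -> k N.< suc n -> ∑ (F k) v * ∑ (G (n N.∸ k)) w ≡ ∑ (F k ▹ (\ _ _ -> G (n N.∸ k))) term
  inner k _ = sym (∑-▹ (F k) (\ _ _ -> G (n N.∸ k)) term (\ x -> v x * ∑ (G (n N.∸ k)) w)
    (\ x _ -> sym (∑-* (G (n N.∸ k)) (v x) w)) &
   ∑-*ʳ (F k) (∑ (G (n N.∸ k)) w) v)

 -- As `g 0` vanishes, coefficient n + 1 of the equation expresses (n + 1) f(n + 1) through f 0,
 -- ..., f n, so the constant term determines the solution. Theta identities are proved below by
 -- showing that both sides solve one such equation.
 D-unique : ∀ f h g -> g 0 ≡ 0# -> D f ≐ g ⊛ f -> D h ≐ g ⊛ h -> f 0 ≡ h 0 -> f ≐ h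
 D-unique f h g g0 df dh e0 n = below-eq (suc n) n N.≤-refl where
  ⊛-local : ∀ n g f h -> (∀ k -> k N.≤ n -> f k ≡ h k) -> (g ⊛ f) n ≡ (g ⊛ h) n
  ⊛-local zero    g f h e = cong (_*_ (g 0)) (e 0 N.z≤n)
  ⊛-local (suc n) g f h e = cong2 _+_ (cong (_*_ (g 0)) (e (suc n) N.≤-refl))
   (⊛-local n (tail g) f h (\ k k≤n -> e k (N.≤-trans k≤n (N.n≤1+n n))))
  step : ∀ n -> (∀ k -> k N.≤ n -> f k ≡ h k) -> f (suc n) ≡ h (suc n)
  step n e = Z.*-cancelˡ-≡ (+ suc n) (f (suc n)) (h (suc n)) (df (suc n) & cong2 _+_ (cong (_* f (suc n)) g0 & sym (cong (_* h (suc n)) g0)) (⊛-local n (tail g) f h e) &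
   sym (dh (suc n)))
  below-eq : ∀ b k -> k N.< b -> f k ≡ h k
  below-eq (suc b) zero    _ = e0
  below-eq (suc b) (suc k) (N.s≤s k<b) = step k (\ i i≤k -> below-eq b i (N.≤-<-trans i≤k k<b))

 ⊛-cancelˡ : ∀ f g -> f 0 ≢ 0# -> f ⊛ g ≐ κ 0# -> g ≐ κ 0#
 ⊛-cancelˡ f g f0 e = \ { zero -> vanish 1 0 N.≤-refl ; (suc n) -> vanish (suc (suc n)) (suc n) N.≤-refl } where
  drop : ∀ n f -> (∀ k -> k N.< suc n -> g k ≡ 0#) -> (f ⊛ g) n ≡ 0#
  drop zero    f z = cong (_*_ (f 0)) (z 0 (N.s≤s N.z≤n)) & Z.*-zeroʳ (f 0)
  drop (suc n) f z = cong2 _+_ (cong (_*_ (f 0)) (z (suc n) N.≤-refl) & Z.*-zeroʳ (f 0))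
   (drop n (tail f) (\ k k<n -> z k (N.m<n⇒m<1+n k<n))) & refl
  zero-product : ∀ {x y} -> x ≢ 0# -> x * y ≡ 0# -> y ≡ 0#
  zero-product {x} {y} x≢0 p with Z.i*j≡0⇒i≡0∨j≡0 x p
  ... | inl x≡0 = ⊥-elim (x≢0 x≡0)
  ... | inr y≡0 = y≡0
  vanish : ∀ b k -> k N.< b -> g k ≡ 0#
  vanish (suc b) zero    _ = zero-product f0 (e 0)
  vanish (suc b) (suc k) (N.s≤s k<b) = zero-product f0
   (sym (Z.+-identityʳ _) & cong (_+_ (f 0 * g (suc k))) (sym (drop k (tail f)
    (\ i i<k -> vanish b i (N.<-≤-trans i<k k<b)))) & e (suc k))

-- The overpartition series and its logarithmic derivative.

module OverpartitionSeries where
 open PowerSeries public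
 open import Data.Bool using (Bool; true; false; if_then_else_; T)
 open import Data.List using (map; upTo; List; []; _∷_)
 open import Data.Nat.ListAction using (sum)
 open import Defs

 module Ideal (m : ℕ) where
  open Congruence m
  private module R = CommutativeRing seriesRing

  -- Set-up for proofs by ideal membership: the difference of two sides is written, by `by` and the
  -- solver, as an explicit combination of known null series. The multipliers left as `_` are read
  -- off from the identity given to the solver.
  Null : Series -> Set
  Null f = f ≈ κ 0#

  null : ∀ {f g} -> f ≈ g -> Null (f ⊕ ⊝ g)
  null {f} {g} e = R.trans (R.+-cong e R.refl) (R.-‿inverseʳ g)

  unnull : ∀ {f g} -> Null (f ⊕ ⊝ g) -> f ≈ g
  unnull {f} {g} z = R.trans (solve 2 (\ f g -> f := (f :- g) :+ g) R.refl f g)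
   (R.trans (R.+-cong z R.refl) (R.+-identityˡ g))
   where open Solver

  infixl 6 _+ᶻ_
  infixr 7 _*ᶻ_
  _+ᶻ_ : ∀ {f g} -> Null f -> Null g -> Null (f ⊕ g)
  _+ᶻ_ p q = R.trans (R.+-cong p q) (R.+-identityˡ _)

  _*ᶻ_ : ∀ c {f} -> Null f -> Null (c ⊛ f)
  c *ᶻ p = R.trans (R.*-cong R.refl p) (R.zeroʳ c)

  by : ∀ {f g} -> f ≈ g -> Null g -> Null f
  by = R.trans

 q^ : ℕ -> Series
 q^ zero             = κ 1#
 q^ (suc j) zero     = 0#
 q^ (suc j) (suc n)  = q^ j n

 q^-⊛-+ : ∀ j f n -> (q^ j ⊛ f) (j N.+ n) ≡ f n
 q^-⊛-+ zero    f n = ⊛-identityˡ≐ f n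
 q^-⊛-+ (suc j) f n = Z.+-identityˡ _ & q^-⊛-+ j f n

 q^-⊛-< : ∀ j f n -> n N.< j -> (q^ j ⊛ f) n ≡ 0#
 q^-⊛-< (suc j) f zero    _         = refl
 q^-⊛-< (suc j) f (suc n) (s≤s n<j) = Z.+-identityˡ _ & q^-⊛-< j f n n<j

 D-q^ : ∀ j -> D (q^ j) ≐ κ (+ j) ⊛ q^ j
 D-q^ j n = go j n & sym (κ-⊛ (+ j) (q^ j) n) where
  go : ∀ j n -> + n * q^ j n ≡ + j * q^ j n
  go zero    zero    = refl
  go zero    (suc n) = Z.*-zeroʳ (+ suc n)
  go (suc j) zero    = sym (Z.*-zeroʳ (+ suc j))
  go (suc j) (suc n) = cong (_* q^ j n) (Z.pos-+ 1 n) & Z.*-distribʳ-+ (q^ j n) 1# (+ n) &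
   cong (_+_ (1# * q^ j n)) (go j n) & sym (Z.*-distribʳ-+ (q^ j n) 1# (+ j)) &
   cong (_* q^ j n) (sym (Z.pos-+ 1 j))

 data Compare (j n : ℕ) : Set where
  less : n N.< j -> Compare j n
  more : ∀ k -> n ≡ j N.+ k -> Compare j n

 compare : ∀ j n -> Compare j n
 compare j n with n N.<? j
 ... | yes n<j = less n<j
 ... | no n≮j  = more (n N.∸ j) (sym (N.m+[n∸m]≡n (N.≮⇒≥ n≮j)))

 ≐-split : ∀ j {f g} -> (∀ n -> n N.< j -> f n ≡ g n) -> (∀ n -> f (j N.+ n) ≡ g (j N.+ n)) -> f ≐ g
 ≐-split j lo hi n with compare j n
 ... | less p      = lo n p
 ... | more k refl = hi k

 below-extend : ∀ n d (v : ℕ -> ℤ) -> (∀ i -> n N.≤ i -> v i ≡ 0#) -> ∑ (below (n N.+ d)) v ≡ ∑ (below n) v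
 below-extend n zero    v z = cong (\ k -> ∑ (below k) v) (N.+-identityʳ n)
 below-extend n (suc d) v z = cong (\ k -> ∑ (below k) v) (N.+-suc n d) &
  ∑-below-last (n N.+ d) v & cong2 _+_ (below-extend n d v z) (z (n N.+ d) (N.m≤m+n n d)) &
   Z.+-identityʳ _

 pos-sum : (f : ℕ -> ℕ) (xs : List ℕ) -> + sum (map f xs) ≡ sumL xs (+_ ∘ f)
 pos-sum f []       = refl
 pos-sum f (x ∷ xs) = Z.pos-+ (f x) _ & cong (_+_ (+ f x)) (pos-sum f xs)

 product : ℕ -> Series
 product k n = + opCoeff k n

 private
  term : ℕ -> ℕ -> ℕ -> ℕ
  term k n i = if (suc i N.* suc k) N.≤ᵇ n then opCoeff k (n N.∸ suc i N.* suc k) else 0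

  product-suc : ∀ k n -> product (suc k) n ≡ product k n + + 2 * ∑ (below n) (+_ ∘ term k n)
  product-suc k n = Z.pos-+ (opCoeff k n) _ & cong (_+_ (product k n))
   (Z.pos-* 2 (sum (map (term k n) (upTo n))) & cong (_*_ (+ 2)) (pos-sum (term k n) (upTo n) & sym (∑-elems (below n) (+_ ∘ term k n))))

  term-out : ∀ k n i -> n N.< suc i N.* suc k -> term k n i ≡ 0
  term-out k n i n< with (suc i N.* suc k) N.≤ᵇ n in eq
  ... | false = refl
  ... | true  = ⊥-elim (N.<⇒≱ n< (N.≤ᵇ⇒≤ (suc i N.* suc k) n (subst T (sym eq) _)))

  term-in : ∀ k n i -> suc i N.* suc k N.≤ n -> term k n i ≡ opCoeff k (n N.∸ suc i N.* suc k)
  term-in k n i ≤n with (suc i N.* suc k) N.≤ᵇ n in eq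
  ... | true  = refl
  ... | false = ⊥-elim (subst T eq (N.≤⇒≤ᵇ ≤n))

  i<[1+i][1+k] : ∀ i k -> i N.< suc i N.* suc k
  i<[1+i][1+k] i k = N.m≤m*n (suc i) (suc k)

  term-first : ∀ k n -> term k (suc k N.+ n) 0 ≡ opCoeff k n
  term-first k n = term-in k (suc k N.+ n) 0 (subst (N._≤ suc k N.+ n) (sym (N.*-identityˡ (suc k))) (N.m≤m+n (suc k) n)) &
   cong (opCoeff k) (cong (suc k N.+ n N.∸_) (N.*-identityˡ (suc k)) & N.m+n∸m≡n (suc k) n)

  term-shift : ∀ k n i -> term k (suc k N.+ n) (suc i) ≡ term k n i
  term-shift k n i with suc i N.* suc k N.≤? n
  ... | yes p = term-in k (suc k N.+ n) (suc i) (N.+-monoʳ-≤ (suc k) p) &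
          cong (opCoeff k) (N.[m+n]∸[m+o]≡n∸o (suc k) n (suc i N.* suc k)) & sym (term-in k n i p)
  ... | no ¬p = term-out k (suc k N.+ n) (suc i) (N.+-monoʳ-< (suc k) (N.≰⇒> ¬p)) &
          sym (term-out k n i (N.≰⇒> ¬p))

 product-low : ∀ k n -> n N.< suc k -> product (suc k) n ≡ product k n
 product-low k n n<k = product-suc k n & cong (\ z -> product k n + + 2 * z)
  (∑-0 (below n) (\ i _ -> cong +_ (term-out k n i (N.<-≤-trans n<k (N.m≤n*m (suc k) (suc i)))))) &
  Z.+-identityʳ _

 -- Among the multiplicities of the part k + 1, multiplicity one gives `product k n` and the higher
 -- ones repeat the whole sum for n. This is the geometric series behind `product-step`.
 product-high : ∀ k n -> product (suc k) (suc k N.+ n) - product (suc k) n ≡ product k (suc k N.+ n) + product k n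
 product-high k n = cong2 _-_ (product-suc k (suc k N.+ n) & cong (\ z -> product k (suc k N.+ n) + + 2 * z) high)
   (product-suc k n) & lemma (product k (suc k N.+ n)) (product k n) (∑ (below n) (+_ ∘ term k n)) where
  lemma : ∀ a b s -> (a + + 2 * (b + s)) - (b + + 2 * s) ≡ a + b
  lemma = ring
  high : ∑ (below (suc k N.+ n)) (+_ ∘ term k (suc k N.+ n)) ≡ product k n + ∑ (below n) (+_ ∘ term k n)
  high = ∑-below-suc (k N.+ n) (+_ ∘ term k (suc k N.+ n)) & cong2 _+_ (cong +_ (term-first k n))
   (∑-cong (below (k N.+ n)) (\ i _ -> cong +_ (term-shift k n i)) &
   cong (\ z -> ∑ (below z) (+_ ∘ term k n)) (N.+-comm k n) &
    below-extend n k (+_ ∘ term k n) (\ i n≤i -> cong +_ (term-out k n i (N.≤-<-trans n≤i (i<[1+i][1+k] i k)))))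

 product-step : ∀ k -> (κ 1# ⊕ ⊝ q^ (suc k)) ⊛ product (suc k) ≐ (κ 1# ⊕ q^ (suc k)) ⊛ product k
 product-step k = ≐-split (suc k) lo hi where
  u = q^ (suc k)
  left : ∀ f n -> ((κ 1# ⊕ ⊝ u) ⊛ f) n ≡ f n - (u ⊛ f) n
  left f n = (⊛-distribʳ≐ f (κ 1#) (⊝ u) n) & cong2 _+_ (⊛-identityˡ≐ f n)
   ((⊛-cong≐ {⊝ u} {scale -[1+ 0 ] u} (\ i -> sym (Z.-1*i≡-i (u i))) (\ _ -> refl) n) &
    (scale-⊛ -[1+ 0 ] u f n) & Z.-1*i≡-i _)
  right : ∀ f n -> ((κ 1# ⊕ u) ⊛ f) n ≡ f n + (u ⊛ f) n
  right f n = (⊛-distribʳ≐ f (κ 1#) u n) & cong (_+ (u ⊛ f) n) (⊛-identityˡ≐ f n)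
  lo : ∀ n -> n N.< suc k -> _
  lo n p = left (product (suc k)) n & cong2 _-_ (product-low k n p) (q^-⊛-< (suc k) (product (suc k)) n p) &
   sym (right (product k) n & cong (_+_ (product k n)) (q^-⊛-< (suc k) (product k) n p))
  hi : ∀ n -> _
  hi n = left (product (suc k)) (suc k N.+ n) & cong (\ z -> product (suc k) (suc k N.+ n) - z) (q^-⊛-+ (suc k) (product (suc k)) n) &
   product-high k n & sym (right (product k) (suc k N.+ n) &
    cong (_+_ (product k (suc k N.+ n))) (q^-⊛-+ (suc k) (product k) n))

 even? : ℕ -> Bool
 even? zero          = true
 even? (suc zero)    = false
 even? (suc (suc n)) = even? n

 odd01 even01 : ℕ -> ℤ
 even01 n = if even? n then 1# else 0#
 odd01 n  = if even? n then 0# else 1#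

 -- The logarithmic derivative of (1+u)/(1-u) for u = q^j.
 factor-log : ℕ -> Series
 factor-log j n = ∑ (below (suc n) ↾ (\ e -> j N.* e N.≟ n)) (\ e -> + 2 * + j * odd01 e)

 -- A geometric series in u². The coefficients vanish below j, have 2j at j and nothing more below
 -- 2j, and then repeat with period 2j; `lo`, `mid` and `hi` treat these three ranges.
 factor-log-rec : ∀ j -> j ≢ 0 -> (κ 1# ⊕ ⊝ (q^ j ⊛ q^ j)) ⊛ factor-log j ≐ κ (+ 2 * + j) ⊛ q^ j
 factor-log-rec j j≢0 = ≐-split j lo (\ n -> ≐-split j {\ n -> f (j N.+ n)} {\ n -> g (j N.+ n)} mid hi n) where
  instance _ = N.≢-nonZero j≢0
  u = q^ j
  f = (κ 1# ⊕ ⊝ (u ⊛ u)) ⊛ factor-log j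
  g = κ (+ 2 * + j) ⊛ u
  left : ∀ h n -> ((κ 1# ⊕ ⊝ (u ⊛ u)) ⊛ h) n ≡ h n - (u ⊛ (u ⊛ h)) n
  left h n = (⊛-distribʳ≐ h (κ 1#) (⊝ (u ⊛ u)) n) & cong2 _+_ (⊛-identityˡ≐ h n)
   ((⊛-cong≐ {⊝ (u ⊛ u)} {scale -[1+ 0 ] (u ⊛ u)} (\ i -> sym (Z.-1*i≡-i ((u ⊛ u) i))) (\ _ -> refl) n) &
    (scale-⊛ -[1+ 0 ] (u ⊛ u) h n) & Z.-1*i≡-i _ & cong -_ (⊛-assoc≐ u u h n))
  q^-low : ∀ j n -> n N.< j -> q^ j n ≡ 0#
  q^-low (suc j) zero    _         = refl
  q^-low (suc j) (suc n) (s≤s n<j) = q^-low j n n<j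
  q^-one : ∀ j -> q^ j (j N.+ 0) ≡ 1#
  q^-one zero    = refl
  q^-one (suc j) = q^-one j
  q^-high : ∀ j n -> n ≢ 0 -> q^ j (j N.+ n) ≡ 0#
  q^-high zero    zero    n≢0 = ⊥-elim (n≢0 refl)
  q^-high zero    (suc n) _   = refl
  q^-high (suc j) n n≢0       = q^-high j n n≢0
  rhs : ∀ n -> g n ≡ + 2 * + j * u n
  rhs n = κ-⊛ (+ 2 * + j) u n
  only-zero : ∀ n -> n N.< j -> factor-log j n ≡ 0#
  only-zero n n<j = ∑-0 (below (suc n) ↾ (\ e -> j N.* e N.≟ n)) go where
   go : ∀ e -> e N.< suc n × j N.* e ≡ n -> + 2 * + j * odd01 e ≡ 0#
   go zero    _ = Z.*-zeroʳ (+ 2 * + j)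
   go (suc e) (_ , refl) = ⊥-elim (N.<⇒≱ n<j (N.m≤m*n j (suc e)))
  lo : ∀ n -> n N.< j -> f n ≡ g n
  lo n p = left (factor-log j) n & cong2 _-_ (only-zero n p) (q^-⊛-< j (u ⊛ factor-log j) n p) &
   sym (rhs n & cong (_*_ (+ 2 * + j)) (q^-low j n p) & Z.*-zeroʳ (+ 2 * + j))
  first : ∀ n -> n N.< j -> factor-log j (j N.+ n) ≡ + 2 * + j * u (j N.+ n)
  first zero _ = ∑-single (below (suc (j N.+ 0)) ↾ (\ e -> j N.* e N.≟ j N.+ 0)) 1
    (s≤s (N.≤-trans (N.>-nonZero⁻¹ j) (N.m≤m+n j 0)) , N.*-identityʳ j & sym (N.+-identityʳ j))
    (\ { e (_ , p) -> N.*-cancelˡ-≡ e 1 j (p & N.+-identityʳ j & sym (N.*-identityʳ j)) }) &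
   cong (_*_ (+ 2 * + j)) (sym (q^-one j))
  first (suc n) p = ∑-0 (below (suc (j N.+ suc n)) ↾ (\ e -> j N.* e N.≟ j N.+ suc n)) go &
   sym (cong (_*_ (+ 2 * + j)) (q^-high j (suc n) \ ()) & Z.*-zeroʳ (+ 2 * + j)) where
   go : ∀ e -> e N.< suc (j N.+ suc n) × j N.* e ≡ j N.+ suc n -> + 2 * + j * odd01 e ≡ 0#
   go zero (_ , e) = Z.*-zeroʳ (+ 2 * + j)
   go (suc zero) (_ , e) with N.+-cancelˡ-≡ j 0 (suc n) (N.+-identityʳ j & sym (N.*-identityʳ j) & e)
   ... | ()
   go (suc (suc e)) (_ , h) = ⊥-elim (N.<⇒≱ p (N.+-cancelˡ-≤ j j (suc n) (subst (j N.+ j N.≤_) h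
    (subst (j N.+ j N.≤_) (sym (N.*-suc j (suc e) & cong (j N.+_) (N.*-suc j e)))
     (N.+-monoʳ-≤ j (N.m≤m+n j (j N.* e)))))))
  mid : ∀ n -> n N.< j -> f (j N.+ n) ≡ g (j N.+ n)
  mid n p = left (factor-log j) (j N.+ n) & cong2 _-_ (first n p)
    (q^-⊛-+ j (u ⊛ factor-log j) n & q^-⊛-< j (factor-log j) n p) &
   Z.+-identityʳ _ & sym (rhs (j N.+ n))
  *-2+ : ∀ e -> j N.* suc (suc e) ≡ j N.+ (j N.+ j N.* e)
  *-2+ e = N.*-suc j (suc e) & cong (j N.+_) (N.*-suc j e)
  periodic : ∀ n -> factor-log j (j N.+ (j N.+ n)) ≡ factor-log j n
  periodic n = ∑-drop F (\ e -> 2 N.≤? e) small &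
   ∑-reindex (F ↾ (\ e -> 2 N.≤? e)) (below (suc n) ↾ (\ e -> j N.* e N.≟ n)) (N._∸ 2) (2 N.+_) {value} {value}
    (\ { (suc zero) (_ , s≤s ()) ; (suc (suc e)) ((_ , h) , _) -> s≤s (subst (e N.≤_) (cancel e h) (N.m≤n*m e j)) , cancel e h })
    (\ { e (_ , h) -> (s≤s (subst (suc (suc e) N.≤_) ((*-2+ e) & cong (\ z -> j N.+ (j N.+ z)) h) (N.m≤n*m (suc (suc e)) j))
             , (*-2+ e) & cong (\ z -> j N.+ (j N.+ z)) h) , s≤s 0<s })
    (\ { (suc zero) (_ , s≤s ()) ; (suc (suc e)) _ -> refl })
    (\ _ _ -> refl)
    (\ { (suc zero) (_ , s≤s ()) ; (suc (suc e)) _ -> refl }) where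
   F = below (suc (j N.+ (j N.+ n))) ↾ (\ e -> j N.* e N.≟ j N.+ (j N.+ n))
   value : ℕ -> ℤ
   value e = + 2 * + j * odd01 e
   cancel : ∀ e -> j N.* suc (suc e) ≡ j N.+ (j N.+ n) -> j N.* e ≡ n
   cancel e h = N.+-cancelˡ-≡ j _ _ (N.+-cancelˡ-≡ j _ _ (sym (*-2+ e) & h))
   small : ∀ e -> e N.< suc (j N.+ (j N.+ n)) × j N.* e ≡ j N.+ (j N.+ n) -> ¬ (2 N.≤ e) -> value e ≡ 0#
   small zero _ _ = Z.*-zeroʳ (+ 2 * + j)
   small (suc zero) (_ , h) _ = ⊥-elim (N.m+1+n≢m j {N.pred j N.+ n}
    (cong (\ z -> j N.+ (z N.+ n)) (N.suc-pred j) & sym h & N.*-identityʳ j))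
   small (suc (suc e)) _ ¬2≤ = ⊥-elim (¬2≤ (s≤s 0<s))
  hi : ∀ n -> f (j N.+ (j N.+ n)) ≡ g (j N.+ (j N.+ n))
  hi n = left (factor-log j) (j N.+ (j N.+ n)) & cong2 _-_ (periodic n)
    (q^-⊛-+ j (u ⊛ factor-log j) (j N.+ n) & q^-⊛-+ j (factor-log j) n) &
   Z.+-inverseʳ (factor-log j n) & sym (rhs (j N.+ (j N.+ n)) &
    cong (_*_ (+ 2 * + j)) (q^-high j (j N.+ n) (\ e -> j≢0 (N.m+n≡0⇒m≡0 j e))) & Z.*-zeroʳ (+ 2 * + j))

 partial-log : ℕ -> Series
 partial-log zero    = κ 0#
 partial-log (suc k) = partial-log k ⊕ factor-log (suc k)

 -- Logarithmic differentiation without division: the defect `X` is multiplied by 1 - u², which is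
 -- not a zero divisor. The result combines the product recursion, its derivative, the induction
 -- hypothesis and `factor-log-rec`.
 D-product : ∀ k -> D (product k) ≐ partial-log k ⊛ product k
 D-product zero    n = zero-case n & sym (0-⊛ (product 0) (\ { zero -> refl ; (suc i) -> refl }) n) where
  zero-case : ∀ n -> + n * product 0 n ≡ 0#
  zero-case zero    = refl
  zero-case (suc n) = Z.*-zeroʳ (+ suc n)
 D-product (suc k) = exact (unnull (lift (⊛-cancelˡ w X (\ ()) (exact key)))) where
  open Congruence 0
  open Ideal 0
  module R = CommutativeRing seriesRing
  u = q^ (suc k)
  P = product k
  P' = product (suc k)
  Λ = partial-log k
  l = factor-log (suc k)
  c = κ (+ suc k)
  w = κ 1# ⊕ ⊝ (u ⊛ u)
  X = D P' ⊕ ⊝ ((Λ ⊕ l) ⊛ P')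
  D-1-u : ∀ f -> D ((κ 1# ⊕ ⊝ u) ⊛ f) ≈ (⊝ (c ⊛ u)) ⊛ f ⊕ (κ 1# ⊕ ⊝ u) ⊛ D f
  D-1-u f = R.trans (lift (D-⊛ (κ 1# ⊕ ⊝ u) f)) (R.+-cong (R.*-cong (lift \ n ->
   D-⊕ (κ 1#) (⊝ u) n & cong2 _+_ (D-κ 1# n) (sym (Z.neg-distribʳ-* (+ n) (u n)) & cong -_ (D-q^ (suc k) n)) &
   lemma n ((c ⊛ u) n)) R.refl) R.refl) where
   lemma : ∀ n z -> κ 0# n + - z ≡ - z
   lemma zero z = Z.+-identityˡ _
   lemma (suc n) z = Z.+-identityˡ _
  D-1+u : ∀ f -> D ((κ 1# ⊕ u) ⊛ f) ≈ (c ⊛ u) ⊛ f ⊕ (κ 1# ⊕ u) ⊛ D f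
  D-1+u f = R.trans (lift (D-⊛ (κ 1# ⊕ u) f)) (R.+-cong (R.*-cong (lift \ n ->
   D-⊕ (κ 1#) u n & cong2 _+_ (D-κ 1# n) (D-q^ (suc k) n) & lemma n ((c ⊛ u) n)) R.refl) R.refl) where
   lemma : ∀ n z -> κ 0# n + z ≡ z
   lemma zero z = Z.+-identityˡ _
   lemma (suc n) z = Z.+-identityˡ _
  h1 : (κ 1# ⊕ ⊝ u) ⊛ P' ≈ (κ 1# ⊕ u) ⊛ P
  h1 = lift (product-step k)
  h2 : (⊝ (c ⊛ u)) ⊛ P' ⊕ (κ 1# ⊕ ⊝ u) ⊛ D P' ≈ (c ⊛ u) ⊛ P ⊕ (κ 1# ⊕ u) ⊛ D P
  h2 = R.trans (R.sym (D-1-u P')) (R.trans (lift (\ n -> cong (_*_ (+ n)) (product-step k n))) (D-1+u P))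
  h3 : D P ≈ Λ ⊛ P
  h3 = lift (D-product k)
  h4 : w ⊛ l ≈ (c ⊕ c) ⊛ u
  h4 = R.trans (lift (factor-log-rec (suc k) (\ ()))) (R.*-cong (lift (\ { zero -> lemma (+ suc k) ; (suc n) -> refl })) R.refl) where
   lemma : ∀ a -> + 2 * a ≡ a + a
   lemma = ring
  key : w ⊛ X ≈ κ 0#
  key = by (solve 8 (\ u P P' Λ l c dP dP' ->
     (con 1# :- u :* u) :* (dP' :- (Λ :+ l) :* P') :=
     (:- ((con 1# :+ u) :* Λ :+ c :* u)) :* ((con 1# :- u) :* P' :- (con 1# :+ u) :* P)
     :+ (con 1# :+ u) :* (((:- (c :* u)) :* P' :+ (con 1# :- u) :* dP') :- ((c :* u) :* P :+ (con 1# :+ u) :* dP))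
     :+ ((con 1# :+ u) :* (con 1# :+ u)) :* (dP :- Λ :* P)
     :+ (:- P') :* ((con 1# :- u :* u) :* l :- (c :+ c) :* u)) R.refl u P P' Λ l c (D P) (D P'))
   (_ *ᶻ null h1 +ᶻ _ *ᶻ null h2 +ᶻ _ *ᶻ null h3 +ᶻ _ *ᶻ null h4)
   where open Solver

 pbar : Series
 pbar n = + overpartition n

 product-stable : ∀ k n -> product (n N.+ k) n ≡ pbar n
 product-stable zero    n = cong (\ z -> product z n) (N.+-identityʳ n)
 product-stable (suc k) n = cong (\ z -> product z n) (N.+-suc n k) &
  product-low (n N.+ k) n (s≤s (N.m≤m+n n k)) & product-stable k n

 Divs : ℕ -> ℕ × ℕ -> Set
 Divs n (d , e) = 0 N.< d × 0 N.< e × d N.* e ≡ n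

 divs : ∀ n -> Enum (Divs n)
 divs n = within (below (suc n) ▹ (\ _ _ -> below (suc n)))
  (\ { (d , e) -> (0 N.<? d) ×-dec (0 N.<? e) ×-dec (d N.* e N.≟ n) })
  \ { (suc d , suc e) (_ , _ , refl) -> s≤s (N.m≤m*n (suc d) (suc e)) , s≤s (N.m≤n*m (suc e) (suc d)) }

 -- The Lambert series Σ w(d , e) q^(de) over d, e > 0; all Eisenstein series below are of this
 -- kind.
 lam : (ℕ -> ℕ -> ℤ) -> Series
 lam w n = ∑ (divs n) (\ z -> w (fst z) (snd z))

 log-pbar : Series
 log-pbar = lam (\ d e -> + 2 * + d * odd01 e)

 partial-log-∑ : ∀ k n -> partial-log k n ≡ ∑ (below k) (\ j -> factor-log (suc j) n)
 partial-log-∑ zero    zero    = sym (∑-below-zero _)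
 partial-log-∑ zero    (suc n) = sym (∑-below-zero _)
 partial-log-∑ (suc k) n       = cong (_+ factor-log (suc k) n) (partial-log-∑ k n) &
  sym (∑-below-last k (\ j -> factor-log (suc j) n))

 partial-log-limit : ∀ k n -> partial-log (n N.+ k) n ≡ log-pbar n
 partial-log-limit k n = partial-log-∑ (n N.+ k) n & below-extend n k _ big &
  sym (∑-▹ (below n) (\ j _ -> E j) (\ { (j , e) -> + 2 * + suc j * odd01 e }) (\ j -> factor-log (suc j) n) (\ _ _ -> refl)) &
  ∑-split all (\ { (j , e) -> 0 N.<? e }) & cong2 _+_
   (∑-reindex (all ↾ (\ { (j , e) -> 0 N.<? e })) (divs n) (\ { (j , e) -> suc j , e }) (\ { (d , e) -> N.pred d , e })
    (\ { (j , e) ((_ , _ , h) , 0<e) -> s≤s z≤n , 0<e , h })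
    (\ { (suc d , suc e) (_ , 0<e , refl) -> (N.m≤m*n (suc d) (suc e) , s≤s (N.m≤n*m (suc e) (suc d)) , refl) , 0<e })
    (\ _ _ -> refl) (\ { (suc d , e) _ -> refl }) (\ _ _ -> refl))
   (∑-0 (all ↾ _) (\ { (j , zero) _ -> Z.*-zeroʳ (+ 2 * + suc j) ; (j , suc e) (_ , n) -> ⊥-elim (n 0<s) })) &
   Z.+-identityʳ _ where
  E : ∀ j -> Enum (\ e -> e N.< suc n × suc j N.* e ≡ n)
  E j = below (suc n) ↾ (\ e -> suc j N.* e N.≟ n)
  all = below n ▹ (\ j _ -> E j)
  big : ∀ j -> n N.≤ j -> factor-log (suc j) n ≡ 0#
  big j n≤j = ∑-0 (E j) \ { zero _ -> Z.*-zeroʳ (+ 2 * + suc j)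
   ; (suc e) (_ , h) -> ⊥-elim (N.<⇒≱ (s≤s n≤j) (subst (suc j N.≤_) h (N.m≤m*n (suc j) (suc e)))) }

 -- Up to degree n the two limit series agree with `product n` and `partial-log n`, and coefficient
 -- n of a product sees nothing beyond that degree.
 D-pbar : D pbar ≐ log-pbar ⊛ pbar
 D-pbar n = cong (_*_ (+ n)) (sym (product-stable 0 n)) & cong (\ z -> D (product z) n) (N.+-identityʳ n) &
  D-product n n & local n (partial-log n) log-pbar (product n) pbar
   (\ i i≤n -> cong (\ z -> partial-log z i) (sym (N.m+[n∸m]≡n i≤n)) & partial-log-limit (n N.∸ i) i)
   (\ i i≤n -> cong (\ z -> product z i) (sym (N.m+[n∸m]≡n i≤n)) & product-stable (n N.∸ i) i) where
  local : ∀ n f f' g g' -> (∀ i -> i N.≤ n -> f i ≡ f' i) -> (∀ i -> i N.≤ n -> g i ≡ g' i) -> (f ⊛ g) n ≡ (f' ⊛ g') n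
  local zero    f f' g g' p q = cong2 _*_ (p 0 z≤n) (q 0 z≤n)
  local (suc n) f f' g g' p q = cong2 _+_ (cong2 _*_ (p 0 z≤n) (q (suc n) N.≤-refl))
   (local n (tail f) (tail f') g g' (\ i i≤n -> p (suc i) (s≤s i≤n)) (\ i i≤n -> q i (N.m≤n⇒m≤1+n i≤n)))

-- Theta series and the differential equation of θ(-q).

module Theta where
 open OverpartitionSeries public

 Triple : Set
 Triple = ℤ × ℤ × ℤ

 boxed : {R : Triple -> Set} (A B C : ℕ) -> (∀ x -> Dec (R x)) ->
  (∀ x -> R x -> ∣ fst x ∣ N.≤ A × ∣ fst (snd x) ∣ N.≤ B × ∣ snd (snd x) ∣ N.≤ C) -> Enum R
 boxed A B C = within (absBelow A ▹ (\ _ _ -> absBelow B ▹ (\ _ _ -> absBelow C)))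

 ∣∣-+ : ∀ x y {A B} -> ∣ x ∣ N.≤ A -> ∣ y ∣ N.≤ B -> ∣ x + y ∣ N.≤ A N.+ B
 ∣∣-+ x y p q = N.≤-trans (Z.∣i+j∣≤∣i∣+∣j∣ x y) (N.+-mono-≤ p q)

 ∣∣-neg : ∀ x {A} -> ∣ x ∣ N.≤ A -> ∣ - x ∣ N.≤ A
 ∣∣-neg x p = subst (N._≤ _) (sym (Z.∣-i∣≡∣i∣ x)) p

 ∣∣-- : ∀ x y {A B} -> ∣ x ∣ N.≤ A -> ∣ y ∣ N.≤ B -> ∣ x - y ∣ N.≤ A N.+ B
 ∣∣-- x y p q = ∣∣-+ x (- y) p (∣∣-neg y q)

 ∣∣-* : ∀ x y {A B} -> ∣ x ∣ N.≤ A -> ∣ y ∣ N.≤ B -> ∣ x * y ∣ N.≤ A N.* B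
 ∣∣-* x y p q = subst (N._≤ _) (sym (Z.abs-* x y)) (N.*-mono-≤ p q)

 ∣∣-divide : ∀ k x {A} -> k ≢ 0# -> ∣ k * x ∣ N.≤ A -> ∣ x ∣ N.≤ A
 ∣∣-divide k x k≢0 p = N.≤-trans (subst (∣ x ∣ N.≤_) (sym (Z.abs-* k x))
  (N.m≤n*m ∣ x ∣ ∣ k ∣ {{N.≢-nonZero (\ e -> k≢0 (Z.∣i∣≡0⇒i≡0 e))}})) p

 square-abs : ∀ x -> x * x ≡ + (∣ x ∣ N.* ∣ x ∣)
 square-abs (+ n)    = sym (Z.pos-* n n)
 square-abs -[1+ n ] = refl

 -- The source of finiteness for indefinite forms: two values of opposite sign bring the
 -- discriminant equation into the shape x² + uv = M with u and v positive, which bounds all three.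
 square-bounds : ∀ x {u v M} -> 0# < u -> 0# < v -> x * x + u * v ≡ + M ->
  ∣ x ∣ N.≤ M × ∣ u ∣ N.≤ M × ∣ v ∣ N.≤ M
 square-bounds x {+ suc u} {+ suc v} {M} _ _ e =
   N.≤-trans (self ∣ x ∣) (N.≤-trans (N.m≤m+n _ (suc u N.* suc v)) (N.≤-reflexive e'))
  , N.≤-trans (N.m≤m*n (suc u) (suc v)) (N.≤-trans (N.m≤n+m _ (∣ x ∣ N.* ∣ x ∣)) (N.≤-reflexive e'))
  , N.≤-trans (N.m≤n*m (suc v) (suc u)) (N.≤-trans (N.m≤n+m _ (∣ x ∣ N.* ∣ x ∣)) (N.≤-reflexive e')) where
  self : ∀ n -> n N.≤ n N.* n
  self zero    = z≤n
  self (suc n) = N.m≤m*n (suc n) (suc n)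
  e' : ∣ x ∣ N.* ∣ x ∣ N.+ suc u N.* suc v ≡ M
  e' = Z.+-injective (cong2 _+_ (sym (square-abs x)) (Z.pos-* (suc u) (suc v)) & e)
 square-bounds x {u = + zero} (+<+ ())
 square-bounds x {v = + zero} _ (+<+ ())

 0<- : ∀ {x} -> x < 0# -> 0# < - x
 0<- {x} = Z.neg-mono-<

 -<0 : ∀ {x} -> 0# < x -> - x < 0#
 -<0 {x} = Z.neg-mono-<

 sgn : ℕ -> ℤ
 sgn zero    = 1#
 sgn (suc n) = - sgn n

 sg : ℤ -> ℤ
 sg z = sgn ∣ z ∣

 tw-sgn : ∀ f n -> tw f n ≡ sgn n * f n
 tw-sgn f zero    = sym (Z.*-identityˡ (f 0))
 tw-sgn f (suc n) = cong -_ (tw-sgn (tail f) n) & Z.neg-distribˡ-* (sgn n) (f (suc n))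

 sgn-+ : ∀ m n -> sgn (m N.+ n) ≡ sgn m * sgn n
 sgn-+ zero    n = sym (Z.*-identityˡ (sgn n))
 sgn-+ (suc m) n = cong -_ (sgn-+ m n) & Z.neg-distribˡ-* (sgn m) (sgn n)

 sgn² : ∀ n -> sgn n * sgn n ≡ 1#
 sgn² zero    = refl
 sgn² (suc n) = lemma (sgn n) & sgn² n where
  lemma : ∀ x -> (- x) * (- x) ≡ x * x
  lemma = ring

 sgn-square : ∀ n -> sgn (n N.* n) ≡ sgn n
 sgn-square zero    = refl
 sgn-square (suc n) = cong -_ (sgn-+ n (n N.* suc n) & cong (\ z -> sgn n * sgn z) (N.*-suc n n)) &
  cong (\ z -> - (sgn n * z)) (sgn-+ n (n N.* n) & cong (_*_ (sgn n)) (sgn-square n)) &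
  cong (\ z -> - (sgn n * z)) (sgn² n) & cong -_ (Z.*-identityʳ (sgn n))

 sg-neg : ∀ z -> sg (- z) ≡ sg z
 sg-neg z = cong sgn (Z.∣-i∣≡∣i∣ z)

 private
  sg-suc : ∀ z -> sg (1# + z) ≡ - sg z
  sg-suc (+ n)          = refl
  sg-suc -[1+ zero ]    = refl
  sg-suc -[1+ suc n ]   = sym (Z.neg-involutive (- sgn n))

 sg-+ : ∀ a b -> sg (a + b) ≡ sg a * sg b
 sg-+ a (+ n)    = go n a where
  go : ∀ n a -> sg (a + + n) ≡ sg a * sgn n
  go zero    a = cong sg (Z.+-identityʳ a) & sym (Z.*-identityʳ (sg a))
  go (suc n) a = cong sg (cong (_+_ a) (Z.pos-+ 1 n) & lemma a (+ n)) &
   sg-suc (a + + n) & cong -_ (go n a) & Z.neg-distribʳ-* (sg a) (sgn n) where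
   lemma : ∀ a n -> a + (1# + n) ≡ 1# + (a + n)
   lemma = ring
 sg-+ a -[1+ n ] = sym (sg-neg (a + -[1+ n ])) & cong sg (Z.neg-distrib-+ a -[1+ n ]) &
  sg-+ (- a) (+ suc n) & cong (_* sgn (suc n)) (sg-neg a)

 sg-double : ∀ a b -> sg (a + (b + b)) ≡ sg a
 sg-double a b = sg-+ a (b + b) & cong (_*_ (sg a)) (sg-+ b b & (sgn² ∣ b ∣)) & Z.*-identityʳ (sg a)

 Sqrt : ℕ -> ℤ -> Set
 Sqrt n s = s * s ≡ + n

 sqrts : ∀ n -> Enum (Sqrt n)
 sqrts n = within (absBelow n) (\ s -> s * s ≟ + n) (\ s e -> bound ∣ s ∣ (Z.+-injective (sym (square-abs s) & e))) where
  bound : ∀ m -> m N.* m ≡ n -> m N.≤ n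
  bound zero    _    = z≤n
  bound (suc m) refl = N.m≤m*n (suc m) (suc m)

 θ φ : Series
 θ n = ∑ (sqrts n) (\ _ -> 1#)
 φ n = ∑ (sqrts n) sg

 tw-θ : tw θ ≐ φ
 tw-θ n = tw-sgn θ n & sym (∑-* (sqrts n) (sgn n) (\ _ -> 1#)) &
  ∑-cong (sqrts n) (\ s e -> Z.*-identityʳ (sgn n) &
   cong sgn (Z.+-injective (sym e & square-abs s)) & (sgn-square ∣ s ∣))

 -- A count that gives Dφ = -log-pbar · φ without the triple product. A triple is the form aX² +
 -- 2sXY + cY² with s² - ac = n, and `q` is its value at (1 , 2). The regions a < 0 < q, a < 0 < c
 -- and q < 0 < c are each cut by the sign of the missing quantity. A reflection kills the sum over
 -- the first region, a substitution carries the third to the second, and what is left over lies on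
 -- c = 0.
 module ThetaODE (n : ℕ) where
  private
   Disc : Triple -> Set
   Disc (a , s , c) = s * s - a * c ≡ + n
   disc? : ∀ x -> Dec (Disc x)
   disc? (a , s , c) = s * s - a * c ≟ + n
   q : Triple -> ℤ
   q (a , s , c) = a + + 4 * s + + 4 * c
   -- Only odd `a` count. For these the reflection s ↦ -(a + s), which keeps `a` and `q`, reverses
   -- the sign (-1)^s; this is why `∑1≡0` holds.
   w : Triple -> ℤ
   w (a , s , c) = (1# - sg a) * sg s
   R1 R2 R3 : Triple -> Set
   R1 x@(a , s , c) = Disc x × a < 0# × 0# < q x
   R2 x@(a , s , c) = Disc x × a < 0# × 0# < c
   R3 x@(a , s , c) = Disc x × q x < 0# × 0# < c
   E1 : Enum R1
   E1 = boxed n' (n' N.+ n') ((n' N.+ n') N.+ 4 N.* (n' N.+ n'))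
    (\ x@(a , s , c) -> disc? x ×-dec (a <? 0#) ×-dec (0# <? q x)) bound where
    n' = 4 N.* n
    bound : ∀ x -> R1 x -> _
    bound (a , s , c) (d , a<0 , 0<q) =
     bounds (square-bounds (a + + 2 * s) (0<- a<0) 0<q (disc-q a s c & cong (_*_ (+ 4)) d & sym (Z.pos-* 4 n))) where
     disc-q : ∀ a s c -> (a + + 2 * s) * (a + + 2 * s) + (- a) * (a + + 4 * s + + 4 * c) ≡ + 4 * (s * s - a * c)
     disc-q = ring
     two-s : ∀ a s -> (a + + 2 * s) - a ≡ + 2 * s
     two-s = ring
     four-c : ∀ a s c -> (a + + 4 * s + + 4 * c) - a - + 4 * s ≡ + 4 * c
     four-c = ring
     bounds : ∣ a + + 2 * s ∣ N.≤ 4 N.* n × ∣ - a ∣ N.≤ 4 N.* n × ∣ q (a , s , c) ∣ N.≤ 4 N.* n -> ∣ a ∣ N.≤ n' × ∣ s ∣ N.≤ n' N.+ n' × ∣ c ∣ N.≤ (n' N.+ n') N.+ 4 N.* (n' N.+ n')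
     bounds (b , ua , uq) = ba , bs , ∣∣-divide (+ 4) c (\ ()) (subst (\ z -> ∣ z ∣ N.≤ n' N.+ n' N.+ 4 N.* (n' N.+ n')) (four-c a s c)
      (∣∣-- (q (a , s , c) - a) (+ 4 * s) (∣∣-- (q (a , s , c)) a uq ba) (∣∣-* (+ 4) s N.≤-refl bs))) where
      ba : ∣ a ∣ N.≤ n'
      ba = subst (N._≤ n') (Z.∣-i∣≡∣i∣ a) ua
      bs : ∣ s ∣ N.≤ n' N.+ n'
      bs = ∣∣-divide (+ 2) s (\ ()) (subst (\ z -> ∣ z ∣ N.≤ n' N.+ n') (two-s a s) (∣∣-- (a + + 2 * s) a b ba))
   E2 : Enum R2
   E2 = boxed n n n (\ x@(a , s , c) -> disc? x ×-dec (a <? 0#) ×-dec (0# <? c)) bound where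
    bound : ∀ x -> R2 x -> _
    bound (a , s , c) (d , a<0 , 0<c) =
     let b , ua , uc = square-bounds s (0<- a<0) 0<c (lemma a s c & d) in
     subst (N._≤ n) (Z.∣-i∣≡∣i∣ a) ua , b , uc where
     lemma : ∀ a s c -> s * s + (- a) * c ≡ s * s - a * c
     lemma = ring
   to3 from3 : Triple -> Triple
   to3   (a , s , c) = a + + 4 * s + + 4 * c , s + + 2 * c , c
   from3 (a , s , c) = a - + 4 * s + + 4 * c , s - + 2 * c , c
   triple-≡ : ∀ {a a' b b' c c' : ℤ} -> a ≡ a' -> b ≡ b' -> c ≡ c' -> (a , b , c) ≡ (a' , b' , c')
   triple-≡ refl refl refl = refl
   from-to3 : ∀ x -> from3 (to3 x) ≡ x
   from-to3 (a , s , c) = triple-≡ (l1 a s c) (l2 s c) refl where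
    l1 : ∀ a s c -> (a + + 4 * s + + 4 * c) - + 4 * (s + + 2 * c) + + 4 * c ≡ a
    l1 = ring
    l2 : ∀ s c -> (s + + 2 * c) - + 2 * c ≡ s
    l2 = ring
   to-from3 : ∀ x -> to3 (from3 x) ≡ x
   to-from3 (a , s , c) = triple-≡ (l1 a s c) (l2 s c) refl where
    l1 : ∀ a s c -> (a - + 4 * s + + 4 * c) + + 4 * (s - + 2 * c) + + 4 * c ≡ a
    l1 = ring
    l2 : ∀ s c -> (s - + 2 * c) + + 2 * c ≡ s
    l2 = ring
   disc-to3 : ∀ a s c -> (s + + 2 * c) * (s + + 2 * c) - (a + + 4 * s + + 4 * c) * c ≡ s * s - a * c
   disc-to3 = ring
   R3→R2 : ∀ x -> R3 x -> R2 (to3 x)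
   R3→R2 (a , s , c) (d , q<0 , 0<c) = disc-to3 a s c & d , q<0 , 0<c
   R2→R3 : ∀ x -> R2 x -> R3 (from3 x)
   R2→R3 x@(a , s , c) (d , a<0 , 0<c) =
    sym (disc-to3 (fst (from3 x)) (fst (snd (from3 x))) c) & cong (\ { (a , s , c) -> s * s - a * c }) (to-from3 x) & d
    , ≡<0 (sym (cong fst (to-from3 x))) a<0 , 0<c
   E3 : Enum R3
   E3 = boxed (n N.+ 4 N.* (n N.+ 2 N.* n) N.+ 4 N.* n) (n N.+ 2 N.* n) n
    (\ x@(a , s , c) -> disc? x ×-dec (q x <? 0#) ×-dec (0# <? c)) bound where
    lemma : ∀ a s c -> s * s + (- a) * c ≡ s * s - a * c
    lemma = ring
    l1 : ∀ a s c -> (a + + 4 * s + + 4 * c) - + 4 * s - + 4 * c ≡ a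
    l1 = ring
    l2 : ∀ s c -> (s + + 2 * c) - + 2 * c ≡ s
    l2 = ring
    N1 = n N.+ 2 N.* n
    N2 = n N.+ 4 N.* N1 N.+ 4 N.* n
    Bounded : Triple -> Set
    Bounded (a , s , c) = ∣ a ∣ N.≤ N2 × ∣ s ∣ N.≤ N1 × ∣ c ∣ N.≤ n
    unshift : ∀ a s c p t -> p ≡ a + + 4 * s + + 4 * c -> t ≡ s + + 2 * c ->
     ∣ t ∣ N.≤ n × ∣ - p ∣ N.≤ n × ∣ c ∣ N.≤ n -> Bounded (a , s , c)
    unshift a s c p t pe te (bt , bp , bc) = ba , bs , bc where
     bs : ∣ s ∣ N.≤ N1
     bs = subst (\ z -> ∣ z ∣ N.≤ N1) (cong (\ z -> z - + 2 * c) te & l2 s c) (∣∣-- t (+ 2 * c) bt (∣∣-* (+ 2) c {B = n} N.≤-refl bc))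
     b1 : ∣ p - + 4 * s ∣ N.≤ n N.+ 4 N.* N1
     b1 = ∣∣-- p (+ 4 * s) (subst (N._≤ n) (Z.∣-i∣≡∣i∣ p) bp) (∣∣-* (+ 4) s {B = N1} N.≤-refl bs)
     ba : ∣ a ∣ N.≤ N2
     ba = subst (\ z -> ∣ z ∣ N.≤ N2) (cong (\ z -> z - + 4 * s - + 4 * c) pe & l1 a s c)
         (∣∣-- (p - + 4 * s) (+ 4 * c) b1 (∣∣-* (+ 4) c {B = n} N.≤-refl bc))
    bound : ∀ x -> R3 x -> Bounded x
    bound (a , s , c) (d , q<0 , 0<c) = unshift a s c _ _ refl refl
     (square-bounds (s + + 2 * c) (0<- q<0) 0<c (lemma (q (a , s , c)) (s + + 2 * c) c & disc-to3 a s c & d))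
   self-negating : ∀ {z} -> z ≡ - z -> z ≡ 0#
   self-negating {+ zero}   _ = refl
   self-negating {+ suc n} ()
   self-negating { -[1+ n ]} ()
   ∑1≡0 : ∑ E1 (\ x -> w x * q x) ≡ 0#
   ∑1≡0 = self-negating (∑-reindex E1 E1 f f {\ x -> w x * q x} {\ x -> - (w x * q x)} to to inv inv val &
    ∑-neg E1 (\ x -> w x * q x)) where
    f : Triple -> Triple
    f (a , s , c) = a , - (a + s) , a + + 2 * s + c
    dd : ∀ a s c -> (- (a + s)) * (- (a + s)) - a * (a + + 2 * s + c) ≡ s * s - a * c
    dd = ring
    qq : ∀ a s c -> a + + 4 * s + + 4 * c ≡ a + + 4 * (- (a + s)) + + 4 * (a + + 2 * s + c)
    qq = ring
    to : ∀ x -> R1 x -> R1 (f x)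
    to (a , s , c) (d , a<0 , 0<q) = dd a s c & d , a<0 , 0<≡ (qq a s c) 0<q
    inv : ∀ x -> R1 x -> f (f x) ≡ x
    inv (a , s , c) _ = triple-≡ refl (l2 a s) (l3 a s c) where
     l2 : ∀ a s -> - (a + - (a + s)) ≡ s
     l2 = ring
     l3 : ∀ a s c -> a + + 2 * (- (a + s)) + (a + + 2 * s + c) ≡ c
     l3 = ring
    val : ∀ x -> R1 x -> - (w (f x) * q (f x)) ≡ w x * q x
    val (a , s , c) _ = cong (\ z -> - ((1# - sg a) * sg (- (a + s)) * z)) (sym (qq a s c)) &
     cong (\ z -> - ((1# - sg a) * z * q (a , s , c))) (sg-neg (a + s) & sg-+ a s) &
     l (sg a) (sg s) (q (a , s , c)) & cong (\ z -> (z - sg a) * sg s * q (a , s , c)) (sgn² ∣ a ∣) & refl where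
     l : ∀ a s q -> - ((1# - a) * (a * s) * q) ≡ (a * a - a) * s * q
     l = ring
   X1 X2 X3 X0 α β : ℤ
   X1 = ∑ (E2 ↾ \ x -> 0# <? q x) (\ x -> w x * q x)
   X2 = ∑ (E2 ↾ \ x -> q x <? 0#) (\ x -> w x * q x)
   X3 = ∑ (E1 ↾ \ x -> snd (snd x) <? 0#) (\ x -> w x * q x)
   X0 = ∑ (E1 ↾ \ x -> snd (snd x) ≟ 0#) (\ x -> w x * q x)
   α  = ∑ E2 (\ x -> w x * snd (snd x))
   β  = ∑ E2 (\ x -> w x * fst x)
   split1 : X1 + X0 + X3 ≡ 0#
   split1 = cong (\ z -> z + X0 + X3) (∑-same (E2 ↾ \ x -> 0# <? q x) (E1 ↾ \ x -> 0# <? snd (snd x))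
     (\ { x ((d , a , c) , q) -> (d , a , q) , c }) (\ { x ((d , a , q) , c) -> (d , a , c) , q })) &
    sym (∑-sign E1 (\ x -> snd (snd x))) & ∑1≡0
   split2 : ∑ E2 (\ x -> w x * q x) ≡ X1 + X2
   split2 = ∑-sign E2 q & cong (_+ X2) (cong (_+_ X1)
    (∑-0 (E2 ↾ \ x -> q x ≟ 0#) (\ { x (_ , e) -> cong (_*_ (w x)) e & Z.*-zeroʳ (w x) })) & Z.+-identityʳ X1)
   linear2 : ∑ E2 (\ x -> w x * q x) ≡ β + + 4 * α
   linear2 = ∑-cong E2 (\ { (a , s , c) _ -> expand (w (a , s , c)) a s c }) &
    ∑-+ E2 _ _ & cong2 _+_ (∑-+ E2 _ _) refl & cong2 (\ y z -> β + y + z)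
     (∑-* E2 (+ 4) (\ { x@(a , s , c) -> w x * s }) & cong (_*_ (+ 4)) odd) (∑-* E2 (+ 4) (\ x -> w x * snd (snd x))) &
     cong (_+ + 4 * α) (Z.+-identityʳ β) where
    expand : ∀ w a s c -> w * (a + + 4 * s + + 4 * c) ≡ w * a + + 4 * (w * s) + + 4 * (w * c)
    expand = ring
    f : Triple -> Triple
    f (a , s , c) = a , - s , c
    sq : ∀ s -> (- s) * (- s) ≡ s * s
    sq = ring
    to : ∀ x -> R2 x -> R2 (f x)
    to (a , s , c) (d , r) = cong (_- a * c) (sq s) & d , r
    odd : ∑ E2 (\ { x@(a , s , c) -> w x * s }) ≡ 0#
    odd = self-negating (∑-reindex E2 E2 f f {\ { x@(a , s , c) -> w x * s }} {\ { x@(a , s , c) -> - (w x * s) }} to to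
     (\ { (a , s , c) _ -> triple-≡ refl (Z.neg-involutive s) refl })
     (\ { (a , s , c) _ -> triple-≡ refl (Z.neg-involutive s) refl })
     (\ { (a , s , c) _ -> cong (\ z -> - ((1# - sg a) * z * - s)) (sg-neg s) & l ((1# - sg a) * sg s) s }) &
     ∑-neg E2 (\ { x@(a , s , c) -> w x * s })) where
     l : ∀ w s -> - (w * - s) ≡ w * s
     l = ring
   -- The substitution Y ↦ Y + 2X turns the value at (1 , 2) into the leading coefficient and
   -- changes `a` and `s` by even numbers, so the weight is kept.
   shift3 : ∑ E3 (\ x -> w x * q x) ≡ β
   shift3 = ∑-reindex E3 E2 to3 from3 {\ x -> w x * q x} {\ x -> w x * fst x} R3→R2 R2→R3 (\ x _ -> from-to3 x) (\ x _ -> to-from3 x)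
    (\ { (a , s , c) _ -> cong2 (\ y z -> (1# - y) * z * q (a , s , c))
     (cong sg (l1 a s c) & sg-double a (+ 2 * s + + 2 * c)) (cong sg (l2 s c) & sg-double s c) }) where
    l1 : ∀ a s c -> a + + 4 * s + + 4 * c ≡ a + ((+ 2 * s + + 2 * c) + (+ 2 * s + + 2 * c))
    l1 = ring
    l2 : ∀ s c -> s + + 2 * c ≡ s + (c + c)
    l2 = ring
   split3 : ∑ E3 (\ x -> w x * q x) ≡ - X3 + X2
   split3 = ∑-sign E3 fst & cong2 _+_ (cong2 _+_ negated
     (∑-0 (E3 ↾ \ x -> fst x ≟ 0#) (\ { (a , s , c) (_ , refl) -> refl })) & Z.+-identityʳ (- X3))
    (∑-same (E3 ↾ \ x -> fst x <? 0#) (E2 ↾ \ x -> q x <? 0#)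
     (\ { x ((d , q , c) , a) -> (d , a , c) , q }) (\ { x ((d , a , c) , q) -> (d , q , c) , a })) where
    f : Triple -> Triple
    f (a , s , c) = - a , - s , - c
    ff : ∀ x -> f (f x) ≡ x
    ff (a , s , c) = triple-≡ (Z.neg-involutive a) (Z.neg-involutive s) (Z.neg-involutive c)
    dd : ∀ a s c -> (- s) * (- s) - (- a) * (- c) ≡ s * s - a * c
    dd = ring
    qq : ∀ a s c -> - (a + + 4 * s + + 4 * c) ≡ (- a) + + 4 * (- s) + + 4 * (- c)
    qq = ring
    negated : ∑ (E3 ↾ \ x -> 0# <? fst x) (\ x -> w x * q x) ≡ - X3
    negated = ∑-reindex (E3 ↾ \ x -> 0# <? fst x) (E1 ↾ \ x -> snd (snd x) <? 0#) f f
     {\ x -> w x * q x} {\ x -> - (w x * q x)}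
     (\ { (a , s , c) ((d , q , c>) , a>) -> (dd a s c & d , -<0 a> , 0<≡ (qq a s c) (0<- q)) , -<0 c> })
     (\ { (a , s , c) ((d , a< , q) , c<) -> (dd a s c & d , ≡<0 (qq a s c) (-<0 q) , 0<- c<) , 0<- a< })
     (\ x _ -> ff x) (\ x _ -> ff x)
     (\ { (a , s , c) _ -> cong2 (\ y z -> - ((1# - y) * z * q (f (a , s , c)))) (sg-neg a) (sg-neg s) &
       cong (\ z -> - (w (a , s , c) * z)) (sym (qq a s c)) & l (w (a , s , c)) (q (a , s , c)) }) &
     ∑-neg (E1 ↾ \ x -> snd (snd x) <? 0#) (\ x -> w x * q x) where
     l : ∀ w q -> - (w * - q) ≡ w * q
     l = ring
   -- Eliminating `β`, `X1`, `X2` and `X3` from the three decompositions leaves only the forms with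
   -- c = 0.
   4α : + 4 * α ≡ - X0
   4α = combine X1 X2 X3 X0 α β split1 (sym linear2 & split2) (sym shift3 & split3) where
    combine : ∀ x1 x2 x3 x0 α β -> x1 + x0 + x3 ≡ 0# -> β + + 4 * α ≡ x1 + x2 -> β ≡ - x3 + x2 -> + 4 * α ≡ - x0
    combine x1 x2 x3 x0 α β p r t = l1 α β & (trans (cong2 _-_ r t) (l2 x1 x2 x3 x0 & cong (_- x0) p ) ⟨trans⟩ Z.+-identityˡ (- x0)) where
     _⟨trans⟩_ : ∀ {x y z : ℤ} -> x ≡ y -> y ≡ z -> x ≡ z
     _⟨trans⟩_ = trans
     l1 : ∀ α β -> + 4 * α ≡ (β + + 4 * α) - β
     l1 = ring
     l2 : ∀ x1 x2 x3 x0 -> (x1 + x2) - (- x3 + x2) ≡ (x1 + x0 + x3) - x0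
     l2 = ring
   staircase : ∀ j M -> ∑ (below (j N.+ j)) (\ e -> (1# - sgn e) * (M - + e)) ≡ + 2 * (+ j * M - + j * + j)
   staircase zero    M = ∑-below-zero _ & sym (l M) where
    l : ∀ M -> + 2 * (+ 0 * M - + 0 * + 0) ≡ + 0
    l = ring
   staircase (suc j) M = cong (\ k -> ∑ (below k) v) (cong suc (N.+-suc j j)) &
    ∑-below-last (suc (j N.+ j)) v & cong (_+ v (suc (j N.+ j))) (∑-below-last (j N.+ j) v) &
    cong2 (\ y z -> y + (1# - z) * (M - + (j N.+ j)) + (1# - - z) * (M - + suc (j N.+ j)))
     (staircase j M) (sgn-+ j j & sgn² j) &
    cong2 (\ y z -> + 2 * (+ j * M - + j * + j) + (1# - 1#) * (M - y) + (1# - - 1#) * (M - z))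
     (Z.pos-+ j j) (Z.pos-+ 1 (j N.+ j) & cong (_+_ 1#) (Z.pos-+ j j)) &
    l (+ j) M & cong (\ z -> + 2 * (z * M - z * z)) (sym (Z.pos-+ 1 j)) where
    v : ℕ -> ℤ
    v e = (1# - sgn e) * (M - + e)
    l : ∀ j M -> + 2 * (j * M - j * j) + (1# - 1#) * (M - (j + j)) + (1# - - 1#) * (M - (1# + (j + j)))
      ≡ + 2 * ((1# + j) * M - (1# + j) * (1# + j))
    l = ring
   pos : Enum (\ s -> Sqrt n s × 0# < s)
   pos = sqrts n ↾ (0# <?_)
   -- With c = 0 the conditions become s > 0 and a = -e with 0 < e < 4s. The index set also admits e
   -- = 0, where the weight 1 - (-1)^e vanishes; summing 4s - e over the odd e gives the 8s².
   X0-value : X0 ≡ ∑ pos (\ s -> sg s * (+ 8 * (s * s)))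
   X0-value = ∑-drop E0 (\ x -> fst x <? 0#) (\ { x ((_ , a<0 , _) , _) n -> ⊥-elim (n a<0) }) &
    ∑-reindex (E0 ↾ (\ x -> fst x <? 0#)) (pairs ↾ (\ z -> 0 N.<? snd z)) f g {\ x -> w x * q x} {v} to from
     (\ { (-[1+ a ] , s , c) ((_ , refl) , _) -> refl ; (+ a , s , c) (_ , +<+ ()) })
     (\ { (s , suc e) _ -> refl ; (s , zero) (_ , ()) })
     (\ { (a , s , c) ((_ , refl) , a<0) -> val a s a<0 }) &
    sym (∑-drop pairs (\ z -> 0 N.<? snd z)
      (\ { (s , zero) _ _ -> cong (_*_ (sg s)) (Z.*-zeroˡ (+ 4 * s - + 0)) ⟨≡⟩ Z.*-zeroʳ (sg s) ; (s , suc e) _ n -> ⊥-elim (n 0<s) })) &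
    ∑-▹ pos (\ s _ -> below (4 N.* ∣ s ∣)) v (\ s -> sg s * (+ 8 * (s * s))) inner where
    infixl 1 _⟨≡⟩_
    _⟨≡⟩_ : ∀ {x y z : ℤ} -> x ≡ y -> y ≡ z -> x ≡ z
    _⟨≡⟩_ = trans
    dz : ∀ a s -> s * s - a * 0# ≡ s * s
    dz = ring
    E0 = E1 ↾ (\ x -> snd (snd x) ≟ 0#)
    pairs : Enum (\ z -> (Sqrt n (fst z) × 0# < fst z) × snd z N.< 4 N.* ∣ fst z ∣)
    pairs = pos ▹ (\ s _ -> below (4 N.* ∣ s ∣))
    v : ℤ × ℕ -> ℤ
    v (s , e) = sg s * ((1# - sgn e) * (+ 4 * s - + e))
    f : Triple -> ℤ × ℕ
    f (a , s , c) = s , ∣ a ∣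
    g : ℤ × ℕ -> Triple
    g (s , e) = - + e , s , 0#
    to : ∀ x -> (R1 x × snd (snd x) ≡ 0#) × fst x < 0# -> _
    to (-[1+ a ] , + suc s , c) (((d , _ , 0<q) , refl) , a<0) =
     ((sym (dz -[1+ a ] (+ suc s)) & d , +<+ 0<s) ,
      Z.drop‿+<+ (subst2 _<_ (Z.+-identityˡ (+ suc a))
       (cong (_+ + suc a) (Z.+-identityʳ (-[1+ a ] + + 4 * + suc s)) & l (+ suc a) (+ 4 * + suc s) & sym (Z.pos-* 4 (suc s)))
       (Z.+-monoˡ-< (+ suc a) 0<q))) , s≤s z≤n where
     l : ∀ a x -> - a + x + a ≡ x
     l = ring
    to (-[1+ a ] , + zero , c) (((d , _ , ()) , refl) , a<0)
    to (-[1+ a ] , -[1+ s ] , c) (((d , _ , ()) , refl) , a<0)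
    to (+ a , s , c) (_ , +<+ ())
    from : ∀ z -> _ -> _
    from (+ suc s , suc e) (((d , _) , e<4s) , _) =
     (((dz -[1+ e ] (+ suc s)) & d , -<+ ,
      0<≡ (sym (Z.+-identityʳ (-[1+ e ] + + 4 * + suc s))) (subst2 _<_ (Z.+-inverseˡ (+ suc e)) (cong (_+_ -[1+ e ]) (Z.pos-* 4 (suc s))) (Z.+-monoʳ-< -[1+ e ] (+<+ e<4s))))
     , refl) , -<+
    from (+ suc s , zero) (_ , ())
    from (+ zero , e) (((_ , +<+ ()) , _) , _)
    val : ∀ a s -> a < 0# -> v (f (a , s , 0#)) ≡ w (a , s , 0#) * q (a , s , 0#)
    val -[1+ a ] s _ = l (sg s) (sgn (suc a)) (+ suc a) s where
     l : ∀ σ τ a s -> σ * ((1# - τ) * (+ 4 * s - a)) ≡ (1# - τ) * σ * ((- a) + + 4 * s + + 4 * 0#)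
     l = ring
    val (+ a) s (+<+ ())
    inner : ∀ s (p : Sqrt n s × 0# < s) -> sg s * (+ 8 * (s * s)) ≡ ∑ (below (4 N.* ∣ s ∣)) (\ e -> v (s , e))
    inner (+ s) _ = sym (∑-* (below (4 N.* s)) (sgn s) (\ e -> (1# - sgn e) * (+ 4 * + s - + e)) &
     cong (_*_ (sgn s)) (cong (\ k -> ∑ (below k) (\ e -> (1# - sgn e) * (+ 4 * + s - + e))) (dbl s) &
     staircase (2 N.* s) (+ 4 * + s) & cong (\ z -> + 2 * (z * (+ 4 * + s) - z * z)) (Z.pos-* 2 s) & l (+ s))) where
     l : ∀ s -> + 2 * (+ 2 * s * (+ 4 * s) - + 2 * s * (+ 2 * s)) ≡ + 8 * (s * s)
     l = ring
     dbl : ∀ s -> 4 N.* s ≡ 2 N.* s N.+ 2 N.* s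
     dbl s = N.*-distribʳ-+ s 2 2
    inner -[1+ s ] (_ , ())
   D-φ-value : D φ n ≡ + 2 * ∑ pos (\ s -> sg s * (s * s))
   D-φ-value = sym (∑-* (sqrts n) (+ n) sg) & ∑-cong (sqrts n) (\ s e -> Z.*-comm (+ n) (sg s) & cong (_*_ (sg s)) (sym e)) &
    ∑-sign (sqrts n) id & cong2 (\ y z -> P + y + z)
     (∑-0 (sqrts n ↾ (_≟ 0#)) (\ { s (_ , refl) -> refl }))
     (∑-reindex (sqrts n ↾ (_<? 0#)) pos -_ -_ {u} {u} (\ { s (e , p) -> sq s & e , 0<- p }) (\ { s (e , p) -> sq s & e , -<0 p })
      (\ s _ -> Z.neg-involutive s) (\ s _ -> Z.neg-involutive s) (\ s _ -> cong2 _*_ (sg-neg s) (sq s))) &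
     l P where
    u : ℤ -> ℤ
    u s = sg s * (s * s)
    P = ∑ pos u
    sq : ∀ s -> (- s) * (- s) ≡ s * s
    sq = ring
    l : ∀ p -> p + 0# + p ≡ + 2 * p
    l = ring
   odd01-sgn : ∀ e -> + 2 * odd01 e ≡ 1# - sgn e
   odd01-sgn zero          = refl
   odd01-sgn (suc zero)    = refl
   odd01-sgn (suc (suc e)) = odd01-sgn e & cong (_-_ 1#) (sym (Z.neg-involutive (sgn e)))
   Conv : ℕ × (ℕ × ℕ) × ℤ -> Set
   Conv (k , z , s) = k N.< suc n × Divs k z × Sqrt (n N.∸ k) s
   conv : Enum Conv
   conv = below (suc n) ▹ (\ k _ -> divs k ▹ (\ _ _ -> sqrts (n N.∸ k)))
   v1 : ℕ × ℕ -> ℤ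
   v1 (d , e) = + 2 * + d * odd01 e
   -- Writing a = -e and c = d turns s² - ac = n into n = s² + de; the factor 1 - (-1)^e is twice
   -- the indicator of odd e, which is the weight in `log-pbar`.
   convolution : (log-pbar ⊛ φ) n ≡ α
   convolution = (⊛-∑∑ divs sqrts v1 sg n) &
    ∑-reindex conv E2 f g {\ z -> v1 (fst (snd z)) * sg (snd (snd z))} {\ x -> w x * snd (snd x)} to from
     (\ { (k , (d , suc e) , s) (_ , (_ , _ , refl) , _) -> refl ; (k , (d , zero) , s) (_ , (_ , () , _) , _) })
     back
     (\ { (k , (d , suc e) , s) (_ , (_ , _ , refl) , _) -> cong (\ z -> z * sg s * + d) (sym (odd01-sgn (suc e))) & l (odd01 (suc e)) (+ d) (sg s)
       ; (k , (d , zero) , s) (_ , (_ , () , _) , _) }) where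
    f : ℕ × (ℕ × ℕ) × ℤ -> Triple
    f (k , (d , e) , s) = - + e , s , + d
    g : Triple -> ℕ × (ℕ × ℕ) × ℤ
    g (a , s , c) = ∣ c ∣ N.* ∣ a ∣ , (∣ c ∣ , ∣ a ∣) , s
    l : ∀ o d s -> + 2 * o * s * d ≡ + 2 * d * o * s
    l = ring
    to : ∀ z -> Conv z -> R2 (f z)
    to (k , (d , suc e) , s) (k<n , (0<d , _ , de) , ss) =
     cong2 _+_ ss (cong -_ (sym (Z.neg-distribˡ-* (+ suc e) (+ d))) & Z.neg-involutive (+ suc e * + d) & sym (Z.pos-* (suc e) d) & cong +_ (N.*-comm (suc e) d & de)) &
      sym (Z.pos-+ (n N.∸ k) k) & cong +_ (N.m∸n+n≡m (N.≤-pred k<n)) , -<+ , +<+ 0<d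
    to (k , (d , zero) , s) (_ , (_ , () , _) , _)
    g-sum : ∀ a c s -> s * s - -[1+ a ] * + suc c ≡ + n -> ∣ s ∣ N.* ∣ s ∣ N.+ suc c N.* suc a ≡ n
    g-sum a c s d = Z.+-injective (Z.pos-+ (∣ s ∣ N.* ∣ s ∣) _ & cong2 _+_ (sym (square-abs s))
     (Z.pos-* (suc c) (suc a) & lemma (+ suc a) (+ suc c)) & d) where
     lemma : ∀ a c -> c * a ≡ - ((- a) * c)
     lemma = ring
    from : ∀ x -> R2 x -> Conv (g x)
    from (-[1+ a ] , s , + suc c) (d , _ , _) =
     s≤s (subst (suc c N.* suc a N.≤_) e (N.m≤n+m _ (∣ s ∣ N.* ∣ s ∣))) , (s≤s z≤n , s≤s z≤n , refl) ,
     square-abs s & cong +_ (sym (N.m+n∸n≡m _ (suc c N.* suc a)) & cong (N._∸ suc c N.* suc a) e)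
     where e = g-sum a c s d
    from (+ a , s , c) (d , +<+ () , _)
    from (-[1+ a ] , s , + zero) (d , _ , +<+ ())
    back : ∀ x -> R2 x -> f (g x) ≡ x
    back (-[1+ a ] , s , + suc c) _ = refl
    back (+ a , s , c) (d , +<+ () , _)
    back (-[1+ a ] , s , + zero) (d , _ , +<+ ())

  D-φ : D φ n ≡ - (log-pbar ⊛ φ) n
  D-φ = D-φ-value & Z.*-cancelˡ-≡ (+ 4) (+ 2 * P) (- (log-pbar ⊛ φ) n) (l P &
   sym (X0-value & ∑-cong pos (\ s _ -> l2 (sg s) (s * s)) & ∑-* pos (+ 8) (\ s -> sg s * (s * s))) &
   sym (Z.neg-involutive X0) & cong -_ (sym 4α) & Z.neg-distribʳ-* (+ 4) α & cong (\ z -> + 4 * - z) (sym convolution)) where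
   P = ∑ pos (\ s -> sg s * (s * s))
   l : ∀ p -> + 4 * (+ 2 * p) ≡ + 8 * p
   l = ring
   l2 : ∀ a b -> a * (+ 8 * b) ≡ + 8 * (a * b)
   l2 = ring

-- Liouville's elementary identity for sums over ax + by = n.

module Liouville where
 open Theta public
 open import Data.Nat.DivMod using (m<n⇒m/n≡0; +-distrib-/-∣ʳ)
 open import Data.Nat.Divisibility using (n∣m*n)

 ∑-tri : {A : Set} {P : A -> Set} (F : Enum P) (g h : A -> ℕ) {v : A -> ℤ} ->
  ∑ F v ≡ ∑ (F ↾ \ x -> g x N.<? h x) v + ∑ (F ↾ \ x -> g x N.≟ h x) v + ∑ (F ↾ \ x -> h x N.<? g x) v
 ∑-tri F g h {v} = ∑-split F (\ x -> g x N.<? h x) & cong (_+_ (∑ (F ↾ \ x -> g x N.<? h x) v)) (∑-split F' (\ x -> g x N.≟ h x) & cong2 _+_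
   (∑-same (F' ↾ \ x -> g x N.≟ h x) (F ↾ \ x -> g x N.≟ h x) (\ { x ((p , _) , e) -> p , e })
    (\ { x (p , e) -> (p , \ l -> N.<⇒≢ l e) , e }))
   (∑-same (F' ↾ (¬? ∘ \ x -> g x N.≟ h x)) (F ↾ \ x -> h x N.<? g x)
    (\ { x ((p , n) , ne) -> p , N.≤∧≢⇒< (N.≮⇒≥ n) (ne ∘ sym) })
    (\ { x (p , l) -> (p , N.<-asym l) , \ e -> N.<⇒≢ l (sym e) }))) &
  sym (Z.+-assoc (∑ (F ↾ \ x -> g x N.<? h x) v) _ _) where
  F' = F ↾ (¬? ∘ \ x -> g x N.<? h x)

 Quad : Set
 Quad = (ℕ × ℕ) × (ℕ × ℕ)

 IsQuad : ℕ -> Quad -> Set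
 IsQuad n ((a , x) , b , y) = 0 N.< a × 0 N.< x × 0 N.< b × 0 N.< y × a N.* x N.+ b N.* y ≡ n

 private
  left≤ : ∀ {a x r n} -> 0 N.< a -> 0 N.< x -> a N.* x N.+ r ≡ n -> a N.< suc n × x N.< suc n
  left≤ {suc a} {suc x} {r} _ _ refl =
   s≤s (N.≤-trans (N.m≤m*n (suc a) (suc x)) (N.m≤m+n _ r)) ,
   s≤s (N.≤-trans (N.m≤n*m (suc x) (suc a)) (N.m≤m+n _ r))

  right≤ : ∀ {a x r n} -> 0 N.< a -> 0 N.< x -> r N.+ a N.* x ≡ n -> a N.< suc n × x N.< suc n
  right≤ {a} {x} {r} p q e = left≤ p q (N.+-comm (a N.* x) r & e)

 quads : ∀ n -> Enum (IsQuad n)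
 quads n = within ((below (suc n) ▹ \ _ _ -> below (suc n)) ▹ \ _ _ -> (below (suc n) ▹ \ _ _ -> below (suc n)))
  (\ { ((a , x) , b , y) -> (0 N.<? a) ×-dec (0 N.<? x) ×-dec (0 N.<? b) ×-dec (0 N.<? y) ×-dec (a N.* x N.+ b N.* y N.≟ n) })
  (\ { ((a , x) , b , y) (pa , px , pb , py , e) -> left≤ pa px e , right≤ pb py e })

 lam-⊛ : ∀ v w n -> (lam v ⊛ lam w) n ≡ ∑ (quads n) (\ { ((a , x) , b , y) -> v a x * w b y })
 lam-⊛ v w n = (⊛-∑∑ divs divs (\ z -> v (fst z) (snd z)) (\ z -> w (fst z) (snd z)) n) &
  ∑-reindex conv (quads n) snd (\ { z@((a , x) , _) -> a N.* x , z })
   {\ z -> v (fst (fst (snd z))) (snd (fst (snd z))) * w (fst (snd (snd z))) (snd (snd (snd z)))}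
   {\ { ((a , x) , b , y) -> v a x * w b y }}
   (\ { (k , (a , x) , b , y) (k≤n , (pa , px , e) , (pb , py , e')) ->
    pa , px , pb , py , (cong2 N._+_ e e') & N.m+[n∸m]≡n (N.≤-pred k≤n) })
   (\ { ((a , x) , b , y) (pa , px , pb , py , e) ->
    s≤s (subst (a N.* x N.≤_) e (N.m≤m+n _ _)) , (pa , px , refl) , (pb , py ,
    sym (N.m+n∸m≡n (a N.* x) (b N.* y)) & cong (N._∸ a N.* x) e) })
   (\ { (k , (a , x) , b , y) (_ , (_ , _ , refl) , _) -> refl })
   (\ { ((a , x) , b , y) _ -> refl })
   (\ { (k , (a , x) , b , y) _ -> refl }) where
  Conv : ℕ × (ℕ × ℕ) × (ℕ × ℕ) -> Set
  Conv (k , z , z') = k N.< suc n × Divs k z × Divs (n N.∸ k) z'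
  conv : Enum Conv
  conv = below (suc n) ▹ (\ k _ -> divs k ▹ (\ _ _ -> divs (n N.∸ k)))

 upTo' : (ℕ -> ℤ) -> ℕ -> ℤ
 upTo' f zero          = 0#
 upTo' f (suc zero)    = 0#
 upTo' f (suc (suc d)) = upTo' f (suc d) + f (suc d)

 ∑-upTo' : ∀ f d -> ∑ (below d ↾ (0 N.<?_)) f ≡ upTo' f d
 ∑-upTo' f d = ∑-𝟙 (below d) (0 N.<?_) & go d where
  v : ℕ -> ℤ
  v i = 𝟙 (0 N.<? i) * f i
  go : ∀ d -> ∑ (below d) v ≡ upTo' f d
  go zero          = ∑-below-zero v
  go (suc zero)    = ∑-below-suc 0 v & cong (_+_ (v 0)) (∑-below-zero _)
  go (suc (suc d)) = ∑-below-last (suc d) v & cong2 _+_ (go (suc d)) (Z.*-identityˡ (f (suc d)))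

 upTo'-const : ∀ k d -> 0 N.< d -> upTo' (\ _ -> k) d ≡ (+ d - 1#) * k
 upTo'-const k (suc zero)    _ = refl
 upTo'-const k (suc (suc d)) _ = cong (_+ k) (upTo'-const k (suc d) 0<s) &
  lemma (+ suc d) k & cong (\ z -> (z - 1#) * k) (sym (Z.pos-+ 1 (suc d))) where
  lemma : ∀ d k -> (d - 1#) * k + k ≡ (1# + d - 1#) * k
  lemma = ring

 module Liouville (f : ℕ -> ℤ) (n : ℕ) where
  private
   Q = quads n
   x<y? b<a? a<b? y<x? : (q : Quad) -> Dec _
   x<y? ((a , x) , b , y) = x N.<? y
   b<a? ((a , x) , b , y) = b N.<? a
   a<b? ((a , x) , b , y) = a N.<? b
   y<x? ((a , x) , b , y) = y N.<? x
   a=b? x=y? : (q : Quad) -> Dec _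
   a=b? ((a , x) , b , y) = a N.≟ b
   x=y? ((a , x) , b , y) = x N.≟ y
   fa fm fp : Quad -> ℤ
   fa ((a , x) , b , y) = f a
   fm ((a , x) , b , y) = f N.∣ a - b ∣
   fp ((a , x) , b , y) = f (a N.+ b)
   quad-≡ : ∀ {a a' x x' b b' y y' : ℕ} -> a ≡ a' -> x ≡ x' -> b ≡ b' -> y ≡ y' -> ((a , x) , b , y) ≡ ((a' , x') , (b' , y'))
   quad-≡ refl refl refl refl = refl
   swap : Quad -> Quad
   swap (p , q) = q , p
   swap-ok : ∀ q -> IsQuad n q -> IsQuad n (swap q)
   swap-ok ((a , x) , b , y) (pa , px , pb , py , e) = pb , py , pa , px , N.+-comm (b N.* y) _ & e
   0<∸ : ∀ {a b} -> b N.< a -> 0 N.< a N.∸ b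
   0<∸ = N.m<n⇒0<n∸m
   ∸+ : ∀ {a b} -> b N.< a -> a N.∸ b N.+ b ≡ a
   ∸+ p = N.m∸n+n≡m (N.<⇒≤ p)
   -- Subtraction of the smaller first factor: (a , x , b , y) ↦ (a - b , x , b , x + y) carries b <
   -- a onto x < y, and |a - b| becomes the new a.
   minus-split : ∑ Q fm ≡ ∑ (Q ↾ a=b?) fm + + 2 * ∑ (Q ↾ x<y?) fa
   minus-split = ∑-tri Q (\ { ((a , x) , b , y) -> a }) (\ { ((a , x) , b , y) -> b }) &
    cong2 (\ s t -> s + ∑ (Q ↾ a=b?) fm + t) (flip & shift) shift & lemma (∑ (Q ↾ a=b?) fm) (∑ (Q ↾ x<y?) fa) where
    lemma : ∀ e s -> s + e + s ≡ e + + 2 * s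
    lemma = ring
    flip : ∑ (Q ↾ a<b?) fm ≡ ∑ (Q ↾ b<a?) fm
    flip = ∑-reindex (Q ↾ a<b?) (Q ↾ b<a?) swap swap {fm} {fm} (\ { q (p , l) -> swap-ok q p , l }) (\ { q (p , l) -> swap-ok q p , l })
     (\ _ _ -> refl) (\ _ _ -> refl) (\ { ((a , x) , b , y) _ -> cong f (N.∣-∣-comm b a) })
    shift : ∑ (Q ↾ b<a?) fm ≡ ∑ (Q ↾ x<y?) fa
    shift = ∑-reindex (Q ↾ b<a?) (Q ↾ x<y?)
     (\ { ((a , x) , b , y) -> (a N.∸ b , x) , (b , x N.+ y) }) (\ { ((a , x) , b , y) -> (a N.+ b , x) , (b , y N.∸ x) }) {fm} {fa}
     (\ { ((a , x) , b , y) ((pa , px , pb , py , e) , l) ->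
      (0<∸ l , px , pb , N.≤-trans px (N.m≤m+n x y) , l1 (a N.∸ b) x b y & cong (\ z -> z N.* x N.+ b N.* y) (∸+ l) & e)
      , subst (N._< x N.+ y) (N.+-identityʳ x) (N.+-monoʳ-< x py) })
     (\ { ((a , x) , b , y) ((pa , px , pb , py , e) , l) ->
      (N.≤-trans pa (N.m≤m+n a b) , px , pb , 0<∸ l , l2 a x b (y N.∸ x) & cong (\ z -> a N.* x N.+ b N.* z) (∸+ l) & e)
      , subst (N._< a N.+ b) (N.+-identityˡ b) (N.+-monoˡ-< b pa) })
     (\ { ((a , x) , b , y) (_ , l) -> quad-≡ (∸+ l) refl refl (N.m+n∸m≡n x y) })
     (\ { ((a , x) , b , y) (_ , l) -> quad-≡ (N.m+n∸n≡m a b) refl refl (N.+-comm x _ & (∸+ l)) })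
     (\ { ((a , x) , b , y) (_ , l) -> cong f (sym (N.m≤n⇒∣n-m∣≡n∸m (N.<⇒≤ l)) & refl) }) where
     l1 : ∀ k x b y -> k N.* x N.+ b N.* (x N.+ y) ≡ (k N.+ b) N.* x N.+ b N.* y
     l1 = ringN!
     l2 : ∀ a x b k -> (a N.+ b) N.* x N.+ b N.* k ≡ a N.* x N.+ b N.* (k N.+ x)
     l2 = ringN!
   -- Dual to `minus-split`: now the smaller second factor is subtracted, a + b becomes the new
   -- first factor, and y < x is carried onto b < a.
   plus-split : ∑ Q fp ≡ ∑ (Q ↾ x=y?) fp + + 2 * ∑ (Q ↾ b<a?) fa
   plus-split = ∑-tri Q (\ { ((a , x) , b , y) -> x }) (\ { ((a , x) , b , y) -> y }) &
    cong2 (\ s t -> s + ∑ (Q ↾ x=y?) fp + t) (flip & shift) shift & lemma (∑ (Q ↾ x=y?) fp) (∑ (Q ↾ b<a?) fa) where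
    lemma : ∀ e s -> s + e + s ≡ e + + 2 * s
    lemma = ring
    flip : ∑ (Q ↾ x<y?) fp ≡ ∑ (Q ↾ y<x?) fp
    flip = ∑-reindex (Q ↾ x<y?) (Q ↾ y<x?) swap swap {fp} {fp} (\ { q (p , l) -> swap-ok q p , l }) (\ { q (p , l) -> swap-ok q p , l })
     (\ _ _ -> refl) (\ _ _ -> refl) (\ { ((a , x) , b , y) _ -> cong f (N.+-comm b a) })
    shift : ∑ (Q ↾ y<x?) fp ≡ ∑ (Q ↾ b<a?) fa
    shift = ∑-reindex (Q ↾ y<x?) (Q ↾ b<a?)
     (\ { ((a , x) , b , y) -> (a N.+ b , y) , (a , x N.∸ y) }) (\ { ((a , x) , b , y) -> (b , x N.+ y) , (a N.∸ b , x) }) {fp} {fa}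
     (\ { ((a , x) , b , y) ((pa , px , pb , py , e) , l) ->
      (N.≤-trans pa (N.m≤m+n a b) , py , pa , 0<∸ l , l1 a (x N.∸ y) b y & cong (\ z -> a N.* z N.+ b N.* y) (∸+ l) & e)
      , subst (N._< a N.+ b) (N.+-identityʳ a) (N.+-monoʳ-< a pb) })
     (\ { ((a , x) , b , y) ((pa , px , pb , py , e) , l) ->
      (pb , N.≤-trans px (N.m≤m+n x y) , 0<∸ l , px , l2 (a N.∸ b) x b y & cong (\ z -> z N.* x N.+ b N.* y) (∸+ l) & e)
      , subst (N._< x N.+ y) (N.+-identityʳ x) (N.+-monoʳ-< x py) })
     (\ { ((a , x) , b , y) (_ , l) -> quad-≡ refl (N.+-comm y _ & (∸+ l)) (N.m+n∸m≡n a b) refl })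
     (\ { ((a , x) , b , y) (_ , l) -> quad-≡ (N.+-comm b _ & (∸+ l)) refl refl (N.m+n∸m≡n x y) })
     (\ { ((a , x) , b , y) _ -> refl }) where
     l1 : ∀ a k b y -> (a N.+ b) N.* y N.+ a N.* k ≡ a N.* (k N.+ y) N.+ b N.* y
     l1 = ringN!
     l2 : ∀ k x b y -> b N.* (x N.+ y) N.+ k N.* x ≡ (k N.+ b) N.* x N.+ b N.* y
     l2 = ringN!
   -- The windows x < y and b < a, enlarged by the solutions with x = 0 or b = 0.
   X0 B0 : Quad -> Set
   X0 ((a , x) , b , y) = 0 N.< a × 0 N.< y × a N.* x N.+ b N.* y ≡ n × a N.* y N.< n × x N.< y
   B0 ((a , x) , b , y) = 0 N.< a × 0 N.< y × a N.* x N.+ b N.* y ≡ n × a N.* y N.< n × b N.< a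
   factor≤ : ∀ {a y} -> 0 N.< a -> 0 N.< y -> a N.* y N.< n -> a N.< suc n × y N.< suc n
   factor≤ {suc a} {suc y} _ _ p =
    s≤s (N.≤-trans (N.m≤m*n (suc a) (suc y)) (N.<⇒≤ p)) , s≤s (N.≤-trans (N.m≤n*m (suc y) (suc a)) (N.<⇒≤ p))
   enum0 : {R : Quad -> Set} -> (∀ q -> Dec (R q)) -> (∀ { a x b y } -> R ((a , x) , b , y) -> 0 N.< a × 0 N.< y × a N.* x N.+ b N.* y ≡ n × a N.* y N.< n) -> Enum R
   enum0 R? h = within ((below (suc n) ▹ \ _ _ -> below (suc n)) ▹ \ _ _ -> (below (suc n) ▹ \ _ _ -> below (suc n))) R? bound where
    bound : ∀ q -> _ -> _
    bound ((a , x) , b , y) r with h r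
    ... | pa , py , e , p = (fst (factor≤ pa py p) , s≤s (subst (x N.≤_) e (N.≤-trans (N.m≤n*m x a {{N.>-nonZero pa}}) (N.m≤m+n _ _))))
     , (s≤s (subst (b N.≤_) e (N.≤-trans (N.m≤m*n b y {{N.>-nonZero py}}) (N.m≤n+m _ _))) , snd (factor≤ pa py p))
   EX : Enum X0
   EX = enum0 (\ { ((a , x) , b , y) -> (0 N.<? a) ×-dec (0 N.<? y) ×-dec (a N.* x N.+ b N.* y N.≟ n) ×-dec (a N.* y N.<? n) ×-dec (x N.<? y) })
    (\ { (p , q , r , s , _) -> p , q , r , s })
   EB : Enum B0
   EB = enum0 (\ { ((a , x) , b , y) -> (0 N.<? a) ×-dec (0 N.<? y) ×-dec (a N.* x N.+ b N.* y N.≟ n) ×-dec (a N.* y N.<? n) ×-dec (b N.<? a) })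
    (\ { (p , q , r , s , _) -> p , q , r , s })
   -- Both enlarged windows are fundamental domains for (x , b) ↦ (x + y , b - a).
   slide-x slide-b : Quad -> Quad
   slide-b ((suc a , x) , (b , suc y)) = (suc a , x % suc y) , (b N.+ (x / suc y) N.* suc a , suc y)
   slide-b q = q
   slide-x ((suc a , x) , (b , suc y)) = (suc a , x N.+ (b / suc a) N.* suc y) , (b % suc a , suc y)
   slide-x q = q
   div-shift : ∀ b k a -> b N.< suc a -> (b N.+ k N.* suc a) / suc a ≡ k
   div-shift b k a p = (+-distrib-/-∣ʳ b (n∣m*n k)) & (cong2 N._+_ (m<n⇒m/n≡0 p) (m*n/n≡m k (suc a)))
   mod-shift : ∀ b k a -> b N.< suc a -> (b N.+ k N.* suc a) % suc a ≡ b
   mod-shift b k a p = ([m+kn]%n≡m%n b k (suc a)) & m<n⇒m%n≡m p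
   windows : ∑ EB fa ≡ ∑ EX fa
   windows = ∑-reindex EB EX slide-b slide-x {fa} {fa}
    (\ { ((suc a , x) , (b , suc y)) (pa , py , e , l , r) -> pa , py ,
        (l1 (suc a) (x % suc y) b (x / suc y) (suc y) & cong (\ z -> suc a N.* z N.+ b N.* suc y) (sym (m≡m%n+[m/n]*n x (suc y)))) & e
        , l , m%n<n x (suc y)
      ; ((suc a , x) , (b , zero)) (_ , () , _) ; ((zero , x) , b , y) (() , _) })
    (\ { ((suc a , x) , (b , suc y)) (pa , py , e , l , r) -> pa , py ,
        (l2 (suc a) x (b % suc a) (b / suc a) (suc y) & cong (\ z -> suc a N.* x N.+ z N.* suc y) (sym (m≡m%n+[m/n]*n b (suc a)))) & e
        , l , m%n<n b (suc a)
      ; ((suc a , x) , (b , zero)) (_ , () , _) ; ((zero , x) , b , y) (() , _) })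
    (\ { ((suc a , x) , (b , suc y)) (pa , py , e , l , r) -> quad-≡ refl
        (cong (\ z -> x % suc y N.+ z N.* suc y) (div-shift b (x / suc y) a r) & sym (m≡m%n+[m/n]*n x (suc y)))
        (mod-shift b (x / suc y) a r) refl
      ; ((suc a , x) , (b , zero)) (_ , () , _) ; ((zero , x) , b , y) (() , _) })
    (\ { ((suc a , x) , (b , suc y)) (pa , py , e , l , r) -> quad-≡ refl (mod-shift x (b / suc a) y r)
        (cong (\ z -> b % suc a N.+ z N.* suc a) (div-shift x (b / suc a) y r) & sym (m≡m%n+[m/n]*n b (suc a))) refl
      ; ((suc a , x) , (b , zero)) (_ , () , _) ; ((zero , x) , b , y) (() , _) })
    (\ { ((suc a , x) , (b , suc y)) _ -> refl
      ; ((suc a , x) , (b , zero)) (_ , () , _) ; ((zero , x) , b , y) (() , _) }) where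
    l1 : ∀ a r b k y -> a N.* r N.+ (b N.+ k N.* a) N.* y ≡ a N.* (r N.+ k N.* y) N.+ b N.* y
    l1 = ringN!
    l2 : ∀ a x r k y -> a N.* (x N.+ k N.* y) N.+ r N.* y ≡ a N.* x N.+ (r N.+ k N.* a) N.* y
    l2 = ringN!
   ay<n? : (q : Quad) -> Dec _
   ay<n? ((a , x) , b , y) = a N.* y N.<? n
   0<x? 0<b? : (q : Quad) -> Dec _
   0<x? ((a , x) , b , y) = 0 N.<? x
   0<b? ((a , x) , b , y) = 0 N.<? b
   zero? : ∀ m -> ¬ (0 N.< m) -> m ≡ 0
   zero? zero    _ = refl
   zero? (suc m) p = ⊥-elim (p 0<s)
   edge-x : ∑ (EX ↾ (¬? ∘ 0<x?)) fa ≡ ∑ (divs n) (\ z -> upTo' f (fst z))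
   edge-x = ∑-reindex (EX ↾ (¬? ∘ 0<x?)) (divs n ▹ (\ z _ -> below (fst z) ↾ (0 N.<?_)))
     (\ { ((a , x) , b , y) -> (b , y) , a }) (\ { ((b , y) , a) -> (a , 0) , (b , y) }) {fa} {\ z -> f (snd z)}
     to from (\ { ((a , x) , b , y) (_ , p) -> quad-≡ refl (sym (zero? x p)) refl refl }) (\ _ _ -> refl) (\ _ _ -> refl) &
    ∑-▹ (divs n) (\ z _ -> below (fst z) ↾ (0 N.<?_)) (\ z -> f (snd z)) (\ z -> upTo' f (fst z)) (\ z _ -> sym (∑-upTo' f (fst z))) where
    to : ∀ q -> _ -> _
    to ((a , suc x) , b , y) (_ , p) = ⊥-elim (p 0<s)
    to ((a , zero) , b , y) ((pa , py , e , l , _) , _) = (N.≤-trans pa (N.<⇒≤ a<b) , py , by≡n) , (a<b , pa) where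
     by≡n : b N.* y ≡ n
     by≡n = cong (N._+ b N.* y) (sym (N.*-zeroʳ a)) & e
     a<b : a N.< b
     a<b = N.*-cancelʳ-< y a b (subst (a N.* y N.<_) (sym by≡n) l)
    from : ∀ z -> _ -> _
    from ((b , y) , a) ((pb , py , e) , (a<b , pa)) = (pa , py , cong (N._+ b N.* y) (N.*-zeroʳ a) & e
     , subst (a N.* y N.<_) e (N.*-monoˡ-< y {{N.>-nonZero py}} a<b) , py) , \ ()
   edge-b : ∑ (EB ↾ (¬? ∘ 0<b?)) fa ≡ ∑ (divs n) (\ z -> (+ snd z - 1#) * f (fst z))
   edge-b = ∑-reindex (EB ↾ (¬? ∘ 0<b?)) (divs n ▹ (\ z _ -> below (snd z) ↾ (0 N.<?_)))
     (\ { ((a , x) , b , y) -> (a , x) , y }) (\ { ((a , x) , y) -> (a , x) , (0 , y) }) {fa} {\ z -> f (fst (fst z))}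
     to from (\ { ((a , x) , b , y) (_ , p) -> quad-≡ refl refl (sym (zero? b p)) refl }) (\ _ _ -> refl) (\ _ _ -> refl) &
    ∑-▹ (divs n) (\ z _ -> below (snd z) ↾ (0 N.<?_)) (\ z -> f (fst (fst z))) (\ z -> (+ snd z - 1#) * f (fst z))
     (\ { (a , x) (_ , px , _) -> sym (∑-upTo' (\ _ -> f a) x & upTo'-const (f a) x px) }) where
    to : ∀ q -> _ -> _
    to ((a , x) , (suc b , y)) (_ , p) = ⊥-elim (p 0<s)
    to ((a , x) , (zero , y)) ((pa , py , e , l , _) , _) = (pa , N.≤-trans py (N.<⇒≤ y<x) , ax≡n) , (y<x , py) where
     ax≡n : a N.* x ≡ n
     ax≡n = sym (N.+-identityʳ _) & e
     y<x : y N.< x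
     y<x = N.*-cancelˡ-< a y x (subst (a N.* y N.<_) (sym ax≡n) l)
    from : ∀ z -> _ -> _
    from ((a , x) , y) ((pa , px , e) , (y<x , py)) = (pa , py , N.+-identityʳ _ & e
     , subst (a N.* y N.<_) e (N.*-monoʳ-< a {{N.>-nonZero pa}} y<x) , pa) , \ ()
   inner-x : ∑ ((Q ↾ x<y?) ↾ ay<n?) fa ≡ ∑ (EX ↾ 0<x?) fa
   inner-x = ∑-same ((Q ↾ x<y?) ↾ ay<n?) (EX ↾ 0<x?) {fa}
    (\ { ((a , x) , b , y) (((pa , px , pb , py , e) , x<y) , l) -> (pa , py , e , l , x<y) , px })
    (\ { ((a , x) , b , y) ((pa , py , e , l , x<y) , px) -> ((pa , px , pos a x b y pa e l x<y , py , e) , x<y) , l }) where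
    pos : ∀ a x b y -> 0 N.< a -> a N.* x N.+ b N.* y ≡ n -> a N.* y N.< n -> x N.< y -> 0 N.< b
    pos a x (suc b) y _ _ _ _ = s≤s z≤n
    pos a x zero y pa e l x<y = ⊥-elim (N.<-irrefl refl (N.<-trans l
     (subst (N._< a N.* y) (sym (N.+-identityʳ _) & e) (N.*-monoʳ-< a {{N.>-nonZero pa}} x<y))))
   inner-b : ∑ ((Q ↾ b<a?) ↾ ay<n?) fa ≡ ∑ (EB ↾ 0<b?) fa
   inner-b = ∑-same ((Q ↾ b<a?) ↾ ay<n?) (EB ↾ 0<b?) {fa}
    (\ { ((a , x) , b , y) (((pa , px , pb , py , e) , b<a) , l) -> (pa , py , e , l , b<a) , pb })
    (\ { ((a , x) , b , y) ((pa , py , e , l , b<a) , pb) -> ((pa , pos a x b y py e l b<a , pb , py , e) , b<a) , l }) where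
    pos : ∀ a x b y -> 0 N.< y -> a N.* x N.+ b N.* y ≡ n -> a N.* y N.< n -> b N.< a -> 0 N.< x
    pos a (suc x) b y _ _ _ _ = s≤s z≤n
    pos a zero b y py e l b<a = ⊥-elim (N.<-irrefl refl (N.<-trans l
     (subst (N._< a N.* y) (cong (N._+ b N.* y) (sym (N.*-zeroʳ a)) & e) (N.*-monoˡ-< y {{N.>-nonZero py}} b<a))))
   -- If ay ≥ n, then by < n and ax < n give b < a and x < y, so both window conditions hold
   -- automatically.
   outer : ∑ ((Q ↾ x<y?) ↾ (¬? ∘ ay<n?)) fa ≡ ∑ ((Q ↾ b<a?) ↾ (¬? ∘ ay<n?)) fa
   outer = ∑-same ((Q ↾ x<y?) ↾ (¬? ∘ ay<n?)) ((Q ↾ b<a?) ↾ (¬? ∘ ay<n?)) {fa}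
    (\ { ((a , x) , b , y) ((p@(pa , px , pb , py , e) , _) , l) -> (p , N.*-cancelʳ-< y b a (N.<-≤-trans
      (subst (b N.* y N.<_) e (N.m<n+m (b N.* y) (N.*-mono-< pa px))) (N.≮⇒≥ l))) , l })
    (\ { ((a , x) , b , y) ((p@(pa , px , pb , py , e) , _) , l) -> (p , N.*-cancelˡ-< a x y (N.<-≤-trans
      (subst (a N.* x N.<_) e (N.m<m+n (a N.* x) (N.*-mono-< pb py))) (N.≮⇒≥ l))) , l })
   -- The enlarged windows have equal sums, so the original ones differ by the added solutions:
   -- those with b = 0 minus those with x = 0. Either kind is counted by the numbers below a divisor
   -- of n.
   window-difference : ∑ (Q ↾ x<y?) fa - ∑ (Q ↾ b<a?) fa
    ≡ ∑ (divs n) (\ z -> (+ snd z - 1#) * f (fst z)) - ∑ (divs n) (\ z -> upTo' f (fst z))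
   window-difference = cong2 _-_
     (∑-split (Q ↾ x<y?) ay<n? & cong (_+ O) inner-x)
     (∑-split (Q ↾ b<a?) ay<n? & cong2 _+_ inner-b (sym outer)) &
    lemma IX IB O (∑ (divs n) (\ z -> upTo' f (fst z))) (∑ (divs n) (\ z -> (+ snd z - 1#) * f (fst z)))
     (cong (_+_ IB) (sym edge-b) & sym (∑-split EB 0<b?) & windows &
     ∑-split EX 0<x? & cong (_+_ IX) edge-x) where
    IX = ∑ (EX ↾ 0<x?) fa
    IB = ∑ (EB ↾ 0<b?) fa
    O  = ∑ ((Q ↾ x<y?) ↾ (¬? ∘ ay<n?)) fa
    lemma : ∀ ix ib o ex eb -> ib + eb ≡ ix + ex -> (ix + o) - (ib + o) ≡ eb - ex
    lemma ix ib o ex eb h = l1 ix ib o ex & cong (\ z -> z - ib - ex) (sym h) & l2 ib eb ex where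
     l1 : ∀ ix ib o ex -> (ix + o) - (ib + o) ≡ (ix + ex) - ib - ex
     l1 = ring
     l2 : ∀ ib eb ex -> (ib + eb) - ib - ex ≡ eb - ex
     l2 = ring
   diagonal-a : ∑ (Q ↾ a=b?) fm ≡ ∑ (divs n) (\ z -> (+ snd z - 1#) * f 0)
   diagonal-a = ∑-reindex (Q ↾ a=b?) (divs n ▹ (\ z _ -> below (snd z) ↾ (0 N.<?_)))
     (\ { ((a , x) , b , y) -> (a , x N.+ y) , x }) (\ { ((d , e) , x) -> (d , x) , (d , e N.∸ x) }) {fm} {\ _ -> f 0}
     (\ { ((a , x) , (.a , y)) ((pa , px , pb , py , e) , refl) -> (pa , N.≤-trans px (N.m≤m+n x y) , N.*-distribˡ-+ a x y & e)
       , subst (N._< x N.+ y) (N.+-identityʳ x) (N.+-monoʳ-< x py) , px })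
     (\ { ((d , e) , x) ((pd , pe , h) , x<e , px) -> (pd , px , pd , 0<∸ x<e ,
        sym (N.*-distribˡ-+ d x (e N.∸ x)) & cong (d N.*_) (N.m+[n∸m]≡n (N.<⇒≤ x<e)) & h) , refl })
     (\ { ((a , x) , (.a , y)) (_ , refl) -> quad-≡ refl refl refl (N.m+n∸m≡n x y) })
     (\ { ((d , e) , x) (_ , x<e , _) -> cong (\ z -> (d , z) , x) (N.m+[n∸m]≡n (N.<⇒≤ x<e)) })
     (\ { ((a , x) , (.a , y)) (_ , refl) -> cong f (sym (N.∣n-n∣≡0 a)) }) &
    ∑-▹ (divs n) (\ z _ -> below (snd z) ↾ (0 N.<?_)) (\ _ -> f 0) (\ z -> (+ snd z - 1#) * f 0)
     (\ { (d , e) (_ , pe , _) -> sym (∑-upTo' (\ _ -> f 0) e & upTo'-const (f 0) e pe) })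
   diagonal-x : ∑ (Q ↾ x=y?) fp ≡ ∑ (divs n) (\ z -> (+ fst z - 1#) * f (fst z))
   diagonal-x = ∑-reindex (Q ↾ x=y?) (divs n ▹ (\ z _ -> below (fst z) ↾ (0 N.<?_)))
     (\ { ((a , x) , b , y) -> (a N.+ b , x) , a }) (\ { ((d , e) , a) -> (a , e) , (d N.∸ a , e) }) {fp} {\ z -> f (fst (fst z))}
     (\ { ((a , x) , (b , .x)) ((pa , px , pb , py , e) , refl) -> (N.≤-trans pa (N.m≤m+n a b) , px , N.*-distribʳ-+ x a b & e)
       , subst (N._< a N.+ b) (N.+-identityʳ a) (N.+-monoʳ-< a pb) , pa })
     (\ { ((d , e) , a) ((pd , pe , h) , a<d , pa) -> (pa , pe , 0<∸ a<d , pe ,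
        sym (N.*-distribʳ-+ e a (d N.∸ a)) & cong (N._* e) (N.m+[n∸m]≡n (N.<⇒≤ a<d)) & h) , refl })
     (\ { ((a , x) , (b , .x)) (_ , refl) -> quad-≡ refl refl (N.m+n∸m≡n a b) refl })
     (\ { ((d , e) , a) (_ , a<d , _) -> cong (\ z -> (z , e) , a) (N.m+[n∸m]≡n (N.<⇒≤ a<d)) })
     (\ { ((a , x) , b , y) _ -> refl }) &
    ∑-▹ (divs n) (\ z _ -> below (fst z) ↾ (0 N.<?_)) (\ z -> f (fst (fst z))) (\ z -> (+ fst z - 1#) * f (fst z))
     (\ { (d , e) (pd , _ , _) -> sym (∑-upTo' (\ _ -> f d) d & upTo'-const (f d) d pd) })

  identity : ∑ (quads n) (\ { ((a , x) , b , y) -> f N.∣ a - b ∣ - f (a N.+ b) })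
   ≡ lam (\ d e -> (+ e - 1#) * f 0 - (+ d - 1#) * f d + + 2 * ((+ e - 1#) * f d) - + 2 * upTo' f d) n
  identity = ∑-cong Q {w = \ q -> fm q - fp q} (\ { ((a , x) , b , y) _ -> refl }) &
   ∑-- Q fm fp & cong2 _-_ minus-split plus-split &
   lemma (∑ (Q ↾ a=b?) fm) (∑ (Q ↾ x=y?) fp) _ _ _ _ window-difference & cong2 (\ s t -> s - t + + 2 * E - + 2 * U) diagonal-a diagonal-x &
   sym (∑-- N _ _ & cong2 _-_ (∑-+ N _ _ & cong2 _+_ (∑-- N _ _) (∑-* N (+ 2) _)) (∑-* N (+ 2) _)) where
   N = divs n
   E = ∑ N (\ z -> (+ snd z - 1#) * f (fst z))
   U = ∑ N (\ z -> upTo' f (fst z))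
   lemma : ∀ p q x b e u -> x - b ≡ e - u -> (p + + 2 * x) - (q + + 2 * b) ≡ p - q + + 2 * e - + 2 * u
   lemma p q x b e u h = l1 p q x b & cong (\ z -> p - q + + 2 * z) h & l2 (p - q) e u where
    l1 : ∀ p q x b -> (p + + 2 * x) - (q + + 2 * b) ≡ p - q + + 2 * (x - b)
    l1 = ring
    l2 : ∀ p e u -> p + + 2 * (e - u) ≡ p + + 2 * e - + 2 * u
    l2 = ring

-- Convolutions of divisor sums from Liouville's identity.

module DivisorSums where
 open Liouville public
 open import Data.Bool using (true; false)

 data Parity : ℕ -> Set where
  even : ∀ k -> Parity (k N.+ k)
  odd  : ∀ k -> Parity (suc (k N.+ k))

 parity : ∀ n -> Parity n
 parity zero = even 0
 parity (suc n) with parity n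
 ... | even k = odd k
 ... | odd k  = subst Parity (cong suc (N.+-suc k k)) (even (suc k))

 even01-even : ∀ k -> even01 (k N.+ k) ≡ 1#
 even01-even zero    = refl
 even01-even (suc k) = cong (even01 ∘ suc) (N.+-suc k k) & even01-even k

 even01-odd : ∀ k -> even01 (suc (k N.+ k)) ≡ 0#
 even01-odd zero    = refl
 even01-odd (suc k) = cong (even01 ∘ suc ∘ suc) (N.+-suc k k) & even01-odd k

 dil-even : ∀ f k -> dil f (k N.+ k) ≡ f k
 dil-even f zero    = refl
 dil-even f (suc k) = cong (dil f ∘ suc) (N.+-suc k k) & dil-even (tail f) k

 dil-odd : ∀ f k -> dil f (suc (k N.+ k)) ≡ 0#
 dil-odd f zero    = refl
 dil-odd f (suc k) = cong (dil f ∘ suc ∘ suc) (N.+-suc k k) & dil-odd (tail f) k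

 even≢odd : ∀ k l -> k N.+ k ≢ suc (l N.+ l)
 even≢odd k l e with trans (sym (even01-even k)) (cong even01 e & even01-odd l)
 ... | ()

 lam-cong : ∀ {v w} n -> (∀ d e -> 0 N.< d -> 0 N.< e -> d N.* e ≡ n -> v d e ≡ w d e) -> lam v n ≡ lam w n
 lam-cong n h = ∑-cong (divs n) (\ { (d , e) (p , q , r) -> h d e p q r })

 lam-ext : ∀ {v w} -> (∀ d e -> v d e ≡ w d e) -> lam v ≐ lam w
 lam-ext h n = lam-cong n (\ d e _ _ _ -> h d e)

 lam-+ : ∀ v w n -> lam (\ d e -> v d e + w d e) n ≡ lam v n + lam w n
 lam-+ v w n = ∑-+ (divs n) _ _

 lam-* : ∀ k v n -> lam (\ d e -> k * v d e) n ≡ k * lam v n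
 lam-* k v n = ∑-* (divs n) k _

 lam-swap : ∀ v -> lam v ≐ lam (\ d e -> v e d)
 lam-swap v n = ∑-reindex (divs n) (divs n) (\ { (d , e) -> e , d }) (\ { (d , e) -> e , d })
  {\ z -> v (fst z) (snd z)} {\ z -> v (snd z) (fst z)}
  flip flip (\ _ _ -> refl) (\ _ _ -> refl) (\ _ _ -> refl) where
  flip : ∀ z -> Divs n z -> Divs n (snd z , fst z)
  flip (d , e) (p , q , r) = q , p , N.*-comm e d & r

 lam-D : ∀ v -> D (lam v) ≐ lam (\ d e -> + d * + e * v d e)
 lam-D v n = sym (∑-* (divs n) (+ n) _) & ∑-cong (divs n) (\ { (d , e) (_ , _ , refl) -> cong (_* v d e) (Z.pos-* d e) })

 lam-even : ∀ v w -> (∀ d e -> v (d N.+ d) e ≡ w d e) -> (∀ d e -> v (suc (d N.+ d)) e ≡ 0#) -> lam v ≐ dil (lam w)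
 lam-even v w ev od n with parity n
 ... | even k = ∑-drop (divs (k N.+ k)) R? drop & ∑-reindex (divs (k N.+ k) ↾ R?) (divs k) (\ { (d , e) -> N.⌊ d /2⌋ , e }) (\ { (d , e) -> d N.+ d , e })
    {\ z -> v (fst z) (snd z)} {\ z -> w (fst z) (snd z)} to from back (\ { (d , e) _ -> cong (_, e) (sym (N.n≡⌊n+n/2⌋ d)) }) val &
   sym (dil-even (lam w) k) where
  R? : (z : ℕ × ℕ) -> Dec (even? (fst z) ≡ true)
  R? z = even? (fst z) BoolP.≟ true
  even?-odd : ∀ k -> even? (suc (k N.+ k)) ≡ false
  even?-odd zero    = refl
  even?-odd (suc k) = cong (even? ∘ suc ∘ suc) (N.+-suc k k) & even?-odd k
  even?-even : ∀ k -> even? (k N.+ k) ≡ true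
  even?-even zero    = refl
  even?-even (suc k) = cong (even? ∘ suc) (N.+-suc k k) & even?-even k
  half : ∀ d -> even? d ≡ true -> N.⌊ d /2⌋ N.+ N.⌊ d /2⌋ ≡ d
  half d p with parity d
  ... | even j = cong2 N._+_ (sym (N.n≡⌊n+n/2⌋ j)) (sym (N.n≡⌊n+n/2⌋ j))
  ... | odd j with trans (sym p) (even?-odd j)
  ... | ()
  drop : ∀ z -> Divs (k N.+ k) z -> ¬ (even? (fst z) ≡ true) -> v (fst z) (snd z) ≡ 0#
  drop (d , e) _ ne with parity d
  ... | even j = ⊥-elim (ne (even?-even j))
  ... | odd j  = od j e
  2* : ∀ d e -> (d N.+ d) N.* e ≡ d N.* e N.+ d N.* e
  2* d e = N.*-distribʳ-+ e d d
  halve : ∀ {a b} -> a N.+ a ≡ b N.+ b -> a ≡ b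
  halve {a} {b} e = N.n≡⌊n+n/2⌋ a & (cong N.⌊_/2⌋ e) & sym (N.n≡⌊n+n/2⌋ b)
  pos : ∀ d -> 0 N.< d N.+ d -> 0 N.< d
  pos (suc d) _ = s≤s z≤n
  to : ∀ z -> _ -> _
  to (d , e) ((pd , pe , h) , p) = pos N.⌊ d /2⌋ (subst (0 N.<_) (sym (half d p)) pd) , pe ,
   halve (sym (2* N.⌊ d /2⌋ e) & cong (N._* e) (half d p) & h)
  from : ∀ z -> _ -> _
  from (d , e) (pd , pe , h) = (N.≤-trans pd (N.m≤m+n d d) , pe , 2* d e & (cong2 N._+_ h h)) , even?-even d
  back : ∀ z -> _ -> _
  back (d , e) (_ , p) = cong (_, e) (half d p)
  val : ∀ z -> Divs (k N.+ k) z × even? (fst z) ≡ true -> w N.⌊ fst z /2⌋ (snd z) ≡ v (fst z) (snd z)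
  val (d , e) (_ , p) = sym (ev N.⌊ d /2⌋ e) & cong (\ z -> v z e) (half d p)
 ... | odd k = ∑-0 (divs (suc (k N.+ k))) zero! & sym (dil-odd (lam w) k) where
  zero! : ∀ z -> Divs (suc (k N.+ k)) z -> v (fst z) (snd z) ≡ 0#
  zero! (d , e) (_ , _ , h) with parity d
  ... | even j = ⊥-elim (even≢odd (j N.* e) k (sym (N.*-distribʳ-+ e j j) & h))
  ... | odd j  = od j e

 -- `U` and `S` generate σ₁ and σ₃, so that 1 - 24U and 1 + 240S are the Eisenstein series E₂ and
 -- E₄. `V`, `W` and `T3`, `R3` are their dilations to q² and q⁴; `E` sums the even divisors and `X`
 -- sums χ₋₄ over the divisors.
 U S X V W T3 R3 E : Series
 U  = lam (\ d e -> + d)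
 S  = lam (\ d e -> + d * + d * + d)
 V  = dil U
 W  = dil V
 T3 = dil S
 R3 = dil T3
 E  = lam (\ d e -> even01 d * + d)

 χ four : ℕ -> ℤ
 χ 0 = 0#
 χ 1 = 1#
 χ 2 = 0#
 χ 3 = -[1+ 0 ]
 χ (suc (suc (suc (suc n)))) = χ n
 four 0 = 1#
 four 1 = 0#
 four 2 = 0#
 four 3 = 0#
 four (suc (suc (suc (suc n)))) = four n

 X = lam (\ d e -> χ d)

 private
  pos-double : ∀ d -> + (d N.+ d) ≡ + d + + d
  pos-double d = Z.pos-+ d d

 lam-even-d : (w : ℕ -> ℕ -> ℤ) -> lam (\ d e -> even01 d * w d e) ≐ dil (lam (\ d e -> w (d N.+ d) e))
 lam-even-d w = lam-even (\ d e -> even01 d * w d e) (\ d e -> w (d N.+ d) e) (\ d e -> cong (_* w (d N.+ d) e) (even01-even d) & Z.*-identityˡ _)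
  (\ d e -> cong (_* w (suc (d N.+ d)) e) (even01-odd d) & Z.*-zeroˡ (w (suc (d N.+ d)) e))

 lam-even-e : (w : ℕ -> ℕ -> ℤ) -> lam (\ d e -> even01 e * w d e) ≐ dil (lam (\ d e -> w d (e N.+ e)))
 lam-even-e w n = lam-swap (\ d e -> even01 e * w d e) n & lam-even-d (\ d e -> w e d) n &
  dil-cong (lam-swap (\ d e -> w e (d N.+ d))) n

 E≐2V : E ≐ scale (+ 2) V
 E≐2V n = lam-even-d (\ d e -> + d) n & dil-cong (\ k -> lam-ext (\ d e -> pos-double d & two (+ d)) k &
   lam-* (+ 2) (\ d e -> + d) k) n & dil-scale (+ 2) U n where
  two : ∀ d -> d + d ≡ + 2 * d
  two = ring

 even-cubes : lam (\ d e -> even01 d * (+ d * + d * + d)) ≐ scale (+ 8) T3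
 even-cubes n = lam-even-d (\ d e -> + d * + d * + d) n & dil-cong (\ k -> lam-ext (\ d e ->
   cong (\ z -> z * z * z) (pos-double d) & eight (+ d)) k &
   lam-* (+ 8) (\ d e -> + d * + d * + d) k) n & dil-scale (+ 8) S n where
  eight : ∀ d -> (d + d) * (d + d) * (d + d) ≡ + 8 * (d * d * d)
  eight = ring

 abs-square : ∀ a b -> + N.∣ a - b ∣ * + N.∣ a - b ∣ ≡ (+ a - + b) * (+ a - + b)
 abs-square zero    b       = lemma (+ b) where
  lemma : ∀ b -> b * b ≡ (+ 0 - b) * (+ 0 - b)
  lemma = ring
 abs-square (suc a) zero    = lemma (+ suc a) where
  lemma : ∀ b -> b * b ≡ (b - + 0) * (b - + 0)
  lemma = ring
 abs-square (suc a) (suc b) = abs-square a b & lemma (+ a) (+ b) &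
  cong2 (\ x y -> (x - y) * (x - y)) (sym (Z.pos-+ 1 a)) (sym (Z.pos-+ 1 b)) where
  lemma : ∀ a b -> (a - b) * (a - b) ≡ ((1# + a) - (1# + b)) * ((1# + a) - (1# + b))
  lemma = ring

 sq : ℕ -> ℤ
 sq n = + n * + n

 sq-difference : ∀ a b -> sq N.∣ a - b ∣ - sq (a N.+ b) ≡ - (+ 4) * (+ a * + b)
 sq-difference a b = cong2 _-_ (abs-square a b) (cong (\ z -> z * z) (Z.pos-+ a b)) & lemma (+ a) (+ b) where
  lemma : ∀ a b -> (a - b) * (a - b) - (a + b) * (a + b) ≡ - (+ 4) * (a * b)
  lemma = ring

 upTo'-sq : ∀ d -> 0 N.< d -> + 6 * upTo' sq d ≡ + 2 * (+ d * + d * + d) - + 3 * (+ d * + d) + + d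
 upTo'-sq (suc zero)    _ = refl
 upTo'-sq (suc (suc d)) _ = Z.*-distribˡ-+ (+ 6) (upTo' sq (suc d)) _ &
  cong (_+ + 6 * sq (suc d)) (upTo'-sq (suc d) 0<s) &
  lemma (+ suc d) & cong (\ z -> + 2 * (z * z * z) - + 3 * (z * z) + z) (sym (Z.pos-+ 1 (suc d))) where
  lemma : ∀ d -> + 2 * (d * d * d) - + 3 * (d * d) + d + + 6 * (d * d) ≡
   + 2 * ((1# + d) * (1# + d) * (1# + d)) - + 3 * ((1# + d) * (1# + d)) + (1# + d)
  lemma = ring

 private
  N = divs

 -- Liouville's identity for f(n) = n², where f(|a - b|) - f(a + b) = -4ab. The factor -3 clears the
 -- denominator of the sum of squares and produces 12 = (-3)(-4).
 U² : ∀ n -> + 12 * (U ⊛ U) n ≡ + 5 * S n - + 6 * D U n + U n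
 U² n = lemma ((U ⊛ U) n) & cong (\ z -> - (+ 3) * z) (cong (\ z -> - (+ 4) * z) (lam-⊛ (\ d e -> + d) (\ d e -> + d) n) &
   sym (∑-* (quads n) (- (+ 4)) _) & ∑-cong (quads n) {w = \ { ((a , x) , b , y) -> sq N.∣ a - b ∣ - sq (a N.+ b) }} (\ { ((a , x) , b , y) _ -> sym (sq-difference a b) }) & Liouville.identity sq n) &
  sym (lam-* (- (+ 3)) term n) & lam-cong n (\ d e p _ _ -> pointwise d e p) &
  lam-+ (\ d e -> + 5 * (+ d * + d * + d) + - (+ 6) * (+ d * + e * + d)) (\ d e -> + d) n & cong (_+ U n)
  (lam-+ (\ d e -> + 5 * (+ d * + d * + d)) (\ d e -> - (+ 6) * (+ d * + e * + d)) n & cong2 _+_ (lam-* (+ 5) (\ d e -> + d * + d * + d) n)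
   (lam-* (- (+ 6)) (\ d e -> + d * + e * + d) n & cong (_*_ (- (+ 6))) (sym (lam-D (\ d e -> + d) n)) & sym (Z.neg-distribˡ-* (+ 6) (D U n)))) where
  term : ℕ -> ℕ -> ℤ
  term d e = (+ e - 1#) * sq 0 - (+ d - 1#) * sq d + + 2 * ((+ e - 1#) * sq d) - + 2 * upTo' sq d
  lemma : ∀ u -> + 12 * u ≡ - (+ 3) * (- (+ 4) * u)
  lemma = ring
  pointwise : ∀ d e -> 0 N.< d -> - (+ 3) * term d e ≡ + 5 * (+ d * + d * + d) + - (+ 6) * (+ d * + e * + d) + + d
  pointwise d e p = l1 (+ d) (+ e) (upTo' sq d) & cong (_+_ (+ 3 * ((+ d - 1#) * (+ d * + d)) - + 6 * ((+ e - 1#) * (+ d * + d)))) (upTo'-sq d p) & l2 (+ d) (+ e) where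
   l1 : ∀ d e u -> - (+ 3) * ((e - 1#) * 0# - (d - 1#) * (d * d) + + 2 * ((e - 1#) * (d * d)) - + 2 * u)
    ≡ (+ 3 * ((d - 1#) * (d * d)) - + 6 * ((e - 1#) * (d * d))) + + 6 * u
   l1 = ring
   l2 : ∀ d e -> (+ 3 * ((d - 1#) * (d * d)) - + 6 * ((e - 1#) * (d * d))) + (+ 2 * (d * d * d) - + 3 * (d * d) + d)
    ≡ + 5 * (d * d * d) + - (+ 6) * (d * e * d) + d
   l2 = ring

 evsq : ℕ -> ℤ
 evsq n = even01 n * (+ n * + n)

 even01-∣-∣ : ∀ a b -> even01 N.∣ a - b ∣ ≡ even01 (a N.+ b)
 even01-∣-∣ zero    b       = refl
 even01-∣-∣ (suc a) zero    = cong even01 (cong suc (sym (N.+-identityʳ a)))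
 even01-∣-∣ (suc a) (suc b) = even01-∣-∣ a b & cong (even01 ∘ suc) (sym (N.+-suc a b))

 even01-suc : ∀ n -> even01 (suc n) ≡ 1# - even01 n
 even01-suc zero          = refl
 even01-suc (suc zero)    = refl
 even01-suc (suc (suc n)) = even01-suc n

 even01-+ : ∀ a b -> even01 (a N.+ b) ≡ 1# - even01 a - even01 b + + 2 * (even01 a * even01 b)
 even01-+ zero    b = lemma (even01 b) where
  lemma : ∀ b -> b ≡ 1# - 1# - b + + 2 * (1# * b)
  lemma = ring
 even01-+ (suc a) b = even01-suc (a N.+ b) & cong (_-_ 1#) (even01-+ a b) &
  lemma (even01 a) (even01 b) & cong (\ z -> 1# - z - even01 b + + 2 * (z * even01 b)) (sym (even01-suc a)) where
  lemma : ∀ a b -> 1# - (1# - a - b + + 2 * (a * b)) ≡ 1# - (1# - a) - b + + 2 * ((1# - a) * b)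
  lemma = ring

 upTo'-evsq : ∀ d -> 0 N.< d -> + 6 * upTo' evsq d ≡ + d * + d * + d - + d + even01 d * (+ 3 * + d - + 3 * (+ d * + d))
 upTo'-evsq (suc zero)    _ = refl
 upTo'-evsq (suc (suc d)) _ = Z.*-distribˡ-+ (+ 6) (upTo' evsq (suc d)) _ &
  cong (_+ + 6 * evsq (suc d)) (upTo'-evsq (suc d) 0<s) &
  lemma (even01 (suc d)) (+ suc d) & cong2 (\ z w -> z * z * z - z + w * (+ 3 * z - + 3 * (z * z))) (sym (Z.pos-+ 1 (suc d))) (sym (even01-suc (suc d))) where
  lemma : ∀ w d -> d * d * d - d + w * (+ 3 * d - + 3 * (d * d)) + + 6 * (w * (d * d)) ≡
   (1# + d) * (1# + d) * (1# + d) - (1# + d) + (1# - w) * (+ 3 * (1# + d) - + 3 * ((1# + d) * (1# + d)))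
  lemma = ring

 -- Now f(n) is n² for even n and 0 for odd n. The numbers |a - b| and a + b have the same parity,
 -- so the left side becomes a convolution over pairs of equal parity; it contains the product of
 -- `U` with its dilation.
 UE : ∀ n -> + 12 * ((U ⊛ U) n - + 2 * (U ⊛ E) n + + 2 * (E ⊛ E) n) ≡ S n - U n + + 24 * T3 n - + 6 * D E n + + 3 * E n
 UE n = lemma (A - + 2 * B + + 2 * C) & cong (\ z -> - (+ 3) * z) (left & Liouville.identity evsq n) &
  sym (lam-* (- (+ 3)) term n) & lam-cong n (\ d e p _ _ -> pointwise d e p) & right where
  A = (U ⊛ U) n
  B = (U ⊛ E) n
  C = (E ⊛ E) n
  term : ℕ -> ℕ -> ℤ
  term d e = (+ e - 1#) * evsq 0 - (+ d - 1#) * evsq d + + 2 * ((+ e - 1#) * evsq d) - + 2 * upTo' evsq d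
  lemma : ∀ u -> + 12 * u ≡ - (+ 3) * (- (+ 4) * u)
  lemma = ring
  uu ue eu ee : Quad -> ℤ
  uu ((a , x) , b , y) = + a * + b
  ue ((a , x) , b , y) = + a * (even01 b * + b)
  eu ((a , x) , b , y) = (even01 a * + a) * + b
  ee ((a , x) , b , y) = (even01 a * + a) * (even01 b * + b)
  u w : ℕ -> ℕ -> ℤ
  u d e = + d
  w d e = even01 d * + d
  left : - (+ 4) * (A - + 2 * B + + 2 * C) ≡ ∑ (quads n) (\ { ((a , x) , b , y) -> evsq N.∣ a - b ∣ - evsq (a N.+ b) })
  left = cong (_*_ (- (+ 4))) (l0 A B C & cong2 _+_ (cong2 _-_ (cong2 _-_ (lam-⊛ u u n) (lam-⊛ u w n)) ((⊛-comm≐ U E n) & lam-⊛ w u n)) (cong (_*_ (+ 2)) (lam-⊛ w w n) & sym (∑-* (quads n) (+ 2) ee))) &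
   cong (_*_ (- (+ 4))) (cong (_+ ∑ (quads n) (\ q -> + 2 * ee q)) (cong (_- ∑ (quads n) eu) (sym (∑-- (quads n) uu ue)) & sym (∑-- (quads n) _ eu)) & sym (∑-+ (quads n) _ _)) &
   sym (∑-* (quads n) (- (+ 4)) _) & ∑-cong (quads n) (\ { ((a , x) , b , y) _ -> sym (evsq-difference a b) }) where
   l0 : ∀ A B C -> A - + 2 * B + + 2 * C ≡ A - B - B + + 2 * C
   l0 = ring
   evsq-difference : ∀ a b -> evsq N.∣ a - b ∣ - evsq (a N.+ b) ≡
    - (+ 4) * (+ a * + b - + a * (even01 b * + b) - (even01 a * + a) * + b + + 2 * ((even01 a * + a) * (even01 b * + b)))
   evsq-difference a b = cong (\ z -> z * sq N.∣ a - b ∣ - evsq (a N.+ b)) (even01-∣-∣ a b) &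
    l1 (even01 (a N.+ b)) (sq N.∣ a - b ∣) (sq (a N.+ b)) & cong2 _*_ (even01-+ a b) (sq-difference a b) & l2 (even01 a) (even01 b) (+ a) (+ b) where
    l1 : ∀ v x y -> v * x - v * y ≡ v * (x - y)
    l1 = ring
    l2 : ∀ p q a b -> (1# - p - q + + 2 * (p * q)) * (- (+ 4) * (a * b)) ≡
     - (+ 4) * (a * b - a * (q * b) - (p * a) * b + + 2 * ((p * a) * (q * b)))
    l2 = ring
  goal : ℕ -> ℕ -> ℤ
  goal d e = + d * + d * + d - + d + + 3 * (even01 d * (+ d * + d * + d)) - + 6 * (+ d * + e * (even01 d * + d)) + + 3 * (even01 d * + d)
  pointwise : ∀ d e -> 0 N.< d -> - (+ 3) * term d e ≡ goal d e
  pointwise d e p = l1 (even01 d) (+ d) (+ e) (upTo' evsq d) & cong (_+_ (even01 d * (+ 3 * ((+ d - 1#) * (+ d * + d)) - + 6 * ((+ e - 1#) * (+ d * + d))))) (upTo'-evsq d p) & l2 (even01 d) (+ d) (+ e) where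
   l1 : ∀ w d e u -> - (+ 3) * ((e - 1#) * 0# - (d - 1#) * (w * (d * d)) + + 2 * ((e - 1#) * (w * (d * d))) - + 2 * u)
    ≡ w * (+ 3 * ((d - 1#) * (d * d)) - + 6 * ((e - 1#) * (d * d))) + + 6 * u
   l1 = ring
   l2 : ∀ w d e -> w * (+ 3 * ((d - 1#) * (d * d)) - + 6 * ((e - 1#) * (d * d))) + (d * d * d - d + w * (+ 3 * d - + 3 * (d * d)))
    ≡ d * d * d - d + + 3 * (w * (d * d * d)) - + 6 * (d * e * (w * d)) + + 3 * (w * d)
   l2 = ring
  right : lam goal n ≡ S n - U n + + 24 * T3 n - + 6 * D E n + + 3 * E n
  right = ∑-+ (N n) _ _ & cong2 _+_ (∑-- (N n) _ _ & cong2 _-_ (∑-+ (N n) _ _ & cong2 _+_ (∑-- (N n) _ _)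
    (lam-* (+ 3) (\ d e -> even01 d * (+ d * + d * + d)) n & cong (_*_ (+ 3)) (even-cubes n) & sym (Z.*-assoc (+ 3) (+ 8) (T3 n))))
    (lam-* (+ 6) (\ d e -> + d * + e * (even01 d * + d)) n & cong (_*_ (+ 6)) (sym (lam-D (\ d e -> even01 d * + d) n))))
   (lam-* (+ 3) (\ d e -> even01 d * + d) n)

 private
  +-4 : ∀ a b -> a N.+ suc (suc (suc (suc b))) ≡ 4 N.+ (a N.+ b)
  +-4 = ringN!

  four-shift : ∀ a b -> four N.∣ suc (suc (suc (suc a))) - b ∣ ≡ four N.∣ a - b ∣
  four-shift 0       0 = refl
  four-shift (suc a) 0 = refl
  four-shift 0       1 = refl
  four-shift 0       2 = refl
  four-shift 0       3 = refl
  four-shift 0       (suc (suc (suc (suc b)))) = refl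
  four-shift (suc a) (suc b) = four-shift a b

  -- Both sides depend only on a and b modulo 4. The two indicators test a ≡ b and a ≡ -b; they
  -- agree unless both numbers are odd, and then their difference is the product of the characters.
  four-χ : ∀ a b -> four N.∣ a - b ∣ - four (a N.+ b) ≡ χ a * χ b
  four-χ (suc (suc (suc (suc a)))) b = cong (_- four (a N.+ b)) (four-shift a b) & four-χ a b
  four-χ a (suc (suc (suc (suc b)))) = cong2 _-_ (cong four (N.∣-∣-comm a (4 N.+ b)) & four-shift b a & cong four (N.∣-∣-comm b a)) (cong four (+-4 a b)) & four-χ a b
  four-χ 0 0 = refl
  four-χ 0 1 = refl
  four-χ 0 2 = refl
  four-χ 0 3 = refl
  four-χ 1 0 = refl
  four-χ 1 1 = refl
  four-χ 1 2 = refl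
  four-χ 1 3 = refl
  four-χ 2 0 = refl
  four-χ 2 1 = refl
  four-χ 2 2 = refl
  four-χ 2 3 = refl
  four-χ 3 0 = refl
  four-χ 3 1 = refl
  four-χ 3 2 = refl
  four-χ 3 3 = refl

  upTo'-four : ∀ d -> 0 N.< d -> + 4 * upTo' four d ≡ + d - + 2 - + 2 * four d + χ d
  upTo'-four 1 _ = refl
  upTo'-four 2 _ = refl
  upTo'-four 3 _ = refl
  upTo'-four 4 _ = refl
  upTo'-four (suc (suc (suc (suc d@(suc d'))))) _ = cong (_*_ (+ 4)) (period d') &
   Z.*-distribˡ-+ (+ 4) (upTo' four d) 1# & cong (_+ + 4 * 1#) (upTo'-four d 0<s) &
   lemma (+ d) (four d) (χ d) & cong (\ z -> z - + 2 - + 2 * four d + χ d) (sym (Z.pos-+ 4 d)) where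
   lemma : ∀ d f c -> d - + 2 - + 2 * f + c + + 4 * 1# ≡ + 4 + d - + 2 - + 2 * f + c
   lemma = ring
   one-of-four : ∀ k -> four k + four (suc k) + four (suc (suc k)) + four (suc (suc (suc k))) ≡ 1#
   one-of-four 0 = refl
   one-of-four 1 = refl
   one-of-four 2 = refl
   one-of-four 3 = refl
   one-of-four (suc (suc (suc (suc k)))) = one-of-four k
   period : ∀ d -> upTo' four (5 N.+ d) ≡ upTo' four (suc d) + 1#
   period d = l (upTo' four (suc d)) (four (suc d)) (four (2 N.+ d)) (four (3 N.+ d)) (four d) &
    cong (_+_ (upTo' four (suc d))) (l2 (four (suc d)) (four (2 N.+ d)) (four (3 N.+ d)) (four d) & one-of-four d) where
    l : ∀ u a b c z -> u + a + b + c + z ≡ u + (a + b + c + z)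
    l = ring
    l2 : ∀ a b c z -> a + b + c + z ≡ z + a + b + c
    l2 = ring

 lam-four : (w : ℕ -> ℕ -> ℤ) -> lam (\ d e -> four d * w d e) ≐ dil (dil (lam (\ d e -> w (4 N.* d) e)))
 lam-four w n = lam-even (\ d e -> four d * w d e) (\ d e -> even01 d * w (d N.+ d) e) (\ d e -> cong (_* w (d N.+ d) e) (f-even d))
   (\ d e -> cong (_* w (suc (d N.+ d)) e) (f-odd d) & Z.*-zeroˡ (w (suc (d N.+ d)) e)) n &
  dil-cong (\ k -> lam-even-d (\ d e -> w (d N.+ d) e) k & dil-cong (lam-ext (\ d e -> cong (\ z -> w z e) (quad d))) k) n where
  f-even : ∀ d -> four (d N.+ d) ≡ even01 d
  f-even zero          = refl
  f-even (suc zero)    = refl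
  f-even (suc (suc d)) = cong four (lemma d) & f-even d where
   lemma : ∀ d -> suc (suc d) N.+ suc (suc d) ≡ 4 N.+ (d N.+ d)
   lemma = ringN!
  f-odd : ∀ d -> four (suc (d N.+ d)) ≡ 0#
  f-odd zero          = refl
  f-odd (suc zero)    = refl
  f-odd (suc (suc d)) = cong (four ∘ suc) (lemma d) & f-odd d where
   lemma : ∀ d -> suc (suc d) N.+ suc (suc d) ≡ 4 N.+ (d N.+ d)
   lemma = ringN!
  quad : ∀ d -> d N.+ d N.+ (d N.+ d) ≡ 4 N.* d
  quad = ringN!

 -- Liouville's identity for the indicator of the multiples of 4. It ties the two-square series 1 +
 -- 4X to the four-square series, see `θ²`.
 X² : ∀ n -> + 2 * (X ⊛ X) n ≡ U n - X n - + 4 * W n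
 X² n = cong (_*_ (+ 2)) (lam-⊛ (\ d e -> χ d) (\ d e -> χ d) n & ∑-cong (quads n)
   {w = \ { ((a , x) , b , y) -> four N.∣ a - b ∣ - four (a N.+ b) }} (\ { ((a , x) , b , y) _ -> sym (four-χ a b) }) &
   Liouville.identity four n) & sym (lam-* (+ 2) term n) & lam-cong n (\ d e p _ _ -> pointwise d e p) & right where
  term goal : ℕ -> ℕ -> ℤ
  term d e = (+ e - 1#) * four 0 - (+ d - 1#) * four d + + 2 * ((+ e - 1#) * four d) - + 2 * upTo' four d
  goal d e = + 2 * + e - + d - χ d - + 2 * (four d * + d) + + 4 * (four d * + e)
  pointwise : ∀ d e -> 0 N.< d -> + 2 * term d e ≡ goal d e
  pointwise d e p = l1 (+ d) (+ e) (four d) (upTo' four d) & cong (\ z -> + 2 * (+ e - 1#) - + 2 * ((+ d - 1#) * four d) + + 4 * ((+ e - 1#) * four d) - z) (upTo'-four d p) & l2 (+ d) (+ e) (four d) (χ d) where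
   l1 : ∀ d e f u -> + 2 * ((e - 1#) * 1# - (d - 1#) * f + + 2 * ((e - 1#) * f) - + 2 * u) ≡
    + 2 * (e - 1#) - + 2 * ((d - 1#) * f) + + 4 * ((e - 1#) * f) - + 4 * u
   l1 = ring
   l2 : ∀ d e f c -> + 2 * (e - 1#) - + 2 * ((d - 1#) * f) + + 4 * ((e - 1#) * f) - (d - + 2 - + 2 * f + c) ≡
    + 2 * e - d - c - + 2 * (f * d) + + 4 * (f * e)
   l2 = ring
  four-e : lam (\ d e -> four d * + e) n ≡ W n
  four-e = lam-four (\ d e -> + e) n & dil-cong (dil-cong (lam-swap (\ d e -> + e))) n
  four-d : lam (\ d e -> four d * + d) n ≡ + 4 * W n
  four-d = lam-four (\ d e -> + d) n & dil-cong (\ k -> dil-cong (\ j -> lam-ext (\ d e -> Z.pos-* 4 d) j & lam-* (+ 4) (\ d e -> + d) j) k &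
   dil-scale (+ 4) U k) n & dil-scale (+ 4) V n
  right : lam goal n ≡ U n - X n - + 4 * W n
  right = ∑-+ (N n) _ _ & cong2 _+_ (∑-- (N n) _ _ & cong2 _-_ (∑-- (N n) _ _ & cong (_- X n) (∑-- (N n) _ _ &
    cong (_- U n) (lam-* (+ 2) (\ d e -> + e) n & cong (_*_ (+ 2)) (lam-swap (\ d e -> + e) n))))
    (lam-* (+ 2) (\ d e -> four d * + d) n & cong (_*_ (+ 2)) four-d)) (lam-* (+ 4) (\ d e -> four d * + e) n & cong (_*_ (+ 4)) four-e) &
   l (U n) (X n) (W n) where
   l : ∀ u x w -> + 2 * u - u - x - + 2 * (+ 4 * w) + + 4 * w ≡ u - x - + 4 * w
   l = ring

-- Quadratic relations and their images under q ↦ q² and q ↦ -q.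

module RingIdentities where
 open DivisorSums public
 open import Data.List using (List; []; _∷_; map)

 lin : List (ℤ × Series) -> Series
 lin []            = κ 0#
 lin ((k , f) ∷ l) = κ k ⊛ f ⊕ lin l

 private
  on : (Series -> Series) -> List (ℤ × Series) -> List (ℤ × Series)
  on T = map (\ { (k , f) -> k , T f })

 module Linear (T : Series -> Series) (T-cong : ∀ {f g} -> f ≐ g -> T f ≐ T g)
  (T-⊕ : ∀ f g -> T (f ⊕ g) ≐ T f ⊕ T g) (T-scale : ∀ k f -> T (scale k f) ≐ scale k (T f))
  (T-⊛ : ∀ f g -> T (f ⊛ g) ≐ T f ⊛ T g) where

  T-κ⊛ : ∀ k f -> T (κ k ⊛ f) ≐ κ k ⊛ T f
  T-κ⊛ k f n = T-cong (κ-⊛ k f) n & T-scale k f n & sym (κ-⊛ k (T f) n)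

  T-lin : ∀ l -> T (lin l) ≐ lin (on T l)
  T-lin [] n = T-cong {g = scale 0# (κ 0#)} (\ { zero -> refl ; (suc n) -> refl }) n &
   T-scale 0# (κ 0#) n & Z.*-zeroˡ (T (κ 0#) n) & sym (κ0 n) where
   κ0 : ∀ n -> κ 0# n ≡ 0#
   κ0 zero    = refl
   κ0 (suc n) = refl
  T-lin ((k , f) ∷ l) n = T-⊕ (κ k ⊛ f) (lin l) n & cong2 _+_ (T-κ⊛ k f n) (T-lin l n)

  -- The substitutions are ring endomorphisms, so a convolution formula yields its images without a
  -- new count.
  T-quadratic : ∀ {k f g l} -> κ k ⊛ (f ⊛ g) ≐ lin l -> κ k ⊛ (T f ⊛ T g) ≐ lin (on T l)
  T-quadratic {k} {f} {g} {l} e n = (⊛-cong≐ {κ k} (\ _ -> refl) (\ i -> sym (T-⊛ f g i)) n) &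
   sym (T-κ⊛ k (f ⊛ g) n) & T-cong e n & T-lin l n

 module Dil = Linear dil dil-cong dil-⊕ dil-scale dil-⊛
 module Tw  = Linear tw tw-cong tw-⊕ tw-scale tw-⊛

 open Congruence 0
 open Ideal 0
 private module R = CommutativeRing seriesRing

 private
  term : ∀ k f n -> (κ k ⊛ f) n ≡ k * f n
  term = κ-⊛

  κ0 : ∀ n -> κ 0# n ≡ 0#
  κ0 zero    = refl
  κ0 (suc n) = refl

 lU : List (ℤ × Series)
 lU = (+ 5 , S) ∷ (- (+ 6) , D U) ∷ (1# , U) ∷ []

 U²-lin : κ (+ 12) ⊛ (U ⊛ U) ≐ lin lU
 U²-lin n = term (+ 12) (U ⊛ U) n & U² n & l (S n) (D U n) (U n) &
  sym (cong2 _+_ (term (+ 5) S n) (cong2 _+_ (term (- (+ 6)) (D U) n) (cong2 _+_ (term 1# U n) (κ0 n)))) where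
  l : ∀ s d u -> + 5 * s - + 6 * d + u ≡ + 5 * s + (- (+ 6) * d + (1# * u + 0#))
  l = ring

 lUV : List (ℤ × Series)
 lUV = (+ 4 , S) ∷ (+ 16 , T3) ∷ (- (+ 6) , D U) ∷ (- (+ 12) , D V) ∷ (+ 2 , U) ∷ (+ 2 , V) ∷ []

 E≈2V : E ≈ κ (+ 2) ⊛ V
 E≈2V = lift (\ n -> E≐2V n & sym (κ-⊛ (+ 2) V n))

 D-cong : ∀ {f g} -> f ≐ g -> D f ≐ D g
 D-cong e n = cong (_*_ (+ n)) (e n)

 D-κ⊛ : ∀ k f -> D (κ k ⊛ f) ≐ κ k ⊛ D f
 D-κ⊛ k f n = cong (_*_ (+ n)) (κ-⊛ k f n) & l (+ n) k (f n) & sym (κ-⊛ k (D f) n) where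
  l : ∀ n k f -> n * (k * f) ≡ k * (n * f)
  l = ring

 V²-lin : κ (+ 12) ⊛ (V ⊛ V) ≐ lin ((+ 5 , T3) ∷ (- (+ 6) , dil (D U)) ∷ (1# , V) ∷ [])
 V²-lin = Dil.T-quadratic {+ 12} {U} {U} {lU} U²-lin

 DV : D V ≈ κ (+ 2) ⊛ dil (D U)
 DV = lift (\ n -> D-dil U n & sym (κ-⊛ (+ 2) (dil (D U)) n))

 DW : D W ≈ κ (+ 2) ⊛ dil (D V)
 DW = lift (\ n -> D-dil V n & sym (κ-⊛ (+ 2) (dil (D V)) n))

 dilDV : dil (D V) ≈ κ (+ 2) ⊛ dil (dil (D U))
 dilDV = lift (\ n -> dil-cong (exact DV) n & Dil.T-κ⊛ (+ 2) (dil (D U)) n)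

 private
  U²-null : Null (κ (+ 12) ⊛ (U ⊛ U) ⊕ ⊝ lin lU)
  U²-null = null (lift U²-lin)

  V²-null : Null (κ (+ 12) ⊛ (V ⊛ V) ⊕ ⊝ lin ((+ 5 , T3) ∷ (- (+ 6) , dil (D U)) ∷ (1# , V) ∷ []))
  V²-null = null (lift V²-lin)

  UE-null : Null (κ (+ 12) ⊛ (U ⊛ U ⊕ ⊝ (κ (+ 2) ⊛ (U ⊛ E)) ⊕ κ (+ 2) ⊛ (E ⊛ E))
   ⊕ ⊝ lin ((1# , S) ∷ (- 1# , U) ∷ (+ 24 , T3) ∷ (- (+ 6) , D E) ∷ (+ 3 , E) ∷ []))
  UE-null = null (lift (\ n -> term (+ 12) _ n & cong (_*_ (+ 12)) (cong2 _+_ (cong (\ z -> (U ⊛ U) n - z) (term (+ 2) (U ⊛ E) n)) (term (+ 2) (E ⊛ E) n)) &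
   UE n & l (S n) (U n) (T3 n) (D E n) (E n) & sym (cong2 _+_ (term 1# S n) (cong2 _+_ (term (- 1#) U n) (cong2 _+_ (term (+ 24) T3 n)
    (cong2 _+_ (term (- (+ 6)) (D E) n) (cong2 _+_ (term (+ 3) E n) (κ0 n)))))))) where
   l : ∀ s u t d e -> s - u + + 24 * t - + 6 * d + + 3 * e ≡ 1# * s + (- 1# * u + (+ 24 * t + (- (+ 6) * d + (+ 3 * e + 0#))))
   l = ring

  DE : D E ≈ κ (+ 2) ⊛ D V
  DE = lift (D-cong (exact E≈2V)) » lift (D-κ⊛ (+ 2) V)

 -- With E = 2V the identity `UE` contains U², UV and V². The first and the last are already linear,
 -- which leaves UV.
 UV-lin : κ (+ 48) ⊛ (U ⊛ V) ≐ lin lUV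
 UV-lin = exact (unnull (by (solve 10 (\ U V S T dU dV E dE u' one ->
   # 48 :* (U :* V) :- (# 4 :* S :+ (# 16 :* T :+ (con (- (+ 6)) :* dU :+ (con (- (+ 12)) :* dV :+ (# 2 :* U :+ (# 2 :* V :+ con 0#))))))
   := con 1# :* (# 12 :* (U :* U) :- (# 5 :* S :+ (con (- (+ 6)) :* dU :+ (con 1# :* U :+ con 0#))))
   :+ # 8 :* (# 12 :* (V :* V) :- (# 5 :* T :+ (con (- (+ 6)) :* u' :+ (con 1# :* V :+ con 0#))))
   :+ con (- 1#) :* (# 12 :* (U :* U :- # 2 :* (U :* E) :+ # 2 :* (E :* E)) :- (con 1# :* S :+ (con (- 1#) :* U :+ (# 24 :* T :+ (con (- (+ 6)) :* dE :+ (# 3 :* E :+ con 0#))))))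
   :+ (# 24 :* E :- # 24 :* U :+ # 48 :* V :- # 3) :* (E :- # 2 :* V)
   :+ # 6 :* (dE :- # 2 :* dV)
   :+ # 24 :* (dV :- # 2 :* u')) R.refl
    U V S T3 (D U) (D V) E (D E) (dil (D U)) (κ 1#))
   (_ *ᶻ U²-null +ᶻ _ *ᶻ V²-null +ᶻ _ *ᶻ UE-null +ᶻ _ *ᶻ null E≈2V +ᶻ _ *ᶻ null DE +ᶻ _ *ᶻ null DV)))
  where open Solver

-- Products of Eisenstein series of level four and the equation of x.

module Differential where
 open RingIdentities public
 open import Data.List using ([]; _∷_)

 open Congruence 0
 open Ideal 0
 private module R = CommutativeRing seriesRing

 sgn-even01 : ∀ n -> sgn n ≡ + 2 * even01 n - 1#
 sgn-even01 zero    = refl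
 sgn-even01 (suc n) = cong -_ (sgn-even01 n) & l (even01 n) & cong (\ z -> + 2 * z - 1#) (sym (even01-suc n)) where
  l : ∀ a -> - (+ 2 * a - 1#) ≡ + 2 * (1# - a) - 1#
  l = ring

 even01² : ∀ n -> even01 n * even01 n ≡ even01 n
 even01² n with parity n
 ... | even k = cong2 _*_ (even01-even k) (even01-even k) & sym (even01-even k)
 ... | odd k  = cong2 _*_ (even01-odd k) (even01-odd k) & sym (even01-odd k)

 even01-* : ∀ d e -> even01 (d N.* e) ≡ even01 d + even01 e - even01 d * even01 e
 even01-* zero    e = l (even01 e) where
  l : ∀ a -> 1# ≡ 1# + a - 1# * a
  l = ring
 even01-* (suc d) e = even01-+ e (d N.* e) & cong (\ z -> 1# - even01 e - z + + 2 * (even01 e * z)) (even01-* d e) &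
  l1 (even01 d) (even01 e) & cong (\ z -> 1# - + 2 * even01 e - even01 d + + 3 * (even01 d * even01 e) + + 2 * z - + 2 * (even01 d * z)) (even01² e) &
  l2 (even01 d) (even01 e) & cong (\ z -> z + even01 e - z * even01 e) (sym (even01-suc d)) where
  l1 : ∀ x a -> 1# - a - (x + a - x * a) + + 2 * (a * (x + a - x * a)) ≡ 1# - + 2 * a - x + + 3 * (x * a) + + 2 * (a * a) - + 2 * (x * (a * a))
  l1 = ring
  l2 : ∀ x a -> 1# - + 2 * a - x + + 3 * (x * a) + + 2 * a - + 2 * (x * a) ≡ (1# - x) + a - (1# - x) * a
  l2 = ring

 -- The sign (-1)^(de) is a polynomial in the parity indicators of d and e. The twist is therefore a
 -- combination of Lambert series restricted to even d or e, and those are dilations.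
 tw-lam : (w : ℕ -> ℕ -> ℤ) -> ∀ n -> tw (lam w) n ≡
  - lam w n + + 2 * lam (\ d e -> even01 d * w d e) n + + 2 * lam (\ d e -> even01 e * w d e) n
  - + 2 * lam (\ d e -> even01 d * (even01 e * w d e)) n
 tw-lam w n = tw-sgn (lam w) n & sym (∑-* (divs n) (sgn n) _) & ∑-cong (divs n) (\ { (d , e) (_ , _ , refl) -> pointwise d e }) &
  ∑-- (divs n) _ _ & cong2 _-_ (∑-+ (divs n) _ _ & cong2 _+_ (∑-+ (divs n) _ _ & cong2 _+_ (∑-neg (divs n) _)
   (∑-* (divs n) (+ 2) _)) (∑-* (divs n) (+ 2) _)) (∑-* (divs n) (+ 2) _) where
  pointwise : ∀ d e -> sgn (d N.* e) * w d e ≡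
   - w d e + + 2 * (even01 d * w d e) + + 2 * (even01 e * w d e) - + 2 * (even01 d * (even01 e * w d e))
  pointwise d e = cong (_* w d e) (sgn-even01 (d N.* e) & cong (\ z -> + 2 * z - 1#) (even01-* d e)) & l (even01 d) (even01 e) (w d e) where
   l : ∀ a b w -> (+ 2 * (a + b - a * b) - 1#) * w ≡ - w + + 2 * (a * w) + + 2 * (b * w) - + 2 * (a * (b * w))
   l = ring

 private
  term : ∀ k f n -> (κ k ⊛ f) n ≡ k * f n
  term = κ-⊛

  double-d : ∀ d (e : ℕ) -> + (d N.+ d) ≡ + 2 * + d
  double-d d e = Z.pos-+ d d & l (+ d) where
   l : ∀ d -> d + d ≡ + 2 * d
   l = ring

  double-d³ : ∀ d (e : ℕ) -> + (d N.+ d) * + (d N.+ d) * + (d N.+ d) ≡ + 8 * (+ d * + d * + d)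
  double-d³ d e = cong (\ z -> z * z * z) (double-d d e) & l (+ d) where
   l : ∀ d -> (+ 2 * d) * (+ 2 * d) * (+ 2 * d) ≡ + 8 * (d * d * d)
   l = ring

  both-even : ∀ (w : ℕ -> ℕ -> ℤ) (k : ℤ) -> (∀ d e -> w d (e N.+ e) ≡ w d e) -> (∀ d e -> w (d N.+ d) e ≡ k * w d e) ->
   ∀ n -> lam (\ d e -> even01 d * (even01 e * w d e)) n ≡ k * dil (dil (lam w)) n
  both-even w k he hd n = lam-even-d (\ d e -> even01 e * w d e) n & dil-cong (\ j ->
    lam-even-e (\ d e -> w (d N.+ d) e) j & dil-cong (\ i -> lam-ext (\ d e -> hd d (e N.+ e) & cong (_*_ k) (he d e)) i &
     lam-* k w i) j & dil-scale k (lam w) j) n & dil-scale k (dil (lam w)) n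

 twU : tw U ≈ κ (+ 6) ⊛ V ⊕ ⊝ (κ (+ 4) ⊛ W) ⊕ ⊝ U
 twU = lift (\ n -> tw-lam (\ d e -> + d) n & cong2 _-_ (cong2 _+_ (cong (\ z -> - U n + + 2 * z) (E≐2V n))
   (cong (_*_ (+ 2)) (lam-even-e (\ d e -> + d) n))) (cong (_*_ (+ 2)) (both-even (\ d e -> + d) (+ 2) (\ _ _ -> refl) double-d n)) &
  l (U n) (V n) (W n) & sym (cong2 _+_ (cong2 _-_ (term (+ 6) V n) (term (+ 4) W n)) refl)) where
  l : ∀ u v w -> - u + + 2 * (+ 2 * v) + + 2 * v - + 2 * (+ 2 * w) ≡ + 6 * v - + 4 * w + - u
  l = ring

 twS : tw S ≈ κ (+ 18) ⊛ T3 ⊕ ⊝ (κ (+ 16) ⊛ R3) ⊕ ⊝ S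
 twS = lift (\ n -> tw-lam (\ d e -> + d * + d * + d) n & cong2 _-_ (cong2 _+_ (cong (\ z -> - S n + + 2 * z) (even-cubes n))
   (cong (_*_ (+ 2)) (lam-even-e (\ d e -> + d * + d * + d) n))) (cong (_*_ (+ 2)) (both-even (\ d e -> + d * + d * + d) (+ 8) (\ _ _ -> refl) double-d³ n)) &
  l (S n) (T3 n) (R3 n) & sym (cong2 _+_ (cong2 _-_ (term (+ 18) T3 n) (term (+ 16) R3 n)) refl)) where
  l : ∀ s t r -> - s + + 2 * (+ 8 * t) + + 2 * t - + 2 * (+ 8 * r) ≡ + 18 * t - + 16 * r + - s
  l = ring


 D-lin2 : ∀ a f b g c h -> D (κ a ⊛ f ⊕ κ b ⊛ g ⊕ κ c ⊛ h) ≈ κ a ⊛ D f ⊕ κ b ⊛ D g ⊕ κ c ⊛ D h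
 D-lin2 a f b g c h = lift (D-⊕ (κ a ⊛ f ⊕ κ b ⊛ g) (κ c ⊛ h)) » R.+-cong (lift (D-⊕ (κ a ⊛ f) (κ b ⊛ g)) »
  R.+-cong (lift (D-κ⊛ a f)) (lift (D-κ⊛ b g))) (lift (D-κ⊛ c h))

 D-≈ : ∀ {f g} -> f ≈ g -> D f ≈ D g
 D-≈ e = lift (D-cong (exact e))

 tw-≈ : ∀ {f g} -> f ≈ g -> tw f ≈ tw g
 tw-≈ e = lift (tw-cong (exact e))

 twDU : tw (D U) ≈ κ (+ 6) ⊛ D V ⊕ κ (- (+ 4)) ⊛ D W ⊕ κ (- 1#) ⊛ D U
 twDU = lift (tw-D U) » D-≈ (twU » solve 3 (\ u v w ->
  # 6 :* v :- # 4 :* w :- u := # 6 :* v :+ con (- (+ 4)) :* w :+ con (- 1#) :* u) R.refl U V W) »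
  D-lin2 (+ 6) V (- (+ 4)) W (- 1#) U
  where open Solver

 private
  dU = D U
  dV = D V
  dW = D W
  u' = dil dU
  v' = dil dV
  u″ = dil u'

 -- Every product of two of U, V, W, in terms of the linear span of S, T₃, R₃, U, V, W and D U, D V, D W.
 module Products where
  open Solver

  UU : Null (κ (+ 12) ⊛ (U ⊛ U) ⊕ ⊝ (κ (+ 5) ⊛ S) ⊕ κ (+ 6) ⊛ dU ⊕ ⊝ U)
  UU = by (solve 3 (\ U S d -> # 12 :* (U :* U) :- # 5 :* S :+ # 6 :* d :- U
    := # 12 :* (U :* U) :- (# 5 :* S :+ (con (- (+ 6)) :* d :+ (con 1# :* U :+ con 0#)))) R.refl U S dU)
   (null (lift U²-lin))

  UV : Null (κ (+ 48) ⊛ (U ⊛ V) ⊕ ⊝ (κ (+ 4) ⊛ S) ⊕ ⊝ (κ (+ 16) ⊛ T3) ⊕ κ (+ 6) ⊛ dU ⊕ κ (+ 12) ⊛ dV ⊕ ⊝ (κ (+ 2) ⊛ U) ⊕ ⊝ (κ (+ 2) ⊛ V))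
  UV = by (solve 6 (\ U V S T dU dV ->
    # 48 :* (U :* V) :- # 4 :* S :- # 16 :* T :+ # 6 :* dU :+ # 12 :* dV :- # 2 :* U :- # 2 :* V
    := # 48 :* (U :* V) :- (# 4 :* S :+ (# 16 :* T :+ (con (- (+ 6)) :* dU :+ (con (- (+ 12)) :* dV :+ (# 2 :* U :+ (# 2 :* V :+ con 0#)))))))
    R.refl U V S T3 dU dV) (null (lift UV-lin))

  VV : Null (κ (+ 12) ⊛ (V ⊛ V) ⊕ ⊝ (κ (+ 5) ⊛ T3) ⊕ κ (+ 3) ⊛ dV ⊕ ⊝ V)
  VV = by (solve 4 (\ V T dV u' -> # 12 :* (V :* V) :- # 5 :* T :+ # 3 :* dV :- V
    := con 1# :* (# 12 :* (V :* V) :- (# 5 :* T :+ (con (- (+ 6)) :* u' :+ (con 1# :* V :+ con 0#))))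
    :+ # 3 :* (dV :- # 2 :* u')) R.refl V T3 dV u')
   (_ *ᶻ null (lift V²-lin) +ᶻ _ *ᶻ null DV)

  VW : Null (κ (+ 48) ⊛ (V ⊛ W) ⊕ ⊝ (κ (+ 4) ⊛ T3) ⊕ ⊝ (κ (+ 16) ⊛ R3) ⊕ κ (+ 3) ⊛ dV ⊕ κ (+ 6) ⊛ dW ⊕ ⊝ (κ (+ 2) ⊛ V) ⊕ ⊝ (κ (+ 2) ⊛ W))
  VW = by (solve 8 (\ V W T R dV dW u' v' ->
    # 48 :* (V :* W) :- # 4 :* T :- # 16 :* R :+ # 3 :* dV :+ # 6 :* dW :- # 2 :* V :- # 2 :* W
    := con 1# :* (# 48 :* (V :* W) :- (# 4 :* T :+ (# 16 :* R :+ (con (- (+ 6)) :* u' :+ (con (- (+ 12)) :* v' :+ (# 2 :* V :+ (# 2 :* W :+ con 0#)))))))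
    :+ # 3 :* (dV :- # 2 :* u') :+ # 6 :* (dW :- # 2 :* v')) R.refl V W T3 R3 dV dW u' v')
   (_ *ᶻ null (lift (Dil.T-quadratic {+ 48} {U} {V} {lUV} UV-lin)) +ᶻ _ *ᶻ null DV +ᶻ _ *ᶻ null DW)

  WW : Null (κ (+ 24) ⊛ (W ⊛ W) ⊕ ⊝ (κ (+ 10) ⊛ R3) ⊕ κ (+ 3) ⊛ dW ⊕ ⊝ (κ (+ 2) ⊛ W))
  WW = by (solve 5 (\ W R dW v' u″ -> # 24 :* (W :* W) :- # 10 :* R :+ # 3 :* dW :- # 2 :* W
    := # 2 :* (# 12 :* (W :* W) :- (# 5 :* R :+ (con (- (+ 6)) :* u″ :+ (con 1# :* W :+ con 0#))))
    :+ # 3 :* (dW :- # 2 :* v') :+ # 6 :* (v' :- # 2 :* u″)) R.refl W R3 dW v' u″)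
   (_ *ᶻ null (lift (Dil.T-quadratic {+ 12} {V} {V} {(+ 5 , T3) ∷ (- (+ 6) , u') ∷ (1# , V) ∷ []} V²-lin)) +ᶻ _ *ᶻ null DW +ᶻ _ *ᶻ null dilDV)

  -- This encodes the product U W: expand the square.
  TT : Null (κ (+ 12) ⊛ ((κ (+ 6) ⊛ V ⊕ ⊝ (κ (+ 4) ⊛ W) ⊕ ⊝ U) ⊛ (κ (+ 6) ⊛ V ⊕ ⊝ (κ (+ 4) ⊛ W) ⊕ ⊝ U))
   ⊕ ⊝ (κ (+ 5) ⊛ (κ (+ 18) ⊛ T3 ⊕ ⊝ (κ (+ 16) ⊛ R3) ⊕ ⊝ S)) ⊕ κ (+ 6) ⊛ (κ (+ 6) ⊛ dV ⊕ κ (- (+ 4)) ⊛ dW ⊕ κ (- 1#) ⊛ dU)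
   ⊕ ⊝ (κ (+ 6) ⊛ V ⊕ ⊝ (κ (+ 4) ⊛ W) ⊕ ⊝ U))
  TT = by (solve 6 (\ a s d t σ δ ->
    # 12 :* (a :* a) :- # 5 :* s :+ # 6 :* d :- a
    := con 1# :* (# 12 :* (t :* t) :- (# 5 :* σ :+ (con (- (+ 6)) :* δ :+ (con 1# :* t :+ con 0#))))
    :+ (con 1# :- # 12 :* (t :+ a)) :* (t :- a) :+ # 5 :* (σ :- s) :+ con (- (+ 6)) :* (δ :- d)) R.refl
    (κ (+ 6) ⊛ V ⊕ ⊝ (κ (+ 4) ⊛ W) ⊕ ⊝ U) (κ (+ 18) ⊛ T3 ⊕ ⊝ (κ (+ 16) ⊛ R3) ⊕ ⊝ S) (κ (+ 6) ⊛ dV ⊕ κ (- (+ 4)) ⊛ dW ⊕ κ (- 1#) ⊛ dU)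
    (tw U) (tw S) (tw dU))
   (_ *ᶻ null (lift (Tw.T-quadratic {+ 12} {U} {U} {lU} U²-lin)) +ᶻ _ *ᶻ null twU +ᶻ _ *ᶻ null twS +ᶻ _ *ᶻ null twDU)

 -- `P` will be Dθ/θ (see `Dθ`). `x` is entered through the divisor sum of Jacobi's four-square
 -- theorem and identified with θ⁴ only later; `y` is then θ(-q)⁴.
 P x y : Series
 P = ⊝ tw log-pbar
 x = κ 1# ⊕ κ (+ 8) ⊛ U ⊕ κ (- (+ 32)) ⊛ W
 y = tw x

 private
  odd-even : ∀ n -> odd01 n ≡ 1# - even01 n
  odd-even zero          = refl
  odd-even (suc zero)    = refl
  odd-even (suc (suc n)) = odd-even n

 tw-dil : ∀ f -> tw (dil f) ≐ dil f
 tw-dil f zero          = refl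
 tw-dil f (suc zero)    = refl
 tw-dil f (suc (suc n)) = Z.neg-involutive _ & tw-dil (tail f) n

 log-pbar≈ : log-pbar ≈ κ (+ 2) ⊛ U ⊕ κ (- (+ 2)) ⊛ V
 log-pbar≈ = lift (\ n -> lam-ext (\ d e -> cong (_*_ (+ 2 * + d)) (odd-even e) & l (+ d) (even01 e)) n &
  lam-+ _ _ n & cong2 _+_ (lam-* (+ 2) _ n & sym (term (+ 2) U n))
   (lam-* (- (+ 2)) _ n & cong (_*_ (- (+ 2))) (lam-even-e (\ d e -> + d) n) & sym (term (- (+ 2)) V n))) where
  l : ∀ d e -> + 2 * d * (1# - e) ≡ + 2 * d + - (+ 2) * (e * d)
  l = ring

 private
  tw-⊕≈ : ∀ f g -> tw (f ⊕ g) ≈ tw f ⊕ tw g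
  tw-⊕≈ f g = lift (tw-⊕ f g)

  tw-κ⊛≈ : ∀ k f -> tw (κ k ⊛ f) ≈ κ k ⊛ tw f
  tw-κ⊛≈ k f = lift (Tw.T-κ⊛ k f)

  tw-κ : ∀ k -> tw (κ k) ≐ κ k
  tw-κ k zero    = refl
  tw-κ k (suc n) = cong -_ (tw-cong {g = scale 0# (κ 0#)} (\ { zero -> refl ; (suc n) -> refl }) n & tw-scale 0# (κ 0#) n & Z.*-zeroˡ (tw (κ 0#) n)) & refl

 P≈ : P ≈ κ (+ 2) ⊛ U ⊕ κ (- (+ 10)) ⊛ V ⊕ κ (+ 8) ⊛ W
 P≈ = R.-‿cong (tw-≈ log-pbar≈ » tw-⊕≈ (κ (+ 2) ⊛ U) (κ (- (+ 2)) ⊛ V) » R.+-cong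
   (tw-κ⊛≈ (+ 2) U » R.*-cong R.refl twU) (tw-κ⊛≈ (- (+ 2)) V » R.*-cong R.refl (lift (tw-dil U)))) »
  solve 3 (\ u v w -> :- (# 2 :* (# 6 :* v :- # 4 :* w :- u) :+ con (- (+ 2)) :* v)
   := # 2 :* u :+ con (- (+ 10)) :* v :+ # 8 :* w) R.refl U V W
  where open Solver

 y≈ : y ≈ κ 1# ⊕ κ (+ 8) ⊛ (κ (+ 6) ⊛ V ⊕ ⊝ (κ (+ 4) ⊛ W) ⊕ ⊝ U) ⊕ κ (- (+ 32)) ⊛ W
 y≈ = tw-⊕≈ (κ 1# ⊕ κ (+ 8) ⊛ U) (κ (- (+ 32)) ⊛ W) » R.+-cong (tw-⊕≈ (κ 1#) (κ (+ 8) ⊛ U) » R.+-cong (lift (tw-κ 1#))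
  (tw-κ⊛≈ (+ 8) U » R.*-cong R.refl twU)) (tw-κ⊛≈ (- (+ 32)) W » R.*-cong R.refl (lift (tw-dil V)))

 ⊛-cancel≈ : ∀ k f -> k ≢ 0# -> Null (κ k ⊛ f) -> Null f
 ⊛-cancel≈ k f k≢0 e = lift (⊛-cancelˡ (κ k) f k≢0 (exact e))

 Dx≈ : D x ≈ κ (+ 8) ⊛ dU ⊕ κ (- (+ 32)) ⊛ dW
 Dx≈ = lift (D-⊕ (κ 1# ⊕ κ (+ 8) ⊛ U) (κ (- (+ 32)) ⊛ W)) » R.+-cong (lift (D-⊕ (κ 1#) (κ (+ 8) ⊛ U)) »
  R.+-cong (lift (D-κ 1#)) (lift (D-κ⊛ (+ 8) U)) » R.+-identityˡ _) (lift (D-κ⊛ (- (+ 32)) W))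

 DP≈ : D P ≈ κ (+ 2) ⊛ dU ⊕ κ (- (+ 10)) ⊛ dV ⊕ κ (+ 8) ⊛ dW
 DP≈ = D-≈ P≈ » D-lin2 (+ 2) U (- (+ 10)) V (+ 8) W

 -- The integer multipliers solve a linear system: they cancel every product of two of `U`, `V`,
 -- `W`, after which the linear terms agree. The factor 3 makes them integral. The same method gives
 -- `DP`, `E4` and `E4-4`.
 Dx : D x ≈ κ (+ 4) ⊛ (P ⊛ x)
 Dx = Dx≈ » unnull (⊛-cancel≈ (+ 3) _ (\ ()) (by (solve 9 (\ U V W S T R dU dV dW ->
   # 3 :* ((# 8 :* dU :+ con (- (+ 32)) :* dW) :- # 4 :* ((# 2 :* U :+ con (- (+ 10)) :* V :+ # 8 :* W) :* (con 1# :+ # 8 :* U :+ con (- (+ 32)) :* W)))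
   := con (- (+ 16)) :* (# 12 :* (U :* U) :- # 5 :* S :+ # 6 :* dU :- U)
   :+ # 20 :* (# 48 :* (U :* V) :- # 4 :* S :- # 16 :* T :+ # 6 :* dU :+ # 12 :* dV :- # 2 :* U :- # 2 :* V)
   :+ con (- (+ 80)) :* (# 48 :* (V :* W) :- # 4 :* T :- # 16 :* R :+ # 3 :* dV :+ # 6 :* dW :- # 2 :* V :- # 2 :* W)
   :+ # 128 :* (# 24 :* (W :* W) :- # 10 :* R :+ # 3 :* dW :- # 2 :* W)
   :+ # 0 :* (# 12 :* ((# 6 :* V :- # 4 :* W :- U) :* (# 6 :* V :- # 4 :* W :- U))
     :- # 5 :* (# 18 :* T :- # 16 :* R :- S) :+ # 6 :* (# 6 :* dV :+ con (- (+ 4)) :* dW :+ con (- 1#) :* dU) :- (# 6 :* V :- # 4 :* W :- U)))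
   R.refl U V W S T3 R3 dU dV dW)
   (_ *ᶻ UU +ᶻ _ *ᶻ UV +ᶻ _ *ᶻ VW +ᶻ _ *ᶻ WW +ᶻ _ *ᶻ TT))) »
  R.*-cong R.refl (R.*-cong (R.sym P≈) R.refl) where
  open Solver
  open Products

-- Eisenstein series as polynomials in x and y, and powers of θ.

module ThetaIdentities where
 open Differential public

 open Congruence 0
 open Ideal 0
 private module R = CommutativeRing seriesRing

 infixl 6 _⊖_
 _⊖_ : Series -> Series -> Series
 f ⊖ g = f ⊕ ⊝ g

 DP : κ (+ 8) ⊛ D P ≈ κ (+ 16) ⊛ (P ⊛ P) ⊕ x ⊛ y ⊖ y ⊛ y
 DP = R.*-cong R.refl DP≈ » unnull (⊛-cancel≈ (+ 3) _ (\ ()) (by (solve 9 (\ U V W S T R dU dV dW ->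
   # 3 :* (# 8 :* (# 2 :* dU :+ con (- (+ 10)) :* dV :+ # 8 :* dW) :- (# 16 :* ((# 2 :* U :+ con (- (+ 10)) :* V :+ # 8 :* W) :* (# 2 :* U :+ con (- (+ 10)) :* V :+ # 8 :* W))
    :+ (con 1# :+ # 8 :* U :+ con (- (+ 32)) :* W) :* (con 1# :+ # 8 :* (# 6 :* V :- # 4 :* W :- U) :+ con (- (+ 32)) :* W) :- (con 1# :+ # 8 :* (# 6 :* V :- # 4 :* W :- U) :+ con (- (+ 32)) :* W) :* (con 1# :+ # 8 :* (# 6 :* V :- # 4 :* W :- U) :+ con (- (+ 32)) :* W)))
   := con (- (+ 8)) :* (# 12 :* (U :* U) :- # 5 :* S :+ # 6 :* dU :- U)
   :+ # 40 :* (# 48 :* (U :* V) :- # 4 :* S :- # 16 :* T :+ # 6 :* dU :+ # 12 :* dV :- # 2 :* U :- # 2 :* V)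
   :+ con (- (+ 688)) :* (# 12 :* (V :* V) :- # 5 :* T :+ # 3 :* dV :- V)
   :+ # 160 :* (# 48 :* (V :* W) :- # 4 :* T :- # 16 :* R :+ # 3 :* dV :+ # 6 :* dW :- # 2 :* V :- # 2 :* W)
   :+ con (- (+ 64)) :* (# 24 :* (W :* W) :- # 10 :* R :+ # 3 :* dW :- # 2 :* W)
   :+ # 24 :* (# 12 :* ((# 6 :* V :- # 4 :* W :- U) :* (# 6 :* V :- # 4 :* W :- U)) :- # 5 :* (# 18 :* T :- # 16 :* R :- S) :+ # 6 :* (# 6 :* dV :+ con (- (+ 4)) :* dW :+ con (- 1#) :* dU) :- (# 6 :* V :- # 4 :* W :- U)))
   R.refl U V W S T3 R3 (D U) (D V) (D W))
   (_ *ᶻ UU +ᶻ _ *ᶻ UV +ᶻ _ *ᶻ VV +ᶻ _ *ᶻ VW +ᶻ _ *ᶻ WW +ᶻ _ *ᶻ TT))) »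
  R.+-cong (R.+-cong (R.*-cong (R.refl {κ (+ 16)}) (R.*-cong (R.sym P≈) (R.sym P≈))) (⊛-congˡ x (R.sym y≈))) (R.-‿cong (R.*-cong (R.sym y≈) (R.sym y≈))) where
  open Solver
  open Products

 E4 : κ 1# ⊕ κ (+ 240) ⊛ S ≈ κ (+ 16) ⊛ (x ⊛ x) ⊖ κ (+ 16) ⊛ (x ⊛ y) ⊕ y ⊛ y
 E4 = unnull (by (solve 9 (\ U V W S T R dU dV dW ->
   (con 1# :+ # 240 :* S) :- (# 16 :* ((con 1# :+ # 8 :* U :+ con (- (+ 32)) :* W) :* (con 1# :+ # 8 :* U :+ con (- (+ 32)) :* W))
    :- # 16 :* ((con 1# :+ # 8 :* U :+ con (- (+ 32)) :* W) :* (con 1# :+ # 8 :* (# 6 :* V :- # 4 :* W :- U) :+ con (- (+ 32)) :* W)) :+ (con 1# :+ # 8 :* (# 6 :* V :- # 4 :* W :- U) :+ con (- (+ 32)) :* W) :* (con 1# :+ # 8 :* (# 6 :* V :- # 4 :* W :- U) :+ con (- (+ 32)) :* W))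
   := con (- (+ 208)) :* (# 12 :* (U :* U) :- # 5 :* S :+ # 6 :* dU :- U)
   :+ # 240 :* (# 48 :* (U :* V) :- # 4 :* S :- # 16 :* T :+ # 6 :* dU :+ # 12 :* dV :- # 2 :* U :- # 2 :* V)
   :+ con (- (+ 1344)) :* (# 12 :* (V :* V) :- # 5 :* T :+ # 3 :* dV :- V)
   :+ # 256 :* (# 24 :* (W :* W) :- # 10 :* R :+ # 3 :* dW :- # 2 :* W)
   :+ # 32 :* (# 12 :* ((# 6 :* V :- # 4 :* W :- U) :* (# 6 :* V :- # 4 :* W :- U)) :- # 5 :* (# 18 :* T :- # 16 :* R :- S) :+ # 6 :* (# 6 :* dV :+ con (- (+ 4)) :* dW :+ con (- 1#) :* dU) :- (# 6 :* V :- # 4 :* W :- U)))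
   R.refl U V W S T3 R3 (D U) (D V) (D W))
   (_ *ᶻ UU +ᶻ _ *ᶻ UV +ᶻ _ *ᶻ VV +ᶻ _ *ᶻ WW +ᶻ _ *ᶻ TT)) »
  R.+-cong (R.+-cong (R.refl {κ (+ 16) ⊛ (x ⊛ x)}) (R.-‿cong (R.*-cong (R.refl {κ (+ 16)}) (⊛-congˡ x (R.sym y≈))))) (R.*-cong (R.sym y≈) (R.sym y≈)) where
  open Solver
  open Products

 E4-4 : κ (+ 16) ⊛ (κ 1# ⊕ κ (+ 240) ⊛ R3) ≈ x ⊛ x ⊕ κ (+ 14) ⊛ (x ⊛ y) ⊕ y ⊛ y
 E4-4 = unnull (by (solve 9 (\ U V W S T R dU dV dW ->
   # 16 :* (con 1# :+ # 240 :* R) :- ((con 1# :+ # 8 :* U :+ con (- (+ 32)) :* W) :* (con 1# :+ # 8 :* U :+ con (- (+ 32)) :* W)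
    :+ # 14 :* ((con 1# :+ # 8 :* U :+ con (- (+ 32)) :* W) :* (con 1# :+ # 8 :* (# 6 :* V :- # 4 :* W :- U) :+ con (- (+ 32)) :* W)) :+ (con 1# :+ # 8 :* (# 6 :* V :- # 4 :* W :- U) :+ con (- (+ 32)) :* W) :* (con 1# :+ # 8 :* (# 6 :* V :- # 4 :* W :- U) :+ con (- (+ 32)) :* W))
   := # 32 :* (# 12 :* (U :* U) :- # 5 :* S :+ # 6 :* dU :- U)
   :+ con (- (+ 1344)) :* (# 12 :* (V :* V) :- # 5 :* T :+ # 3 :* dV :- V)
   :+ # 960 :* (# 48 :* (V :* W) :- # 4 :* T :- # 16 :* R :+ # 3 :* dV :+ # 6 :* dW :- # 2 :* V :- # 2 :* W)
   :+ con (- (+ 1664)) :* (# 24 :* (W :* W) :- # 10 :* R :+ # 3 :* dW :- # 2 :* W)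
   :+ # 32 :* (# 12 :* ((# 6 :* V :- # 4 :* W :- U) :* (# 6 :* V :- # 4 :* W :- U)) :- # 5 :* (# 18 :* T :- # 16 :* R :- S) :+ # 6 :* (# 6 :* dV :+ con (- (+ 4)) :* dW :+ con (- 1#) :* dU) :- (# 6 :* V :- # 4 :* W :- U)))
   R.refl U V W S T3 R3 (D U) (D V) (D W))
   (_ *ᶻ UU +ᶻ _ *ᶻ VV +ᶻ _ *ᶻ VW +ᶻ _ *ᶻ WW +ᶻ _ *ᶻ TT)) »
  R.+-cong (R.+-cong (R.refl {x ⊛ x}) (R.*-cong (R.refl {κ (+ 14)}) (⊛-congˡ x (R.sym y≈)))) (R.*-cong (R.sym y≈) (R.sym y≈)) where
  open Solver
  open Products

 -- 24U - 1 is -E₂, which is not modular. A multiple of `P` cancels its anomaly and leaves a linear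
 -- form in `x` and `y`. In `E2-4`, at q⁴, the multiple is a quarter of this one.
 E2 : κ (+ 24) ⊛ U ⊕ κ (- 1#) ⊕ κ (+ 24) ⊛ P ≈ κ (+ 4) ⊛ x ⊖ κ (+ 5) ⊛ y
 E2 = R.+-cong (R.refl {κ (+ 24) ⊛ U ⊕ κ (- 1#)}) (R.*-cong (R.refl {κ (+ 24)}) P≈) » solve 3 (\ U V W ->
   # 24 :* U :+ con (- 1#) :+ # 24 :* (# 2 :* U :+ con (- (+ 10)) :* V :+ # 8 :* W) := # 4 :* (con 1# :+ # 8 :* U :+ con (- (+ 32)) :* W) :- # 5 :* (con 1# :+ # 8 :* (# 6 :* V :- # 4 :* W :- U) :+ con (- (+ 32)) :* W)) R.refl U V W »
  R.+-cong (R.refl {κ (+ 4) ⊛ x}) (R.-‿cong (R.*-cong (R.refl {κ (+ 5)}) (R.sym y≈)))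
  where open Solver

 E2-4 : κ (+ 4) ⊛ (κ (+ 24) ⊛ W ⊕ κ (- 1#) ⊕ κ (+ 6) ⊛ P) ≈ x ⊖ κ (+ 5) ⊛ y
 E2-4 = R.*-cong (R.refl {κ (+ 4)}) (R.+-cong (R.refl {κ (+ 24) ⊛ W ⊕ κ (- 1#)}) (R.*-cong (R.refl {κ (+ 6)}) P≈)) » solve 3 (\ U V W ->
   # 4 :* (# 24 :* W :+ con (- 1#) :+ # 6 :* (# 2 :* U :+ con (- (+ 10)) :* V :+ # 8 :* W)) := (con 1# :+ # 8 :* U :+ con (- (+ 32)) :* W) :- # 5 :* (con 1# :+ # 8 :* (# 6 :* V :- # 4 :* W :- U) :+ con (- (+ 32)) :* W)) R.refl U V W »
  R.+-cong (R.refl {x}) (R.-‿cong (R.*-cong (R.refl {κ (+ 5)}) (R.sym y≈)))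
  where open Solver

 twP : κ (+ 4) ⊛ tw P ≈ κ (+ 4) ⊛ P ⊖ x ⊕ y
 twP = R.*-cong (R.refl {κ (+ 4)}) (tw-≈ P≈ » lift (tw-⊕ (κ (+ 2) ⊛ U ⊕ κ (- (+ 10)) ⊛ V) (κ (+ 8) ⊛ W)) »
   R.+-cong (lift (tw-⊕ (κ (+ 2) ⊛ U) (κ (- (+ 10)) ⊛ V)) » R.+-cong (lift (Tw.T-κ⊛ (+ 2) U) » R.*-cong (R.refl {κ (+ 2)}) twU)
    (lift (Tw.T-κ⊛ (- (+ 10)) V) » R.*-cong (R.refl {κ (- (+ 10))}) (lift (tw-dil U)))) (lift (Tw.T-κ⊛ (+ 8) W) » R.*-cong (R.refl {κ (+ 8)}) (lift (tw-dil V)))) »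
  solve 3 (\ U V W ->
   # 4 :* (# 2 :* (# 6 :* V :- # 4 :* W :- U) :+ con (- (+ 10)) :* V :+ # 8 :* W)
   := # 4 :* (# 2 :* U :+ con (- (+ 10)) :* V :+ # 8 :* W) :- (con 1# :+ # 8 :* U :+ con (- (+ 32)) :* W) :+ (con 1# :+ # 8 :* (# 6 :* V :- # 4 :* W :- U) :+ con (- (+ 32)) :* W)) R.refl U V W »
  R.+-cong (R.+-cong (R.*-cong (R.refl {κ (+ 4)}) (R.sym P≈)) (R.refl {⊝ x})) (R.sym y≈)
  where open Solver

 Dy : D y ≈ y ⊛ (κ (+ 4) ⊛ P ⊖ x ⊕ y)
 Dy = R.sym (lift (tw-D x)) » tw-≈ Dx » lift (Tw.T-κ⊛ (+ 4) (P ⊛ x)) » R.*-cong (R.refl {κ (+ 4)}) (lift (tw-⊛ P x)) »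
  solve 2 (\ p y -> # 4 :* (p :* y) := y :* (# 4 :* p)) R.refl (tw P) y » (⊛-congˡ y twP)
  where open Solver

 -- The equation of φ counted in `ThetaODE`, carried over by q ↦ -q.
 Dθ : D θ ≈ P ⊛ θ
 Dθ = D-≈ (R.sym θ-tw) » lift (\ n -> sym (tw-D φ n)) » tw-≈ (lift Dφ) » lift (tw-⊛ (⊝ log-pbar) φ) »
  R.*-cong (lift (\ n -> tw-cong (\ k -> sym (Z.-1*i≡-i (log-pbar k))) n & (tw-scale -[1+ 0 ] log-pbar n) & Z.-1*i≡-i (tw log-pbar n))) θ-tw where
  θ-tw : tw φ ≈ θ
  θ-tw = lift (\ n -> tw-cong (\ k -> sym (tw-θ k)) n & tw-tw θ n)
  Dφ : D φ ≐ ⊝ log-pbar ⊛ φ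
  Dφ n = ThetaODE.D-φ n & sym (Z.-1*i≡-i _) & sym (scale-⊛ -[1+ 0 ] log-pbar φ n) &
   (⊛-cong≐ (\ k -> Z.-1*i≡-i (log-pbar k)) (\ _ -> refl) n)

 sqrt-0 : ∀ s -> s * s ≡ 0# -> s ≡ 0#
 sqrt-0 (+ zero) _ = refl

 θ0 : θ 0 ≡ 1#
 θ0 = ∑-single (sqrts 0) 0# refl sqrt-0

 φ0 : φ 0 ≡ 1#
 φ0 = ∑-single (sqrts 0) 0# refl sqrt-0

 pbar0 : pbar 0 ≡ 1#
 pbar0 = refl

 log-pbar0 : log-pbar 0 ≡ 0#
 log-pbar0 = ∑-empty (divs 0) (\ { (suc d , suc e) (_ , _ , ()) ; (zero , e) (() , _) ; (suc d , zero) (_ , () , _) })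

 Q : Series
 Q = tw pbar

 -- Gauss's identity: the logarithmic derivatives of the two factors cancel, so the product is
 -- constant.
 φ-pbar : φ ⊛ pbar ≐ κ 1#
 φ-pbar = D-unique (φ ⊛ pbar) (κ 1#) (κ 0#) refl vanish
   (\ n -> D-κ 1# n & sym (0-⊛ (κ 1#) (\ { zero -> refl ; (suc n) -> refl }) n ⟨≡⟩ κ0 n))
   (cong2 _*_ φ0 pbar0) where
  _⟨≡⟩_ : ∀ {x n} -> x ≡ 0# -> n ≡ 0# -> x ≡ n
  p ⟨≡⟩ q = p & sym q
  κ0 : ∀ n -> κ 0# n ≡ 0#
  κ0 zero    = refl
  κ0 (suc n) = refl
  vanish : D (φ ⊛ pbar) ≐ κ 0# ⊛ (φ ⊛ pbar)
  vanish = exact (lift (D-⊛ φ pbar) » R.+-cong (R.*-cong (lift (\ n -> ThetaODE.D-φ n)) R.refl) (R.*-cong R.refl (lift D-pbar)) »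
   solve 3 (\ l f p -> (:- (l :* f)) :* p :+ f :* (l :* p) := con 0# :* (f :* p)) R.refl log-pbar φ pbar)
   where open Solver

 θ-Q : θ ⊛ Q ≐ κ 1#
 θ-Q n = (⊛-cong≐ {g = Q} (\ k -> sym (tw-cong (\ i -> sym (tw-θ i)) k & tw-tw θ k)) (\ _ -> refl) n) &
  sym (tw-⊛ φ pbar n) & tw-cong φ-pbar n & tw-1 n where
  tw-1 : ∀ n -> tw (κ 1#) n ≡ κ 1# n
  tw-1 zero    = refl
  tw-1 (suc n) = cong -_ (tw-sgn (\ _ -> 0#) n & Z.*-zeroʳ (sgn n))

 P0 : P 0 ≡ 0#
 P0 = cong -_ log-pbar0

 x0 : x 0 ≡ 1#
 x0 = cong (\ z -> 1# + + 8 * z + - (+ 32) * z) (∑-empty (divs 0) (\ { (suc d , suc e) (_ , _ , ()) ; (zero , e) (() , _) ; (suc d , zero) (_ , () , _) }))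

 -- Both sides solve DF = 4PF with constant term 1.
 θ⁴ : (θ ⊛ θ) ⊛ (θ ⊛ θ) ≈ x
 θ⁴ = lift (D-unique ((θ ⊛ θ) ⊛ (θ ⊛ θ)) x (κ (+ 4) ⊛ P) (cong (_*_ (+ 4)) P0 & refl) (exact der)
   (exact (Dx » R.sym (R.*-assoc (κ (+ 4)) P x))) (cong (\ z -> z * z * (z * z)) θ0 & sym x0)) where
  open Solver
  Dθ² : D (θ ⊛ θ) ≈ κ (+ 2) ⊛ (P ⊛ (θ ⊛ θ))
  Dθ² = lift (D-⊛ θ θ) » R.+-cong (R.*-cong Dθ R.refl) (R.*-cong R.refl Dθ) »
   solve 2 (\ p t -> (p :* t) :* t :+ t :* (p :* t) := # 2 :* (p :* (t :* t))) R.refl P θ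
  der : D ((θ ⊛ θ) ⊛ (θ ⊛ θ)) ≈ (κ (+ 4) ⊛ P) ⊛ ((θ ⊛ θ) ⊛ (θ ⊛ θ))
  der = lift (D-⊛ (θ ⊛ θ) (θ ⊛ θ)) » R.+-cong (R.*-cong Dθ² R.refl) (R.*-cong R.refl Dθ²) »
   solve 2 (\ p t -> (# 2 :* (p :* t)) :* t :+ t :* (# 2 :* (p :* t)) := (# 4 :* p) :* (t :* t)) R.refl P (θ ⊛ θ)

 -- By `X²` the right side has the square `x`, as has θ². Their sum has constant term 2 and is no
 -- zero divisor, so their difference vanishes.
 θ² : θ ⊛ θ ≈ κ 1# ⊕ κ (+ 4) ⊛ X
 θ² = R.sym (unnull (lift (⊛-cancelˡ (κ 1# ⊕ κ (+ 4) ⊛ X ⊕ θ ⊛ θ) _ nz (exact (by (solve 4 (\ X t U W ->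
    (con 1# :+ # 4 :* X :+ t) :* ((con 1# :+ # 4 :* X) :- t)
    := # 8 :* (# 2 :* (X :* X) :- (U :- X :- # 4 :* W)) :+ con (- 1#) :* (t :* t :- (con 1# :+ # 8 :* U :+ con (- (+ 32)) :* W))) R.refl X (θ ⊛ θ) U W)
   (_ *ᶻ null X²≈ +ᶻ _ *ᶻ null θ⁴)))))) where
  open Solver
  X²≈ : κ (+ 2) ⊛ (X ⊛ X) ≈ U ⊖ X ⊖ κ (+ 4) ⊛ W
  X²≈ = lift (\ n -> κ-⊛ (+ 2) (X ⊛ X) n & X² n & cong (\ z -> U n - X n - z) (sym (κ-⊛ (+ 4) W n)))
  nz : (κ 1# ⊕ κ (+ 4) ⊛ X ⊕ θ ⊛ θ) 0 ≢ 0#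
  nz e with trans (sym (cong2 (\ a b -> 1# + + 4 * a + b * b) (∑-empty (divs 0) (\ { (suc d , suc e) (_ , _ , ()) ; (zero , e) (() , _) ; (suc d , zero) (_ , () , _) })) θ0)) e
  ... | ()

-- Polynomials in P, x, y modulo m with a derivation.

module ModularPolynomials where
 open ThetaIdentities public
 open import Data.Nat using (_≡ᵇ_; _<ᵇ_)
 open import Data.Bool using (Bool; true; false; if_then_else_; _∧_; T)
 open import Data.List using (List; []; _∷_; map; foldr)
 open import Data.Unit using (tt)
 open import Relation.Binary.PropositionalEquality using ([_])

 pow : Series -> ℕ -> Series
 pow f zero    = κ 1#
 pow f (suc n) = f ⊛ pow f n

 Exponent : Set
 Exponent = ℕ × ℕ × ℕ

 -- Polynomials in P, x, y over ℤ/m, as sorted lists of coefficients and exponents.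
 Poly : Set
 Poly = List (ℕ × Exponent)

 same before : Exponent -> Exponent -> Bool
 same (a , b , c) (a' , b' , c') = (a ≡ᵇ a') ∧ (b ≡ᵇ b') ∧ (c ≡ᵇ c')
 before (a , b , c) (a' , b' , c') =
  if a ≡ᵇ a' then (if b ≡ᵇ b' then c <ᵇ c' else b <ᵇ b') else a <ᵇ a'

 same⇒≡ : ∀ e e' -> T (same e e') -> e ≡ e'
 same⇒≡ (a , b , c) (a' , b' , c') t with a ≡ᵇ a' in p | b ≡ᵇ b' in q | c ≡ᵇ c' in r
 ... | true | true | true = cong2 _,_ (N.≡ᵇ⇒≡ a a' (subst T (sym p) tt))
  (cong2 _,_ (N.≡ᵇ⇒≡ b b' (subst T (sym q) tt)) (N.≡ᵇ⇒≡ c c' (subst T (sym r) tt)))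

 module Polynomials (m : ℕ) {{_ : N.NonZero m}} where

  push : ℕ -> Exponent -> Poly -> Poly
  push c e p = if c ≡ᵇ 0 then p else (c , e) ∷ p

  -- Like terms are merged, coefficients reduced and zeros dropped. Polynomial identities modulo m
  -- thus become equalities of lists, which `refl` can decide.
  insert : ℕ × Exponent -> Poly -> Poly
  insert (c , e) [] = push (c % m) e []
  insert (c , e) ((c' , e') ∷ p) =
   if same e e' then push ((c N.+ c') % m) e' p
   else if before e e' then push (c % m) e ((c' , e') ∷ p)
   else (c' , e') ∷ insert (c , e) p

  mul1 : ℕ × Exponent -> ℕ × Exponent -> ℕ × Exponent
  mul1 (c , a , b , d) (c' , a' , b' , d') = c N.* c' , a N.+ a' , b N.+ b' , d N.+ d'

  add mul : Poly -> Poly -> Poly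
  add p q = foldr insert q p
  mul [] q      = []
  mul (t ∷ p) q = add (map (mul1 t) q) (mul p q)

  -- Coefficients are natural numbers, so m - 1 stands for -1; the same convention is used in
  -- `Coefficients` and in the certificates.
  neg : Poly -> Poly
  neg p = mul ((N.pred m , 0 , 0 , 0) ∷ []) p

  power : Poly -> ℕ -> Poly
  power p zero    = (1 , 0 , 0 , 0) ∷ []
  power p (suc n) = mul p (power p n)

  -- The derivation with P ↦ A, x ↦ x B, y ↦ y C.
  derive : (A B C : Poly) -> Poly -> Poly
  derive A B C [] = []
  derive A B C ((c , a , b , d) ∷ p) =
   add (mul ((c N.* a , N.pred a , b , d) ∷ []) A)
   (add (mul ((c N.* b , a , b , d) ∷ []) B)
   (add (mul ((c N.* d , a , b , d) ∷ []) C) (derive A B C p)))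

  -- The polynomial Dⁿf / f for a series `f` with logarithmic derivative `r`; see `ev-iterate`.
  iterate : (A B C r : Poly) -> ℕ -> Poly
  iterate A B C r zero    = (1 , 0 , 0 , 0) ∷ []
  iterate A B C r (suc n) = add (derive A B C (iterate A B C r n)) (mul r (iterate A B C r n))

  open Congruence m
  open Ideal m
  module R = CommutativeRing seriesRing
  open Solver

  κ-cong : ∀ {a b} -> Cong m a b -> κ a ≈ κ b
  κ-cong e = mk≈ (\ { zero -> e ; (suc n) -> ≡C refl })

  κ-+ : ∀ a b -> κ (a + b) ≈ κ a ⊕ κ b
  κ-+ a b = lift (\ { zero -> refl ; (suc n) -> refl })

  κ-* : ∀ a b -> κ (a * b) ≈ κ a ⊛ κ b
  κ-* a b = lift (\ { zero -> refl ; (suc n) -> sym (κ-⊛ a (κ b) (suc n) & Z.*-zeroʳ a) })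

  κ-pos-* : ∀ a b -> κ (+ (a N.* b)) ≈ κ (+ a) ⊛ κ (+ b)
  κ-pos-* a b = lift (\ n -> cong (\ z -> κ z n) (Z.pos-* a b)) » κ-* (+ a) (+ b)

  κ-% : ∀ a -> κ (+ (a % m)) ≈ κ (+ a)
  κ-% a = κ-cong (cong-by (- (+ (a / m))) (cong (\ z -> + (a % m) - z) (cong +_ (m≡m%n+[m/n]*n a m) & Z.pos-+ (a % m) _ & cong (_+_ (+ (a % m))) (Z.pos-* (a / m) m)) &
   l (+ (a % m)) (+ (a / m)) (+ m))) where
   l : ∀ r q m -> r - (r + q * m) ≡ (- q) * m
   l = ring

  pow-+ : ∀ f a b -> pow f (a N.+ b) ≈ pow f a ⊛ pow f b
  pow-+ f zero    b = R.sym (R.*-identityˡ (pow f b))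
  pow-+ f (suc a) b = (⊛-congˡ f (pow-+ f a b)) » R.sym (R.*-assoc f (pow f a) (pow f b))

  pow-⊛ : ∀ f g n -> pow (f ⊛ g) n ≈ pow f n ⊛ pow g n
  pow-⊛ f g zero    = R.sym (R.*-identityˡ (κ 1#))
  pow-⊛ f g (suc n) = R.*-cong (R.refl {f ⊛ g}) (pow-⊛ f g n) »
   solve 4 (\ f g p q -> (f :* g) :* (p :* q) := (f :* p) :* (g :* q)) R.refl f g (pow f n) (pow g n)

  pow-cong : ∀ {f g} n -> f ≈ g -> pow f n ≈ pow g n
  pow-cong zero    e = R.refl {κ 1#}
  pow-cong (suc n) e = R.*-cong e (pow-cong n e)

  monomial : Exponent -> Series
  monomial (a , b , d) = pow P a ⊛ (pow x b ⊛ pow y d)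

  ev1 : ℕ × Exponent -> Series
  ev1 (c , e) = κ (+ c) ⊛ monomial e

  ev : Poly -> Series
  ev []      = κ 0#
  ev (t ∷ p) = ev1 t ⊕ ev p

  ev-push : ∀ c e p -> ev (push c e p) ≈ ev1 (c , e) ⊕ ev p
  ev-push zero    e p = solve 2 (\ f g -> g := con 0# :* f :+ g) R.refl (monomial e) (ev p)
  ev-push (suc c) e p = R.refl {ev1 (suc c , e) ⊕ ev p}

  ev-insert : ∀ t p -> ev (insert t p) ≈ ev1 t ⊕ ev p
  ev-insert (c , e) [] = (ev-push (c % m) e []) » R.+-cong (R.*-cong (κ-% c) (R.refl {monomial e})) (R.refl {κ 0#})
  ev-insert (c , e) ((c' , e') ∷ p) with same e e' in s
  ... | true with same⇒≡ e e' (subst T (sym s) tt)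
  ... | refl = ev-push ((c N.+ c') % m) e p » R.+-cong (R.*-cong (κ-% (c N.+ c') »
    lift (\ n -> cong (\ z -> κ z n) (Z.pos-+ c c')) » κ-+ (+ c) (+ c')) (R.refl {monomial e})) (R.refl {ev p}) »
   solve 4 (\ c d f g -> (c :+ d) :* f :+ g := c :* f :+ (d :* f :+ g)) R.refl (κ (+ c)) (κ (+ c')) (monomial e) (ev p)
  ev-insert (c , e) ((c' , e') ∷ p) | false with before e e'
  ... | true  = ev-push (c % m) e ((c' , e') ∷ p) » R.+-cong (R.*-cong (κ-% c) (R.refl {monomial e})) (R.refl {ev ((c' , e') ∷ p)})
  ... | false = R.+-cong (R.refl {ev1 (c' , e')}) (ev-insert (c , e) p) »
   solve 3 (\ a b c -> a :+ (b :+ c) := b :+ (a :+ c)) R.refl (ev1 (c' , e')) (ev1 (c , e)) (ev p)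

  ev-add : ∀ p q -> ev (add p q) ≈ ev p ⊕ ev q
  ev-add []      q = R.sym (R.+-identityˡ (ev q))
  ev-add (t ∷ p) q = ev-insert t (add p q) » R.+-cong (R.refl {ev1 t}) (ev-add p q) » R.sym (R.+-assoc (ev1 t) (ev p) (ev q))

  ev-mul1 : ∀ s t -> ev1 (mul1 s t) ≈ ev1 s ⊛ ev1 t
  ev-mul1 (c , a , b , d) (c' , a' , b' , d') = R.*-cong (κ-pos-* c c') (R.*-cong (pow-+ P a a') (R.*-cong (pow-+ x b b') (pow-+ y d d'))) »
   solve 8 (\ c c' p p' q q' r r' -> (c :* c') :* ((p :* p') :* ((q :* q') :* (r :* r'))) := (c :* (p :* (q :* r))) :* (c' :* (p' :* (q' :* r'))))
    R.refl (κ (+ c)) (κ (+ c')) (pow P a) (pow P a') (pow x b) (pow x b') (pow y d) (pow y d')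

  ev-map : ∀ t q -> ev (map (mul1 t) q) ≈ ev1 t ⊛ ev q
  ev-map t []      = R.sym (R.zeroʳ (ev1 t))
  ev-map t (s ∷ q) = R.+-cong (ev-mul1 t s) (ev-map t q) » R.sym (R.distribˡ (ev1 t) (ev1 s) (ev q))

  ev-mul : ∀ p q -> ev (mul p q) ≈ ev p ⊛ ev q
  ev-mul [] q      = R.sym (R.zeroˡ (ev q))
  ev-mul (t ∷ p) q = ev-add (map (mul1 t) q) (mul p q) » R.+-cong (ev-map t q) (ev-mul p q) » R.sym (R.distribʳ (ev q) (ev1 t) (ev p))

  ev-one : ev ((1 , 0 , 0 , 0) ∷ []) ≈ κ 1#
  ev-one = solve 0 (con 1# :* (con 1# :* (con 1# :* con 1#)) :+ con 0# := con 1#) R.refl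

  κm≈0 : κ (+ m) ≈ κ 0#
  κm≈0 = κ-cong (cong-by 1# (Z.+-identityʳ (+ m) & sym (Z.*-identityˡ (+ m))))

  κ-pred : κ (+ N.pred m) ≈ ⊝ κ 1#
  κ-pred = solve 1 (\ k -> k := (con 1# :+ k) :- con 1#) R.refl (κ (+ N.pred m)) »
    R.+-cong (R.sym (κ-+ 1# (+ N.pred m)) » lift (\ n -> cong (\ z -> κ z n) (sym (Z.pos-+ 1 (N.pred m)) & cong +_ (N.suc-pred m))) » κm≈0) (R.refl {⊝ κ 1#}) »
     R.+-identityˡ (⊝ κ 1#)

  ev-neg : ∀ p -> ev (neg p) ≈ ⊝ ev p
  ev-neg p = ev-mul ((N.pred m , 0 , 0 , 0) ∷ []) p » R.*-cong minus (R.refl {ev p}) »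
   solve 1 (\ f -> (:- con 1#) :* f := :- f) R.refl (ev p) where
   minus : ev ((N.pred m , 0 , 0 , 0) ∷ []) ≈ ⊝ κ 1#
   minus = solve 1 (\ k -> k :* (con 1# :* (con 1# :* con 1#)) :+ con 0# := k) R.refl (κ (+ N.pred m)) » κ-pred

  ev-power : ∀ p n -> ev (power p n) ≈ pow (ev p) n
  ev-power p zero    = ev-one
  ev-power p (suc n) = ev-mul p (power p n) » R.*-cong (R.refl {ev p}) (ev-power p n)

  D-≈ₘ : ∀ {f g} -> f ≈ g -> D f ≈ D g
  D-≈ₘ {f} {g} e = mk≈ (\ n -> Cong-* (≡C {+ n} refl) (coeff e n))

  D-product-rule : ∀ f g -> D (f ⊛ g) ≈ D f ⊛ g ⊕ f ⊛ D g
  D-product-rule f g = lift (D-⊛ f g)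

  D-pow : ∀ f n -> D (pow f n) ≈ κ (+ n) ⊛ (pow f (N.pred n) ⊛ D f)
  D-pow f zero = lift (D-κ 1#) » solve 1 (\ g -> con 0# := con 0# :* g) R.refl (pow f 0 ⊛ D f)
  D-pow f (suc zero) = D-product-rule f (κ 1#) » R.+-cong (R.refl {D f ⊛ κ 1#}) (⊛-congˡ f (lift (D-κ 1#))) »
   solve 2 (\ f d -> d :* con 1# :+ f :* con 0# := con 1# :* (con 1# :* d)) R.refl f (D f)
  D-pow f (suc (suc n)) = D-product-rule f (pow f (suc n)) » R.+-cong (R.refl {D f ⊛ pow f (suc n)}) (⊛-congˡ f (D-pow f (suc n))) »
   solve 4 (\ f d p k -> d :* (f :* p) :+ f :* (k :* (p :* d)) := (con 1# :+ k) :* ((f :* p) :* d)) R.refl f (D f) (pow f n) (κ (+ suc n)) »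
    R.*-cong (R.sym (κ-+ 1# (+ suc n)) » lift (\ k -> cong (\ z -> κ z k) (sym (Z.pos-+ 1 (suc n))))) (R.refl {(f ⊛ pow f n) ⊛ D f})

  pow-pred : ∀ f n -> κ (+ n) ⊛ (pow f (N.pred n) ⊛ f) ≈ κ (+ n) ⊛ pow f n
  pow-pred f zero    = solve 2 (\ a b -> con 0# :* a := con 0# :* b) R.refl (pow f 0 ⊛ f) (pow f 0)
  pow-pred f (suc n) = R.*-cong (R.refl {κ (+ suc n)}) (R.*-comm (pow f n) f)

  module Derivation (A B C : Poly) (hA : D P ≈ ev A) (hB : D x ≈ x ⊛ ev B) (hC : D y ≈ y ⊛ ev C) where
   ev-derive : ∀ p -> ev (derive A B C p) ≈ D (ev p)
   ev-derive [] = R.sym (lift (D-κ 0#))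
   ev-derive ((c , a , b , d) ∷ p) = ev-add (mul t1 A) _ » R.+-cong (ev-mul t1 A » R.*-cong (single' (c N.* a) (N.pred a , b , d)) (R.refl {ev A}))
     (ev-add (mul t2 B) _ » R.+-cong (ev-mul t2 B » R.*-cong (single' (c N.* b) (a , b , d)) (R.refl {ev B}))
     (ev-add (mul t3 C) _ » R.+-cong (ev-mul t3 C » R.*-cong (single' (c N.* d) (a , b , d)) (R.refl {ev C})) (ev-derive p))) »
    R.sym regroup » R.sym (lift (D-⊕ (ev1 (c , a , b , d)) (ev p))) where
    t1 = (c N.* a , N.pred a , b , d) ∷ []
    t2 = (c N.* b , a , b , d) ∷ []
    t3 = (c N.* d , a , b , d) ∷ []
    single' : ∀ k e -> ev ((k , e) ∷ []) ≈ κ (+ k) ⊛ monomial e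
    single' k e = R.+-identityʳ (κ (+ k) ⊛ monomial e)
    k = κ (+ c)
    p1 = pow P a
    p2 = pow x b
    p3 = pow y d
    D1 : D p1 ≈ κ (+ a) ⊛ (pow P (N.pred a) ⊛ ev A)
    D1 = D-pow P a » R.*-cong (R.refl {κ (+ a)}) (R.*-cong (R.refl {pow P (N.pred a)}) hA)
    D-log : ∀ f n g -> D f ≈ f ⊛ g -> D (pow f n) ≈ (κ (+ n) ⊛ pow f n) ⊛ g
    D-log f n g h = D-pow f n » R.*-cong (R.refl {κ (+ n)}) (R.*-cong (R.refl {pow f (N.pred n)}) h) »
     solve 4 (\ k p f g -> k :* (p :* (f :* g)) := (k :* (p :* f)) :* g) R.refl (κ (+ n)) (pow f (N.pred n)) f g »
      R.*-cong (pow-pred f n) (R.refl {g})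
    D-mono : D (monomial (a , b , d)) ≈ D p1 ⊛ (p2 ⊛ p3) ⊕ p1 ⊛ (D p2 ⊛ p3 ⊕ p2 ⊛ D p3)
    D-mono = D-product-rule p1 (p2 ⊛ p3) » R.+-cong (R.refl {D p1 ⊛ (p2 ⊛ p3)}) (⊛-congˡ p1 (D-product-rule p2 p3))
    D-term : D (ev1 (c , a , b , d)) ≈ k ⊛ D (monomial (a , b , d))
    D-term = lift (D-κ⊛ (+ c) (monomial (a , b , d)))
    expand : D (ev1 (c , a , b , d)) ≈ (κ (+ (c N.* a)) ⊛ (pow P (N.pred a) ⊛ (p2 ⊛ p3))) ⊛ ev A
     ⊕ ((κ (+ (c N.* b)) ⊛ monomial (a , b , d)) ⊛ ev B ⊕ (κ (+ (c N.* d)) ⊛ monomial (a , b , d)) ⊛ ev C)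
    expand = D-term » (⊛-congˡ k (D-mono » R.+-cong (R.*-cong D1 (R.refl {p2 ⊛ p3}))
      (⊛-congˡ p1 (R.+-cong (R.*-cong (D-log x b (ev B) hB) (R.refl {p3})) (⊛-congˡ p2 (D-log y d (ev C) hC)))))) »
     solve 11 (\ k a b d p0 p1 p2 p3 A B C -> k :* ((a :* (p0 :* A)) :* (p2 :* p3) :+ p1 :* (((b :* p2) :* B) :* p3 :+ p2 :* ((d :* p3) :* C)))
      := ((k :* a) :* (p0 :* (p2 :* p3))) :* A :+ (((k :* b) :* (p1 :* (p2 :* p3))) :* B :+ ((k :* d) :* (p1 :* (p2 :* p3))) :* C)) R.refl
       k (κ (+ a)) (κ (+ b)) (κ (+ d)) (pow P (N.pred a)) p1 p2 p3 (ev A) (ev B) (ev C) »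
     R.+-cong (R.*-cong (R.*-cong (R.sym (κ-pos-* c a)) (R.refl {pow P (N.pred a) ⊛ (p2 ⊛ p3)})) (R.refl {ev A}))
      (R.+-cong (R.*-cong (R.*-cong (R.sym (κ-pos-* c b)) (R.refl {monomial (a , b , d)})) (R.refl {ev B}))
       (R.*-cong (R.*-cong (R.sym (κ-pos-* c d)) (R.refl {monomial (a , b , d)})) (R.refl {ev C}))) 
    regroup : D (ev1 (c , a , b , d)) ⊕ D (ev p) ≈ (κ (+ (c N.* a)) ⊛ (pow P (N.pred a) ⊛ (p2 ⊛ p3))) ⊛ ev A
     ⊕ ((κ (+ (c N.* b)) ⊛ monomial (a , b , d)) ⊛ ev B ⊕ ((κ (+ (c N.* d)) ⊛ monomial (a , b , d)) ⊛ ev C ⊕ D (ev p)))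
    regroup = R.+-cong expand (R.refl {D (ev p)}) » solve 4 (\ a b c d -> (a :+ (b :+ c)) :+ d := a :+ (b :+ (c :+ d))) R.refl
     ((κ (+ (c N.* a)) ⊛ (pow P (N.pred a) ⊛ (p2 ⊛ p3))) ⊛ ev A) ((κ (+ (c N.* b)) ⊛ monomial (a , b , d)) ⊛ ev B) ((κ (+ (c N.* d)) ⊛ monomial (a , b , d)) ⊛ ev C) (D (ev p))
   Dⁿ : ℕ -> Series -> Series
   Dⁿ zero    f = f
   Dⁿ (suc n) f = D (Dⁿ n f)
   ev-iterate : ∀ f r -> D f ≈ f ⊛ ev r -> ∀ n -> Dⁿ n f ≈ f ⊛ ev (iterate A B C r n)
   ev-iterate f r h zero    = R.sym (R.*-identityʳ f) » (⊛-congˡ f (R.sym ev-one))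
   ev-iterate f r h (suc n) = D-≈ₘ (ev-iterate f r h n) » D-product-rule f (ev I) » R.+-cong (R.*-cong h (R.refl {ev I})) (⊛-congˡ f (R.sym (ev-derive I))) »
    solve 4 (\ f r i d -> (f :* r) :* i :+ f :* d := f :* (d :+ r :* i)) R.refl f (ev r) (ev I) (ev (derive A B C I)) »
     (⊛-congˡ f (R.sym (ev-add (derive A B C I) (mul r I) » R.+-cong (R.refl {ev (derive A B C I)}) (ev-mul r I))))
    where I = iterate A B C r n

-- Curvature modulo m, the Hasse invariant and the sieve.

module FrobeniusReduction where
 open ModularPolynomials public
 open import Data.List using ([]; _∷_)
 open import Relation.Binary.PropositionalEquality using ([_])

 module Coefficients (m : ℕ) {{_ : N.NonZero m}} (eighth : ℕ) (H K : Poly) where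
  open Polynomials m

  -- `A`, `B`, `C` encode DP = 2P² + (xy - y²)/8, Dx/x = 4P and Dy/y = 4P - x + y. In `B'` and `C'`
  -- the series `P` is replaced by `K`, and x - y is multiplied by `H`; for the certificates below
  -- all terms are then homogeneous of degree (m + 1)/2.
  A B C B' C' -P x-y : Poly
  A   = (2 , 2 , 0 , 0) ∷ (eighth , 0 , 1 , 1) ∷ (eighth N.* N.pred m , 0 , 0 , 2) ∷ []
  B   = (4 , 1 , 0 , 0) ∷ []
  C   = (4 , 1 , 0 , 0) ∷ (N.pred m , 0 , 1 , 0) ∷ (1 , 0 , 0 , 1) ∷ []
  -P  = (N.pred m , 1 , 0 , 0) ∷ []
  x-y = (1 , 0 , 1 , 0) ∷ (N.pred m , 0 , 0 , 1) ∷ []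
  B'  = mul ((4 , 0 , 0 , 0) ∷ []) K
  C'  = add B' (mul H ((N.pred m , 0 , 1 , 0) ∷ (1 , 0 , 0 , 1) ∷ []))

  -- The value at q = 0, where `P` vanishes and `x`, `y` are 1.
  constant : Poly -> ℤ
  constant []                        = 0#
  constant ((c , zero  , _ , _) ∷ p) = + c + constant p
  constant ((c , suc _ , _ , _) ∷ p) = constant p

 -- H is the Hasse invariant (H ≡ 1 mod m), K ≡ P mod m, and target is θ^{m+1} E^m, where θ E
 -- is the series of (-1)^k p(mk) mod m.  Powers of H make the identities homogeneous.
 record Certificate (m : ℕ) {{_ : N.NonZero m}} : Set where
  open Polynomials m
  field
   eighth : ℕ
   H K target : Poly
   i j : ℕ
  open Coefficients m eighth H K
  field
   eighth-ok   : Cong m (+ 8 * + eighth) 1#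
   constant-ok : Cong m (constant H) 1#
   P-curvature : iterate A B C -P m ≡ neg (mul H K)
   t-curvature : iterate A B C x-y m ≡ mul x-y (mul H H)
   reduced     : add (mul target (power H i)) (iterate A B' C' (neg K) (N.pred m)) ≡ power H j

 Frobenius : (m : ℕ) {{_ : N.NonZero m}} -> Set
 Frobenius m = ∀ f g -> pow (f ⊕ g) m ≈ pow f m ⊕ pow g m where
  open Polynomials m
  open Congruence m

 module Reduction (m : ℕ) {{_ : N.NonZero m}} (cert : Certificate m)
  (frobenius : Frobenius m) where

  open Polynomials m
  open Congruence m
  open Ideal m
  open Solver
  open Certificate cert
  open Coefficients m eighth H K

  κ-^ : ∀ a n -> pow (κ a) n ≈ κ (a Z.^ n)
  κ-^ a zero    = R.refl {κ 1#}
  κ-^ a (suc n) = R.*-cong (R.refl {κ a}) (κ-^ a n) » R.sym (κ-* a (a Z.^ n))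

  m-suc : ∃ \ k -> m ≡ suc k
  m-suc = N.pred m , sym (N.suc-pred m)

  pow-0 : pow (κ 0#) m ≈ κ 0#
  pow-0 with m-suc
  ... | k , refl = R.zeroˡ (pow (κ 0#) k)

  pow-1 : ∀ n -> pow (κ 1#) n ≈ κ 1#
  pow-1 zero    = R.refl {κ 1#}
  pow-1 (suc n) = R.*-identityˡ (pow (κ 1#) n) » pow-1 n

  -- Fermat's little theorem by induction on n, from the additivity of the m-th power applied to
  -- constant series.
  fermat-ℕ : ∀ n -> pow (κ (+ n)) m ≈ κ (+ n)
  fermat-ℕ zero    = pow-0
  fermat-ℕ (suc n) = pow-cong m split » frobenius (κ 1#) (κ (+ n)) » R.+-cong (pow-1 m) (fermat-ℕ n) » R.sym split where
   split : κ (+ suc n) ≈ κ 1# ⊕ κ (+ n)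
   split = lift (\ k -> cong (\ z -> κ z k) (Z.pos-+ 1 n)) » κ-+ 1# (+ n)

  fermat-κ : ∀ a -> pow (κ a) m ≈ κ a
  fermat-κ (+ n) = fermat-ℕ n
  fermat-κ -[1+ n ] = unnull (by (solve 4 (\ a b c d -> a :- b := con 1# :* ((c :+ a) :- con 0#) :+ con (- 1#) :* (c :- d) :+ con (- 1#) :* ((d :+ b) :- con 0#)) R.refl
    (pow (κ -[1+ n ]) m) (κ -[1+ n ]) (pow (κ (+ suc n)) m) (κ (+ suc n)))
    (_ *ᶻ null (R.sym (frobenius (κ (+ suc n)) (κ -[1+ n ])) » pow-cong m cancel » pow-0)
     +ᶻ _ *ᶻ null (fermat-ℕ (suc n)) +ᶻ _ *ᶻ null cancel)) where
   cancel : κ (+ suc n) ⊕ κ -[1+ n ] ≈ κ 0#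
   cancel = R.sym (κ-+ (+ suc n) -[1+ n ]) » lift (\ k -> cong (\ z -> κ z k) (Z.+-inverseʳ (+ suc n)))

  fermat : ∀ a -> Cong m (a Z.^ m) a
  fermat a = coeff (R.sym (κ-^ a m) » fermat-κ a) 0

  shift : ∀ f -> f ≐ κ (f 0) ⊕ q^ 1 ⊛ tail f
  shift f zero    = sym (Z.+-identityʳ (f 0))
  shift f (suc n) = sym (Z.+-identityˡ _ & q^-⊛-+ 1 (tail f) n)

  pow-q : ∀ n -> pow (q^ 1) n ≐ q^ n
  pow-q zero    k = refl
  pow-q (suc n) zero    = Z.*-zeroˡ (pow (q^ 1) n 0)
  pow-q (suc n) (suc k) = q^-⊛-+ 1 (pow (q^ 1) n) k & pow-q n k

  -- The congruence between f^m and f(q^m), one coefficient at a time: f is its constant term plus q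
  -- times its tail, and the m-th power of this sum is taken termwise.
  frobenius-coeff : ∀ k f -> Cong m (pow f m (m N.* k)) (f k)
  frobenius-coeff k f = coeff (pow-cong m (lift (shift f)) » frobenius (κ (f 0)) (q^ 1 ⊛ tail f) »
    R.+-cong (fermat-κ (f 0)) (pow-⊛ (q^ 1) (tail f) m » R.*-cong (lift (pow-q m)) (R.refl {pow (tail f) m}))) (m N.* k) >> go k where
   go : ∀ k -> Cong m (κ (f 0) (m N.* k) + (q^ m ⊛ pow (tail f) m) (m N.* k)) (f k)
   go zero = ≡C (cong2 (\ a b -> κ (f 0) a + (q^ m ⊛ pow (tail f) m) b) (N.*-zeroʳ m) (N.*-zeroʳ m) &
    cong (_+_ (f 0)) (q^-⊛-< m (pow (tail f) m) 0 (N.>-nonZero⁻¹ m)) & Z.+-identityʳ (f 0))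
   go (suc k) = ≡C (cong (\ z -> κ (f 0) z + (q^ m ⊛ pow (tail f) m) z) (N.*-suc m k) &
    cong2 _+_ (κ-pos (N.pred m N.+ m N.* k) (cong (N._+ m N.* k) (sym (N.suc-pred m)))) (q^-⊛-+ m (pow (tail f) m) (m N.* k)) & Z.+-identityˡ _) >>
    frobenius-coeff k (tail f) where
    κ-pos : ∀ j {i} -> i ≡ suc j -> κ (f 0) i ≡ 0#
    κ-pos j refl = refl

  Dx≈B : D x ≈ x ⊛ ev B
  Dx≈B = reduce m Dx » solve 2 (\ p x -> # 4 :* (p :* x) := x :* (# 4 :* ((p :* con 1#) :* (con 1# :* con 1#)) :+ con 0#)) R.refl P x

  evC : ev C ≈ κ (+ 4) ⊛ P ⊖ x ⊕ y
  evC = by' (solve 4 (\ p x y k -> # 4 :* ((p :* con 1#) :* (con 1# :* con 1#)) :+ (k :* (con 1# :* ((x :* con 1#) :* con 1#)) :+ (con 1# :* (con 1# :* (con 1# :* (y :* con 1#))) :+ con 0#))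
    := # 4 :* p :+ k :* x :+ y) R.refl P x y (κ (+ N.pred m)))
    (R.+-cong (R.+-cong (R.refl {κ (+ 4) ⊛ P}) (R.*-cong κ-pred (R.refl {x}))) (R.refl {y}) »
     solve 3 (\ p x y -> # 4 :* p :+ (:- con 1#) :* x :+ y := # 4 :* p :- x :+ y) R.refl P x y) where
   by' = R.trans

  Dy≈C : D y ≈ y ⊛ ev C
  Dy≈C = reduce m Dy » (⊛-congˡ y (R.sym evC))

  κ8⁻¹ : κ (+ eighth) ⊛ κ (+ 8) ≈ κ 1#
  κ8⁻¹ = R.*-comm (κ (+ eighth)) (κ (+ 8)) » R.sym (κ-* (+ 8) (+ eighth)) » κ-cong eighth-ok

  DP≈A : D P ≈ ev A
  DP≈A = unnull (by (solve 6 (\ dp p x y k e -> dp :- (# 2 :* ((p :* (p :* con 1#)) :* (con 1# :* con 1#)) :+ (e :* (con 1# :* ((x :* con 1#) :* (y :* con 1#))) :+ (k :* (con 1# :* (con 1# :* (y :* (y :* con 1#)))) :+ con 0#)))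
    := e :* (# 8 :* dp :- (# 16 :* (p :* p) :+ x :* y :- y :* y)) :+ (# 2 :* (p :* p) :- dp) :* (e :* # 8 :- con 1#) :+ (:- (y :* y)) :* (k :- (:- e))) R.refl
    (D P) P x y (κ (+ (eighth N.* N.pred m))) (κ (+ eighth)))
   (_ *ᶻ null (reduce m DP) +ᶻ _ *ᶻ null κ8⁻¹ +ᶻ _ *ᶻ null
    (κ-pos-* eighth (N.pred m) » R.*-cong (R.refl {κ (+ eighth)}) κ-pred » solve 1 (\ e -> e :* (:- con 1#) := :- e) R.refl (κ (+ eighth)))))

  module D1 = Derivation A B C DP≈A Dx≈B Dy≈C
  open D1 using (Dⁿ; ev-iterate)

  Dⁿ-coeff : ∀ n f k -> Dⁿ n f k ≡ (+ k) Z.^ n * f k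
  Dⁿ-coeff zero    f k = sym (Z.*-identityˡ (f k))
  Dⁿ-coeff (suc n) f k = cong (_*_ (+ k)) (Dⁿ-coeff n f k) & sym (Z.*-assoc (+ k) ((+ k) Z.^ n) (f k))

  -- Fermat on the coefficients. Set against the polynomial formula of `ev-iterate` for the m-th
  -- derivative, this yields relations between `P`, `x` and `y`.
  Dᵐ≈D : ∀ f -> Dⁿ m f ≈ D f
  Dᵐ≈D f = mk≈ (\ k -> ≡C (Dⁿ-coeff m f k) >> Cong-* (fermat (+ k)) (≡C {f k} refl))

  DQ : D Q ≈ Q ⊛ ev -P
  DQ = reduce m exact-DQ » (⊛-congˡ Q (R.sym (solve 2 (\ p k -> k :* ((p :* con 1#) :* (con 1# :* con 1#)) :+ con 0# := k :* p) R.refl P (κ (+ N.pred m)) »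
    R.*-cong κ-pred (R.refl {P}) » solve 1 (\ p -> (:- con 1#) :* p := :- p) R.refl P))) where
   module R0 = CommutativeRing C0.seriesRing
   exact-DQ : D Q C0.≈ Q ⊛ ⊝ P
   exact-DQ = R0.trans (C0.lift (\ n -> sym (tw-D pbar n))) (R0.trans (tw-≈ (C0.lift D-pbar)) (R0.trans (C0.lift (tw-⊛ log-pbar pbar))
    (C0.Solver.solve 2 (\ l q -> C0.Solver._:=_ (C0.Solver._:*_ l q) (C0.Solver._:*_ q (C0.Solver.:-_ (C0.Solver.:-_ l)))) R0.refl (tw log-pbar) Q)))

  θQ : θ ⊛ Q ≈ κ 1#
  θQ = lift θ-Q

  -- D^m Q is -Q H K by the certificate `P-curvature` and DQ = -Q P by Fermat; multiplication by θ
  -- removes `Q`.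
  P≈HK : P ≈ ev H ⊛ ev K
  P≈HK = unnull (by (solve 5 (\ θ Q P hk i -> P :- hk := (θ :* Q) :* (P :- hk) :+ (hk :- P) :* (θ :* Q :- con 1#)) R.refl θ Q P (ev H ⊛ ev K) (κ 1#))
   (by (solve 4 (\ θ Q P hk -> (θ :* Q) :* (P :- hk) :+ (hk :- P) :* (θ :* Q :- con 1#) := θ :* (Q :* (:- hk) :- Q :* (:- P)) :+ (hk :- P) :* (θ :* Q :- con 1#)) R.refl θ Q P (ev H ⊛ ev K))
    (_ *ᶻ null ((⊛-congˡ Q (R.sym pc)) » R.sym (ev-iterate Q -P DQ m) » Dᵐ≈D Q » DQ » (⊛-congˡ Q minusP)) +ᶻ _ *ᶻ null θQ))) where
   minusP : ev -P ≈ ⊝ P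
   minusP = solve 2 (\ p k -> k :* ((p :* con 1#) :* (con 1# :* con 1#)) :+ con 0# := k :* p) R.refl P (κ (+ N.pred m)) »
    R.*-cong κ-pred (R.refl {P}) » solve 1 (\ p -> (:- con 1#) :* p := :- p) R.refl P
   pc : ev (iterate A B C -P m) ≈ ⊝ (ev H ⊛ ev K)
   pc = lift (\ n -> cong (\ p -> ev p n) P-curvature) » ev-neg (mul H K) » R.-‿cong (ev-mul H K)

  -- Since y = φ⁴ and φ · pbar = 1, the fourth power of `pbar` inverts `y`.
  y⁻¹ : Series
  y⁻¹ = (pbar ⊛ pbar) ⊛ (pbar ⊛ pbar)

  y-inverse : y ⊛ y⁻¹ ≈ κ 1#
  y-inverse = R.*-cong (reduce m y-φ) (R.refl {y⁻¹}) » solve 2 (\ f p -> ((f :* f) :* (f :* f)) :* ((p :* p) :* (p :* p)) := ((f :* p) :* (f :* p)) :* ((f :* p) :* (f :* p))) R.refl φ pbar »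
   R.*-cong (R.*-cong φp φp) (R.*-cong φp φp) » solve 0 ((con 1# :* con 1#) :* (con 1# :* con 1#) := con 1#) R.refl where
   module R0 = CommutativeRing C0.seriesRing
   φp : φ ⊛ pbar ≈ κ 1#
   φp = lift φ-pbar
   y-φ : y C0.≈ (φ ⊛ φ) ⊛ (φ ⊛ φ)
   y-φ = R0.trans (tw-≈ (R0.sym θ⁴)) (R0.trans (C0.lift (tw-⊛ (θ ⊛ θ) (θ ⊛ θ))) (R0.*-cong tw² tw²)) where
    tw² : tw (θ ⊛ θ) C0.≈ φ ⊛ φ
    tw² = R0.trans (C0.lift (tw-⊛ θ θ)) (R0.*-cong (C0.lift tw-θ) (C0.lift tw-θ))

  Dy⁻¹ : D y⁻¹ ≈ ⊝ (y⁻¹ ⊛ ev C)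
  Dy⁻¹ = unnull (by (solve 4 (\ y u c du -> du :- (:- (u :* c)) := u :* (((y :* c) :* u :+ y :* du) :- con 0#) :+ (:- (c :* u :+ du)) :* (y :* u :- con 1#)) R.refl y y⁻¹ (ev C) (D y⁻¹))
   (_ *ᶻ null (R.+-cong (R.*-cong (R.sym Dy≈C) (R.refl {y⁻¹})) (R.refl {y ⊛ D y⁻¹}) » R.sym (D-product-rule y y⁻¹) » D-≈ₘ y-inverse » lift (D-κ 1#))
    +ᶻ _ *ᶻ null y-inverse))

  -- x/y = (θ/φ)⁴ has weight 0, so its logarithmic derivative x - y is free of `P`. Fermat applied
  -- to it isolates `H`, as `t-curvature` shows.
  t : Series
  t = x ⊛ y⁻¹

  x-y≈ : ev x-y ≈ x ⊖ y
  x-y≈ = solve 3 (\ x y k -> con 1# :* (con 1# :* ((x :* con 1#) :* con 1#)) :+ (k :* (con 1# :* (con 1# :* (y :* con 1#))) :+ con 0#) := x :+ k :* y) R.refl x y (κ (+ N.pred m)) »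
   R.+-cong (R.refl {x}) (R.*-cong κ-pred (R.refl {y})) » solve 2 (\ x y -> x :+ (:- con 1#) :* y := x :- y) R.refl x y

  Dt : D t ≈ t ⊛ ev x-y
  Dt = unnull (by (solve 7 (\ x u b c p y e -> (((x :* b) :* u) :+ x :* (:- (u :* c))) :- (x :* u) :* e := (x :* u) :* (b :- # 4 :* p) :+ (:- (x :* u)) :* (c :- (# 4 :* p :- x :+ y)) :+ (:- (x :* u)) :* (e :- (x :- y))) R.refl
    x y⁻¹ (ev B) (ev C) P y (ev x-y)) 
   (_ *ᶻ null evB +ᶻ _ *ᶻ null evC +ᶻ _ *ᶻ null x-y≈) ∘' R.trans (D-product-rule x y⁻¹) (R.+-cong (R.*-cong Dx≈B (R.refl {y⁻¹})) (⊛-congˡ x Dy⁻¹))) where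
   evB : ev B ≈ κ (+ 4) ⊛ P
   evB = solve 1 (\ p -> # 4 :* ((p :* con 1#) :* (con 1# :* con 1#)) :+ con 0# := # 4 :* p) R.refl P
   _∘'_ : ∀ {f g h} -> Null (f ⊖ g) -> h ≈ f -> Null (h ⊖ g)
   _∘'_ {f} {g} {h} z e = R.+-cong e (R.refl {⊝ g}) » z

  t-unit : t ⊛ (y ⊛ ((Q ⊛ Q) ⊛ (Q ⊛ Q))) ≈ κ 1#
  t-unit = R.*-cong (R.*-cong (R.sym (reduce m θ⁴)) (R.refl {y⁻¹})) (R.refl {y ⊛ ((Q ⊛ Q) ⊛ (Q ⊛ Q))}) »
   solve 4 (\ θ u y q -> (((θ :* θ) :* (θ :* θ)) :* u) :* (y :* ((q :* q) :* (q :* q))) := ((θ :* q) :* (θ :* q)) :* ((θ :* q) :* (θ :* q)) :* (y :* u)) R.refl θ y⁻¹ y Q »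
   R.*-cong (R.*-cong (R.*-cong θQ θQ) (R.*-cong θQ θQ)) y-inverse » solve 0 ((con 1# :* con 1#) :* (con 1# :* con 1#) :* con 1# := con 1#) R.refl

  H²-null : Null ((x ⊖ y) ⊛ (ev H ⊛ ev H ⊖ κ 1#))
  H²-null = by (solve 4 (\ t v e h -> e :* (h :* h :- con 1#) := v :* (t :* (e :* (h :* h)) :- t :* e) :+ (:- (e :* (h :* h) :- e)) :* (t :* v :- con 1#)) R.refl
    t (y ⊛ ((Q ⊛ Q) ⊛ (Q ⊛ Q))) (x ⊖ y) (ev H))
   (_ *ᶻ null ((⊛-congˡ t (R.sym tc)) » R.sym (ev-iterate t x-y Dt m) » Dᵐ≈D t » Dt » (⊛-congˡ t x-y≈))
    +ᶻ _ *ᶻ null t-unit) where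
   tc : ev (iterate A B C x-y m) ≈ (x ⊖ y) ⊛ (ev H ⊛ ev H)
   tc = lift (\ n -> cong (\ p -> ev p n) t-curvature) » ev-mul x-y (mul H H) » R.*-cong x-y≈ (ev-mul H H)

  -- A series with constant term invertible modulo m, with inverse `c`, is not a zero divisor: the
  -- coefficients of the other factor vanish one after another.
  cancel-unit : ∀ c f g -> Cong m (c * f 0) 1# -> Null (f ⊛ g) -> Null g
  cancel-unit c f g u z = mk≈ (\ n -> vanish (suc n) n N.≤-refl >> ≡C (sym (κ0 n))) where
   κ0 : ∀ n -> κ 0# n ≡ 0#
   κ0 zero    = refl
   κ0 (suc n) = refl
   drop : ∀ n f -> (∀ k -> k N.< suc n -> Cong m (g k) 0#) -> Cong m ((f ⊛ g) n) 0#
   drop zero    f h = Cong-* (≡C {f 0} refl) (h 0 0<s) >> ≡C (Z.*-zeroʳ (f 0))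
   drop (suc n) f h = Cong-+ (Cong-* (≡C {f 0} refl) (h (suc n) N.≤-refl)) (drop n (tail f) (\ k k<n -> h k (N.m<n⇒m<1+n k<n))) >>
    ≡C (Z.+-identityʳ _ & Z.*-zeroʳ (f 0))
   divide : ∀ a -> Cong m (f 0 * a) 0# -> Cong m a 0#
   divide a e = ≡C (sym (Z.*-identityˡ a)) >> Cong-* (Cong-sym u) (≡C {a} refl) >> ≡C (Z.*-assoc c (f 0) a) >>
    Cong-* (≡C {c} refl) e >> ≡C (Z.*-zeroʳ c)
   vanish : ∀ b k -> k N.< b -> Cong m (g k) 0#
   vanish (suc b) zero    _ = divide (g 0) (coeff z 0)
   vanish (suc b) (suc k) (s≤s k<b) = divide (g (suc k)) (≡C (sym (Z.+-identityʳ _)) >>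
    Cong-+ (≡C {f 0 * g (suc k)} refl) (Cong-sym (drop k (tail f) (\ i i<k -> vanish b i (N.<-≤-trans i<k k<b)))) >> coeff z (suc k))


  x1 : x 1 ≡ + 8
  x1 = cong2 _+_ (cong (_+_ 0#) (κ-⊛ (+ 8) U 1 & cong (_*_ (+ 8)) U1)) (κ-⊛ (- (+ 32)) W 1) where
   only : ∀ z -> Divs 1 z -> z ≡ (1 , 1)
   only (d , e) (_ , _ , h) = cong2 _,_ (N.m*n≡1⇒m≡1 d e h) (N.m*n≡1⇒n≡1 d e h)
   U1 : U 1 ≡ 1#
   U1 = ∑-single (divs 1) (1 , 1) (s≤s z≤n , s≤s z≤n , refl) only

  y0 : y 0 ≡ 1#
  y0 = x0

  pow0 : ∀ f n -> f 0 ≡ 1# -> pow f n 0 ≡ 1#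
  pow0 f zero    e = refl
  pow0 f (suc n) e = cong2 _*_ e (pow0 f n e)

  ev-0 : ∀ p -> ev p 0 ≡ constant p
  ev-0 [] = refl
  ev-0 ((c , zero , b , d) ∷ p) = cong2 _+_ (cong2 (\ u v -> + c * (1# * (u * v))) (pow0 x b x0) (pow0 y d y0) & Z.*-identityʳ (+ c)) (ev-0 p)
  ev-0 ((c , suc a , b , d) ∷ p) = cong2 _+_ (cong (\ z -> + c * ((z * pow P a 0) * (pow x b 0 * pow y d 0))) P0 & Z.*-zeroʳ (+ c)) (ev-0 p) & Z.+-identityˡ _

  -- In (x - y)(H² - 1) ≡ 0 the factor x - y begins with 16q, so its tail has a unit as constant
  -- term and H² ≡ 1 follows. Then H + 1 begins with 2, also a unit, and H ≡ 1. The inverses of 16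
  -- and 2 are built from that of 8.
  H≈1 : ev H ≈ κ 1#
  H≈1 = unnull (cancel-unit (+ 4 * + eighth) (ev H ⊕ κ 1#) (ev H ⊖ κ 1#) unit1
   (by (solve 1 (\ h -> (h :+ con 1#) :* (h :- con 1#) := h :* h :- con 1#) R.refl (ev H)) (cancel-unit (+ 4 * + eighth * + eighth) (tail (x ⊖ y)) (ev H ⊛ ev H ⊖ κ 1#) unit2 tail-null))) where
   unit1 : Cong m (+ 4 * + eighth * (ev H ⊕ κ 1#) 0) 1#
   unit1 = Cong-* (≡C {+ 4 * + eighth} refl) (Cong-+ (≡C (ev-0 H) >> constant-ok) (≡C {1#} refl)) >>
    ≡C (l (+ eighth)) >> eighth-ok where
    l : ∀ e -> + 4 * e * (1# + 1#) ≡ + 8 * e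
    l = ring
   unit2 : Cong m (+ 4 * + eighth * + eighth * tail (x ⊖ y) 0) 1#
   unit2 = ≡C (cong (\ z -> + 4 * + eighth * + eighth * (z - - z)) x1 & l (+ eighth)) >> Cong-* eighth-ok eighth-ok where
    l : ∀ e -> + 4 * e * e * + 16 ≡ (+ 8 * e) * (+ 8 * e)
    l = ring
   tail-null : Null (tail (x ⊖ y) ⊛ (ev H ⊛ ev H ⊖ κ 1#))
   tail-null = mk≈ (\ n -> ≡C (sym (cong (_+ (tail (x ⊖ y) ⊛ N) n) (cong (_* N (suc n)) (cong2 _-_ x0 y0 & refl) & Z.*-zeroˡ (N (suc n))) & Z.+-identityˡ _)) >>
    coeff H²-null (suc n) >> ≡C (sym (κ0 n))) where
    N = ev H ⊛ ev H ⊖ κ 1#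
    κ0 : ∀ n -> κ 0# n ≡ 0#
    κ0 zero    = refl
    κ0 (suc n) = refl

  P≈K : P ≈ ev K
  P≈K = P≈HK » R.*-cong H≈1 (R.refl {ev K}) » R.*-identityˡ (ev K)

  B'≈ : ev B' ≈ κ (+ 4) ⊛ P
  B'≈ = ev-mul ((4 , 0 , 0 , 0) ∷ []) K » R.*-cong (solve 0 (# 4 :* (con 1# :* (con 1# :* con 1#)) :+ con 0# := # 4) R.refl) (R.sym P≈K)

  C'≈ : ev C' ≈ κ (+ 4) ⊛ P ⊖ x ⊕ y
  C'≈ = ev-add B' (mul H r) » R.+-cong B'≈ (ev-mul H r » R.*-cong H≈1 r≈) »
   solve 3 (\ p x y -> # 4 :* p :+ con 1# :* (:- x :+ y) := # 4 :* p :- x :+ y) R.refl P x y where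
   r = (N.pred m , 0 , 1 , 0) ∷ (1 , 0 , 0 , 1) ∷ []
   r≈ : ev r ≈ ⊝ x ⊕ y
   r≈ = solve 3 (\ x y k -> k :* (con 1# :* ((x :* con 1#) :* con 1#)) :+ (con 1# :* (con 1# :* (con 1# :* (y :* con 1#))) :+ con 0#) := k :* x :+ y) R.refl x y (κ (+ N.pred m)) »
    R.+-cong (R.*-cong κ-pred (R.refl {x})) (R.refl {y}) » solve 2 (\ x y -> (:- con 1#) :* x :+ y := (:- x) :+ y) R.refl x y

  module D2 = Derivation A B' C' DP≈A
   (reduce m Dx » solve 2 (\ p x -> # 4 :* (p :* x) := x :* (# 4 :* p)) R.refl P x » (⊛-congˡ x (R.sym B'≈)))
   (reduce m Dy » (⊛-congˡ y (R.sym C'≈)))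

  -- In the certificate `reduced` the powers of `H` become 1 and the iterate is D^(m-1)Q / Q; this
  -- leaves target ≡ 1 - D^(m-1)Q / Q.
  sieve : Q ⊖ D2.Dⁿ (N.pred m) Q ≈ Q ⊛ ev target
  sieve = unnull (by (solve 5 (\ Q d p t i -> (Q :- d) :- Q :* t := (:- con 1#) :* (d :- Q :* p) :+ (:- Q) :* (t :+ p :- i) :+ (:- Q) :* (i :- con 1#)) R.refl
    Q (D2.Dⁿ (N.pred m) Q) (ev I) (ev target) (ev (power H j)))
   (_ *ᶻ null (D2.ev-iterate Q (neg K) DQ' (N.pred m)) +ᶻ _ *ᶻ null sum +ᶻ _ *ᶻ null (H^ j))) where
   I = iterate A B' C' (neg K) (N.pred m)
   H^ : ∀ n -> ev (power H n) ≈ κ 1#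
   H^ n = ev-power H n » pow-cong n H≈1 » pow-1 n
   DQ' : D Q ≈ Q ⊛ ev (neg K)
   DQ' = DQ » (⊛-congˡ Q ((solve 2 (\ p k -> k :* ((p :* con 1#) :* (con 1# :* con 1#)) :+ con 0# := k :* p) R.refl P (κ (+ N.pred m)) »
    R.*-cong κ-pred P≈K » solve 1 (\ p -> (:- con 1#) :* p := :- p) R.refl (ev K)) » R.sym (ev-neg K)))
   sum : ev target ⊕ ev I ≈ ev (power H j)
   sum = R.+-cong (R.sym (R.*-identityʳ (ev target)) » R.*-cong (R.refl {ev target}) (R.sym (H^ i)) » R.sym (ev-mul target (power H i))) (R.refl {ev I}) »
    R.sym (ev-add (mul target (power H i)) I) » lift (\ n -> cong (\ p -> ev p n) reduced)

  -- At exponents mk the operator 1 - D^(m-1) changes nothing modulo m, because (mk)^(m-1) ≡ 0. On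
  -- the other side the coefficient of G^m at mk is that of G at k.
  main : ∀ G -> pow G m ≈ Q ⊛ ev target -> 1 N.< m -> ∀ k -> Cong m (Q (m N.* k)) (G k)
  main G e 1<m k = (Cong-sym (coeff sieve (m N.* k) >> Cong-sym (coeff e (m N.* k))) ⟨sieved⟩ low) >> frobenius-coeff k G where
   a = (+ (m N.* k)) Z.^ N.pred m
   divisible : Cong m a 0#
   divisible = go (N.pred m) (N.<⇒≤pred 1<m) where
    go : ∀ n -> 1 N.≤ n -> Cong m ((+ (m N.* k)) Z.^ n) 0#
    go (suc n) _ = cong-by (+ k * (+ (m N.* k)) Z.^ n) (Z.+-identityʳ _ & cong (_* (+ (m N.* k)) Z.^ n) (Z.pos-* m k) & l (+ m) (+ k) ((+ (m N.* k)) Z.^ n)) where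
     l : ∀ m k z -> m * k * z ≡ k * z * m
     l = ring
   low : Cong m ((Q ⊖ D2.Dⁿ (N.pred m) Q) (m N.* k)) (Q (m N.* k))
   low = Cong-+ (≡C {Q (m N.* k)} refl) (Cong-neg (≡C (Dⁿ-coeff' (N.pred m)) >> Cong-* divisible (≡C {Q (m N.* k)} refl) >> ≡C (Z.*-zeroˡ (Q (m N.* k))))) >>
    ≡C (Z.+-identityʳ _) where
    Dⁿ-coeff' : ∀ n -> D2.Dⁿ n Q (m N.* k) ≡ (+ (m N.* k)) Z.^ n * Q (m N.* k)
    Dⁿ-coeff' zero    = sym (Z.*-identityˡ (Q (m N.* k)))
    Dⁿ-coeff' (suc n) = cong (_*_ (+ (m N.* k))) (Dⁿ-coeff' n) & sym (Z.*-assoc (+ (m N.* k)) ((+ (m N.* k)) Z.^ n) (Q (m N.* k)))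
   _⟨sieved⟩_ : ∀ {a b c} -> Cong m b a -> Cong m a c -> Cong m c b
   p ⟨sieved⟩ q = Cong-sym q >> Cong-sym p

-- The polynomial certificates for m = 3, 5, 7, 11.

module Certificates where
 open FrobeniusReduction public
 open import Data.List using (List; []; _∷_)
 open import Data.Fin using () renaming (zero to zeroᶠ; suc to sucᶠ)
 open import Data.Vec using () renaming (_∷_ to _∷ⱽ_; [] to []ⱽ)
 open import Relation.Binary.PropositionalEquality using ([_])

 module FrobeniusSolver (m : ℕ) {{_ : N.NonZero m}} where
  open Congruence m
  open Polynomials m
  open Solver

  powᴱ : ∀ {n} -> Polynomial n -> ℕ -> Polynomial n
  powᴱ p zero    = con 1#
  powᴱ p (suc n) = p :* powᴱ p n

  -- Used for the mixed terms of (f + g)^m divided by m: the lists below consist of the numbers C(m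
  -- , k)/m with 0 < k < m.
  mixed : ∀ {n} -> Polynomial n -> Polynomial n -> ℕ -> ℕ -> List ℤ -> Polynomial n
  mixed f g a b []       = con 0#
  mixed f g a b (k ∷ ks) = con k :* (powᴱ f a :* powᴱ g b) :+ mixed f g (suc a) (N.pred b) ks

  absorb : ∀ {f g} r -> f ≈ g ⊕ κ (+ m) ⊛ r -> f ≈ g
  absorb {f} {g} r e = e » R.+-cong (R.refl {g}) (R.*-cong κm≈0 (R.refl {r})) »
   solve 2 (\ g r -> g :+ con 0# :* r := g) R.refl g r

 module Mod3 where
  open Congruence 3
  open Polynomials 3
  open FrobeniusSolver 3
  open Solver

  frobenius : ∀ f g -> pow (f ⊕ g) 3 ≈ pow f 3 ⊕ pow g 3
  frobenius f g = absorb (⟦ mixed (var zeroᶠ) (var (sucᶠ zeroᶠ)) 1 2 (+ 1 ∷ + 1 ∷ []) ⟧ (f ∷ⱽ g ∷ⱽ []ⱽ))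
   (solve 2 (\ f g -> powᴱ (f :+ g) 3 := (powᴱ f 3 :+ powᴱ g 3) :+ # 3 :* mixed f g 1 2 (+ 1 ∷ + 1 ∷ [])) R.refl f g)

  -- In all four certificates, with r = (m - 1)/2, `H` is (-1)^r Σ C(r , i)² x^i y^(r - i) modulo m,
  -- the homogeneous form of Deuring's polynomial. `K` has degree (m + 1)/2, and j = m + 1, so that
  -- both sides of `reduced` have degree (m² - 1)/2; `i` makes up the degree missing in `target`.
  certificate : Certificate 3
  certificate = record
   { eighth = 2
   ; H = (2 , 0 , 0 , 1) ∷ (2 , 0 , 1 , 0) ∷ []
   ; K = (1 , 0 , 0 , 2) ∷ (2 , 0 , 1 , 1) ∷ []
   -- θ¹⁶ = θ⁴ (θ⁴)³, hence E = θ⁴.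
   ; target = (1 , 0 , 4 , 0) ∷ []
   ; i = 0 ; j = 4
   ; eighth-ok = cong-by (+ 5) refl
   ; constant-ok = cong-by (+ 1) refl
   ; P-curvature = refl
   ; t-curvature = refl
   ; reduced = refl }

  open Reduction 3 certificate frobenius public using (main; θQ)

 module Mod5 where
  open Congruence 5
  open Polynomials 5
  open FrobeniusSolver 5
  open Solver

  frobenius : ∀ f g -> pow (f ⊕ g) 5 ≈ pow f 5 ⊕ pow g 5
  frobenius f g = absorb (⟦ mixed (var zeroᶠ) (var (sucᶠ zeroᶠ)) 1 4 (+ 1 ∷ + 2 ∷ + 2 ∷ + 1 ∷ []) ⟧ (f ∷ⱽ g ∷ⱽ []ⱽ))
   (solve 2 (\ f g -> powᴱ (f :+ g) 5 := (powᴱ f 5 :+ powᴱ g 5) :+ # 5 :* mixed f g 1 4 (+ 1 ∷ + 2 ∷ + 2 ∷ + 1 ∷ [])) R.refl f g)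

  certificate : Certificate 5
  certificate = record
   { eighth = 2
   ; H = (1 , 0 , 0 , 2) ∷ (4 , 0 , 1 , 1) ∷ (1 , 0 , 2 , 0) ∷ []
   ; K = (1 , 0 , 0 , 3) ∷ (1 , 0 , 1 , 2) ∷ (3 , 0 , 2 , 1) ∷ []
   -- θ¹⁶ = θ⁶ (θ²)⁵, hence E = θ².
   ; target = (1 , 0 , 4 , 0) ∷ []
   ; i = 4 ; j = 6
   ; eighth-ok = cong-by (+ 3) refl
   ; constant-ok = cong-by (+ 1) refl
   ; P-curvature = refl
   ; t-curvature = refl
   ; reduced = refl }

  open Reduction 5 certificate frobenius public using (main; θQ)

 module Mod7 where
  open Congruence 7
  open Polynomials 7
  open FrobeniusSolver 7
  open Solver

  frobenius : ∀ f g -> pow (f ⊕ g) 7 ≈ pow f 7 ⊕ pow g 7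
  frobenius f g = absorb (⟦ mixed (var zeroᶠ) (var (sucᶠ zeroᶠ)) 1 6 (+ 1 ∷ + 3 ∷ + 5 ∷ + 5 ∷ + 3 ∷ + 1 ∷ []) ⟧ (f ∷ⱽ g ∷ⱽ []ⱽ))
   (solve 2 (\ f g -> powᴱ (f :+ g) 7 := (powᴱ f 7 :+ powᴱ g 7) :+ # 7 :* mixed f g 1 6 (+ 1 ∷ + 3 ∷ + 5 ∷ + 5 ∷ + 3 ∷ + 1 ∷ [])) R.refl f g)

  certificate : Certificate 7
  certificate = record
   { eighth = 1
   ; H = (6 , 0 , 0 , 3) ∷ (5 , 0 , 1 , 2) ∷ (5 , 0 , 2 , 1) ∷ (6 , 0 , 3 , 0) ∷ []
   ; K = (2 , 0 , 0 , 4) ∷ (3 , 0 , 1 , 3) ∷ (1 , 0 , 2 , 2) ∷ (1 , 0 , 3 , 1) ∷ []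
   ; target = mul ((1 , 0 , 2 , 0) ∷ []) (power ((6 , 0 , 1 , 0) ∷ (2 , 0 , 0 , 1) ∷ []) 7)
   ; i = 5 ; j = 8
   ; eighth-ok = cong-by (+ 1) refl
   ; constant-ok = cong-by (+ 3) refl
   ; P-curvature = refl
   ; t-curvature = refl
   ; reduced = refl }

  open Reduction 7 certificate frobenius public using (main; θQ)

 module Mod11 where
  open Congruence 11
  open Polynomials 11
  open FrobeniusSolver 11
  open Solver

  frobenius : ∀ f g -> pow (f ⊕ g) 11 ≈ pow f 11 ⊕ pow g 11
  frobenius f g = absorb (⟦ mixed (var zeroᶠ) (var (sucᶠ zeroᶠ)) 1 10 (+ 1 ∷ + 5 ∷ + 15 ∷ + 30 ∷ + 42 ∷ + 42 ∷ + 30 ∷ + 15 ∷ + 5 ∷ + 1 ∷ []) ⟧ (f ∷ⱽ g ∷ⱽ []ⱽ))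
   (solve 2 (\ f g -> powᴱ (f :+ g) 11 := (powᴱ f 11 :+ powᴱ g 11) :+ # 11 :* mixed f g 1 10 (+ 1 ∷ + 5 ∷ + 15 ∷ + 30 ∷ + 42 ∷ + 42 ∷ + 30 ∷ + 15 ∷ + 5 ∷ + 1 ∷ [])) R.refl f g)

  certificate : Certificate 11
  certificate = record
   { eighth = 7
   ; H = (10 , 0 , 0 , 5) ∷ (8 , 0 , 1 , 4) ∷ (10 , 0 , 2 , 3) ∷ (10 , 0 , 3 , 2) ∷ (8 , 0 , 4 , 1) ∷ (10 , 0 , 5 , 0) ∷ []
   ; K = (3 , 0 , 0 , 6) ∷ (2 , 0 , 1 , 5) ∷ (10 , 0 , 2 , 4) ∷ (6 , 0 , 3 , 3) ∷ (5 , 0 , 4 , 2) ∷ (7 , 0 , 5 , 1) ∷ []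
   ; target = mul ((1 , 0 , 3 , 0) ∷ []) (power ((10 , 0 , 2 , 0) ∷ (2 , 0 , 1 , 1) ∷ []) 11)
   ; i = 7 ; j = 12
   ; eighth-ok = cong-by (+ 5) refl
   ; constant-ok = cong-by (+ 5) refl
   ; P-curvature = refl
   ; t-curvature = refl
   ; reduced = refl }

  open Reduction 11 certificate frobenius public using (main; θQ)

-- The series θE for each m.

module Identification where
 open Certificates public
 open import Data.List using ([]; _∷_)
 open import Data.Fin using () renaming (zero to zeroᶠ; suc to sucᶠ)
 open import Data.Vec using () renaming (_∷_ to _∷ⱽ_; [] to []ⱽ)
 open import Relation.Binary.PropositionalEquality using ([_])

 module Identify3 where
  open Mod3
  open Congruence 3
  open Ideal 3
  open Polynomials 3
  open Solver

  -- For each m it remains to check that (θE)^m is `Q` times the target, which follows from θ⁴ = x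
  -- and θQ = 1.
  overpartition-mod : ∀ k -> Cong 3 (Q (3 N.* k)) ((θ ⊛ x) k)
  overpartition-mod = main (θ ⊛ x) (unnull (by (solve 3 (\ t q x ->
    (t :* x) :* ((t :* x) :* ((t :* x) :* con 1#)) :- q :* (con 1# :* (con 1# :* ((x :* (x :* (x :* (x :* con 1#)))) :* con 1#)) :+ con 0#)
    := (q :* (x :* (x :* x))) :* ((t :* t) :* (t :* t) :- x) :+ (:- ((t :* (t :* t)) :* (x :* (x :* x)))) :* (t :* q :- con 1#)) R.refl θ Q x)
   (_ *ᶻ null (reduce 3 θ⁴) +ᶻ _ *ᶻ null θQ))) (s≤s 0<s)

 module Identify5 where
  open Mod5
  open Congruence 5
  open Ideal 5
  open Polynomials 5
  open FrobeniusSolver 5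
  open Solver

  private
   Θ = (θ ⊛ θ) ⊛ (θ ⊛ θ)

  overpartition-mod : ∀ k -> Cong 5 (Q (5 N.* k)) ((θ ⊛ (θ ⊛ θ)) k)
  overpartition-mod = main (θ ⊛ (θ ⊛ θ)) (unnull (by (solve 3 (\ t q x ->
    powᴱ (t :* (t :* t)) 5 :- q :* (con 1# :* (con 1# :* (powᴱ x 4 :* con 1#)) :+ con 0#)
    := (q :* (((t :* t) :* (t :* t) :+ x) :* (((t :* t) :* (t :* t)) :* ((t :* t) :* (t :* t)) :+ x :* x))) :* ((t :* t) :* (t :* t) :- x)
     :+ (:- powᴱ (t :* (t :* t)) 5) :* (t :* q :- con 1#)) R.refl θ Q x)
   (_ *ᶻ null (reduce 5 θ⁴) +ᶻ _ *ᶻ null θQ))) (s≤s 0<s)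

 module Identify7 where
  open Mod7
  open Congruence 7
  open Ideal 7
  open Polynomials 7
  open FrobeniusSolver 7
  open Solver

  -- Congruent to -x + 2y modulo 7, as 4 times `E2` plus 4 times `E2-4`. The multiple of `P` cancels
  -- the quasimodular parts of `U` and `W`; times θ it becomes 3Dθ, which supplies terms needed at
  -- square n.
  E7 : Series
  E7 = κ (+ 5) ⊛ U ⊕ κ (+ 6) ⊛ W ⊕ κ 1# ⊕ κ (+ 3) ⊛ P

  private
   e : Poly
   e = (6 , 0 , 1 , 0) ∷ (2 , 0 , 0 , 1) ∷ []
   E≈ : E7 ≈ ev e
   E≈ = unnull (by (solve 5 (\ U W P x y ->
     (# 5 :* U :+ # 6 :* W :+ con 1# :+ # 3 :* P) :- (# 6 :* (con 1# :* ((x :* con 1#) :* con 1#)) :+ (# 2 :* (con 1# :* (con 1# :* (y :* con 1#))) :+ con 0#))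
     := # 4 :* ((# 24 :* U :+ con (- 1#) :+ # 24 :* P) :- (# 4 :* x :- # 5 :* y))
      :+ # 4 :* (# 4 :* (# 24 :* W :+ con (- 1#) :+ # 6 :* P) :- (x :- # 5 :* y))
      :+ (con (- (+ 13)) :* U :+ con (- (+ 54)) :* W :+ # 3 :+ con (- (+ 27)) :* P :+ # 2 :* x :+ con (- (+ 6)) :* y) :* (# 7 :- con 0#)) R.refl U W P x y)
    (_ *ᶻ null (reduce 7 E2) +ᶻ _ *ᶻ null (reduce 7 E2-4) +ᶻ _ *ᶻ null κm≈0))
   target≈ : ev (mul ((1 , 0 , 2 , 0) ∷ []) (power e 7)) ≈ (x ⊛ x) ⊛ pow E7 7
   target≈ = ev-mul ((1 , 0 , 2 , 0) ∷ []) (power e 7) » R.*-cong (solve 1 (\ x -> con 1# :* (con 1# :* ((x :* (x :* con 1#)) :* con 1#)) :+ con 0# := x :* x) R.refl x)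
    (ev-power e 7 » pow-cong 7 (R.sym E≈))

  overpartition-mod : ∀ k -> Cong 7 (Q (7 N.* k)) ((θ ⊛ E7) k)
  overpartition-mod = main (θ ⊛ E7) (pow-⊛ θ E7 7 » unnull (by (solve 4 (\ t q x e ->
    powᴱ t 7 :* e :- q :* ((x :* x) :* e)
    := ((q :* e) :* ((t :* t) :* (t :* t) :+ x)) :* ((t :* t) :* (t :* t) :- x) :+ (:- (powᴱ t 7 :* e)) :* (t :* q :- con 1#)) R.refl θ Q x (pow E7 7))
   (_ *ᶻ null (reduce 7 θ⁴) +ᶻ _ *ᶻ null θQ)) » (⊛-congˡ Q (R.sym target≈))) (s≤s 0<s)

 module Identify11 where
  open Mod11
  open Congruence 11
  open Ideal 11
  open Polynomials 11
  open FrobeniusSolver 11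
  open Solver

  -- 8 E₄(q) + 48 E₄(q⁴) reduced modulo 11, a combination in which y² drops out: it is -x² + 2xy.
  E11 : Series
  E11 = κ (+ 6) ⊛ S ⊕ κ (+ 3) ⊛ R3 ⊕ κ 1#

  private
   e : Poly
   e = (10 , 0 , 2 , 0) ∷ (2 , 0 , 1 , 1) ∷ []
   E≈ : E11 ≈ ev e
   E≈ = unnull (by (solve 4 (\ S R x y ->
     (# 6 :* S :+ # 3 :* R :+ con 1#) :- (# 10 :* (con 1# :* ((x :* (x :* con 1#)) :* con 1#)) :+ (# 2 :* (con 1# :* ((x :* con 1#) :* (y :* con 1#))) :+ con 0#))
     := # 8 :* ((con 1# :+ # 240 :* S) :- (# 16 :* (x :* x) :- # 16 :* (x :* y) :+ y :* y))
      :+ # 3 :* (# 16 :* (con 1# :+ # 240 :* R) :- (x :* x :+ # 14 :* (x :* y) :+ y :* y))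
      :+ (con (- (+ 174)) :* S :+ con (- (+ 1047)) :* R :+ con (- (+ 5)) :+ # 11 :* (x :* x) :+ con (- (+ 8)) :* (x :* y) :+ y :* y) :* (# 11 :- con 0#)) R.refl S R3 x y)
    (_ *ᶻ null (reduce 11 E4) +ᶻ _ *ᶻ null (reduce 11 E4-4) +ᶻ _ *ᶻ null κm≈0))
   target≈ : ev (mul ((1 , 0 , 3 , 0) ∷ []) (power e 11)) ≈ (x ⊛ (x ⊛ x)) ⊛ pow E11 11
   target≈ = ev-mul ((1 , 0 , 3 , 0) ∷ []) (power e 11) » R.*-cong (solve 1 (\ x -> con 1# :* (con 1# :* ((x :* (x :* (x :* con 1#))) :* con 1#)) :+ con 0# := x :* (x :* x)) R.refl x)
    (ev-power e 11 » pow-cong 11 (R.sym E≈))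

  overpartition-mod : ∀ k -> Cong 11 (Q (11 N.* k)) ((θ ⊛ E11) k)
  overpartition-mod = main (θ ⊛ E11) (pow-⊛ θ E11 11 » unnull (by (solve 4 (\ t q x e ->
    powᴱ t 11 :* e :- q :* ((x :* (x :* x)) :* e)
    := ((q :* e) :* (((t :* t) :* (t :* t)) :* ((t :* t) :* (t :* t)) :+ ((t :* t) :* (t :* t)) :* x :+ x :* x)) :* ((t :* t) :* (t :* t) :- x) :+ (:- (powᴱ t 11 :* e)) :* (t :* q :- con 1#)) R.refl θ Q x (pow E11 11))
   (_ *ᶻ null (reduce 11 θ⁴) +ᶻ _ *ᶻ null θQ)) » (⊛-congˡ Q (R.sym target≈))) (s≤s 0<s)

-- Residues modulo an odd prime p, and forms of discriminant p²D.

module PrimeModulus where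
 open PowerSeries public
 open import Data.Nat.Primality using (euclidsLemma; prime⇒irreducible; prime⇒nonTrivial)
 open import Data.Nat.Coprimality using (coprime-Bézout)
 open import Data.Nat.GCD using (module Bézout)
 open import Data.Sum using ([_,_]′)
 open import Relation.Nullary.Decidable using (map′)

 cong? : ∀ m a b -> Dec (Cong m a b)
 cong? m a b = map′ (\ { (ZD.divides q e) -> cong-by q e }) (\ { (cong-by q e) -> ZD.divides q e }) (+ m ZD.∣? (a - b))

 Zero : ℕ -> ℤ -> Set
 Zero m z = Cong m z 0#

 zero-by : ∀ {m z} q -> z ≡ q * + m -> Zero m z
 zero-by {z = z} q e = cong-by q (Z.+-identityʳ z & e)

 zero-quotient : ∀ {m z} -> Zero m z -> ∃ \ q -> z ≡ q * + m
 zero-quotient {z = z} (cong-by q e) = q , sym (Z.+-identityʳ z) & e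

 zero1 : ∀ {m z X} k -> X ≡ k * z -> Zero m z -> Zero m X
 zero1 {m} {z} {X} k e h with zero-quotient h
 ... | q , refl = zero-by (k * q) (e & sym (Z.*-assoc k q (+ m)))

 zero2 : ∀ {m z w X} k l -> X ≡ k * z + l * w -> Zero m z -> Zero m w -> Zero m X
 zero2 {m} k l e h h' with zero-quotient h | zero-quotient h'
 ... | q , refl | r , refl = zero-by (k * q + l * r) (e & lemma k q l r (+ m)) where
  lemma : ∀ k q l r m -> k * (q * m) + l * (r * m) ≡ (k * q + l * r) * m
  lemma = ring

 zero-minus : ∀ {m a b} -> Cong m a b -> Zero m (a - b)
 zero-minus (cong-by q e) = zero-by q e

 minus-zero : ∀ {m a b} -> Zero m (a - b) -> Cong m a b
 minus-zero {a = a} {b} h = let q , e = zero-quotient h in cong-by q e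

 module ModPrime (p' : ℕ) (prime : Prime (suc p')) (odd-p : suc p' ≢ 2) where
  p : ℕ
  p = suc p'

  open Congruence p using (≡C; Cong-sym; _>>_; Cong-+; Cong-*; Cong-neg)

  zero⇒∣ : ∀ {z} -> Zero p z -> p ND.∣ ∣ z ∣
  zero⇒∣ h = let q , e = zero-quotient h in ZD.∣⇒∣ᵤ (ZD.divides q e)

  ∣⇒zero : ∀ {z} -> p ND.∣ ∣ z ∣ -> Zero p z
  ∣⇒zero {z} h with ZD.∣ᵤ⇒∣ {+ p} {z} h
  ... | ZD.divides q e = zero-by q e

  euclid : ∀ a b -> Zero p (a * b) -> Zero p a ⊎ Zero p b
  euclid a b h with euclidsLemma ∣ a ∣ ∣ b ∣ prime (subst (p ND.∣_) (Z.abs-* a b) (zero⇒∣ h))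
  ... | inl l = inl (∣⇒zero l)
  ... | inr r = inr (∣⇒zero r)

  euclid-¬ : ∀ a b -> ¬ Zero p a -> Zero p (a * b) -> Zero p b
  euclid-¬ a b na h with euclid a b h
  ... | inl l = ⊥-elim (na l)
  ... | inr r = r

  ¬zero-* : ∀ a b -> ¬ Zero p a -> ¬ Zero p b -> ¬ Zero p (a * b)
  ¬zero-* a b na nb h = nb (euclid-¬ a b na h)

  p>1 : 1 N.< p
  p>1 = N.nonTrivial⇒n>1 p {{prime⇒nonTrivial prime}}

  ¬zero-1 : ¬ Zero p 1#
  ¬zero-1 h = N.<⇒≱ p>1 (ND.∣⇒≤ (zero⇒∣ h))

  ¬zero-2 : ¬ Zero p (+ 2)
  ¬zero-2 h = odd-p (N.≤-antisym (ND.∣⇒≤ (zero⇒∣ h)) p>1)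

  inverse : ∀ a -> ¬ Zero p a -> ∃ \ u -> Cong p (u * a) 1#
  inverse a na = signed a (coprime-Bézout coprime) where
   coprime : Coprime p ∣ a ∣
   coprime (d∣p , d∣a) with prime⇒irreducible prime d∣p
   ... | inl e    = e
   ... | inr refl = ⊥-elim (na (∣⇒zero d∣a))
   signed : ∀ a -> Bézout.Identity 1 p ∣ a ∣ -> ∃ \ u -> Cong p (u * a) 1#
   signed (+ n)    b = natural' n b where
    natural' : ∀ n -> Bézout.Identity 1 p n -> ∃ \ u -> Cong p (u * + n) 1#
    natural' n (Bézout.+- x y e) = - + y , cong-by (- + x) (l (+ y) (+ n) & cong -_ (cong (_+_ 1#) (sym (Z.pos-* y n)) &
      sym (Z.pos-+ 1 (y N.* n)) & cong +_ e & Z.pos-* x p) & Z.neg-distribˡ-* (+ x) (+ p)) where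
     l : ∀ y a -> (- y) * a - 1# ≡ - (1# + y * a)
     l = ring
    natural' n (Bézout.-+ x y e) = + y , cong-by (+ x) (cong (_- 1#) (sym (Z.pos-* y n) & cong +_ (sym e) & Z.pos-+ 1 (x N.* p) & cong (_+_ 1#) (Z.pos-* x p)) &
      l (+ x * + p)) where
     l : ∀ x -> 1# + x - 1# ≡ x
     l = ring
   signed -[1+ n ] b = let u , h = signed (+ suc n) b in - u , ≡C (l u (+ suc n)) >> h where
    l : ∀ u a -> (- u) * (- a) ≡ u * a
    l = ring

  res : ℤ -> ℕ
  res z = z %ℕ p

  res< : ∀ z -> res z N.< p
  res< z = n%ℕd<d z p

  res-cong : ∀ z -> Cong p z (+ res z)
  res-cong z = cong-by (z /ℕ p) (cong (_- + res z) (a≡a%ℕn+[a/ℕn]*n z p) & l (+ res z) ((z /ℕ p) * + p)) where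
   l : ∀ r q -> r + q - r ≡ q
   l = ring

  small-unique : ∀ i j -> i N.< p -> j N.< p -> Cong p (+ i) (+ j) -> i ≡ j
  small-unique i j i<p j<p h = Z.+-injective (Z.i-j≡0⇒i≡j (+ i) (+ j) (Z.∣i∣≡0⇒i≡0 (small ∣ + i - + j ∣ bound (zero⇒∣ (zero-minus h))))) where
   small : ∀ n -> n N.< p -> p ND.∣ n -> n ≡ 0
   small zero    _   _ = refl
   small (suc n) n<p d = ⊥-elim (N.<⇒≱ n<p (ND.∣⇒≤ d))
   bound : ∣ + i - + j ∣ N.< p
   bound = subst (N._< p) (cong ∣_∣ (sym (Z.m-n≡m⊖n i j))) (N.≤-<-trans (Z.∣m⊝n∣≤m⊔n i j) (N.⊔-lub i<p j<p))

  res-unique : ∀ z k -> k N.< p -> Cong p z (+ k) -> res z ≡ k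
  res-unique z k k<p h = small-unique (res z) k (res< z) k<p (Cong-sym (res-cong z) >> h)

  count : {R : ℕ -> Set} -> (∀ j -> Dec (R j)) -> ℤ
  count R? = ∑ (below p) (\ j -> 𝟙 (R? j))

  count-one : {R : ℕ -> Set} (R? : ∀ j -> Dec (R j)) -> ∀ i -> i N.< p -> R i -> (∀ j -> j N.< p -> R j -> j ≡ i) -> count R? ≡ 1#
  count-one R? i i<p ri only = sym (∑-𝟙 (below p) R? {\ _ -> 1#} & ∑-cong (below p) (\ j _ -> Z.*-identityʳ (𝟙 (R? j)))) &
   ∑-single (below p ↾ R?) i (i<p , ri) (\ { j (j<p , rj) -> only j j<p rj })

  count-none : {R : ℕ -> Set} (R? : ∀ j -> Dec (R j)) -> (∀ j -> ¬ R j) -> count R? ≡ 0#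
  count-none R? n = ∑-0 (below p) (\ j _ -> 𝟙-no (R? j) (n j))

  count-iff : {R S : ℕ -> Set} (R? : ∀ j -> Dec (R j)) (S? : ∀ j -> Dec (S j)) -> (∀ j -> R j -> S j) -> (∀ j -> S j -> R j) -> count R? ≡ count S?
  count-iff R? S? f g = ∑-cong (below p) (\ j _ -> 𝟙-cong (R? j) (S? j) (f j) (g j))

  count-affine : {S : ℤ -> Set} (S? : ∀ z -> Dec (S z)) -> (∀ {a b} -> Cong p a b -> S a -> S b) ->
   ∀ u w -> ¬ Zero p u -> count (\ j -> S? (u * + j + w)) ≡ count (\ j -> S? (+ j))
  count-affine S? resp u w nu = ∑-reindex (below p) (below p) (\ j -> res (u * + j + w)) (\ x -> res (ū * (+ x - w)))
   {\ j -> 𝟙 (S? (u * + j + w))} {\ x -> 𝟙 (S? (+ x))}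
   (\ j _ -> res< (u * + j + w)) (\ x _ -> res< (ū * (+ x - w)))
   (\ j j<p -> res-unique _ j j<p (Cong-* (≡C {ū} refl) (Cong-+ (Cong-sym (res-cong (u * + j + w))) (≡C { - w} refl)) >>
    ≡C (l1 ū u (+ j) w) >> Cong-* uu (≡C {+ j} refl) >> ≡C (Z.*-identityˡ (+ j))))
   (\ x x<p -> res-unique _ x x<p (Cong-+ (Cong-* (≡C {u} refl) (Cong-sym (res-cong (ū * (+ x - w))))) (≡C {w} refl) >>
    ≡C (l2 ū u (+ x) w) >> Cong-+ (Cong-* uu (≡C {+ x - w} refl)) (≡C {w} refl) >> ≡C (l3 (+ x) w)))
   (\ j _ -> 𝟙-cong (S? (+ res (u * + j + w))) (S? (u * + j + w)) (resp (Cong-sym (res-cong (u * + j + w)))) (resp (res-cong (u * + j + w)))) where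
   ū = fst (inverse u nu)
   uu = snd (inverse u nu)
   l1 : ∀ v u j w -> v * (u * j + w - w) ≡ v * u * j
   l1 = ring
   l2 : ∀ v u x w -> u * (v * (x - w)) + w ≡ v * u * (x - w) + w
   l2 = ring
   l3 : ∀ x w -> 1# * (x - w) + w ≡ x
   l3 = ring

  root? : ∀ D z -> Dec (Cong p (z * z) D)
  root? D z = cong? p (z * z) D

  -- One more than the Legendre symbol: `roots D - 1` stands for the symbol throughout.
  roots : ℤ -> ℤ
  roots D = count (\ x -> root? D (+ x))

  roots-two : ∀ D s -> ¬ Zero p s -> Cong p (s * s) D -> roots D ≡ + 2
  roots-two D s ns h = sym (∑-𝟙 (below p) (\ x -> root? D (+ x)) {\ _ -> 1#} & ∑-cong (below p) (\ j _ -> Z.*-identityʳ (𝟙 (root? D (+ j))))) &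
   ∑-split (below p ↾ \ x -> root? D (+ x)) (\ x -> x N.≟ res s) & cong2 _+_
    (∑-single ((below p ↾ \ x -> root? D (+ x)) ↾ \ x -> x N.≟ res s) (res s)
     ((res< s , Cong-* (Cong-sym (res-cong s)) (Cong-sym (res-cong s)) >> h) , refl) (\ { x (_ , e) -> e }))
    (∑-single ((below p ↾ \ x -> root? D (+ x)) ↾ _) (res (- s))
     ((res< (- s) , Cong-* (Cong-sym (res-cong (- s))) (Cong-sym (res-cong (- s))) >> ≡C (l0 s) >> h) , distinct) only) where
   l0 : ∀ s -> (- s) * (- s) ≡ s * s
   l0 = ring
   distinct : ¬ (res (- s) ≡ res s)
   distinct e = ¬zero-* (+ 2) s ¬zero-2 ns (≡C (l s) >> zero-minus (res-cong s >> ≡C (cong +_ (sym e)) >> Cong-sym (res-cong (- s)))) where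
    l : ∀ s -> + 2 * s ≡ s - (- s)
    l = ring
   only : ∀ x -> (x N.< p × Cong p (+ x * + x) D) × ¬ (x ≡ res s) -> x ≡ res (- s)
   only x ((x<p , hx) , ne) with euclid (+ x - s) (+ x + s) (≡C (l (+ x) s) >> zero-minus (hx >> Cong-sym h)) where
    l : ∀ x s -> (x - s) * (x + s) ≡ x * x - s * s
    l = ring
   ... | inl z = ⊥-elim (ne (sym (res-unique s x x<p (Cong-sym (minus-zero z)))))
   ... | inr z = sym (res-unique (- s) x x<p (minus-zero (zero1 (- 1#) (l s (+ x)) z))) where
    l : ∀ s x -> (- s) - x ≡ - 1# * (x + s)
    l = ring

  roots-none : ∀ D -> (∀ z -> ¬ Cong p (z * z) D) -> roots D ≡ 0#
  roots-none D n = count-none (\ x -> root? D (+ x)) (\ x -> n (+ x))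

  pp : ℕ
  pp = p N.* p

  +pp : + pp ≡ + p * + p
  +pp = Z.pos-* p p

  zero²-intro : ∀ {z} -> Zero p z -> Zero pp (z * + p)
  zero²-intro h = let q , e = zero-quotient h in zero-by q (cong (_* + p) e & Z.*-assoc q (+ p) (+ p) & cong (_*_ q) (sym +pp))

  zero²-elim : ∀ {z} -> Zero pp (z * + p) -> Zero p z
  zero²-elim {z} h = let q , e = zero-quotient h in zero-by q (Z.*-cancelʳ-≡ z (q * + p) (+ p) (e & cong (_*_ q) +pp & sym (Z.*-assoc q (+ p) (+ p))))

  zero²⇒zero : ∀ {z} -> Zero pp z -> Zero p z
  zero²⇒zero h = let q , e = zero-quotient h in zero-by (q * + p) (e & cong (_*_ q) +pp & sym (Z.*-assoc q (+ p) (+ p)))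

  zero²-cancel : ∀ k z -> ¬ Zero p k -> Zero pp (k * z) -> Zero pp z
  zero²-cancel k z nk h with zero-quotient (euclid-¬ k z nk (zero²⇒zero h))
  ... | z' , refl = zero²-intro (euclid-¬ k z' nk (zero²-elim (Congruence.Cong-trans pp (Congruence.≡C pp (Z.*-assoc k z' (+ p))) h)))

  -- The sublattices of index p on which p² divides a form (a , b , c).
  At∞ : ℤ -> ℤ -> ℤ -> Set
  At∞ a b c = Zero pp a × Zero p b

  At : ℤ -> ℤ -> ℤ -> ℕ -> Set
  At a b c j = Zero p (b - + 2 * a * + j) × Zero pp (c - b * + j + a * (+ j * + j))

  Scaled : ℤ -> ℤ -> ℤ -> Set
  Scaled a b c = Zero p a × Zero p b × Zero p c

  open import Relation.Nullary.Decidable using (_×-dec_)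

  zero? : ∀ m z -> Dec (Zero m z)
  zero? m z = cong? m z 0#

  at∞? : ∀ a b c -> Dec (At∞ a b c)
  at∞? a b c = zero? pp a ×-dec zero? p b

  at? : ∀ a b c j -> Dec (At a b c j)
  at? a b c j = zero? p (b - + 2 * a * + j) ×-dec zero? pp (c - b * + j + a * (+ j * + j))

  scaled? : ∀ a b c -> Dec (Scaled a b c)
  scaled? a b c = zero? p a ×-dec zero? p b ×-dec zero? p c

  zero-p : ∀ k -> Zero p (k * + p)
  zero-p k = zero-by k refl

  private
   -- Modulo p the form is a constant times the square of a linear form; as p does not divide a, its
   -- zero is the single residue b/(2a).
   multiplicity1 : ∀ a b c D -> ¬ Zero p a -> b * b - + 4 * (a * c) ≡ + p * + p * D ->
    𝟙 (at∞? a b c) + count (at? a b c) ≡ 1# + (roots D - 1#) * 𝟙 (scaled? a b c)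
   multiplicity1 a b c D na disc = cong2 _+_ (𝟙-no (at∞? a b c) (\ { (h , _) -> na (zero²⇒zero h) }))
     (count-one (at? a b c) j0 (res< (u * b)) here only) &
    sym (cong (\ z -> 1# + (roots D - 1#) * z) (𝟙-no (scaled? a b c) (na ∘ fst)) & cong (_+_ 1#) (Z.*-zeroʳ (roots D - 1#))) where
    n2a : ¬ Zero p (+ 2 * a)
    n2a = ¬zero-* (+ 2) a ¬zero-2 na
    n4a : ¬ Zero p (+ 2 * (+ 2 * a))
    n4a = ¬zero-* (+ 2) (+ 2 * a) ¬zero-2 n2a
    u = fst (inverse (+ 2 * a) n2a)
    uu = snd (inverse (+ 2 * a) n2a)
    j0 = res (u * b)
    first : Zero p (b - + 2 * a * + j0)
    first = zero-minus (Cong-sym (Cong-* (≡C {+ 2 * a} refl) (Cong-sym (res-cong (u * b))) >>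
     ≡C (l u (+ 2 * a) b) >> Cong-* uu (≡C {b} refl) >> ≡C (Z.*-identityˡ b))) where
     l : ∀ u a b -> a * (u * b) ≡ u * a * b
     l = ring
    -- 4a(c - bj + aj²) = (b - 2aj)² - p²D, so divisibility of b - 2aj by p already gives the
    -- condition modulo p².
    second : ∀ j -> Zero p (b - + 2 * a * + j) -> Zero pp (c - b * + j + a * (+ j * + j))
    second j h with zero-quotient h
    ... | q , e = zero²-cancel (+ 2 * (+ 2 * a)) _ n4a (zero-by (q * q - D) (l1 a b c (+ j) & cong2 (\ y z -> y * y - z) e disc & l2 q (+ p) D & cong (_*_ (q * q - D)) (sym +pp))) where
     l1 : ∀ a b c j -> + 2 * (+ 2 * a) * (c - b * j + a * (j * j)) ≡ (b - + 2 * a * j) * (b - + 2 * a * j) - (b * b - + 4 * (a * c))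
     l1 = ring
     l2 : ∀ q p D -> q * p * (q * p) - p * p * D ≡ (q * q - D) * (p * p)
     l2 = ring
    here : At a b c j0
    here = first , second j0 first
    only : ∀ j -> j N.< p -> At a b c j -> j ≡ j0
    only j j<p (h , _) = small-unique j j0 j<p (res< (u * b)) (minus-zero (euclid-¬ (+ 2 * a) (+ j - + j0) n2a
     (zero2 (- 1#) 1# (l (+ 2 * a) b (+ j) (+ j0)) h first))) where
     l : ∀ a b j k -> a * (j - k) ≡ - 1# * (b - a * j) + 1# * (b - a * k)
     l = ring
   zero-b : ∀ a' b c D -> b * b - + 4 * (a' * + p * c) ≡ + p * + p * D -> Zero p b
   zero-b a' b c D disc = [ id , id ]′ (euclid b b (zero2 (+ 4 * c) (+ p * D)
     (l b (a' * + p) c & cong (_+ + 4 * (a' * + p * c)) disc & l2 (+ p) D a' c) (zero-p a') (zero-by 1# (sym (Z.*-identityˡ (+ p)))))) where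
    l : ∀ b a c -> b * b ≡ b * b - + 4 * (a * c) + + 4 * (a * c)
    l = ring
    l2 : ∀ p D a c -> p * p * D + + 4 * (a * p * c) ≡ + 4 * c * (a * p) + p * D * p
    l2 = ring
   -- The double zero modulo p now lies at infinity, and the discriminant improves p | a to p² | a.
   multiplicity2 : ∀ a' b c D -> ¬ Zero p c -> b * b - + 4 * (a' * + p * c) ≡ + p * + p * D ->
    𝟙 (at∞? (a' * + p) b c) + count (at? (a' * + p) b c) ≡ 1# + (roots D - 1#) * 𝟙 (scaled? (a' * + p) b c)
   multiplicity2 a' b c D nc disc = cong2 _+_ (𝟙-yes (at∞? (a' * + p) b c) (zero²-intro za' , zb)) (count-none (at? (a' * + p) b c) none) &
    sym (cong (\ z -> 1# + (roots D - 1#) * z) (𝟙-no (scaled? (a' * + p) b c) (\ { (_ , _ , h) -> nc h })) & cong (_+_ 1#) (Z.*-zeroʳ (roots D - 1#))) where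
    zb = zero-b a' b c D disc
    za = zero-p a'
    b' = fst (zero-quotient zb)
    be = snd (zero-quotient zb)
    za' : Zero p a'
    za' = euclid-¬ (+ 2 * (+ 2 * c)) a' (¬zero-* (+ 2) (+ 2 * c) ¬zero-2 (¬zero-* (+ 2) c ¬zero-2 nc))
     (zero-by (b' * b' - D) (Z.*-cancelʳ-≡ (+ 2 * (+ 2 * c) * a') ((b' * b' - D) * + p) (+ p) (l1 a' b c (+ p) & cong2 (\ y z -> y * y - z) be disc & l2 b' (+ p) D))) where
     l1 : ∀ a b c p -> + 2 * (+ 2 * c) * a * p ≡ b * b - (b * b - + 4 * (a * p * c))
     l1 = ring
     l2 : ∀ b p D -> b * p * (b * p) - p * p * D ≡ (b * b - D) * p * p
     l2 = ring
    none : ∀ j -> ¬ At (a' * + p) b c j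
    none j (_ , h) = nc (zero2 1# 1# (l c b (a' * + p) (+ j)) (zero²⇒zero h) (zero2 (+ j) (- (+ j * + j)) refl zb za)) where
     l : ∀ c b a j -> c ≡ 1# * (c - b * j + a * (j * j)) + 1# * (j * b + (- (j * j)) * a)
     l = ring
   -- Division by p gives a form of discriminant D, prime to p. The sublattices are its zeros on the
   -- projective line over the field with p elements: one at infinity and one finite if p divides
   -- the new a, otherwise the roots found by completing the square.
   multiplicity3 : ∀ a' b c' D -> ¬ Zero p D -> b * b - + 4 * (a' * + p * (c' * + p)) ≡ + p * + p * D ->
    𝟙 (at∞? (a' * + p) b (c' * + p)) + count (at? (a' * + p) b (c' * + p)) ≡ 1# + (roots D - 1#) * 𝟙 (scaled? (a' * + p) b (c' * + p))
   multiplicity3 a' b c' D nD disc = C (zero? p a') & sym (cong (\ z -> 1# + (roots D - 1#) * z) (𝟙-yes (scaled? (a' * + p) b (c' * + p)) (za , zb , zc)) & l (roots D)) where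
    zb = zero-b a' b (c' * + p) D disc
    za = zero-p a'
    zc = zero-p c'
    b' = fst (zero-quotient zb)
    be = snd (zero-quotient zb)
    l : ∀ r -> 1# + (r - 1#) * 1# ≡ r
    l = ring
    disc' : b' * b' - + 4 * (a' * c') ≡ D
    disc' = Z.*-cancelˡ-≡ (+ p * + p) _ _ (l1 a' b' c' (+ p) & cong (\ z -> z * z - + 4 * (a' * + p * (c' * + p))) (sym be) & disc) where
     l1 : ∀ a b c p -> p * p * (b * b - + 4 * (a * c)) ≡ b * p * (b * p) - + 4 * (a * p * (c * p))
     l1 = ring
    Lin : ℕ -> Set
    Lin j = Zero p (c' - b' * + j + a' * (+ j * + j))
    lin? : ∀ j -> Dec (Lin j)
    lin? j = zero? p (c' - b' * + j + a' * (+ j * + j))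
    at⇔lin : count (at? (a' * + p) b (c' * + p)) ≡ count lin?
    at⇔lin = count-iff (at? (a' * + p) b (c' * + p)) lin?
     (\ j h -> zero²-elim (Congruence.Cong-trans pp (Congruence.≡C pp (eq j)) (snd h)))
     (\ j h -> zero2 1# (- (+ 2 * + j)) (l3 b (a' * + p) (+ j)) zb za , Congruence.Cong-trans pp (Congruence.≡C pp (sym (eq j))) (zero²-intro h)) where
     l2 : ∀ a b c p j -> (c - b * j + a * (j * j)) * p ≡ c * p - b * p * j + a * p * (j * j)
     l2 = ring
     l3 : ∀ b a j -> b - + 2 * a * j ≡ 1# * b + (- (+ 2 * j)) * a
     l3 = ring
     eq : ∀ j -> (c' - b' * + j + a' * (+ j * + j)) * + p ≡ c' * + p - b * + j + a' * + p * (+ j * + j)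
     eq j = l2 a' b' c' (+ p) (+ j) & cong (\ z -> c' * + p - z * + j + a' * + p * (+ j * + j)) (sym be)
    C : Dec (Zero p a') -> 𝟙 (at∞? (a' * + p) b (c' * + p)) + count (at? (a' * + p) b (c' * + p)) ≡ roots D
    C (yes za') = cong2 _+_ (𝟙-yes (at∞? (a' * + p) b (c' * + p)) (zero²-intro za' , zb)) (at⇔lin & count-one lin? j0 (res< (u * c')) here only) &
     sym (roots-two D b' nb' square) where
     square : Cong p (b' * b') D
     square = minus-zero (zero1 (+ 4 * c') (cong (\ z -> b' * b' - z) (sym disc') & l3 b' a' c') za') where
      l3 : ∀ b a c -> b * b - (b * b - + 4 * (a * c)) ≡ + 4 * c * a
      l3 = ring
     nb' : ¬ Zero p b'
     nb' h = nD (Cong-sym square >> zero1 b' refl h)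
     u = fst (inverse b' nb')
     uu = snd (inverse b' nb')
     j0 = res (u * c')
     bj0 : Zero p (c' - b' * + j0)
     bj0 = zero-minus (Cong-sym (Cong-* (≡C {b'} refl) (Cong-sym (res-cong (u * c'))) >>
      ≡C (l4 u b' c') >> Cong-* uu (≡C {c'} refl) >> ≡C (Z.*-identityˡ c'))) where
      l4 : ∀ u a b -> a * (u * b) ≡ u * a * b
      l4 = ring
     here : Lin j0
     here = zero2 1# (+ j0 * + j0) (l5 (c' - b' * + j0) a' (+ j0)) bj0 za' where
      l5 : ∀ z a j -> z + a * (j * j) ≡ 1# * z + j * j * a
      l5 = ring
     only : ∀ j -> j N.< p -> Lin j -> j ≡ j0
     only j j<p h = small-unique j j0 j<p (res< (u * c')) (minus-zero (euclid-¬ b' (+ j - + j0) nb'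
      (zero2 1# 1# (l6 b' c' a' (+ j) (+ j0)) bj0 (zero2 (- 1#) (+ j * + j) refl h za')))) where
      l6 : ∀ b c a j k -> b * (j - k) ≡ 1# * (c - b * k) + 1# * (- 1# * (c - b * j + a * (j * j)) + j * j * a)
      l6 = ring
    C (no na') = cong2 _+_ (𝟙-no (at∞? (a' * + p) b (c' * + p)) (\ { (h , _) -> na' (zero²-elim h) })) (at⇔lin &
      count-iff lin? (\ j -> root? D (+ 2 * a' * + j + (- b'))) (\ j h -> minus-zero (zero1 (+ 4 * a') (complete-square j) h))
       (\ j h -> euclid-¬ (+ 2 * (+ 2 * a')) _ (¬zero-* (+ 2) (+ 2 * a') ¬zero-2 (¬zero-* (+ 2) a' ¬zero-2 na')) (zero1 1# (l7 a' _ & sym (complete-square j) & sym (Z.*-identityˡ _)) (zero-minus h))) &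
       count-affine (root? D) (\ e h -> Cong-sym (Cong-* e e) >> h) (+ 2 * a') (- b') (¬zero-* (+ 2) a' ¬zero-2 na')) &
     Z.+-identityˡ (roots D) where
     l7 : ∀ a z -> + 2 * (+ 2 * a) * z ≡ + 4 * a * z
     l7 = ring
     complete-square : ∀ j -> (+ 2 * a' * + j + (- b')) * (+ 2 * a' * + j + (- b')) - D ≡ + 4 * a' * (c' - b' * + j + a' * (+ j * + j))
     complete-square j = cong (\ z -> (+ 2 * a' * + j + (- b')) * (+ 2 * a' * + j + (- b')) - z) (sym disc') & l8 a' b' c' (+ j) where
      l8 : ∀ a b c j -> (+ 2 * a * j + (- b)) * (+ 2 * a * j + (- b)) - (b * b - + 4 * (a * c)) ≡ + 4 * a * (c - b * j + a * (j * j))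
      l8 = ring

  -- A form prime to p is counted once and a multiple of p is counted `roots D` times. This
  -- difference is the source of the Legendre symbol in the Hecke relation.
  multiplicity : ∀ a b c D -> ¬ Zero p D -> b * b - + 4 * (a * c) ≡ + p * + p * D ->
   𝟙 (at∞? a b c) + count (at? a b c) ≡ 1# + (roots D - 1#) * 𝟙 (scaled? a b c)
  multiplicity a b c D nD disc = go a c (zero? p a) (zero? p c) disc where
   go : ∀ a c -> Dec (Zero p a) -> Dec (Zero p c) -> b * b - + 4 * (a * c) ≡ + p * + p * D ->
    𝟙 (at∞? a b c) + count (at? a b c) ≡ 1# + (roots D - 1#) * 𝟙 (scaled? a b c)
   go a c (no na) _ disc = multiplicity1 a b c D na disc
   go a c (yes za) (no nc) disc = go2 (zero-quotient za) disc where
    go2 : ∀ {a} -> ∃ (\ q -> a ≡ q * + p) -> b * b - + 4 * (a * c) ≡ + p * + p * D ->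
     𝟙 (at∞? a b c) + count (at? a b c) ≡ 1# + (roots D - 1#) * 𝟙 (scaled? a b c)
    go2 (a' , refl) disc = multiplicity2 a' b c D nc disc
   go a c (yes za) (yes zc) disc = go3 (zero-quotient za) (zero-quotient zc) disc where
    go3 : ∀ {a c} -> ∃ (\ q -> a ≡ q * + p) -> ∃ (\ q -> c ≡ q * + p) -> b * b - + 4 * (a * c) ≡ + p * + p * D ->
     𝟙 (at∞? a b c) + count (at? a b c) ≡ 1# + (roots D - 1#) * 𝟙 (scaled? a b c)
    go3 (a' , refl) (c' , refl) disc = multiplicity3 a' b c' D nD disc

-- The Hecke operator at p² on sums over forms.

module HeckeCounting where
 open PrimeModulus public
 open Theta public

 val : ℤ -> ℤ -> Triple -> ℤ
 val j p (a , b , c) = a * (j * j) + b * (j * p) + c * (p * p)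

 disc : Triple -> ℤ
 disc (a , b , c) = b * b - + 4 * (a * c)

 triple-≡ : ∀ {a a' b b' c c' : ℤ} -> a ≡ a' -> b ≡ b' -> c ≡ c' -> (a , b , c) ≡ (a' , b' , c')
 triple-≡ refl refl refl = refl

 IsForm : ℕ -> ℤ -> ℤ -> Triple -> Set
 IsForm D j p Q = disc Q ≡ + D × fst Q < 0# × 0# < val j p Q

 val01 : ∀ Q -> val 0# 1# Q ≡ snd (snd Q)
 val01 (a , b , c) = l a b c where
  l : ∀ a b c -> a * (0# * 0#) + b * (0# * 1#) + c * (1# * 1#) ≡ c
  l = ring

 private
  -- (2aj + bp)² - 4a Q(j , p) = disc(Q) p², where the sign conditions make -4a and Q(j , p)
  -- positive.
  form-bounds : ∀ D j p Q -> p ≢ 0# -> IsForm D j p Q -> let M = D N.* (∣ p ∣ N.* ∣ p ∣); B = M N.+ 2 N.* (M N.* ∣ j ∣) in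
   ∣ fst Q ∣ N.≤ M × ∣ fst (snd Q) ∣ N.≤ B × ∣ snd (snd Q) ∣ N.≤ M N.+ M N.* (∣ j ∣ N.* ∣ j ∣) N.+ B N.* (∣ j ∣ N.* ∣ p ∣)
  form-bounds D j p (a , b , c) p≢0 (d , a<0 , 0<q) = combine (square-bounds (+ 2 * a * j + b * p) u>0 0<q key) where
   M = D N.* (∣ p ∣ N.* ∣ p ∣)
   B = M N.+ 2 N.* (M N.* ∣ j ∣)
   q = val j p (a , b , c)
   u>0 : 0# < - (+ 4 * a)
   u>0 = 0<- (subst (+ 4 * a <_) (Z.*-zeroʳ (+ 4)) (Z.*-monoˡ-<-pos (+ 4) a<0))
   key : (+ 2 * a * j + b * p) * (+ 2 * a * j + b * p) + - (+ 4 * a) * q ≡ + M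
   key = l a b c j p & cong2 _*_ d (square-abs p) & sym (Z.pos-* D (∣ p ∣ N.* ∣ p ∣)) where
    l : ∀ a b c j p -> (+ 2 * a * j + b * p) * (+ 2 * a * j + b * p) + - (+ 4 * a) * (a * (j * j) + b * (j * p) + c * (p * p))
     ≡ (b * b - + 4 * (a * c)) * (p * p)
    l = ring
   combine : ∣ + 2 * a * j + b * p ∣ N.≤ M × ∣ - (+ 4 * a) ∣ N.≤ M × ∣ q ∣ N.≤ M -> _
   combine (bs , ba , bq) = a≤ , b≤ , c≤ where
    a≤ : ∣ a ∣ N.≤ M
    a≤ = ∣∣-divide (+ 4) a (\ ()) (subst (N._≤ M) (Z.∣-i∣≡∣i∣ (+ 4 * a)) ba)
    aj≤ : ∣ + 2 * (a * j) ∣ N.≤ 2 N.* (M N.* ∣ j ∣)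
    aj≤ = ∣∣-* (+ 2) (a * j) {B = M N.* ∣ j ∣} N.≤-refl (∣∣-* a j a≤ N.≤-refl)
    b≤ : ∣ b ∣ N.≤ B
    b≤ = ∣∣-divide p b p≢0 (subst (\ z -> ∣ z ∣ N.≤ B) (l a b j p) (∣∣-- (+ 2 * a * j + b * p) (+ 2 * (a * j)) bs aj≤)) where
     l : ∀ a b j p -> (+ 2 * a * j + b * p) - + 2 * (a * j) ≡ p * b
     l = ring
    c≤ : ∣ c ∣ N.≤ M N.+ M N.* (∣ j ∣ N.* ∣ j ∣) N.+ B N.* (∣ j ∣ N.* ∣ p ∣)
    c≤ = ∣∣-divide p c p≢0 (∣∣-divide p (p * c) p≢0 (subst (\ z -> ∣ z ∣ N.≤ M N.+ M N.* (∣ j ∣ N.* ∣ j ∣) N.+ B N.* (∣ j ∣ N.* ∣ p ∣)) (l a b c j p)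
     (∣∣-- (q - a * (j * j)) (b * (j * p)) (∣∣-- q (a * (j * j)) bq (∣∣-* a (j * j) a≤ (∣∣-* j j N.≤-refl N.≤-refl)))
      (∣∣-* b (j * p) b≤ (∣∣-* j p N.≤-refl N.≤-refl))))) where
     l : ∀ a b c j p -> (a * (j * j) + b * (j * p) + c * (p * p)) - a * (j * j) - b * (j * p) ≡ p * (p * c)
     l = ring

 -- The form (a , b , c) is a X² + b X Y + c Y², negative at (1 , 0) and positive at (j , p), with p = suc p'.
 abstract
  forms : ∀ D j p' -> Enum (IsForm D (+ j) (+ suc p'))
  forms D j p' = boxed _ _ _ (\ Q -> (disc Q ≟ + D) ×-dec (fst Q <? 0#) ×-dec (0# <? val (+ j) (+ suc p') Q))
   (\ Q -> form-bounds D (+ j) (+ suc p') Q (\ ()))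

 -- For (j , p) = (0 , 1) the value is the coefficient `c`, and these sums `A` are the ones wanted;
 -- other vectors arise when a form is pulled back to a sublattice of index p.
 G : (ℤ -> ℤ) -> ℕ -> ℕ -> ℕ -> ℕ -> ℤ
 G wt r D j p' = ∑ (forms D j p') (\ Q -> wt (fst Q) * val (+ j) (+ suc p') Q ^ r)

 A : (ℤ -> ℤ) -> ℕ -> ℕ -> ℤ
 A wt r D = G wt r D 0 0

 neg-*⁺ : ∀ n {a} -> 0 N.< n -> a < 0# -> a * + n < 0#
 neg-*⁺ (suc k) { -[1+ a ]} _ _ = -<+
 neg-*⁺ (suc k) {+ a} _ (+<+ ())

 neg-*⁻ : ∀ n a -> 0 N.< n -> a * + n < 0# -> a < 0#
 neg-*⁻ (suc k) -[1+ a ] _ _ = -<+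
 neg-*⁻ (suc k) (+ zero) _ (+<+ ())
 neg-*⁻ (suc k) (+ suc a) _ (+<+ ())

 pos-*⁺ : ∀ n {a} -> 0 N.< n -> 0# < a -> 0# < a * + n
 pos-*⁺ (suc k) {+ suc a} _ _ = +<+ 0<s
 pos-*⁺ (suc k) {+ zero} _ (+<+ ())

 pos-*⁻ : ∀ n a -> 0 N.< n -> 0# < a * + n -> 0# < a
 pos-*⁻ (suc k) (+ suc a) _ _ = +<+ 0<s
 pos-*⁻ (suc k) (+ zero) _ (+<+ ())

 ^-distrib-* : ∀ a b r -> (a * b) ^ r ≡ a ^ r * b ^ r
 ^-distrib-* a b zero    = refl
 ^-distrib-* a b (suc r) = cong (_*_ (a * b)) (^-distrib-* a b r) & l a b (a ^ r) (b ^ r) where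
  l : ∀ a b x y -> a * b * (x * y) ≡ a * x * (b * y)
  l = ring

 module Hecke (p' : ℕ) (prime : Prime (suc p')) (odd-p : suc p' ≢ 2) (wt : ℤ -> ℤ) (r : ℕ) (η : ℤ)
  (wt-square : ∀ a -> wt (a * (+ suc p' * + suc p')) ≡ wt a) (wt-scale : ∀ a -> wt (a * + suc p') ≡ η * wt a)
  (D : ℕ) (p∤D : ¬ Zero (suc p') (+ D)) where

  open ModPrime p' prime odd-p

  D' : ℕ
  D' = p N.* p N.* D

  private
   +D' : + D' ≡ + p * + p * + D
   +D' = Z.pos-* (p N.* p) D & cong (_* + D) (Z.pos-* p p)
   0<p : 0 N.< p
   0<p = s≤s z≤n
   0<pp : 0 N.< pp
   0<pp = s≤s z≤n
   E' = forms D' 0 0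
   v : Triple -> ℤ
   v Q = wt (fst Q) * val 0# 1# Q ^ r
   cancel-p² : ∀ {x y} -> + p * + p * x ≡ + p * + p * y -> x ≡ y
   cancel-p² {x} {y} e = Z.*-cancelˡ-≡ (+ p) x y (Z.*-cancelˡ-≡ (+ p) (+ p * x) (+ p * y)
    (sym (Z.*-assoc (+ p) (+ p) x) & e & Z.*-assoc (+ p) (+ p) y))
   cancel-p : ∀ {x y} -> x * + p ≡ y * + p -> x ≡ y
   cancel-p {x} {y} = Z.*-cancelʳ-≡ x y (+ p)
   cancel-pp : ∀ {x y} -> x * + pp ≡ y * + pp -> x ≡ y
   cancel-pp {x} {y} = Z.*-cancelʳ-≡ x y (+ pp)
   first : Triple -> ℤ
   first Q = fst Q
   second third : Triple -> ℤ
   second Q = fst (snd Q)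
   third Q = snd (snd Q)
   R∞? : ∀ Q -> Dec (At∞ (first Q) (second Q) (third Q))
   R∞? (a , b , c) = at∞? a b c
   R? : ∀ j Q -> Dec (At (first Q) (second Q) (third Q) j)
   R? j (a , b , c) = at? a b c j
   Rs? : ∀ Q -> Dec (Scaled (first Q) (second Q) (third Q))
   Rs? (a , b , c) = scaled? a b c
   sum∞ : ∑ (E' ↾ R∞?) v ≡ A wt r D
   sum∞ = sym (∑-bij (forms D 0 0) (E' ↾ R∞?) f {v} {v} to inj onto
    (\ { Q@(a , b , c) _ -> cong2 (\ y z -> y * z ^ r) (cong (\ z -> wt (a * z)) +pp & wt-square a) (val01 (f Q) & sym (val01 Q)) })) where
    f : Triple -> Triple
    f (a , b , c) = a * + pp , b * + p , c
    df : ∀ a b c -> disc (f (a , b , c)) ≡ + p * + p * disc (a , b , c)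
    df a b c = cong (\ z -> b * + p * (b * + p) - + 4 * (a * z * c)) +pp & l a b c (+ p) where
     l : ∀ a b c p -> b * p * (b * p) - + 4 * (a * (p * p) * c) ≡ p * p * (b * b - + 4 * (a * c))
     l = ring
    to : ∀ Q -> IsForm D 0# 1# Q -> IsForm D' 0# 1# (f Q) × At∞ (first (f Q)) (second (f Q)) (third (f Q))
    to Q@(a , b , c) (d , a<0 , 0<q) = (df a b c & cong (_*_ (+ p * + p)) d & (sym +D') , neg-*⁺ pp {a} 0<pp a<0
     , 0<≡ (val01 Q & sym (val01 (f Q))) 0<q) , zero-by a refl , zero-by b refl
    inj : ∀ Q R -> f Q ≡ f R -> Q ≡ R
    inj (a , b , c) (a' , b' , c') e = triple-≡ (cancel-pp {a} {a'} (cong first e)) (cancel-p {b} {b'} (cong second e)) (cong third e)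
    onto : ∀ Q -> IsForm D' 0# 1# Q × At∞ (first Q) (second Q) (third Q) -> ∃ \ R -> IsForm D 0# 1# R × f R ≡ Q
    onto Q@(a , b , c) ((d , a<0 , 0<q) , za , zb) = go (zero-quotient za) (zero-quotient zb) where
     go : ∃ (\ x -> a ≡ x * + pp) -> ∃ (\ y -> b ≡ y * + p) -> ∃ \ R -> IsForm D 0# 1# R × f R ≡ Q
     go (x , ea) (y , eb) = (x , y , c) , (cancel-p² {disc (x , y , c)} {+ D} (sym (df x y c) & cong disc e & d & +D')
      , neg-*⁻ pp x 0<pp (≡<0 ea a<0) , 0<≡ (val01 Q & sym (val01 (x , y , c))) 0<q) , e where
      e : f (x , y , c) ≡ Q
      e = triple-≡ (sym ea) (sym eb) refl
   -- A form of discriminant p²D that meets the condition at j is R(X + jY , pY) for a unique form R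
   -- of discriminant D. Its value at (0 , 1) is R(j , p), which is how the vector (j , p) enters.
   sum-j : ∀ j -> ∑ (E' ↾ R? j) v ≡ G wt r D j p'
   sum-j j = sym (∑-bij (forms D j p') (E' ↾ R? j) f {\ Q -> wt (first Q) * val (+ j) (+ p) Q ^ r} {v} to inj onto
    (\ { Q@(a , b , c) _ -> cong (\ z -> wt a * z ^ r) (val01 (f Q)) })) where
    f : Triple -> Triple
    f Q@(a , b , c) = a , + 2 * a * + j + b * + p , val (+ j) (+ p) Q
    df : ∀ a b c -> disc (f (a , b , c)) ≡ + p * + p * disc (a , b , c)
    df a b c = l a b c (+ j) (+ p) where
     l : ∀ a b c j p -> (+ 2 * a * j + b * p) * (+ 2 * a * j + b * p) - + 4 * (a * (a * (j * j) + b * (j * p) + c * (p * p)))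
      ≡ p * p * (b * b - + 4 * (a * c))
     l = ring
    l1 : ∀ a b j p -> + 2 * a * j + b * p - + 2 * a * j ≡ b * p
    l1 = ring
    l2 : ∀ a b c j p -> a * (j * j) + b * (j * p) + c * (p * p) - (+ 2 * a * j + b * p) * j + a * (j * j) ≡ c * (p * p)
    l2 = ring
    to : ∀ Q -> IsForm D (+ j) (+ p) Q -> IsForm D' 0# 1# (f Q) × At (first (f Q)) (second (f Q)) (third (f Q)) j
    to Q@(a , b , c) (d , a<0 , 0<q) = (df a b c & cong (_*_ (+ p * + p)) d & (sym +D') , a<0
     , 0<≡ (sym (val01 (f Q))) 0<q) , zero-by b (l1 a b (+ j) (+ p)) , zero-by c (l2 a b c (+ j) (+ p) & cong (_*_ c) (sym +pp))
    inj : ∀ Q R -> f Q ≡ f R -> Q ≡ R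
    inj (a , b , c) (a' , b' , c') e with cong first e
    ... | refl with cancel-p {b} {b'} (sym (l1 a b (+ j) (+ p)) & cong (_- + 2 * a * + j) (cong second e) & l1 a b' (+ j) (+ p))
    ... | refl = triple-≡ refl refl (cancel-pp {c} {c'} (cong (_*_ c) +pp & sym (l2 a b c (+ j) (+ p)) &
      cong (\ z -> z - (+ 2 * a * + j + b * + p) * + j + a * (+ j * + j)) (cong third e) & l2 a b c' (+ j) (+ p) & cong (_*_ c') (sym +pp)))
    onto : ∀ Q -> IsForm D' 0# 1# Q × At (first Q) (second Q) (third Q) j -> ∃ \ R -> IsForm D (+ j) (+ p) R × f R ≡ Q
    onto Q@(a , b , c) ((d , a<0 , 0<q) , zb , zc) = go (zero-quotient zb) (zero-quotient zc) where
     go : ∃ (\ x -> b - + 2 * a * + j ≡ x * + p) -> ∃ (\ y -> c - b * + j + a * (+ j * + j) ≡ y * + pp) -> ∃ \ R -> IsForm D (+ j) (+ p) R × f R ≡ Q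
     go (x , eb) (y , ec) = (a , x , y) , (cancel-p² {disc (a , x , y)} {+ D} (sym (df a x y) & cong disc e & d & +D')
      , a<0 , 0<≡ (val01 Q & sym (cong third e)) 0<q) , e where
      second-e : + 2 * a * + j + x * + p ≡ b
      second-e = cong (_+_ (+ 2 * a * + j)) (sym eb) & l3 a b (+ j) where
       l3 : ∀ a b j -> + 2 * a * j + (b - + 2 * a * j) ≡ b
       l3 = ring
      third-e : val (+ j) (+ p) (a , x , y) ≡ c
      third-e = l4 a x y (+ j) (+ p) & cong2 (\ s t -> a * (+ j * + j) + s * + j + t) (sym eb) (cong (_*_ y) (sym +pp) & sym ec) & l5 a b c (+ j) where
       l4 : ∀ a x y j p -> a * (j * j) + x * (j * p) + y * (p * p) ≡ a * (j * j) + x * p * j + y * (p * p)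
       l4 = ring
       l5 : ∀ a b c j -> a * (j * j) + (b - + 2 * a * j) * j + (c - b * j + a * (j * j)) ≡ c
       l5 = ring
      e : f (a , x , y) ≡ Q
      e = triple-≡ refl second-e third-e
   sum-scaled : ∑ (E' ↾ Rs?) v ≡ η * (+ p) ^ r * A wt r D
   sum-scaled = sym (∑-bij (forms D 0 0) (E' ↾ Rs?) f {\ Q -> η * (+ p) ^ r * v Q} {v} to inj onto value) & ∑-* (forms D 0 0) (η * (+ p) ^ r) v where
    f : Triple -> Triple
    f (a , b , c) = a * + p , b * + p , c * + p
    value : ∀ Q -> IsForm D 0# 1# Q -> v (f Q) ≡ η * (+ p) ^ r * v Q
    value Q@(a , b , c) _ = cong2 (\ y z -> y * z ^ r) (wt-scale a) (val01 (f Q) & cong (_* + p) (sym (val01 Q))) &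
     cong (_*_ (η * wt a)) (^-distrib-* (val 0# 1# Q) (+ p) r) & l η (wt a) (val 0# 1# Q ^ r) ((+ p) ^ r) where
     l : ∀ η w x y -> η * w * (x * y) ≡ η * y * (w * x)
     l = ring
    df : ∀ a b c -> disc (f (a , b , c)) ≡ + p * + p * disc (a , b , c)
    df a b c = l a b c (+ p) where
     l : ∀ a b c p -> b * p * (b * p) - + 4 * (a * p * (c * p)) ≡ p * p * (b * b - + 4 * (a * c))
     l = ring
    to : ∀ Q -> IsForm D 0# 1# Q -> IsForm D' 0# 1# (f Q) × Scaled (first (f Q)) (second (f Q)) (third (f Q))
    to Q@(a , b , c) (d , a<0 , 0<q) = (df a b c & cong (_*_ (+ p * + p)) d & (sym +D') , neg-*⁺ p {a} 0<p a<0
     , 0<≡ (sym (val01 (f Q))) (pos-*⁺ p {c} 0<p (0<≡ (val01 Q) 0<q))) , zero-p a , zero-p b , zero-p c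
    inj : ∀ Q R -> f Q ≡ f R -> Q ≡ R
    inj (a , b , c) (a' , b' , c') e = triple-≡ (cancel-p {a} {a'} (cong first e)) (cancel-p {b} {b'} (cong second e)) (cancel-p {c} {c'} (cong third e))
    onto : ∀ Q -> IsForm D' 0# 1# Q × Scaled (first Q) (second Q) (third Q) -> ∃ \ R -> IsForm D 0# 1# R × f R ≡ Q
    onto Q@(a , b , c) ((d , a<0 , 0<q) , za , zb , zc) = go (zero-quotient za) (zero-quotient zb) (zero-quotient zc) where
     go : ∃ (\ x -> a ≡ x * + p) -> ∃ (\ y -> b ≡ y * + p) -> ∃ (\ z -> c ≡ z * + p) -> ∃ \ R -> IsForm D 0# 1# R × f R ≡ Q
     go (x , ea) (y , eb) (z , ec) = (x , y , z) , (cancel-p² {disc (x , y , z)} {+ D} (sym (df x y z) & cong disc e & d & +D')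
      , neg-*⁻ p x 0<p (≡<0 ea a<0) , 0<≡ (sym (val01 (x , y , z))) (pos-*⁻ p z 0<p (0<≡ (val01 Q & ec) 0<q))) , e where
      e : f (x , y , z) ≡ Q
      e = triple-≡ (sym ea) (sym eb) (sym ec)

  -- `multiplicity` is summed over the forms of discriminant p²D, and each sublattice is then
  -- evaluated on its own. The Hecke relation is thereby reduced to the sums `G` at the vectors (j ,
  -- p).
  hecke : A wt r D' + (roots (+ D) - 1#) * (η * (+ p) ^ r * A wt r D) ≡ A wt r D + ∑ (below p) (\ j -> G wt r D j p')
  hecke = cong (\ z -> A wt r D' + (roots (+ D) - 1#) * z) (sym sum-scaled & ∑-𝟙 E' Rs?) &
   cong (_+_ (A wt r D')) (sym (∑-* E' (roots (+ D) - 1#) _)) & sym (∑-+ E' _ _) & ∑-cong E' pointwise &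
   ∑-+ E' _ _ & cong2 _+_ (sym (∑-𝟙 E' R∞?) & sum∞) (∑-swap E' (below p) (\ Q j -> 𝟙 (R? j Q) * v Q) &
    ∑-cong (below p) (\ j _ -> sym (∑-𝟙 E' (R? j)) & sum-j j)) where
   pointwise : ∀ Q -> IsForm D' 0# 1# Q -> v Q + (roots (+ D) - 1#) * (𝟙 (Rs? Q) * v Q) ≡ 𝟙 (R∞? Q) * v Q + ∑ (below p) (\ j -> 𝟙 (R? j Q) * v Q)
   pointwise Q@(a , b , c) (d , _ , _) = l1 (v Q) (roots (+ D) - 1#) (𝟙 (Rs? Q)) & cong (_* v Q) (sym (multiplicity a b c (+ D) p∤D (d & +D'))) &
    Z.*-distribʳ-+ (v Q) (𝟙 (R∞? Q)) (count (at? a b c)) & cong (_+_ (𝟙 (R∞? Q) * v Q)) (sym (∑-*ʳ (below p) (v Q) (\ j -> 𝟙 (at? a b c j)))) where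
    l1 : ∀ v ρ s -> v + ρ * (s * v) ≡ (1# + ρ * s) * v
    l1 = ring

-- Substitutions, and reciprocity between the vectors (j , p) and (p , j).

module FormSums where
 open HeckeCounting public

 third : Triple -> ℤ
 third Q = snd (snd Q)

 Root : ℕ -> ℕ -> Set
 Root D f = 0 N.< f × f N.* f ≡ D

 rootsN : ∀ D -> Enum (Root D)
 rootsN D = within (below (suc D)) (\ f -> (0 N.<? f) ×-dec (f N.* f N.≟ D))
  (\ { (suc f) (_ , e) -> s≤s (subst (suc f N.≤_) e (N.m≤m*n (suc f) (suc f))) })

 self-negating : ∀ {z} -> z ≡ - z -> z ≡ 0#
 self-negating {+ zero}     _  = refl
 self-negating {+ suc n}    ()
 self-negating { -[1+ n ]}  ()

 -- The substitution X ↦ X + Y fixes the vector (1 , 0) and hence `a`, so it respects every weight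
 -- in `a` and the value.
 forms-shift : ∀ D (v : ℤ -> ℤ -> ℤ) j p' -> ∑ (forms D (j N.+ suc p') p') (\ Q -> v (fst Q) (val (+ (j N.+ suc p')) (+ suc p') Q)) ≡ ∑ (forms D j p') (\ Q -> v (fst Q) (val (+ j) (+ suc p') Q))
 forms-shift D v j p' = ∑-reindex (forms D (j N.+ suc p') p') (forms D j p') f f⁻¹ {\ Q -> v (fst Q) (val (+ (j N.+ suc p')) p Q)} {\ Q -> v (fst Q) (val (+ j) p Q)}
  (\ { Q@(a , b , c) (d , a<0 , q) -> disc-f Q & d , a<0 , 0<≡ (sym (val-f Q)) q })
  (\ { Q@(a , b , c) (d , a<0 , q) -> sym (disc-f (f⁻¹ Q)) & cong disc (f-f⁻¹ Q) & d , a<0 , 0<≡ (cong (val (+ j) p) (sym (f-f⁻¹ Q)) & val-f (f⁻¹ Q)) q })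
  (\ { (a , b , c) _ -> triple-≡ refl (l1 a b) (l2 a b c) }) (\ Q _ -> f-f⁻¹ Q) (\ Q _ -> cong (v (fst Q)) (val-f Q)) where
  p = + suc p'
  f f⁻¹ : Triple -> Triple
  f (a , b , c) = a , b + + 2 * a , a + b + c
  f⁻¹ (a , b , c) = a , b - + 2 * a , a - b + c
  l1 : ∀ a b -> (b + + 2 * a) - + 2 * a ≡ b
  l1 = ring
  l2 : ∀ a b c -> a - (b + + 2 * a) + (a + b + c) ≡ c
  l2 = ring
  f-f⁻¹ : ∀ Q -> f (f⁻¹ Q) ≡ Q
  f-f⁻¹ (a , b , c) = triple-≡ refl (l3 a b) (l4 a b c) where
   l3 : ∀ a b -> (b - + 2 * a) + + 2 * a ≡ b
   l3 = ring
   l4 : ∀ a b c -> a + (b - + 2 * a) + (a - b + c) ≡ c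
   l4 = ring
  disc-f : ∀ Q -> disc (f Q) ≡ disc Q
  disc-f (a , b , c) = l a b c where
   l : ∀ a b c -> (b + + 2 * a) * (b + + 2 * a) - + 4 * (a * (a + b + c)) ≡ b * b - + 4 * (a * c)
   l = ring
  val-f : ∀ Q -> val (+ j) p (f Q) ≡ val (+ (j N.+ suc p')) p Q
  val-f (a , b , c) = l a b c (+ j) p & cong (\ z -> val z p (a , b , c)) (sym (Z.pos-+ j (suc p'))) where
   l : ∀ a b c j p -> a * (j * j) + (b + + 2 * a) * (j * p) + (a + b + c) * (p * p) ≡ a * ((j + p) * (j + p)) + b * ((j + p) * p) + c * (p * p)
   l = ring

 forms-reflect : ∀ D (v : ℤ -> ℤ -> ℤ) i j p' -> i N.+ j ≡ suc p' -> ∑ (forms D i p') (\ Q -> v (fst Q) (val (+ i) (+ suc p') Q)) ≡ ∑ (forms D j p') (\ Q -> v (fst Q) (val (+ j) (+ suc p') Q))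
 forms-reflect D v i j p' e = ∑-reindex (forms D i p') (forms D j p') f f {\ Q -> v (fst Q) (val (+ i) p Q)} {\ Q -> v (fst Q) (val (+ j) p Q)}
  (\ { Q@(a , b , c) (d , a<0 , q) -> disc-f Q & d , a<0 , 0<≡ (sym (val-f i j e Q)) q })
  (\ { Q@(a , b , c) (d , a<0 , q) -> disc-f Q & d , a<0 , 0<≡ (sym (val-f j i (N.+-comm j i & e) Q)) q })
  (\ Q _ -> ff Q) (\ Q _ -> ff Q) (\ Q _ -> cong (v (fst Q)) (val-f i j e Q)) where
  p = + suc p'
  f : Triple -> Triple
  f (a , b , c) = a , - b - + 2 * a , a + b + c
  ff : ∀ Q -> f (f Q) ≡ Q
  ff (a , b , c) = triple-≡ refl (l1 a b) (l2 a b c) where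
   l1 : ∀ a b -> - (- b - + 2 * a) - + 2 * a ≡ b
   l1 = ring
   l2 : ∀ a b c -> a + (- b - + 2 * a) + (a + b + c) ≡ c
   l2 = ring
  disc-f : ∀ Q -> disc (f Q) ≡ disc Q
  disc-f (a , b , c) = l a b c where
   l : ∀ a b c -> (- b - + 2 * a) * (- b - + 2 * a) - + 4 * (a * (a + b + c)) ≡ b * b - + 4 * (a * c)
   l = ring
  val-f : ∀ i j -> i N.+ j ≡ suc p' -> ∀ Q -> val (+ j) p (f Q) ≡ val (+ i) p Q
  val-f i j e (a , b , c) = cong (\ z -> val (+ j) z (f (a , b , c))) pe & l a b c (+ i) (+ j) & cong (\ z -> val (+ i) z (a , b , c)) (sym pe) where
   pe : p ≡ + i + + j
   pe = cong +_ (sym e) & Z.pos-+ i j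
   l : ∀ a b c i j -> a * (j * j) + (- b - + 2 * a) * (j * (i + j)) + (a + b + c) * ((i + j) * (i + j)) ≡ a * (i * i) + b * (i * (i + j)) + c * ((i + j) * (i + j))
   l = ring

 module Reciprocity (D : ℕ) (0<D : 0 N.< D) (h : ℤ -> ℤ) (h-odd : ∀ z -> h (- z) ≡ - h z) where

  S : ℕ -> ℕ -> ℤ
  S j p' = ∑ (forms D j p') (\ Q -> h (val (+ j) (+ suc p') Q))

  h0 : h 0# ≡ 0#
  h0 = self-negating (h-odd 0#)

  E : Enum (IsForm D 0# 1#)
  E = forms D 0 0

  pos-c : ∀ Q -> 0# < val 0# 1# Q -> 0# < third Q
  pos-c Q = 0<≡ (val01 Q)

  pos-val : ∀ Q -> 0# < third Q -> 0# < val 0# 1# Q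
  pos-val Q = 0<≡ (sym (val01 Q))

  module _ (j' p' : ℕ) where
   private
    j p : ℤ
    j = + suc j'
    p = + suc p'
    F = forms D (suc j') p'
    F' = forms D (suc p') j'
    hq : Triple -> ℤ
    hq Q = h (val j p Q)
    hq' : Triple -> ℤ
    hq' Q = h (val p j Q)
    reverse negrev : Triple -> Triple
    reverse (a , b , c) = c , b , a
    negrev (a , b , c) = - c , - b , - a
    val-reverse : ∀ j p Q -> val p j (reverse Q) ≡ val j p Q
    val-reverse j p (a , b , c) = l a b c j p where
     l : ∀ a b c j p -> c * (p * p) + b * (p * j) + a * (j * j) ≡ a * (j * j) + b * (j * p) + c * (p * p)
     l = ring
    val-negrev : ∀ j p Q -> val p j (negrev Q) ≡ - val j p Q
    val-negrev j p (a , b , c) = l a b c j p where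
     l : ∀ a b c j p -> (- c) * (p * p) + (- b) * (p * j) + (- a) * (j * j) ≡ - (a * (j * j) + b * (j * p) + c * (p * p))
     l = ring
    disc-reverse : ∀ Q -> disc (reverse Q) ≡ disc Q
    disc-reverse (a , b , c) = l a b c where
     l : ∀ a b c -> b * b - + 4 * (c * a) ≡ b * b - + 4 * (a * c)
     l = ring
    disc-negrev : ∀ Q -> disc (negrev Q) ≡ disc Q
    disc-negrev (a , b , c) = l a b c where
     l : ∀ a b c -> (- b) * (- b) - + 4 * ((- c) * (- a)) ≡ b * b - + 4 * (a * c)
     l = ring
    negrev² : ∀ Q -> negrev (negrev Q) ≡ Q
    negrev² (a , b , c) = triple-≡ (Z.neg-involutive a) (Z.neg-involutive b) (Z.neg-involutive c)
   Z : ℤ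
   Z = ∑ (F ↾ (\ Q -> third Q ≟ 0#)) hq
   private
    Z' X⁺ X⁻ N : ℤ
    Z' = ∑ (F' ↾ (\ Q -> third Q ≟ 0#)) hq'
    X⁺ = ∑ (E ↾ (\ Q -> 0# <? val j p Q)) hq
    X⁻ = ∑ (E ↾ (\ Q -> val j p Q <? 0#)) hq
    N  = ∑ (F ↾ (\ Q -> third Q <? 0#)) hq
    M-split : ∑ E hq ≡ X⁺ + X⁻
    M-split = ∑-sign E (val j p) & cong (_+ X⁻) (cong (_+_ X⁺) (∑-0 (E ↾ (\ Q -> val j p Q ≟ 0#)) (\ { Q (_ , e) -> cong h e & h0 })) & Z.+-identityʳ X⁺)
    F-split : S (suc j') p' ≡ X⁺ + Z + N
    F-split = ∑-sign F third & cong (\ z -> z + Z + N) (∑-same (F ↾ (\ Q -> 0# <? third Q)) (E ↾ (\ Q -> 0# <? val j p Q)) {hq}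
     (\ { Q ((d , a , q) , c) -> (d , a , pos-val Q c) , q }) (\ { Q ((d , a , c) , q) -> (d , a , q) , pos-c Q c }))
    F'-split : S (suc p') j' ≡ - X⁻ + Z' + N
    F'-split = ∑-sign F' third & cong2 (\ y z -> y + Z' + z)
     (∑-reindex (F' ↾ (\ Q -> 0# <? third Q)) (E ↾ (\ Q -> val j p Q <? 0#)) negrev negrev {hq'} {\ Q -> - hq Q}
      (\ { Q@(a , b , c) ((d , a<0 , q) , 0<c) -> (disc-negrev Q & d , -<0 0<c , pos-val (negrev Q) (0<- a<0)) , ≡<0 (sym (val-negrev p j Q)) (-<0 q) })
      (\ { Q@(a , b , c) ((d , a<0 , v) , q) -> (disc-negrev Q & d , -<0 (pos-c Q v) , 0<≡ (sym (val-negrev j p Q)) (0<- q)) , 0<- a<0 })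
      (\ Q _ -> negrev² Q) (\ Q _ -> negrev² Q)
      (\ Q _ -> cong (-_ ∘ h) (val-negrev p j Q) & cong -_ (h-odd (val p j Q)) & Z.neg-involutive _) &
      ∑-neg (E ↾ (\ Q -> val j p Q <? 0#)) hq)
     (∑-reindex (F' ↾ (\ Q -> third Q <? 0#)) (F ↾ (\ Q -> third Q <? 0#)) reverse reverse {hq'} {hq}
      (\ { Q@(a , b , c) ((d , a<0 , q) , c<0) -> (disc-reverse Q & d , c<0 , 0<≡ (sym (val-reverse p j Q)) q) , a<0 })
      (\ { Q@(a , b , c) ((d , a<0 , q) , c<0) -> (disc-reverse Q & d , c<0 , 0<≡ (sym (val-reverse j p Q)) q) , a<0 })
      (\ _ _ -> refl) (\ _ _ -> refl) (\ Q _ -> cong h (val-reverse p j Q)))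
   -- Both sums are cut by the sign of `c`. The parts with c < 0 correspond when `a` and `c` are
   -- exchanged. The parts with c > 0 together make up the region a < 0 < c, because `h` is odd. The
   -- parts with c = 0 remain.
   functional : S (suc j') p' - S (suc p') j' ≡ ∑ E hq + Z - ∑ (F' ↾ (\ Q -> third Q ≟ 0#)) hq'
   functional = cong2 _-_ F-split F'-split & l X⁺ X⁻ Z Z' N & cong (\ z -> z + Z - Z') (sym M-split) where
    l : ∀ x y z w n -> (x + z + n) - (- y + w + n) ≡ x + y + z - w
    l = ring

  module _ (j' p' : ℕ) where
   private
    j p : ℕ
    j = suc j'
    p = suc p'
    ρ e : ℕ -> ℕ
    ρ f = (f N.* p) % j
    e f = (f N.* p) / j
    fp : ∀ f -> f N.* p ≡ ρ f N.+ e f N.* j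
    fp f = m≡m%n+[m/n]*n (f N.* p) j
    rest : ℕ -> ℕ -> ℕ
    rest f i = ρ f N.+ i N.* j
    F = forms D j p' ↾ (\ Q -> third Q ≟ 0#)
    pairs = rootsN D ▹ (\ f _ -> below (e f))
    T = pairs ↾ (\ z -> 0 N.<? rest (fst z) (snd z))
    g : ℕ × ℕ -> Triple
    g (f , i) = - + (e f N.∸ i) , + f , 0#
    val-g : ∀ f i -> i N.≤ e f -> val (+ j) (+ p) (g (f , i)) ≡ + j * + rest f i
    val-g f i i≤e = l1 (+ (e f N.∸ i)) (+ f) (+ j) (+ p) & cong (_*_ (+ j)) (cong (_- + (e f N.∸ i) * + j) fpz &
     cong (\ z -> + ρ f + z * + j - + (e f N.∸ i) * + j) ez & l2 (+ ρ f) (+ (e f N.∸ i)) (+ i) (+ j) & sym restz) where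
     l1 : ∀ k f j p -> (- k) * (j * j) + f * (j * p) + 0# * (p * p) ≡ j * (f * p - k * j)
     l1 = ring
     l2 : ∀ r k i j -> r + (k + i) * j - k * j ≡ r + i * j
     l2 = ring
     fpz : + f * + p ≡ + ρ f + + e f * + j
     fpz = sym (Z.pos-* f p) & cong +_ (fp f) & Z.pos-+ (ρ f) _ & cong (_+_ (+ ρ f)) (Z.pos-* (e f) j)
     ez : + e f ≡ + (e f N.∸ i) + + i
     ez = cong +_ (sym (N.m∸n+n≡m i≤e)) & Z.pos-+ (e f N.∸ i) i
     restz : + rest f i ≡ + ρ f + + i * + j
     restz = Z.pos-+ (ρ f) _ & cong (_+_ (+ ρ f)) (Z.pos-* i j)
    IsPair : ℕ × ℕ -> Set
    IsPair z = (Root D (fst z) × snd z N.< e (fst z)) × 0 N.< rest (fst z) (snd z)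
    IsEdge : Triple -> Set
    IsEdge Q = IsForm D (+ j) (+ p) Q × third Q ≡ 0#
    to : ∀ z -> IsPair z -> IsEdge (g z)
    to (f , i) (((0<f , ff) , i<e) , 0<r) = (l (+ f) (- + (e f N.∸ i)) & sym (Z.pos-* f f) & cong +_ ff
      , neg (e f N.∸ i) (N.m<n⇒0<n∸m i<e) , 0<≡ (sym (val-g f i (N.<⇒≤ i<e))) (prod (rest f i) 0<r)) , refl where
     l : ∀ f a -> f * f - + 4 * (a * 0#) ≡ f * f
     l = ring
     neg : ∀ k -> 0 N.< k -> - + k < 0#
     neg (suc k) _ = -<+
     prod : ∀ k -> 0 N.< k -> 0# < + j * + k
     prod (suc k) _ = +<+ 0<s
    inverse-g : Triple -> ℕ × ℕ
    inverse-g (a , b , c) = ∣ b ∣ , e ∣ b ∣ N.∸ ∣ a ∣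
    from : ∀ Q -> IsEdge Q -> IsPair (inverse-g Q) × g (inverse-g Q) ≡ Q
    from (-[1+ k ] , + suc f' , .0#) ((d , a<0 , 0<q) , refl) = (((s≤s z≤n , ff) , N.∸-monoʳ-< 0<s k<e) , 0<rest) , triple-≡ (cong (\ z -> - + z) (N.m∸[m∸n]≡n k<e)) refl refl where
     f = suc f'
     l : ∀ f a -> f * f - + 4 * (a * 0#) ≡ f * f
     l = ring
     l1 : ∀ k f j p -> (- k) * (j * j) + f * (j * p) + 0# * (p * p) ≡ (f * p - k * j) * j
     l1 = ring
     ff : f N.* f ≡ D
     ff = Z.+-injective (Z.pos-* f f & sym (l (+ f) -[1+ k ]) & d)
     kj<fp : suc k N.* j N.< f N.* p
     kj<fp = Z.drop‿+<+ (subst2 _<_ (Z.+-identityˡ _ & sym (Z.pos-* (suc k) j)) (l2 (+ f * + p) (+ suc k * + j) & sym (Z.pos-* f p))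
      (Z.+-monoˡ-< (+ suc k * + j) (pos-*⁻ j (+ f * + p - + suc k * + j) 0<s (0<≡ (l1 (+ suc k) (+ f) (+ j) (+ p)) 0<q)))) where
      l2 : ∀ x y -> x - y + y ≡ x
      l2 = ring
     k<e : suc k N.≤ e f
     k<e = N.≤-pred (N.*-cancelʳ-< j (suc k) (suc (e f)) (N.<-trans kj<fp (subst (N._< suc (e f) N.* j) (sym (fp f)) (N.+-monoˡ-< (e f N.* j) (m%n<n (f N.* p) j)))))
     0<rest : 0 N.< rest f (e f N.∸ suc k)
     0<rest = N.+-cancelʳ-< (suc k N.* j) 0 (rest f (e f N.∸ suc k)) (subst (suc k N.* j N.<_) (fp f & cong (\ z -> ρ f N.+ z N.* j) (sym (N.m∸n+n≡m k<e)) & l3 (ρ f) (e f N.∸ suc k) (suc k) j) kj<fp) where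
      l3 : ∀ r x y j -> r N.+ (x N.+ y) N.* j ≡ r N.+ x N.* j N.+ y N.* j
      l3 = ringN!
    from (-[1+ k ] , + zero , .0#) ((d , a<0 , 0<q) , refl) = ⊥-elim (N.<⇒≢ 0<D (Z.+-injective (sym (l -[1+ k ]) & d))) where
     l : ∀ a -> 0# * 0# - + 4 * (a * 0#) ≡ 0#
     l = ring
    from (-[1+ k ] , -[1+ f ] , .0#) ((d , a<0 , 0<q) , refl) = ⊥-elim (not-pos (0<≡ (l (+ suc k) (+ suc f) (+ j) (+ p)) 0<q)) where
     l : ∀ k f j p -> (- k) * (j * j) + (- f) * (j * p) + 0# * (p * p) ≡ - (k * (j * j) + f * (j * p))
     l = ring
     not-pos : ¬ (0# < - (+ suc k * (+ j * + j) + + suc f * (+ j * + p)))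
     not-pos ()
    from (+ k , b , c) ((d , +<+ () , _) , _)
   -- With c = 0, b = f and a = -k the value at (j , p) is j(fp - kj). Counting k down from the
   -- quotient of fp by j makes it j times the remainder plus multiples of j. A vanishing value may
   -- be included, as h 0 = 0.
   edge-sum : ∑ (forms D j p' ↾ (\ Q -> third Q ≟ 0#)) (\ Q -> h (val (+ j) (+ p) Q))
    ≡ ∑ (rootsN D) (\ f -> ∑ (below ((f N.* p) / j)) (\ i -> h (+ j * + ((f N.* p) % j N.+ i N.* j))))
   edge-sum = sym (∑-reindex T F g inverse-g {\ { (f , i) -> h (+ j * + rest f i) }} {\ Q -> h (val (+ j) (+ p) Q)}
     to (\ Q r -> fst (from Q r))
     (\ { (f , i) ((_ , i<e) , _) -> cong (f ,_) (cong (e f N.∸_) (Z.∣-i∣≡∣i∣ (+ (e f N.∸ i))) & N.m∸[m∸n]≡n (N.<⇒≤ i<e)) })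
     (\ Q r -> snd (from Q r)) (\ { (f , i) ((_ , i<e) , _) -> cong h (val-g f i (N.<⇒≤ i<e)) })) &
    sym (∑-drop pairs (\ z -> 0 N.<? rest (fst z) (snd z)) (\ { (f , i) _ n -> drop (rest f i) n })) &
    ∑-▹ (rootsN D) (\ f _ -> below (e f)) (\ { (f , i) -> h (+ j * + rest f i) }) _ (\ f _ -> refl) where
    drop : ∀ k -> ¬ (0 N.< k) -> h (+ j * + k) ≡ 0#
    drop zero    _ = cong h (Z.*-zeroʳ (+ j)) & h0
    drop (suc k) n = ⊥-elim (n 0<s)

  S-shift : ∀ j p' -> S (j N.+ suc p') p' ≡ S j p'
  S-shift = forms-shift D (\ _ -> h)

  S-reflect : ∀ i j p' -> i N.+ j ≡ suc p' -> S i p' ≡ S j p'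
  S-reflect = forms-reflect D (\ _ -> h)

  negate-b : (u : Triple -> ℤ) -> (∀ a b c -> u (a , - b , c) ≡ - u (a , b , c)) -> ∑ E u ≡ 0#
  negate-b u odd = self-negating (∑-reindex E E f f {u} {\ Q -> - u Q} to to (\ { (a , b , c) _ -> triple-≡ refl (Z.neg-involutive b) refl })
    (\ { (a , b , c) _ -> triple-≡ refl (Z.neg-involutive b) refl }) (\ { (a , b , c) _ -> cong -_ (odd a b c) & Z.neg-involutive _ }) & ∑-neg E u) where
   f : Triple -> Triple
   f (a , b , c) = a , - b , c
   to : ∀ Q -> IsForm D 0# 1# Q -> IsForm D 0# 1# (f Q)
   to Q@(a , b , c) (d , a<0 , q) = l a b c & d , a<0 , pos-val (f Q) (pos-c Q q) where
    l : ∀ a b c -> (- b) * (- b) - + 4 * (a * c) ≡ b * b - + 4 * (a * c)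
    l = ring

  swap-ac : (u w : Triple -> ℤ) -> (∀ a b c -> w (- c , b , - a) ≡ u (a , b , c)) -> ∑ E u ≡ ∑ E w
  swap-ac u w e = ∑-reindex E E f f {u} {w} to to inv inv (\ { (a , b , c) _ -> e a b c }) where
   f : Triple -> Triple
   f (a , b , c) = - c , b , - a
   inv : ∀ Q -> IsForm D 0# 1# Q -> f (f Q) ≡ Q
   inv (a , b , c) _ = triple-≡ (Z.neg-involutive a) refl (Z.neg-involutive c)
   to : ∀ Q -> IsForm D 0# 1# Q -> IsForm D 0# 1# (f Q)
   to Q@(a , b , c) (d , a<0 , q) = l a b c & d , -<0 (pos-c Q q) , pos-val (f Q) (0<- a<0) where
    l : ∀ a b c -> b * b - + 4 * ((- c) * (- a)) ≡ b * b - + 4 * (a * c)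
    l = ring

 -- Euclid's algorithm on (j , p).
 euclid-constant : (Δ : ℕ -> ℕ -> ℤ) -> (∀ j p' -> Δ (j N.+ suc p') p' ≡ Δ j p') -> (∀ j' p' -> Δ (suc j') p' ≡ Δ (suc p') j') ->
  ∀ p' j -> Coprime j (suc p') -> Δ j p' ≡ Δ 0 0
 euclid-constant Δ periodic symmetric = <-rec (\ p' -> ∀ j -> Coprime j (suc p') -> Δ j p' ≡ Δ 0 0) step where
  periodic* : ∀ k j p' -> Δ (j N.+ k N.* suc p') p' ≡ Δ j p'
  periodic* zero    j p' = cong (\ z -> Δ z p') (N.+-identityʳ j)
  periodic* (suc k) j p' = cong (\ z -> Δ z p') (l j (suc p') (k N.* suc p')) & periodic (j N.+ k N.* suc p') p' & periodic* k j p' where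
   l : ∀ j p q -> j N.+ (p N.+ q) ≡ j N.+ q N.+ p
   l = ringN!
  step : ∀ p' -> (∀ {q'} -> q' N.< p' -> ∀ j -> Coprime j (suc q') -> Δ j q' ≡ Δ 0 0) -> ∀ j -> Coprime j (suc p') -> Δ j p' ≡ Δ 0 0
  step p' rec j co = cong (\ z -> Δ z p') je & periodic* (j / suc p') (j % suc p') p' & go (j % suc p') (m%n<n j (suc p'))
    (\ { (d∣s , d∣p) -> co (subst (_ ND.∣_) (sym je) (ND.∣m∣n⇒∣m+n d∣s (ND.∣n⇒∣m*n (j / suc p') d∣p)) , d∣p) }) where
   je : j ≡ j % suc p' N.+ (j / suc p') N.* suc p'
   je = m≡m%n+[m/n]*n j (suc p')
   go : ∀ s -> s N.< suc p' -> Coprime s (suc p') -> Δ s p' ≡ Δ 0 0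
   go zero    _ co' = cong (\ z -> Δ 0 z) (N.suc-injective (co' (ND._∣0 (suc p') , ND.∣-refl)))
   go (suc s) (s≤s s<p) co' = symmetric s p' & rec s<p (suc p') (\ { (x , y) -> co' (y , x) })

-- Evaluation of the linear and cubic sums by Euclid's algorithm.

module EuclidReduction where
 open FormSums public

 one : ℤ -> ℤ
 one _ = 1#

 abstract
  -- The factor 1 is the weight `one`, so that the sums `S` agree termwise with `G one r`.
  power : ℕ -> ℤ -> ℤ
  power r q = 1# * q ^ r

  power-def : ∀ r q -> power r q ≡ 1# * q ^ r
  power-def r q = refl

 private
  Σf : ℕ -> (ℕ -> ℤ) -> ℤ
  Σf D u = ∑ (rootsN D) u

  four-sums : ∀ D (a b c d : ℕ -> ℤ) -> (∀ f -> Root D f -> a f - b f - c f + d f ≡ 0#) -> Σf D a - Σf D b - Σf D c + Σf D d ≡ 0#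
  four-sums D a b c d h = cong (_+ Σf D d) (cong (_- Σf D c) (sym (∑-- (rootsN D) a b)) & sym (∑-- (rootsN D) (\ f -> a f - b f) c)) &
   sym (∑-+ (rootsN D) (\ f -> a f - b f - c f) d) & ∑-0 (rootsN D) h

  scale-sum : ∀ D k (u w : ℕ -> ℤ) -> (∀ f -> k * u f ≡ w f) -> k * Σf D u ≡ Σf D w
  scale-sum D k u w h = sym (∑-* (rootsN D) k u) & ∑-cong (rootsN D) (\ f _ -> h f)

  pos-split : ∀ f p j {{_ : N.NonZero j}} -> + f * + p ≡ + ((f N.* p) % j) + + ((f N.* p) / j) * + j
  pos-split f p j = sym (Z.pos-* f p) & cong +_ (m≡m%n+[m/n]*n (f N.* p) j) & Z.pos-+ ((f N.* p) % j) _ & cong (_+_ (+ ((f N.* p) % j))) (Z.pos-* ((f N.* p) / j) j)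

  pos-rest : ∀ r i j -> + (r N.+ i N.* j) ≡ + r + + i * + j
  pos-rest r i j = Z.pos-+ r _ & cong (_+_ (+ r)) (Z.pos-* i j)

 residue-shift : ∀ p' f j -> (+ ((f N.* (j N.+ suc p')) % suc p')) ≡ (+ ((f N.* j) % suc p'))
 residue-shift p' f j = cong +_ (cong (_% suc p') (l f j (suc p')) & ([m+kn]%n≡m%n (f N.* j) f (suc p'))) where
  l : ∀ f j p -> f N.* (j N.+ p) ≡ f N.* j N.+ f N.* p
  l = ringN!

 module LinearSums (D : ℕ) (0<D : 0 N.< D) where
  private
   h : ℤ -> ℤ
   h = power 1
   h≡ : ∀ q -> h q ≡ q
   h≡ q = power-def 1 q & Z.*-identityˡ (q * 1#) & Z.*-identityʳ q
  open Reciprocity D 0<D h (\ z -> h≡ (- z) & cong -_ (sym (h≡ z))) public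

  A1 : ℤ
  A1 = S 0 0

  private
   A-c : A1 ≡ ∑ E third
   A-c = ∑-cong E (\ Q _ -> h≡ (val 0# 1# Q) & val01 Q)

  -- The part odd in `b` cancels under b ↦ -b, and (a , c) ↦ (-c , -a) relates the sum of `a` to
  -- that of `c`, so a single moment survives.
  main-term : ∀ j p -> ∑ E (\ Q -> h (val j p Q)) ≡ A1 * (p * p - j * j)
  main-term j p = ∑-cong E (\ { Q@(a , b , c) _ -> h≡ (val j p Q) }) & ∑-+ E _ _ & cong2 _+_ (∑-+ E _ _ & cong2 _+_ (∑-*ʳ E (j * j) fst)
    (∑-*ʳ E (j * p) (\ Q -> fst (snd Q)) & cong (_* (j * p)) (negate-b (\ Q -> fst (snd Q)) (\ _ _ _ -> refl)))) (∑-*ʳ E (p * p) third) &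
   cong2 (\ y z -> y * (j * j) + 0# * (j * p) + z * (p * p)) (swap-ac fst (\ Q -> - third Q) (\ a b c -> Z.neg-involutive a) & ∑-neg E third & cong -_ (sym A-c)) (sym A-c) & l A1 j p where
   l : ∀ a j p -> (- a) * (j * j) + 0# * (j * p) + a * (p * p) ≡ a * (p * p - j * j)
   l = ring

  private
   -- x(x - j) is the second Bernoulli polynomial scaled by j, up to a constant; its difference with
   -- step j is 2jx, so the sum telescopes.
   staircase : ∀ ρ j e -> + 2 * ∑ (below e) (\ i -> h (+ j * + (ρ N.+ i N.* j))) ≡ (+ ρ + + e * + j) * (+ ρ + + e * + j - + j) - + ρ * (+ ρ - + j)
   staircase ρ j zero    = cong (_*_ (+ 2)) (∑-below-zero _) & sym (l (+ ρ) (+ j)) where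
    l : ∀ ρ j -> (ρ + 0# * j) * (ρ + 0# * j - j) - ρ * (ρ - j) ≡ + 2 * 0#
    l = ring
   staircase ρ j (suc e) = cong (_*_ (+ 2)) (∑-below-last e v) & Z.*-distribˡ-+ (+ 2) (∑ (below e) v) (v e) &
    cong2 _+_ (staircase ρ j e) (cong (_*_ (+ 2)) (h≡ (+ j * + (ρ N.+ e N.* j)) & cong (_*_ (+ j)) (pos-rest ρ e j))) &
    l (+ ρ) (+ j) (+ e) & cong (\ z -> (+ ρ + z * + j) * (+ ρ + z * + j - + j) - + ρ * (+ ρ - + j)) (sym (Z.pos-+ 1 e)) where
    v : ℕ -> ℤ
    v i = h (+ j * + (ρ N.+ i N.* j))
    l : ∀ ρ j e -> (ρ + e * j) * (ρ + e * j - j) - ρ * (ρ - j) + + 2 * (j * (ρ + e * j)) ≡ (ρ + (1# + e) * j) * (ρ + (1# + e) * j - j) - ρ * (ρ - j)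
    l = ring
   edge : ℕ -> ℕ -> ℕ -> ℤ
   edge j' p' f = + f * + suc p' * (+ f * + suc p' - + suc j') - (+ ((f N.* (suc p')) % suc j')) * ((+ ((f N.* (suc p')) % suc j')) - + suc j')
   edge-value : ∀ j' p' -> + 2 * ∑ (forms D (suc j') p' ↾ (\ Q -> third Q ≟ 0#)) (\ Q -> h (val (+ suc j') (+ suc p') Q)) ≡ Σf D (edge j' p')
   edge-value j' p' = cong (_*_ (+ 2)) (edge-sum j' p') & scale-sum D (+ 2)
    (\ f -> ∑ (below ((f N.* suc p') / suc j')) (\ i -> h (+ suc j' * + ((f N.* suc p') % suc j' N.+ i N.* suc j')))) (edge j' p') inner where
    inner : ∀ f -> + 2 * ∑ (below ((f N.* suc p') / suc j')) (\ i -> h (+ suc j' * + ((f N.* suc p') % suc j' N.+ i N.* suc j'))) ≡ edge j' p' f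
    inner f = staircase ((f N.* suc p') % suc j') (suc j') ((f N.* suc p') / suc j') &
     cong (\ z -> z * (z - + suc j') - (+ ((f N.* (suc p')) % suc j')) * ((+ ((f N.* (suc p')) % suc j')) - + suc j')) (sym (pos-split f (suc p') (suc j')))
   -- Chosen to make `Δ` both periodic and symmetric. It depends on j only through the remainder of
   -- fj modulo p, and exchanging j and p reproduces the telescoped edge sums.
   corr : ℕ -> ℕ -> ℕ -> ℤ
   corr j p' f = + f * + f * (+ suc p' * + suc p') - (+ ((f N.* j) % suc p')) * (+ suc p' - (+ ((f N.* j) % suc p')))
   Δ : ℕ -> ℕ -> ℤ
   Δ j p' = + 2 * S j p' - + 2 * A1 * (+ suc p' * + suc p') - Σf D (corr j p')
   Δ-periodic : ∀ j p' -> Δ (j N.+ suc p') p' ≡ Δ j p'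
   Δ-periodic j p' = cong2 (\ y z -> + 2 * y - + 2 * A1 * (+ suc p' * + suc p') - z) (S-shift j p')
    (∑-cong (rootsN D) (\ f _ -> cong (\ z -> + f * + f * (+ suc p' * + suc p') - z * (+ suc p' - z)) (residue-shift p' f j)))
   Δ-symmetric : ∀ j' p' -> Δ (suc j') p' ≡ Δ (suc p') j'
   Δ-symmetric j' p' = Z.i-j≡0⇒i≡j _ _ (l1 (S (suc j') p') (S (suc p') j') A1 (+ suc j') (+ suc p') (Σf D (corr (suc j') p')) (Σf D (corr (suc p') j')) &
    cong (\ z -> + 2 * z - + 2 * (A1 * (+ suc p' * + suc p' - + suc j' * + suc j')) - Σf D (corr (suc j') p') + Σf D (corr (suc p') j')) (functional j' p' &
     cong (\ z -> z + Z j' p' - Z') (main-term (+ suc j') (+ suc p'))) &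
    l2 (A1 * (+ suc p' * + suc p' - + suc j' * + suc j')) (Z j' p') Z' (Σf D (corr (suc j') p')) (Σf D (corr (suc p') j')) &
    cong2 (\ y z -> y - z - Σf D (corr (suc j') p') + Σf D (corr (suc p') j')) (edge-value j' p') (edge-value p' j') &
     four-sums D (edge j' p') (edge p' j') (corr (suc j') p') (corr (suc p') j')
      (\ f _ -> l3 (+ f) (+ suc j') (+ suc p') (+ ((f N.* (suc p')) % suc j')) (+ ((f N.* (suc j')) % suc p')))) where
    Z' = ∑ (forms D (suc p') j' ↾ (\ Q -> third Q ≟ 0#)) (\ Q -> h (val (+ suc p') (+ suc j') Q))
    l1 : ∀ s t a j p c d -> (+ 2 * s - + 2 * a * (p * p) - c) - (+ 2 * t - + 2 * a * (j * j) - d) ≡ + 2 * (s - t) - + 2 * (a * (p * p - j * j)) - c + d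
    l1 = ring
    l2 : ∀ m z w c d -> + 2 * (m + z - w) - + 2 * m - c + d ≡ + 2 * z - + 2 * w - c + d
    l2 = ring
    l3 : ∀ f j p ρ σ -> (f * p * (f * p - j) - ρ * (ρ - j)) - (f * j * (f * j - p) - σ * (σ - p)) - (f * f * (p * p) - σ * (p - σ)) + (f * f * (j * j) - ρ * (j - ρ)) ≡ 0#
    l3 = ring
   Δ0 : Δ 0 0 ≡ - Σf D (\ f -> + f * + f)
   Δ0 = cong (\ z -> + 2 * A1 - + 2 * A1 * (1# * 1#) - z) (∑-cong (rootsN D) (\ f _ -> cong (\ z -> + f * + f * (1# * 1#) - + z * (1# - + z)) (n%1≡0 (f N.* 0)) & l1 (+ f))) &
    l2 A1 (Σf D (\ f -> + f * + f)) where
    l1 : ∀ f -> f * f * (1# * 1#) - 0# * (1# - 0#) ≡ f * f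
    l1 = ring
    l2 : ∀ a z -> + 2 * a - + 2 * a * (1# * 1#) - z ≡ - z
    l2 = ring

  coprime-value : ∀ j p' -> Coprime j (suc p') -> + 2 * S j p' ≡ + 2 * A1 * (+ suc p' * + suc p')
   + Σf D (\ f -> + f * + f * (+ suc p' * + suc p' - 1#) - (+ ((f N.* j) % suc p')) * (+ suc p' - (+ ((f N.* j) % suc p'))))
  coprime-value j p' co = l (+ 2 * S j p') (+ 2 * A1 * (+ suc p' * + suc p')) (Σf D (corr j p')) &
   cong (\ z -> z + (+ 2 * A1 * (+ suc p' * + suc p') + Σf D (corr j p'))) (euclid-constant Δ Δ-periodic Δ-symmetric p' j co & Δ0) &
   l2 (Σf D (\ f -> + f * + f)) (+ 2 * A1 * (+ suc p' * + suc p')) (Σf D (corr j p')) & cong (_+_ (+ 2 * A1 * (+ suc p' * + suc p')))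
    (sym (∑-- (rootsN D) (corr j p') (\ f -> + f * + f)) & ∑-cong (rootsN D) (\ f _ -> l3 (+ f) (+ suc p') ((+ ((f N.* j) % suc p')) * (+ suc p' - (+ ((f N.* j) % suc p')))))) where
   l : ∀ s m c -> s ≡ (s - m - c) + (m + c)
   l = ring
   l2 : ∀ z m c -> (- z) + (m + c) ≡ m + (c - z)
   l2 = ring
   l3 : ∀ f p r -> (f * f * (p * p) - r) - f * f ≡ f * f * (p * p - 1#) - r
   l3 = ring

 module Cubic (D : ℕ) (0<D : 0 N.< D) where
  private
   h : ℤ -> ℤ
   h = power 3
   h≡ : ∀ q -> h q ≡ q * q * q
   h≡ q = power-def 3 q & l q where
    l : ∀ q -> 1# * (q * (q * (q * 1#))) ≡ q * q * q
    l = ring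
   h-odd : ∀ z -> h (- z) ≡ - h z
   h-odd z = h≡ (- z) & l z & cong -_ (sym (h≡ z)) where
    l : ∀ q -> (- q) * (- q) * (- q) ≡ - (q * q * q)
    l = ring
  open Reciprocity D 0<D h h-odd public

  A3 : ℤ
  A3 = S 0 0

  private
   c³ a³ mixed mixed' : Triple -> ℤ
   c³ (a , b , c) = c * c * c
   a³ (a , b , c) = a * a * a
   mixed (a , b , c) = a * c * c + b * b * c
   mixed' (a , b , c) = a * a * c + a * b * b
   -- The new moment of the cubic case, which accompanies j²p⁴ and j⁴p² in the expansion of the
   -- cube. The symmetries of the region leave it undetermined; `B'≡0` evaluates it.
   B3 : ℤ
   B3 = ∑ E mixed
   A-c : A3 ≡ ∑ E c³
   A-c = ∑-cong E (\ { Q@(a , b , c) _ -> h≡ (val 0# 1# Q) & cong (\ z -> z * z * z) (val01 Q) })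
   ∑a³ : ∑ E a³ ≡ - A3
   ∑a³ = swap-ac a³ (\ Q -> - c³ Q) (\ a b c -> l a) & ∑-neg E c³ & cong -_ (sym A-c) where
    l : ∀ a -> - ((- a) * (- a) * (- a)) ≡ a * a * a
    l = ring
   ∑mixed' : ∑ E mixed' ≡ - B3
   ∑mixed' = swap-ac mixed' (\ Q -> - mixed Q) (\ a b c -> l a b c) & ∑-neg E mixed where
    l : ∀ a b c -> - ((- c) * (- a) * (- a) + b * b * (- a)) ≡ a * a * c + a * b * b
    l = ring

  main-term : ∀ j p -> ∑ E (\ Q -> h (val j p Q)) ≡ A3 * (p * p * (p * p) * (p * p) - j * j * (j * j) * (j * j)) + + 3 * B3 * (j * j * (p * p) * (p * p) - j * j * (j * j) * (p * p))
  main-term j p = ∑-cong E {w = \ Q -> (j⁶ * a³ Q + p⁶ * c³ Q) + (k1 * mixed' Q + k2 * mixed Q) + od Q} (\ { Q@(a , b , c) _ -> h≡ (val j p Q) & expand a b c j p }) &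
    ∑-+ E _ od & cong2 _+_ (∑-+ E _ _ & cong2 _+_ (∑-+ E _ _ & cong2 _+_ (∑-* E j⁶ a³ & cong (_*_ j⁶) ∑a³) (∑-* E p⁶ c³ & cong (_*_ p⁶) (sym A-c)))
     (∑-+ E _ _ & cong2 _+_ (∑-* E k1 mixed' & cong (_*_ k1) ∑mixed') (∑-* E k2 mixed))) (negate-b od (\ a b c -> od-odd a b c j p)) &
    l A3 B3 j p where
   j⁶ = j * j * (j * j) * (j * j)
   p⁶ = p * p * (p * p) * (p * p)
   k1 = + 3 * (j * j * (j * j) * (p * p))
   k2 = + 3 * (j * j * (p * p) * (p * p))
   od : Triple -> ℤ
   od (a , b , c) = b * (j * p) * (b * b * (j * p * (j * p)) + + 6 * (a * c) * (j * p * (j * p)) + + 3 * (a * a) * (j * j * (j * j)) + + 3 * (c * c) * (p * p * (p * p)))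
   od-odd : ∀ a b c j p -> (- b) * (j * p) * ((- b) * (- b) * (j * p * (j * p)) + + 6 * (a * c) * (j * p * (j * p)) + + 3 * (a * a) * (j * j * (j * j)) + + 3 * (c * c) * (p * p * (p * p)))
    ≡ - (b * (j * p) * (b * b * (j * p * (j * p)) + + 6 * (a * c) * (j * p * (j * p)) + + 3 * (a * a) * (j * j * (j * j)) + + 3 * (c * c) * (p * p * (p * p))))
   od-odd = ring
   expand : ∀ a b c j p -> (a * (j * j) + b * (j * p) + c * (p * p)) * (a * (j * j) + b * (j * p) + c * (p * p)) * (a * (j * j) + b * (j * p) + c * (p * p))
    ≡ (j * j * (j * j) * (j * j) * (a * a * a) + p * p * (p * p) * (p * p) * (c * c * c)) + (+ 3 * (j * j * (j * j) * (p * p)) * (a * a * c + a * b * b) + + 3 * (j * j * (p * p) * (p * p)) * (a * c * c + b * b * c))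
     + b * (j * p) * (b * b * (j * p * (j * p)) + + 6 * (a * c) * (j * p * (j * p)) + + 3 * (a * a) * (j * j * (j * j)) + + 3 * (c * c) * (p * p * (p * p)))
   expand = ring
   l : ∀ a b j p -> (j * j * (j * j) * (j * j) * (- a) + p * p * (p * p) * (p * p) * a) + (+ 3 * (j * j * (j * j) * (p * p)) * (- b) + + 3 * (j * j * (p * p) * (p * p)) * b) + 0#
    ≡ a * (p * p * (p * p) * (p * p) - j * j * (j * j) * (j * j)) + + 3 * b * (j * j * (p * p) * (p * p) - j * j * (j * j) * (p * p))
   l = ring

  -- j⁶ B₄(x/j) up to the constant term of B₄; its difference with step j is 4(jx)³.
  bernoulli : ℤ -> ℤ -> ℤ
  bernoulli j x = j * j * (x * x * ((x - j) * (x - j)))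

  private
   staircase : ∀ ρ j e -> + 4 * ∑ (below e) (\ i -> h (+ j * + (ρ N.+ i N.* j))) ≡ bernoulli (+ j) (+ ρ + + e * + j) - bernoulli (+ j) (+ ρ)
   staircase ρ j zero    = cong (_*_ (+ 4)) (∑-below-zero _) & sym (l (+ ρ) (+ j)) where
    l : ∀ ρ j -> j * j * ((ρ + 0# * j) * (ρ + 0# * j) * ((ρ + 0# * j - j) * (ρ + 0# * j - j))) - j * j * (ρ * ρ * ((ρ - j) * (ρ - j))) ≡ + 4 * 0#
    l = ring
   staircase ρ j (suc e) = cong (_*_ (+ 4)) (∑-below-last e v) & Z.*-distribˡ-+ (+ 4) (∑ (below e) v) (v e) &
    cong2 _+_ (staircase ρ j e) (cong (_*_ (+ 4)) (h≡ (+ j * + (ρ N.+ e N.* j)) & cong (\ z -> (+ j * z) * (+ j * z) * (+ j * z)) (pos-rest ρ e j))) &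
    l (+ j) (+ ρ + + e * + j) (bernoulli (+ j) (+ ρ)) & cong (\ z -> bernoulli (+ j) z - bernoulli (+ j) (+ ρ)) (l2 (+ ρ) (+ j) (+ e) & cong (\ z -> + ρ + z * + j) (sym (Z.pos-+ 1 e))) where
    v : ℕ -> ℤ
    v i = h (+ j * + (ρ N.+ i N.* j))
    l : ∀ j x b -> j * j * (x * x * ((x - j) * (x - j))) - b + + 4 * ((j * x) * (j * x) * (j * x)) ≡ j * j * ((x + j) * (x + j) * ((x + j - j) * (x + j - j))) - b
    l = ring
    l2 : ∀ ρ j e -> ρ + e * j + j ≡ ρ + (1# + e) * j
    l2 = ring
   edge : ℕ -> ℕ -> ℕ -> ℤ
   edge j' p' f = bernoulli (+ suc j') (+ f * + suc p') - bernoulli (+ suc j') (+ ((f N.* (suc p')) % suc j'))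
   edge-value : ∀ j' p' -> + 4 * ∑ (forms D (suc j') p' ↾ (\ Q -> third Q ≟ 0#)) (\ Q -> h (val (+ suc j') (+ suc p') Q)) ≡ Σf D (edge j' p')
   edge-value j' p' = cong (_*_ (+ 4)) (edge-sum j' p') & scale-sum D (+ 4)
    (\ f -> ∑ (below ((f N.* suc p') / suc j')) (\ i -> h (+ suc j' * + ((f N.* suc p') % suc j' N.+ i N.* suc j')))) (edge j' p') inner where
    inner : ∀ f -> + 4 * ∑ (below ((f N.* suc p') / suc j')) (\ i -> h (+ suc j' * + ((f N.* suc p') % suc j' N.+ i N.* suc j'))) ≡ edge j' p' f
    inner f = staircase ((f N.* suc p') % suc j') (suc j') ((f N.* suc p') / suc j') &
     cong (\ z -> bernoulli (+ suc j') z - bernoulli (+ suc j') (+ ((f N.* (suc p')) % suc j'))) (sym (pos-split f (suc p') (suc j')))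
   corr : ℕ -> ℕ -> ℕ -> ℤ
   corr j p' f = bernoulli (+ suc p') (+ ((f N.* j) % suc p'))
   K : ℕ -> ℕ -> ℤ
   K j p' = + 4 * S j p' - + 4 * A3 * (+ suc p' * + suc p' * (+ suc p' * + suc p') * (+ suc p' * + suc p')) - Σf D (corr j p')
   K-periodic : ∀ j p' -> K (j N.+ suc p') p' ≡ K j p'
   K-periodic j p' = cong2 (\ y z -> + 4 * y - + 4 * A3 * (+ suc p' * + suc p' * (+ suc p' * + suc p') * (+ suc p' * + suc p')) - z) (S-shift j p')
    (∑-cong (rootsN D) (\ f _ -> cong (bernoulli (+ suc p')) (residue-shift p' f j)))
   B' : ℤ
   B' = + 12 * B3 + Σf D (\ f -> + f * + f * (+ f * + f) - + f * + f)
   -- Unlike in the linear case, symmetry fails by a multiple of j²p⁴ - j⁴p², whose coefficient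
   -- collects `B3` and the edge terms f⁴ - f².
   K-reciprocity : ∀ j' p' -> K (suc j') p' - K (suc p') j' ≡
    B' * (+ suc j' * + suc j' * (+ suc p' * + suc p') * (+ suc p' * + suc p') - + suc j' * + suc j' * (+ suc j' * + suc j') * (+ suc p' * + suc p'))
   K-reciprocity j' p' = l1 (S (suc j') p') (S (suc p') j') A3 (j * j * (j * j) * (j * j)) (p * p * (p * p) * (p * p)) (Σf D (corr (suc j') p')) (Σf D (corr (suc p') j')) &
    cong (\ z -> + 4 * z - + 4 * (A3 * (p * p * (p * p) * (p * p) - j * j * (j * j) * (j * j))) - Σf D (corr (suc j') p') + Σf D (corr (suc p') j')) (functional j' p' &
     cong (\ z -> z + Z j' p' - Z') (main-term j p)) &
    l2 (A3 * (p * p * (p * p) * (p * p) - j * j * (j * j) * (j * j))) B3 w (Z j' p') Z' (Σf D (corr (suc j') p')) (Σf D (corr (suc p') j')) &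
    cong (\ z -> + 12 * B3 * w + z) (cong2 (\ y z -> y - z - Σf D (corr (suc j') p') + Σf D (corr (suc p') j')) (edge-value j' p') (edge-value p' j') &
     sym (Z.+-identityʳ _) & cong (\ z -> Σf D (edge j' p') - Σf D (edge p' j') - Σf D (corr (suc j') p') + Σf D (corr (suc p') j') + z) (sym (Z.+-inverseˡ W)) &
      l4 (Σf D (edge j' p')) (Σf D (edge p' j')) (Σf D (corr (suc j') p')) (Σf D (corr (suc p') j')) W & 
       cong (_+ W) vanish & Z.+-identityˡ W) &
     cong (_+_ (+ 12 * B3 * w)) (∑-*ʳ (rootsN D) w φf) & sym (Z.*-distribʳ-+ w (+ 12 * B3) (Σf D φf)) where
    j = + suc j'
    p = + suc p'
    w = j * j * (p * p) * (p * p) - j * j * (j * j) * (p * p)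
    φf : ℕ -> ℤ
    φf f = + f * + f * (+ f * + f) - + f * + f
    W = Σf D (\ f -> φf f * w)
    Z' = ∑ (forms D (suc p') j' ↾ (\ Q -> third Q ≟ 0#)) (\ Q -> h (val (+ suc p') (+ suc j') Q))
    l1 : ∀ s t a j p c d -> (+ 4 * s - + 4 * a * p - c) - (+ 4 * t - + 4 * a * j - d) ≡ + 4 * (s - t) - + 4 * (a * (p - j)) - c + d
    l1 = ring
    l2 : ∀ m b w z z' c d -> + 4 * (m + + 3 * b * w + z - z') - + 4 * m - c + d ≡ + 12 * b * w + (+ 4 * z - + 4 * z' - c + d)
    l2 = ring
    l4 : ∀ a b c d w -> a - b - c + d + (- w + w) ≡ (a - b - c + d - w) + w
    l4 = ring
    l3 : ∀ f j p ρ σ -> (j * j * (f * p * (f * p) * ((f * p - j) * (f * p - j))) - j * j * (ρ * ρ * ((ρ - j) * (ρ - j))))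
     - (p * p * (f * j * (f * j) * ((f * j - p) * (f * j - p))) - p * p * (σ * σ * ((σ - p) * (σ - p)))) - p * p * (σ * σ * ((σ - p) * (σ - p)))
     + (j * j * (ρ * ρ * ((ρ - j) * (ρ - j))) - (f * f * (f * f) - f * f) * (j * j * (p * p) * (p * p) - j * j * (j * j) * (p * p))) ≡ 0#
    l3 = ring
    vanish : Σf D (edge j' p') - Σf D (edge p' j') - Σf D (corr (suc j') p') + Σf D (corr (suc p') j') - W ≡ 0#
    vanish = (l5 (Σf D (edge j' p')) (Σf D (edge p' j')) (Σf D (corr (suc j') p')) (Σf D (corr (suc p') j')) W &
     cong (\ z -> Σf D (edge j' p') - Σf D (edge p' j') - Σf D (corr (suc j') p') + z) (sym (∑-- (rootsN D) (corr (suc p') j') (\ f -> φf f * w))) &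
      four-sums D (edge j' p') (edge p' j') (corr (suc j') p') (\ f -> corr (suc p') j' f - φf f * w)
       (\ f _ -> l3 (+ f) j p (+ ((f N.* (suc p')) % suc j')) (+ ((f N.* (suc j')) % suc p')))) where
     l5 : ∀ a b c d w -> a - b - c + d - w ≡ a - b - c + (d - w)
     l5 = ring
   K0 : K 0 0 ≡ 0#
   K0 = cong (\ z -> + 4 * A3 - + 4 * A3 * (1# * 1# * (1# * 1#) * (1# * 1#)) - z) (∑-0 (rootsN D) (\ f _ -> cong (\ z -> bernoulli 1# (+ z)) (n%1≡0 (f N.* 0)))) &
    l A3 where
    l : ∀ a -> + 4 * a - + 4 * a * (1# * 1# * (1# * 1#) * (1# * 1#)) - 0# ≡ 0#
    l = ring
   -- The second argument is p - 1, so this compares the vectors (1 , 3) and (2 , 3). Their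
   -- remainders are exchanged by x ↦ 3 - x, which preserves the scaled Bernoulli polynomial.
   K-reflect3 : K 1 2 ≡ K 2 2
   K-reflect3 = cong2 (\ y z -> + 4 * y - + 4 * A3 * (+ 3 * + 3 * (+ 3 * + 3) * (+ 3 * + 3)) - z) (S-reflect 1 2 2 refl)
    (∑-cong (rootsN D) (\ f _ -> by-residue (f % 3) (m%n<n f 3) (f / 3) f (m≡m%n+[m/n]*n f 3))) where
    by-residue : ∀ r -> r N.< 3 -> ∀ k f -> f ≡ r N.+ k N.* 3 -> bernoulli (+ 3) (+ ((f N.* 1) % suc 2)) ≡ bernoulli (+ 3) (+ ((f N.* 2) % suc 2))
    by-residue r r<3 k .(r N.+ k N.* 3) refl = cong (\ z -> bernoulli (+ 3) (+ z)) (cong (_% 3) (l1 r k) & ([m+kn]%n≡m%n (r N.* 1) k 3)) &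
     small r r<3 & cong (\ z -> bernoulli (+ 3) (+ z)) (sym (cong (_% 3) (l2 r k) & ([m+kn]%n≡m%n (r N.* 2) (2 N.* k) 3))) where
     l1 : ∀ r k -> (r N.+ k N.* 3) N.* 1 ≡ r N.* 1 N.+ k N.* 3
     l1 = ringN!
     l2 : ∀ r k -> (r N.+ k N.* 3) N.* 2 ≡ r N.* 2 N.+ 2 N.* k N.* 3
     l2 = ringN!
     small : ∀ r -> r N.< 3 -> bernoulli (+ 3) (+ ((r N.* 1) % 3)) ≡ bernoulli (+ 3) (+ ((r N.* 2) % 3))
     small 0 _ = refl
     small 1 _ = refl
     small 2 _ = refl
     small (suc (suc (suc r))) (s≤s (s≤s (s≤s ())))
   -- Reciprocity at (1,2), (1,3), (2,3), with K(1,3) = K(2,3), forces the mixed moment to vanish.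
   B'≡0 : B' ≡ 0#
   B'≡0 = Z.*-cancelˡ-≡ (+ 120) B' 0# (combine (sub (K 1 1) (K 2 0) (+ 12) (K-reciprocity 0 1)) (sub (K 1 2) (K 3 0) (+ 72) (K-reciprocity 0 2)) (sub (K 2 2) (K 3 1) (+ 180) (K-reciprocity 1 2)) K-reflect3
    (K-periodic 1 0 & K-periodic 0 0 & K0) (K-periodic 2 0 & K-periodic 1 0 & K-periodic 0 0 & K0) (K-periodic 1 1)) where
    sub : ∀ a b k -> a - b ≡ B' * k -> a ≡ b + B' * k
    sub a b k e = l a b & cong (_+_ b) e where
     l : ∀ a b -> a ≡ b + (a - b)
     l = ring
    -- 12, 72 and 180 are the values of j²p⁴ - j⁴p² at (1 , 2), (1 , 3) and (2 , 3), and 120 = 12 +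
    -- 180 - 72.
    combine : K 1 1 ≡ K 2 0 + B' * + 12 -> K 1 2 ≡ K 3 0 + B' * + 72 -> K 2 2 ≡ K 3 1 + B' * + 180 -> K 1 2 ≡ K 2 2 ->
     K 2 0 ≡ 0# -> K 3 0 ≡ 0# -> K 3 1 ≡ K 1 1 -> + 120 * B' ≡ + 120 * 0#
    combine e1 e2 e3 e4 z1 z2 e5 = l B' & cong (\ z -> 0# + B' * + 12 + B' * + 180 - z) (sym (Z.+-identityˡ (B' * + 72)) & cong (_+ B' * + 72) (sym z2) & sym e2 & e4 & e3 & cong (_+ B' * + 180) (e5 & e1 & cong (_+ B' * + 12) z1)) & Z.+-inverseʳ (0# + B' * + 12 + B' * + 180) where
     l : ∀ b -> + 120 * b ≡ 0# + b * + 12 + b * + 180 - b * + 72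
     l = ring
   K-symmetric : ∀ j' p' -> K (suc j') p' ≡ K (suc p') j'
   K-symmetric j' p' = Z.i-j≡0⇒i≡j _ _ (K-reciprocity j' p' & vanish B' _ B'≡0) where
    vanish : ∀ b k -> b ≡ 0# -> b * k ≡ 0#
    vanish .0# k refl = Z.*-zeroˡ k

  coprime-value : ∀ j p' -> Coprime j (suc p') -> + 4 * S j p' ≡ + 4 * A3 * (+ suc p' * + suc p' * (+ suc p' * + suc p') * (+ suc p' * + suc p'))
   + Σf D (\ f -> bernoulli (+ suc p') (+ ((f N.* j) % suc p')))
  coprime-value j p' co = l (+ 4 * S j p') (+ 4 * A3 * (+ suc p' * + suc p' * (+ suc p' * + suc p') * (+ suc p' * + suc p'))) (Σf D (corr j p')) &
   cong (_+ (+ 4 * A3 * (+ suc p' * + suc p' * (+ suc p' * + suc p') * (+ suc p' * + suc p')) + Σf D (corr j p'))) (euclid-constant K K-periodic K-symmetric p' j co & K0) & Z.+-identityˡ _ where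
   l : ∀ s m c -> s ≡ (s - m - c) + (m + c)
   l = ring

-- Averages over j modulo p.

module Averages where
 open EuclidReduction public

 ∑-const : ∀ n k -> ∑ (below n) (\ _ -> k) ≡ + n * k
 ∑-const zero    k = ∑-below-zero (\ _ -> k) & sym (Z.*-zeroˡ k)
 ∑-const (suc n) k = ∑-below-last n (\ _ -> k) & cong (_+ k) (∑-const n k) & l (+ n) k & cong (_* k) (sym (Z.pos-+ 1 n)) where
  l : ∀ n k -> n * k + k ≡ (1# + n) * k
  l = ring

 ∑-linear : ∀ n q -> + 6 * ∑ (below n) (\ x -> + x * (q - + x)) ≡ + n * (+ n - 1#) * (+ 3 * q - + 2 * + n + 1#)
 ∑-linear zero    q = cong (_*_ (+ 6)) (∑-below-zero _) & sym (Z.*-zeroˡ (+ 3 * q - + 2 * 0# + 1#))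
 ∑-linear (suc n) q = cong (_*_ (+ 6)) (∑-below-last n v) & Z.*-distribˡ-+ (+ 6) (∑ (below n) v) (v n) & cong (_+ + 6 * v n) (∑-linear n q) &
  l (+ n) q & cong (\ z -> z * (z - 1#) * (+ 3 * q - + 2 * z + 1#)) (sym (Z.pos-+ 1 n)) where
  v : ℕ -> ℤ
  v x = + x * (q - + x)
  l : ∀ n q -> n * (n - 1#) * (+ 3 * q - + 2 * n + 1#) + + 6 * (n * (q - n)) ≡ (1# + n) * (1# + n - 1#) * (+ 3 * q - + 2 * (1# + n) + 1#)
  l = ring

 ∑-quartic : ∀ n q -> + 30 * ∑ (below n) (\ x -> + x * + x * ((+ x - q) * (+ x - q))) ≡
  + n * (+ n - 1#) * (+ 5 * (q * q) * (+ 2 * + n - 1#) - + 15 * q * (+ n * (+ n - 1#)) + (+ 2 * + n - 1#) * (+ 3 * (+ n * + n) - + 3 * + n - 1#))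
 ∑-quartic zero    q = cong (_*_ (+ 30)) (∑-below-zero _) & sym (Z.*-zeroˡ (+ 5 * (q * q) * (+ 2 * 0# - 1#) - + 15 * q * (0# * (0# - 1#)) + (+ 2 * 0# - 1#) * (+ 3 * (0# * 0#) - + 3 * 0# - 1#)))
 ∑-quartic (suc n) q = cong (_*_ (+ 30)) (∑-below-last n v) & Z.*-distribˡ-+ (+ 30) (∑ (below n) v) (v n) & cong (_+ + 30 * v n) (∑-quartic n q) &
  l (+ n) q & cong (\ z -> z * (z - 1#) * (+ 5 * (q * q) * (+ 2 * z - 1#) - + 15 * q * (z * (z - 1#)) + (+ 2 * z - 1#) * (+ 3 * (z * z) - + 3 * z - 1#))) (sym (Z.pos-+ 1 n)) where
  v : ℕ -> ℤ
  v x = + x * + x * ((+ x - q) * (+ x - q))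
  l : ∀ n q -> n * (n - 1#) * (+ 5 * (q * q) * (+ 2 * n - 1#) - + 15 * q * (n * (n - 1#)) + (+ 2 * n - 1#) * (+ 3 * (n * n) - + 3 * n - 1#)) + + 30 * (n * n * ((n - q) * (n - q)))
   ≡ (1# + n) * (1# + n - 1#) * (+ 5 * (q * q) * (+ 2 * (1# + n) - 1#) - + 15 * q * ((1# + n) * (1# + n - 1#)) + (+ 2 * (1# + n) - 1#) * (+ 3 * ((1# + n) * (1# + n)) - + 3 * (1# + n) - 1#))
  l = ring

 G-at-zero : ∀ wt r D p' -> G wt r D 0 p' ≡ (+ suc p' * + suc p') ^ r * A wt r D
 G-at-zero wt r D p' = ∑-reindex (forms D 0 p') (forms D 0 0) id id {w = \ Q -> (p * p) ^ r * (wt (fst Q) * val 0# 1# Q ^ r)}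
   (\ { Q (d , a<0 , q) -> d , a<0 , 0<≡ (sym (val01 Q)) (pos-*⁻ (suc p' N.* suc p') (third Q) 0<s (0<≡ (v0 Q & cong (_*_ (third Q)) (sym (Z.pos-* (suc p') (suc p')))) q)) })
   (\ { Q (d , a<0 , q) -> d , a<0 , 0<≡ (sym (v0 Q & cong (_*_ (third Q)) (sym (Z.pos-* (suc p') (suc p'))))) (pos-*⁺ (suc p' N.* suc p') 0<s (0<≡ (val01 Q) q)) })
   (\ _ _ -> refl) (\ _ _ -> refl)
   (\ Q _ -> l ((p * p) ^ r) (wt (fst Q)) (val 0# 1# Q ^ r) & cong (_*_ (wt (fst Q))) (sym (^-distrib-* (val 0# 1# Q) (p * p) r) & cong (_^ r) (cong (_* (p * p)) (val01 Q) & sym (v0 Q)))) &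
  ∑-* (forms D 0 0) ((p * p) ^ r) _ where
  p = + suc p'
  v0 : ∀ Q -> val 0# p Q ≡ third Q * (p * p)
  v0 (a , b , c) = l0 a b c p where
   l0 : ∀ a b c p -> a * (0# * 0#) + b * (0# * p) + c * (p * p) ≡ c * (p * p)
   l0 = ring
  l : ∀ k w x -> k * (w * x) ≡ w * (x * k)
  l = ring

 module Average (p' : ℕ) (prime : Prime (suc p')) (odd-p : suc p' ≢ 2) (D : ℕ) (p∤D : ¬ Zero (suc p') (+ D)) where
  open ModPrime p' prime odd-p public
  open Congruence p using (≡C; Cong-sym; _>>_; Cong-*; Cong-+)

  D' : ℕ
  D' = p N.* p N.* D

  ∤-root : ∀ f -> Root D f -> ¬ Zero p (+ f)
  ∤-root f (_ , ff) z = p∤D (zero1 (+ f) (cong +_ (sym ff) & Z.pos-* f f) z)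

  -- f is a unit modulo p, so j ↦ fj permutes the residues; after averaging, the correction no
  -- longer depends on f.
  ∑-multiples : ∀ f -> ¬ Zero p (+ f) -> (w : ℤ -> ℤ) -> ∑ (below p) (\ j -> w (+ ((f N.* j) % p))) ≡ ∑ (below p) (\ x -> w (+ x))
  ∑-multiples f nf w = ∑-reindex (below p) (below p) (\ j -> (f N.* j) % p) (\ x -> res (u * + x)) {w = \ x -> w (+ x)}
   (\ j _ -> m%n<n (f N.* j) p) (\ x _ -> res< (u * + x))
   (\ j j<p -> res-unique _ j j<p (Cong-* (≡C {u} refl) (Cong-sym (fj j)) >>
    ≡C (l1 u (+ f) (+ j)) >> Cong-* uu (≡C {+ j} refl) >> ≡C (Z.*-identityˡ (+ j))))
   (\ x x<p -> small-unique _ x (m%n<n (f N.* res (u * + x)) p) x<p (Cong-sym (fj (res (u * + x))) >> Cong-* (≡C {+ f} refl) (Cong-sym (res-cong (u * + x))) >>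
    ≡C (l2 u (+ f) (+ x)) >> Cong-* uu (≡C {+ x} refl) >> ≡C (Z.*-identityˡ (+ x))))
   (\ _ _ -> refl) where
   u = fst (inverse (+ f) nf)
   uu = snd (inverse (+ f) nf)
   fj : ∀ j -> Cong p (+ f * + j) (+ ((f N.* j) % p))
   fj j = ≡C (sym (Z.pos-* f j)) >> res-cong (+ (f N.* j))
   l1 : ∀ u f j -> u * (f * j) ≡ u * f * j
   l1 = ring
   l2 : ∀ u f x -> f * (u * x) ≡ u * f * x
   l2 = ring

  ∑-roots : ∀ (w : ℕ -> ℤ) -> ∑ (rootsN D') w ≡ ∑ (rootsN D) (\ f -> w (p N.* f))
  ∑-roots w = sym (∑-bij (rootsN D) (rootsN D') (p N.*_) {\ f -> w (p N.* f)} {w}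
   (\ { f (0<f , ff) -> N.*-mono-≤ {1} {p} {1} 0<s 0<f , l p f & cong (p N.* p N.*_) ff })
   (\ f g -> N.*-cancelˡ-≡ f g p) onto (\ _ _ -> refl)) where
   l : ∀ p f -> p N.* f N.* (p N.* f) ≡ p N.* p N.* (f N.* f)
   l = ringN!
   onto : ∀ g -> Root D' g -> ∃ \ f -> Root D f × p N.* f ≡ g
   onto g (0<g , gg) with zero⇒∣ {+ g} (reduce-square (euclid (+ g) (+ g) (zero-by (+ p * + D) (sym (Z.pos-* g g) & cong +_ gg & Z.pos-* (p N.* p) D & cong (_* + D) +pp & l2 (+ p) (+ D))))) where
    reduce-square : Zero p (+ g) ⊎ Zero p (+ g) -> Zero p (+ g)
    reduce-square (inl z) = z
    reduce-square (inr z) = z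
    l2 : ∀ p D -> p * p * D ≡ p * D * p
    l2 = ring
   ... | ND.divides k refl = k , (nonzero k 0<g , N.*-cancelˡ-≡ (k N.* k) D (p N.* p) (l3 p k & gg)) , N.*-comm p k where
    nonzero : ∀ k -> 0 N.< k N.* p -> 0 N.< k
    nonzero (suc k) _ = s≤s z≤n
    l3 : ∀ p k -> p N.* p N.* (k N.* k) ≡ k N.* p N.* (k N.* p)
    l3 = ringN!

  roots-at-root : ∀ f -> Root D f -> roots (+ D) ≡ + 2
  roots-at-root f r@(_ , ff) = roots-two (+ D) (+ f) (∤-root f r) (≡C (sym (Z.pos-* f f) & cong +_ ff))

  -- For 0 < j < p the vector (j , p) is primitive and `co` applies; for j = 0 it is p times (0 ,
  -- 1), and homogeneity gives the value. The numbers `k` and `c` clear the denominators of the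
  -- coprime formula and of the power sum.
  average : (g : ℕ -> ℤ) (u : ℕ -> ℤ) (w : ℤ -> ℤ) (k q a c W : ℤ) -> g 0 ≡ q * a -> w 0# ≡ 0# -> c * ∑ (below p) (\ x -> w (+ x)) ≡ W ->
   (∀ j -> Coprime j p -> k * g j ≡ k * a * q + ∑ (rootsN D) (\ f -> u f - w (+ ((f N.* j) % p)))) ->
   c * k * ∑ (below p) g ≡ c * k * + p * q * a + ∑ (rootsN D) (\ f -> c * (+ p - 1#) * u f - W)
  average g u w k q a c W g0 w0 cW co = cong (_*_ (c * k)) (∑-below-suc p' g & cong (_+ ∑ (below p') (g ∘ suc)) g0) &
   l1 c k (q * a) (∑ (below p') (g ∘ suc)) & cong (\ z -> c * k * (q * a) + c * z) inner & 
    l2 c k q a (+ p') (∑ (rootsN D) (\ f -> + p' * u f - Wf)) & cong2 _+_ (cong (\ z -> c * k * z * q * a) (sym (Z.pos-+ 1 p'))) outer where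
   Wf = ∑ (below p) (\ x -> w (+ x))
   l1 : ∀ c k x y -> c * k * (x + y) ≡ c * k * x + c * (k * y)
   l1 = ring
   l2 : ∀ c k q a p z -> c * k * (q * a) + c * (p * (k * a * q) + z) ≡ c * k * (1# + p) * q * a + c * z
   l2 = ring
   l3 : ∀ c p u w -> c * (p * u - w) ≡ c * (1# + p - 1#) * u - c * w
   l3 = ring
   value : ∀ j -> j N.< p' -> k * g (suc j) ≡ k * a * q + ∑ (rootsN D) (\ f -> u f - w (+ ((f N.* suc j) % p)))
   value j j<p' = co (suc j) (CP.sym (prime⇒coprime prime (s≤s j<p')))
   tail-sum : ∀ f -> Root D f -> ∑ (below p') (\ j -> w (+ ((f N.* suc j) % p))) ≡ Wf
   tail-sum f r = sym (Z.+-identityˡ _) & cong (_+ ∑ (below p') (\ j -> w (+ ((f N.* suc j) % p)))) (sym (cong (\ z -> w (+ (z % p))) (N.*-zeroʳ f) & w0)) &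
    sym (∑-below-suc p' (\ j -> w (+ ((f N.* j) % p)))) & ∑-multiples f (∤-root f r) w
   inner : k * ∑ (below p') (g ∘ suc) ≡ + p' * (k * a * q) + ∑ (rootsN D) (\ f -> + p' * u f - Wf)
   inner = sym (∑-* (below p') k (g ∘ suc)) & ∑-cong (below p') value & ∑-+ (below p') (\ _ -> k * a * q) _ & cong2 _+_ (∑-const p' (k * a * q))
    (∑-swap (below p') (rootsN D) (\ j f -> u f - w (+ ((f N.* suc j) % p))) & ∑-cong (rootsN D) (\ f r ->
     ∑-- (below p') (\ _ -> u f) (\ j -> w (+ ((f N.* suc j) % p))) & cong2 _-_ (∑-const p' (u f)) (tail-sum f r)))
   outer : c * ∑ (rootsN D) (\ f -> + p' * u f - Wf) ≡ ∑ (rootsN D) (\ f -> c * (+ p - 1#) * u f - W)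
   outer = sym (∑-* (rootsN D) c _) & ∑-cong (rootsN D) (\ f _ -> l3 c (+ p') (u f) Wf & cong2 (\ y z -> c * (y - 1#) * u f - z) (sym (Z.pos-+ 1 p')) cW)

-- The Hecke relation for the weights c and c³.

module HeckeOddWeights where
 open Averages public

 -- Cohen numbers up to a scalar: the sum over the roots f of f² = D is the boundary term that keeps the Hecke relation true for square D.
 H1 H3 : ℕ -> ℤ
 H1 D = + 12 * A one 1 D + ∑ (rootsN D) (\ f -> + 6 * (+ f * + f) - 1#)
 H3 D = + 120 * A one 3 D + ∑ (rootsN D) (\ f -> 1#)

 module HeckeOdd (p' : ℕ) (prime : Prime (suc p')) (odd-p : suc p' ≢ 2) (D : ℕ) (0<D : 0 N.< D) (p∤D : ¬ Zero (suc p') (+ D)) where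
  open Average p' prime odd-p D p∤D

  private
   P ρ : ℤ
   P = + p
   ρ = roots (+ D) - 1#
   power-G : ∀ r j -> ∑ (forms D j p') (\ Q -> power r (val (+ j) P Q)) ≡ G one r D j p'
   power-G r j = ∑-cong (forms D j p') (\ Q _ -> power-def r (val (+ j) P Q))
   power-A : ∀ r -> ∑ (forms D 0 0) (\ Q -> power r (val 0# 1# Q)) ≡ A one r D
   power-A r = ∑-cong (forms D 0 0) (\ Q _ -> power-def r (val 0# 1# Q))
   ρ-at-root : ∀ f -> Root D f -> ρ ≡ 1#
   ρ-at-root f r = cong (_- 1#) (roots-at-root f r)
   combine : ∀ c a' e a s k x y z -> a' + ρ * (1# * e * a) ≡ a + s -> c * s ≡ k * (c * a) + x -> x + y ≡ (1# + k - e * ρ) * z ->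
    c * a' + y ≡ (1# + k - e * ρ) * (c * a + z)
   combine c a' e a s k x y z h hs hz = l1 c a' (ρ * (1# * e * a)) y & cong (\ t -> c * t - c * (ρ * (1# * e * a)) + y) h & l2 c a s (ρ * (1# * e * a)) y &
    cong (\ t -> c * a + t - c * (ρ * (1# * e * a)) + y) hs & l3 c e a k x y ρ & cong (_+_ ((1# + k - e * ρ) * (c * a))) hz & sym (Z.*-distribˡ-+ (1# + k - e * ρ) (c * a) z) where
    l1 : ∀ c a r y -> c * a + y ≡ c * (a + r) - c * r + y
    l1 = ring
    l2 : ∀ c a s r y -> c * (a + s) - c * r + y ≡ c * a + c * s - c * r + y
    l2 = ring
    l3 : ∀ c e a k x y ρ -> c * a + (k * (c * a) + x) - c * (ρ * (1# * e * a)) + y ≡ (1# + k - e * ρ) * (c * a) + (x + y)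
    l3 = ring

  -- At a root f of D the symbol is 1, and the boundary terms satisfy the Hecke relation as a
  -- polynomial identity in p and f. This identity is the reason for the summand 6f² - 1 in `H1`.
  linear : H1 D' ≡ (1# + P * P * P - P * ρ) * H1 D
  linear = combine (+ 12) (A one 1 D') P (A one 1 D) (∑ (below p) g) (P * P * P) X Y (∑ (rootsN D) (\ f -> + 6 * (+ f * + f) - 1#)) hecke' average' roots' where
   module L = LinearSums D 0<D
   module H = Hecke p' prime odd-p one 1 1# (\ _ -> refl) (\ _ -> refl) D p∤D
   g : ℕ -> ℤ
   g j = G one 1 D j p'
   u : ℕ -> ℤ
   u f = + f * + f * (P * P - 1#)
   w : ℤ -> ℤ
   w x = x * (P - x)
   X Y : ℤ
   X = ∑ (rootsN D) (\ f -> + 6 * (P - 1#) * u f - (P * P * P - P))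
   Y = ∑ (rootsN D') (\ f -> + 6 * (+ f * + f) - 1#)
   hecke' : A one 1 D' + ρ * (1# * P * A one 1 D) ≡ A one 1 D + ∑ (below p) g
   hecke' = cong (\ z -> A one 1 D' + ρ * (1# * z * A one 1 D)) (sym (Z.*-identityʳ P)) & H.hecke
   W-value : + 6 * ∑ (below p) (\ x -> w (+ x)) ≡ P * P * P - P
   W-value = ∑-linear p P & l P where
    l : ∀ p -> p * (p - 1#) * (+ 3 * p - + 2 * p + 1#) ≡ p * p * p - p
    l = ring
   average' : + 12 * ∑ (below p) g ≡ P * P * P * (+ 12 * A one 1 D) + X
   average' = average g u w (+ 2) (P * P) (A one 1 D) (+ 6) (P * P * P - P) (G-at-zero one 1 D p' & cong (_* A one 1 D) (Z.*-identityʳ (P * P))) (Z.*-zeroˡ (P - 0#)) W-value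
     (\ j co -> cong (_*_ (+ 2)) (sym (power-G 1 j)) & L.coprime-value j p' co & cong (\ z -> + 2 * z * (P * P) + ∑ (rootsN D) (\ f -> u f - w (+ ((f N.* j) % p)))) (power-A 1)) &
    cong (_+ X) (l P (A one 1 D)) where
    l : ∀ p a -> + 6 * + 2 * p * (p * p) * a ≡ p * p * p * (+ 12 * a)
    l = ring
   roots' : X + Y ≡ (1# + P * P * P - P * ρ) * ∑ (rootsN D) (\ f -> + 6 * (+ f * + f) - 1#)
   roots' = cong (_+_ X) (∑-roots (\ f -> + 6 * (+ f * + f) - 1#)) & sym (∑-+ (rootsN D) _ _) &
    ∑-cong (rootsN D) {w = \ f -> (1# + P * P * P - P * ρ) * (+ 6 * (+ f * + f) - 1#)} pointwise & ∑-* (rootsN D) (1# + P * P * P - P * ρ) _ where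
    l : ∀ p f -> + 6 * (p - 1#) * (f * f * (p * p - 1#)) - (p * p * p - p) + (+ 6 * (p * f * (p * f)) - 1#) ≡ (1# + p * p * p - p * 1#) * (+ 6 * (f * f) - 1#)
    l = ring
    pointwise : ∀ f -> Root D f -> + 6 * (P - 1#) * u f - (P * P * P - P) + (+ 6 * (+ (p N.* f) * + (p N.* f)) - 1#) ≡ (1# + P * P * P - P * ρ) * (+ 6 * (+ f * + f) - 1#)
    pointwise f r = cong (\ z -> + 6 * (P - 1#) * u f - (P * P * P - P) + (+ 6 * (z * z) - 1#)) (Z.pos-* p f) &
     l P (+ f) & cong (\ z -> (1# + P * P * P - P * z) * (+ 6 * (+ f * + f) - 1#)) (sym (ρ-at-root f r))

  cubic : H3 D' ≡ (1# + P * P * P * (P * P * P) * P - P * P * P * ρ) * H3 D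
  cubic = combine (+ 120) (A one 3 D') (P * P * P) (A one 3 D) (∑ (below p) g) (P * P * P * (P * P * P) * P) X Y (∑ (rootsN D) (\ f -> 1#)) hecke' average' roots' where
   module C = Cubic D 0<D
   module H = Hecke p' prime odd-p one 3 1# (\ _ -> refl) (\ _ -> refl) D p∤D
   g : ℕ -> ℤ
   g j = G one 3 D j p'
   u : ℕ -> ℤ
   u f = 0#
   w : ℤ -> ℤ
   w x = - C.bernoulli P x
   q V : ℤ
   q = P * P * (P * P) * (P * P)
   V = - (P * P * P * (P * P * P) * P - P * P * P)
   X Y : ℤ
   X = ∑ (rootsN D) (\ f -> + 30 * (P - 1#) * u f - V)
   Y = ∑ (rootsN D') (\ f -> 1#)
   hecke' : A one 3 D' + ρ * (1# * (P * P * P) * A one 3 D) ≡ A one 3 D + ∑ (below p) g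
   hecke' = cong (\ z -> A one 3 D' + ρ * (1# * z * A one 3 D)) (l P) & H.hecke where
    l : ∀ p -> p * p * p ≡ p * (p * (p * 1#))
    l = ring
   W-value : + 30 * ∑ (below p) (\ x -> w (+ x)) ≡ V
   W-value = cong (_*_ (+ 30)) (∑-neg (below p) (\ x -> C.bernoulli P (+ x)) & cong -_ (∑-* (below p) (P * P) (\ x -> + x * + x * ((+ x - P) * (+ x - P))))) &
    l1 (P * P) (∑ (below p) (\ x -> + x * + x * ((+ x - P) * (+ x - P)))) & cong (\ z -> - (P * P * z)) (∑-quartic p P) & l2 P where
    l1 : ∀ p s -> + 30 * - (p * s) ≡ - (p * (+ 30 * s))
    l1 = ring
    l2 : ∀ p -> - (p * p * (p * (p - 1#) * (+ 5 * (p * p) * (+ 2 * p - 1#) - + 15 * p * (p * (p - 1#)) + (+ 2 * p - 1#) * (+ 3 * (p * p) - + 3 * p - 1#)))) ≡ - (p * p * p * (p * p * p) * p - p * p * p)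
    l2 = ring
   w0 : w 0# ≡ 0#
   w0 = l P where
    l : ∀ p -> - (p * p * (0# * 0# * ((0# - p) * (0# - p)))) ≡ 0#
    l = ring
   average' : + 120 * ∑ (below p) g ≡ P * P * P * (P * P * P) * P * (+ 120 * A one 3 D) + X
   average' = average g u w (+ 4) q (A one 3 D) (+ 30) V (G-at-zero one 3 D p' & cong (_* A one 3 D) (l1 P)) w0 W-value
     (\ j co -> cong (_*_ (+ 4)) (sym (power-G 3 j)) & C.coprime-value j p' co & cong2 (\ z s -> + 4 * z * q + s) (power-A 3)
      (∑-cong (rootsN D) {w = \ f -> u f - w (+ ((f N.* j) % p))} (\ f _ -> l2 (C.bernoulli P (+ ((f N.* j) % p)))))) &
    cong (_+ X) (l3 P (A one 3 D)) where
    l1 : ∀ p -> p * p * (p * p * (p * p * 1#)) ≡ p * p * (p * p) * (p * p)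
    l1 = ring
    l2 : ∀ b -> b ≡ 0# - - b
    l2 = ring
    l3 : ∀ p a -> + 30 * + 4 * p * (p * p * (p * p) * (p * p)) * a ≡ p * p * p * (p * p * p) * p * (+ 120 * a)
    l3 = ring
   roots' : X + Y ≡ (1# + P * P * P * (P * P * P) * P - P * P * P * ρ) * ∑ (rootsN D) (\ f -> 1#)
   roots' = cong (_+_ X) (∑-roots (\ f -> 1#)) & sym (∑-+ (rootsN D) _ _) &
    ∑-cong (rootsN D) {w = \ f -> (1# + P * P * P * (P * P * P) * P - P * P * P * ρ) * 1#} pointwise & ∑-* (rootsN D) (1# + P * P * P * (P * P * P) * P - P * P * P * ρ) _ where
    l : ∀ p -> + 30 * (p - 1#) * 0# - - (p * p * p * (p * p * p) * p - p * p * p) + 1# ≡ (1# + p * p * p * (p * p * p) * p - p * p * p * 1#) * 1#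
    l = ring
    pointwise : ∀ f -> Root D f -> + 30 * (P - 1#) * u f - V + 1# ≡ (1# + P * P * P * (P * P * P) * P - P * P * P * ρ) * 1#
    pointwise f r = l P & cong (\ z -> (1# + P * P * P * (P * P * P) * P - P * P * P * z) * 1#) (sym (ρ-at-root f r))

-- The character modulo 4 and a Euclidean algorithm that suits it.

module CharacterFour where
 open FormSums public
 open DivisorSums public using (χ)

 private
  χ-+4 : ∀ n -> χ (n N.+ 4) ≡ χ n
  χ-+4 n = cong χ (N.+-comm n 4)

 -- The nontrivial character modulo 4 on all of ℤ, obtained as the odd extension of `χ`.
 ψ : ℤ -> ℤ
 ψ (+ n)    = χ n
 ψ -[1+ n ] = - χ (suc n)

 ψ-neg : ∀ a -> ψ (- a) ≡ - ψ a
 ψ-neg (+ zero)  = refl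
 ψ-neg (+ suc n) = refl
 ψ-neg -[1+ n ]  = sym (Z.neg-involutive (χ (suc n)))

 private
  ψ-+4 : ∀ a -> ψ (a + + 4) ≡ ψ a
  ψ-+4 (+ n)    = χ-+4 n
  ψ-+4 -[1+ 0 ] = refl
  ψ-+4 -[1+ 1 ] = refl
  ψ-+4 -[1+ 2 ] = refl
  ψ-+4 -[1+ 3 ] = refl
  ψ-+4 -[1+ suc (suc (suc (suc n))) ] = refl

  ψ-+4n : ∀ a n -> ψ (a + + n * + 4) ≡ ψ a
  ψ-+4n a zero    = cong ψ (Z.+-identityʳ a)
  ψ-+4n a (suc n) = cong ψ (cong (\ z -> a + z * + 4) (Z.pos-+ 1 n) & l a (+ n)) & ψ-+4 (a + + n * + 4) & ψ-+4n a n where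
   l : ∀ a n -> a + (1# + n) * + 4 ≡ a + n * + 4 + + 4
   l = ring

 ψ-periodic : ∀ a k -> ψ (a + k * + 4) ≡ ψ a
 ψ-periodic a (+ n)    = ψ-+4n a n
 ψ-periodic a -[1+ n ] = sym (ψ-+4n (a + -[1+ n ] * + 4) (suc n)) & cong ψ (l a (+ suc n)) where
  l : ∀ a n -> a + (- n) * + 4 + n * + 4 ≡ a
  l = ring

 ψ-* : ∀ a b -> ψ (a * b) ≡ ψ a * ψ b
 ψ-* a b = cong ψ (cong2 _*_ (a≡a%ℕn+[a/ℕn]*n a 4) (a≡a%ℕn+[a/ℕn]*n b 4) & l (+ r) (a /ℕ 4) (+ s) (b /ℕ 4)) &
  ψ-periodic (+ r * + s) ((a /ℕ 4) * + s + + r * (b /ℕ 4) + (a /ℕ 4) * (b /ℕ 4) * + 4) & small r s (n%ℕd<d a 4) (n%ℕd<d b 4) & sym (cong2 _*_ (residue a) (residue b)) where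
  r = a %ℕ 4
  s = b %ℕ 4
  residue : ∀ a -> ψ a ≡ ψ (+ (a %ℕ 4))
  residue a = cong ψ (a≡a%ℕn+[a/ℕn]*n a 4) & ψ-periodic (+ (a %ℕ 4)) (a /ℕ 4)
  l : ∀ r k s m -> (r + k * + 4) * (s + m * + 4) ≡ r * s + (k * s + r * m + k * m * + 4) * + 4
  l = ring
  small : ∀ r s -> r N.< 4 -> s N.< 4 -> ψ (+ r * + s) ≡ χ r * χ s
  small 0 s _ _ = refl
  small 1 0 _ _ = refl
  small 1 1 _ _ = refl
  small 1 2 _ _ = refl
  small 1 3 _ _ = refl
  small 2 0 _ _ = refl
  small 2 1 _ _ = refl
  small 2 2 _ _ = refl
  small 2 3 _ _ = refl
  small 3 0 _ _ = refl
  small 3 1 _ _ = refl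
  small 3 2 _ _ = refl
  small 3 3 _ _ = refl
  small (suc (suc (suc (suc r)))) s (s≤s (s≤s (s≤s (s≤s ())))) _
  small 1 (suc (suc (suc (suc s)))) _ (s≤s (s≤s (s≤s (s≤s ()))))
  small 2 (suc (suc (suc (suc s)))) _ (s≤s (s≤s (s≤s (s≤s ()))))
  small 3 (suc (suc (suc (suc s)))) _ (s≤s (s≤s (s≤s (s≤s ()))))

 χ-odd : ∀ i -> χ (suc (i N.+ i)) ≡ sgn i
 χ-odd 0 = refl
 χ-odd 1 = refl
 χ-odd (suc (suc i)) = cong χ (l i) & χ-odd i & sym (Z.neg-involutive (sgn i)) where
  l : ∀ i -> suc (suc (suc i) N.+ suc (suc i)) ≡ suc (suc (suc (suc (suc (i N.+ i)))))
  l = ringN!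

 +odd : ∀ i -> + suc (i N.+ i) ≡ + 2 * + i + 1#
 +odd i = Z.pos-+ 1 (i N.+ i) & cong (_+_ 1#) (Z.pos-+ i i) & l (+ i) where
  l : ∀ i -> 1# + (i + i) ≡ + 2 * i + 1#
  l = ring

 ψ-odd : ∀ i -> ψ (+ 2 * + i + 1#) ≡ sgn i
 ψ-odd i = cong ψ (sym (+odd i)) & χ-odd i

 ψ-even : ∀ z -> ψ (+ 2 * z) ≡ 0#
 ψ-even z = ψ-* (+ 2) z & Z.*-zeroˡ (ψ z)

 parity : ∀ z -> (∃ \ s -> z ≡ + 2 * s) ⊎ (∃ \ s -> z ≡ + 2 * s + 1#)
 parity z = go (z %ℕ 2) (n%ℕd<d z 2) (a≡a%ℕn+[a/ℕn]*n z 2) where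
  go : ∀ r -> r N.< 2 -> z ≡ + r + (z /ℕ 2) * + 2 -> (∃ \ s -> z ≡ + 2 * s) ⊎ (∃ \ s -> z ≡ + 2 * s + 1#)
  go 0 _ e = inl (z /ℕ 2 , e & l (z /ℕ 2)) where
   l : ∀ s -> 0# + s * + 2 ≡ + 2 * s
   l = ring
  go 1 _ e = inr (z /ℕ 2 , e & l (z /ℕ 2)) where
   l : ∀ s -> 1# + s * + 2 ≡ + 2 * s + 1#
   l = ring
  go (suc (suc r)) (s≤s (s≤s ())) _

 odd≢even : ∀ x y -> + 2 * x + 1# ≢ + 2 * y
 odd≢even x y e = 2∤1 (ZD.∣⇒∣ᵤ (ZD.divides (y - x) (l1 x & cong (_- + 2 * x) e & l2 x y))) where
  2∤1 : ¬ (2 ND.∣ 1)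
  2∤1 (ND.divides (suc q) ())
  l1 : ∀ x -> 1# ≡ + 2 * x + 1# - + 2 * x
  l1 = ring
  l2 : ∀ x y -> + 2 * y - + 2 * x ≡ (y - x) * + 2
  l2 = ring

 even-root : ∀ b m -> b * b ≡ + 4 * m -> ∃ \ s -> b ≡ + 2 * s
 even-root b m e = go (parity b) where
  l : ∀ s -> (+ 2 * s + 1#) * (+ 2 * s + 1#) ≡ + 2 * (+ 2 * s * s + + 2 * s) + 1#
  l = ring
  l2 : ∀ m -> + 4 * m ≡ + 2 * (+ 2 * m)
  l2 = ring
  go : (∃ \ s -> b ≡ + 2 * s) ⊎ (∃ \ s -> b ≡ + 2 * s + 1#) -> ∃ \ s -> b ≡ + 2 * s
  go (inl h)       = h
  go (inr (s , h)) = ⊥-elim (odd≢even (+ 2 * s * s + + 2 * s) (+ 2 * m) (sym (l s) & sym (cong2 _*_ h h) & e & l2 m))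

 -- The sign makes the weight of a = -d equal to χ(d), as `θ-X` requires.
 wt : ℤ -> ℤ
 wt a = - ψ a

 wt-neg : ∀ a -> wt (- a) ≡ - wt a
 wt-neg a = cong -_ (ψ-neg a)

 wt-* : ∀ a b -> wt (a * b) ≡ ψ b * wt a
 wt-* a b = cong -_ (ψ-* a b) & l (ψ a) (ψ b) where
  l : ∀ x y -> - (x * y) ≡ y * - x
  l = ring

 ψ-square : ∀ i -> ψ (+ suc (i N.+ i)) * ψ (+ suc (i N.+ i)) ≡ 1#
 ψ-square i = cong2 _*_ (χ-odd i) (χ-odd i) & sgn² i

 -- Euclid's algorithm for an odd second entry p = 2h+1, using only j ↦ j ± p, j ↦ p - j and p ↦ p - 2j.
 odd-euclid : (C : ℕ -> ℕ -> Set) -> C 0 0 -> (∀ j h -> C j h -> C (j N.+ suc (h N.+ h)) h) ->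
  (∀ i j h -> i N.+ j ≡ suc (h N.+ h) -> C i h -> C j h) ->
  (∀ j' h -> Coprime (suc j') (suc (h N.+ h)) -> C (suc j') h -> C (suc j') (h N.+ suc j')) ->
  ∀ h j -> Coprime j (suc (h N.+ h)) -> C j h
 odd-euclid C base shift reflect step = <-rec (\ h -> ∀ j -> Coprime j (suc (h N.+ h)) -> C j h) go where
  shift* : ∀ k j h -> C j h -> C (j N.+ k N.* suc (h N.+ h)) h
  shift* zero    j h c = subst (\ z -> C z h) (sym (N.+-identityʳ j)) c
  shift* (suc k) j h c = subst (\ z -> C z h) (l j (suc (h N.+ h)) (k N.* suc (h N.+ h))) (shift (j N.+ k N.* suc (h N.+ h)) h (shift* k j h c)) where
   l : ∀ j p q -> j N.+ q N.+ p ≡ j N.+ (p N.+ q)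
   l = ringN!
  go : ∀ h -> (∀ {h'} -> h' N.< h -> ∀ j -> Coprime j (suc (h' N.+ h')) -> C j h') -> ∀ j -> Coprime j (suc (h N.+ h)) -> C j h
  go h rec j co = subst (\ z -> C z h) (sym je) (shift* (j / p) (j % p) h (reduced (j % p) (m%n<n j p)
    (\ { {d} (d∣s , d∣p) -> co (subst (d ND.∣_) (sym je) (ND.∣m∣n⇒∣m+n d∣s (ND.∣n⇒∣m*n (j / p) d∣p)) , d∣p) }))) where
   p = suc (h N.+ h)
   je : j ≡ j % p N.+ (j / p) N.* p
   je = m≡m%n+[m/n]*n j p
   l : ∀ h s -> suc ((h N.+ s) N.+ (h N.+ s)) ≡ suc (h N.+ h) N.+ (s N.+ s)
   l = ringN!
   small : ∀ s' -> suc s' N.≤ h -> Coprime (suc s') p -> C (suc s') h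
   small s' s≤h co' = subst (C (suc s')) he (step s' h1 co1 (rec (N.∸-monoʳ-< 0<s s≤h) (suc s') co1)) where
    h1 = h N.∸ suc s'
    he : h1 N.+ suc s' ≡ h
    he = N.m∸n+n≡m s≤h
    co1 : Coprime (suc s') (suc (h1 N.+ h1))
    co1 {d} (d∣s , d∣p) = co' (d∣s , subst (d ND.∣_) (sym (l h1 (suc s')) & cong (\ z -> suc (z N.+ z)) he) (ND.∣m∣n⇒∣m+n d∣p (ND.∣m∣n⇒∣m+n d∣s d∣s)))
   one-∣ : ∀ h -> Coprime 0 (suc (h N.+ h)) -> h ≡ 0
   one-∣ zero    _  = refl
   one-∣ (suc h) co' with () ← co' (ND._∣0 (suc (suc h N.+ suc h)) , ND.∣-refl)
   reduced : ∀ s -> s N.< p -> Coprime s p -> C s h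
   reduced zero    _   co' = subst (C 0) (sym (one-∣ h co')) base
   reduced (suc s') s<p co' with suc s' N.≤? h
   ... | yes s≤h = small s' s≤h co'
   ... | no  s≰h = other (p N.∸ suc s') refl where
    other : ∀ r -> p N.∸ suc s' ≡ r -> C (suc s') h
    other zero     e = ⊥-elim (N.<⇒≱ s<p (N.m∸n≡0⇒m≤n e))
    other (suc r') e = reflect (suc r') (suc s') h rs (small r' r≤h (\ { {d} (d∣r , d∣p) -> co' (ND.∣m+n∣m⇒∣n (subst (d ND.∣_) (sym rs) d∣p) d∣r , d∣p) })) where
     rs : suc r' N.+ suc s' ≡ p
     rs = cong (N._+ suc s') (sym e) & N.m∸n+n≡m (N.<⇒≤ s<p)
     r≤h : suc r' N.≤ h
     r≤h = N.+-cancelʳ-≤ (suc h) (suc r') h (N.≤-trans (N.+-monoʳ-≤ (suc r') (N.≰⇒> s≰h)) (N.≤-reflexive (rs & sym (N.+-suc h h))))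

-- Character sums: the step from (j , p) to (j , p + 2j).

module CharacterSums where
 open Averages public
 open CharacterFour public

 -- At discriminant 4n the middle coefficient is even, so the values `α` at (1 , 2) and `β` at (1 ,
 -- -2) are congruent to `a` modulo 4 and have the same weight. The coefficient `c` has no such
 -- relation to `a`; hence steps by 2j, and not exchanges of j and p.
 module Character (n : ℕ) (0<n : 0 N.< n) where
  D4 : ℕ
  D4 = 4 N.* n

  T : ℕ -> ℕ -> ℤ
  T j p' = ∑ (forms D4 j p') (\ Q -> wt (fst Q))

  α β : Triple -> ℤ
  α (a , b , c) = a + + 2 * b + + 4 * c
  β (a , b , c) = a - + 2 * b + + 4 * c

  α-val : ∀ Q -> val (+ 1) (+ 2) Q ≡ α Q
  α-val (a , b , c) = l a b c where
   l : ∀ a b c -> a * (1# * 1#) + b * (1# * + 2) + c * (+ 2 * + 2) ≡ a + + 2 * b + + 4 * c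
   l = ring

  even-b : ∀ Q -> disc Q ≡ + D4 -> ∃ \ s -> fst (snd Q) ≡ + 2 * s
  even-b (a , b , c) d = even-root b (a * c + + n) (l1 a b c & cong (_+ + 4 * (a * c)) (d & Z.pos-* 4 n) & l2 (+ n) (a * c)) where
   l1 : ∀ a b c -> b * b ≡ b * b - + 4 * (a * c) + + 4 * (a * c)
   l1 = ring
   l2 : ∀ n x -> + 4 * n + + 4 * x ≡ + 4 * (x + n)
   l2 = ring

  wt-α : ∀ Q -> disc Q ≡ + D4 -> wt (α Q) ≡ wt (fst Q)
  wt-α (a , b , c) d = go (even-b (a , b , c) d) where
   go : (∃ \ s -> b ≡ + 2 * s) -> wt (α (a , b , c)) ≡ wt a
   go (s , refl) = cong -_ (cong ψ (l a s c) & ψ-periodic a (s + c)) where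
    l : ∀ a s c -> a + + 2 * (+ 2 * s) + + 4 * c ≡ a + (s + c) * + 4
    l = ring

  private
   wt-β : ∀ Q -> disc Q ≡ + D4 -> wt (β Q) ≡ wt (fst Q)
   wt-β (a , b , c) d = cong wt (l a b c) & wt-α (a , - b , c) (l2 a b c & d) where
    l : ∀ a b c -> a - + 2 * b + + 4 * c ≡ a + + 2 * (- b) + + 4 * c
    l = ring
    l2 : ∀ a b c -> (- b) * (- b) - + 4 * (a * c) ≡ b * b - + 4 * (a * c)
    l2 = ring
   negT : Triple -> Triple
   negT (a , b , c) = - a , - b , - c
   disc-neg : ∀ Q -> disc (negT Q) ≡ disc Q
   disc-neg (a , b , c) = l a b c where
    l : ∀ a b c -> (- b) * (- b) - + 4 * ((- a) * (- c)) ≡ b * b - + 4 * (a * c)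
    l = ring
   neg² : ∀ Q -> negT (negT Q) ≡ Q
   neg² (a , b , c) = triple-≡ (Z.neg-involutive a) (Z.neg-involutive b) (Z.neg-involutive c)
   M : Enum (IsForm D4 (+ 1) (+ 2))
   M = forms D4 1 1
   wt1 : Triple -> ℤ
   wt1 Q = wt (fst Q)
   f g : Triple -> Triple
   f Q@(a , b , c) = α Q , b + + 4 * c , c
   g Q@(a , b , c) = β Q , b - + 4 * c , c
   fg : ∀ Q -> f (g Q) ≡ Q
   fg (a , b , c) = triple-≡ (l a b c) (l2 b c) refl where
    l : ∀ a b c -> (a - + 2 * b + + 4 * c) + + 2 * (b - + 4 * c) + + 4 * c ≡ a
    l = ring
    l2 : ∀ b c -> b - + 4 * c + + 4 * c ≡ b
    l2 = ring
   gf : ∀ Q -> g (f Q) ≡ Q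
   gf (a , b , c) = triple-≡ (l a b c) (l2 b c) refl where
    l : ∀ a b c -> (a + + 2 * b + + 4 * c) - + 2 * (b + + 4 * c) + + 4 * c ≡ a
    l = ring
    l2 : ∀ b c -> b + + 4 * c - + 4 * c ≡ b
    l2 = ring
   βf : ∀ Q -> β (f Q) ≡ fst Q
   βf Q = cong fst (gf Q)
   disc-f : ∀ Q -> disc (f Q) ≡ disc Q
   disc-f (a , b , c) = l a b c where
    l : ∀ a b c -> (b + + 4 * c) * (b + + 4 * c) - + 4 * ((a + + 2 * b + + 4 * c) * c) ≡ b * b - + 4 * (a * c)
    l = ring
   disc-g : ∀ Q -> disc (g Q) ≡ disc Q
   disc-g Q = sym (disc-f (g Q)) & cong disc (fg Q)
   -- The involution Q ↦ - Q(X - Y , 2X - Y) exchanges the two sign conditions and negates the weight.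
   C≡0 : ∑ M wt1 ≡ 0#
   C≡0 = self-negating (∑-reindex M M r r {wt1} {\ Q -> - wt1 Q} to to (\ Q _ -> rr Q) (\ Q _ -> rr Q)
     (\ { Q (d , _ , _) -> cong -_ (wt-neg (α Q)) & Z.neg-involutive (wt (α Q)) & wt-α Q d }) & ∑-neg M wt1) where
    r : Triple -> Triple
    r Q@(a , b , c) = - α Q , + 2 * a + + 3 * b + + 4 * c , - (a + b + c)
    α-r : ∀ Q -> α (r Q) ≡ - fst Q
    α-r (a , b , c) = l a b c where
     l : ∀ a b c -> - (a + + 2 * b + + 4 * c) + + 2 * (+ 2 * a + + 3 * b + + 4 * c) + + 4 * - (a + b + c) ≡ - a
     l = ring
    rr : ∀ Q -> r (r Q) ≡ Q
    rr (a , b , c) = triple-≡ (l1 a b c) (l2 a b c) (l3 a b c) where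
     l1 : ∀ a b c -> - (- (a + + 2 * b + + 4 * c) + + 2 * (+ 2 * a + + 3 * b + + 4 * c) + + 4 * - (a + b + c)) ≡ a
     l1 = ring
     l2 : ∀ a b c -> + 2 * - (a + + 2 * b + + 4 * c) + + 3 * (+ 2 * a + + 3 * b + + 4 * c) + + 4 * - (a + b + c) ≡ b
     l2 = ring
     l3 : ∀ a b c -> - (- (a + + 2 * b + + 4 * c) + (+ 2 * a + + 3 * b + + 4 * c) + - (a + b + c)) ≡ c
     l3 = ring
    disc-r : ∀ Q -> disc (r Q) ≡ disc Q
    disc-r (a , b , c) = l a b c where
     l : ∀ a b c -> (+ 2 * a + + 3 * b + + 4 * c) * (+ 2 * a + + 3 * b + + 4 * c) - + 4 * (- (a + + 2 * b + + 4 * c) * - (a + b + c)) ≡ b * b - + 4 * (a * c)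
     l = ring
    to : ∀ Q -> IsForm D4 (+ 1) (+ 2) Q -> IsForm D4 (+ 1) (+ 2) (r Q)
    to Q (d , a<0 , 0<q) = disc-r Q & d , -<0 (0<≡ (α-val Q) 0<q) , 0<≡ (sym (α-val (r Q) & α-r Q)) (0<- a<0)

  module Step (j' h : ℕ) where
   Pn : ℕ
   Pn = suc ((h N.+ suc j') N.+ (h N.+ suc j'))
   j p P : ℤ
   j = + suc j'
   p = + suc (h N.+ h)
   P = + Pn
   P≡ : P ≡ p + + 2 * j
   P≡ = +odd (h N.+ suc j') & cong (\ z -> + 2 * z + 1#) (Z.pos-+ h (suc j')) & l (+ h) j & cong (_+ + 2 * j) (sym (+odd h)) where
    l : ∀ h j -> + 2 * (h + j) + 1# ≡ + 2 * h + 1# + + 2 * j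
    l = ring
   zeros : Enum (\ Q -> IsForm D4 (+ 1) (+ 2) Q × val j P Q ≡ 0#)
   zeros = M ↾ (\ Q -> val j P Q ≟ 0#)
   val-f : ∀ Q -> val j p (f Q) ≡ val j P Q
   val-f (a , b , c) = l a b c j p & cong (\ z -> val j z (a , b , c)) (sym P≡) where
    l : ∀ a b c j p -> (a + + 2 * b + + 4 * c) * (j * j) + (b + + 4 * c) * (j * p) + c * (p * p) ≡ a * (j * j) + b * (j * (p + + 2 * j)) + c * ((p + + 2 * j) * (p + + 2 * j))
    l = ring
   private
    F' = forms D4 (suc j') ((h N.+ suc j') N.+ (h N.+ suc j'))
    F  = forms D4 (suc j') (h N.+ h)
    X⁺ X⁻ Y⁺ : ℤ
    X⁺ = ∑ (F' ↾ (\ Q -> 0# <? α Q)) wt1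
    X⁻ = ∑ (F' ↾ (\ Q -> α Q <? 0#)) wt1
    Y⁺ = ∑ (F ↾ (\ Q -> 0# <? β Q)) wt1
    val-neg : ∀ Q -> val j p (negT Q) ≡ - val j p Q
    val-neg (a , b , c) = l a b c j p where
     l : ∀ a b c j p -> (- a) * (j * j) + (- b) * (j * p) + (- c) * (p * p) ≡ - (a * (j * j) + b * (j * p) + c * (p * p))
     l = ring
    F'-split : ∑ F' wt1 ≡ X⁺ + X⁻
    F'-split = ∑-sign F' α & cong (_+ X⁻) (cong (_+_ X⁺) (∑-0 (F' ↾ (\ Q -> α Q ≟ 0#)) (\ { Q ((d , _) , e) -> sym (wt-α Q d) & cong wt e })) & Z.+-identityʳ X⁺)
    F-split : ∑ F wt1 ≡ Y⁺ + X⁻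
    F-split = ∑-sign F β & cong2 _+_ (cong (_+_ Y⁺) (∑-0 (F ↾ (\ Q -> β Q ≟ 0#)) (\ { Q ((d , _) , e) -> sym (wt-β Q d) & cong wt e })) & Z.+-identityʳ Y⁺)
     (∑-reindex (F ↾ (\ Q -> β Q <? 0#)) (F' ↾ (\ Q -> α Q <? 0#)) g f {wt1} {wt1}
      (\ { Q ((d , a<0 , q) , b<0) -> (disc-g Q & d , b<0 , 0<≡ (cong (val j p) (sym (fg Q)) & val-f (g Q)) q) , ≡<0 (sym (cong fst (fg Q))) a<0 })
      (\ { Q ((d , a<0 , q) , α<0) -> (disc-f Q & d , α<0 , 0<≡ (sym (val-f Q)) q) , ≡<0 (sym (βf Q)) a<0 })
      (\ Q _ -> fg Q) (\ Q _ -> gf Q) (\ { Q ((d , _) , _) -> wt-β Q d }))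
    M-split : ∑ M wt1 ≡ X⁺ + ∑ zeros wt1 + - Y⁺
    M-split = ∑-sign M (val j P) & cong2 (\ y z -> y + ∑ zeros wt1 + z)
     (∑-same (M ↾ (\ Q -> 0# <? val j P Q)) (F' ↾ (\ Q -> 0# <? α Q))
      (\ { Q ((d , a<0 , m) , q) -> (d , a<0 , q) , 0<≡ (α-val Q) m }) (\ { Q ((d , a<0 , q) , m) -> (d , a<0 , 0<≡ (sym (α-val Q)) m) , q }))
     (∑-reindex (M ↾ (\ Q -> val j P Q <? 0#)) (F ↾ (\ Q -> 0# <? β Q)) (negT ∘ f) (g ∘ negT) {wt1} {\ Q -> - wt1 Q}
      (\ { Q ((d , a<0 , m) , q) -> (disc-neg (f Q) & disc-f Q & d , -<0 (0<≡ (α-val Q) m) , 0<≡ (sym (val-neg (f Q) & cong -_ (val-f Q))) (0<- q)) ,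
        0<≡ (sym (β-neg (f Q) & cong -_ (βf Q))) (0<- a<0) })
      (\ { Q ((d , a<0 , q) , b) -> (disc-g (negT Q) & disc-neg Q & d , ≡<0 (sym (β-neg Q)) (-<0 b) ,
        0<≡ (sym (α-val (g (negT Q)) & cong fst (fg (negT Q)))) (0<- a<0)) ,
        ≡<0 (sym (val-neg Q) & cong (val j p) (sym (fg (negT Q))) & val-f (g (negT Q))) (-<0 q) })
      (\ Q _ -> cong g (neg² (f Q)) & gf Q) (\ Q _ -> cong negT (fg (negT Q)) & neg² Q)
      (\ { Q ((d , _) , _) -> cong -_ (wt-neg (α Q)) & Z.neg-involutive (wt (α Q)) & wt-α Q d }) &
      ∑-neg (F ↾ (\ Q -> 0# <? β Q)) wt1) where
     β-neg : ∀ Q -> β (negT Q) ≡ - β Q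
     β-neg (a , b , c) = l a b c where
      l : ∀ a b c -> (- a) - + 2 * (- b) + + 4 * (- c) ≡ - (a - + 2 * b + + 4 * c)
      l = ring
   -- Cutting by the signs of `α`, of `β` and of the value at (j , P) writes three sums in terms of
   -- common pieces. `C≡0` says that one of them vanishes, and the forms vanishing at (j , P)
   -- account for the difference of the other two.
   step : T (suc j') ((h N.+ suc j') N.+ (h N.+ suc j')) ≡ T (suc j') (h N.+ h) - ∑ zeros wt1
   step = F'-split & l X⁺ X⁻ Y⁺ (∑ zeros wt1) & cong2 (\ y z -> y - ∑ zeros wt1 + z) (sym F-split) (sym M-split & C≡0) & Z.+-identityʳ _ where
    l : ∀ x w y z -> x + w ≡ (y + w) - z + (x + z + - y)
    l = ring
   -- The form (PX - jY)((u - 2k)X + kY). The parameters are chosen so that its value at (1 , 2) is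
   -- pu and its discriminant is the square of ju + pk.
   Φ : ℤ -> ℤ -> Triple
   Φ u k = P * (u - + 2 * k) , P * k - j * (u - + 2 * k) , - (j * k)
   α-Φ : ∀ u k -> α (Φ u k) ≡ p * u
   α-Φ u k = cong (\ z -> z * (u - + 2 * k) + + 2 * (z * k - j * (u - + 2 * k)) + + 4 * - (j * k)) P≡ & l p j u k where
    l : ∀ p j u k -> (p + + 2 * j) * (u - + 2 * k) + + 2 * ((p + + 2 * j) * k - j * (u - + 2 * k)) + + 4 * - (j * k) ≡ p * u
    l = ring
   disc-Φ : ∀ u k -> disc (Φ u k) ≡ (j * u + p * k) * (j * u + p * k)
   disc-Φ u k = cong (\ z -> (z * k - j * (u - + 2 * k)) * (z * k - j * (u - + 2 * k)) - + 4 * (z * (u - + 2 * k) * - (j * k))) P≡ & l p j u k where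
    l : ∀ p j u k -> ((p + + 2 * j) * k - j * (u - + 2 * k)) * ((p + + 2 * j) * k - j * (u - + 2 * k)) - + 4 * ((p + + 2 * j) * (u - + 2 * k) * - (j * k)) ≡ (j * u + p * k) * (j * u + p * k)
    l = ring
   val-Φ : ∀ u k -> val j P (Φ u k) ≡ 0#
   val-Φ u k = l P j u k where
    l : ∀ P j u k -> P * (u - + 2 * k) * (j * j) + (P * k - j * (u - + 2 * k)) * (j * P) + - (j * k) * (P * P) ≡ 0#
    l = ring
   -- A form vanishing at the primitive vector (j , P) has (P X - j Y) as a linear factor.
   decode : Coprime (suc j') (suc (h N.+ h)) -> ∀ Q -> val j P Q ≡ 0# -> ∃ \ u -> ∃ \ k -> Q ≡ Φ u k
   decode co Q q = back (divides-j (f Q) (val-f Q & q)) where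
    divides-j : ∀ R -> val j p R ≡ 0# -> ∃ \ u -> ∃ \ k -> R ≡ (p * u , p * k - j * u , - (j * k))
    divides-j (a , b , c) e = go (divide p a p∣a) (divide j c j∣c) where
     divide : ∀ x y -> ∣ x ∣ ND.∣ ∣ y ∣ -> ∃ \ z -> y ≡ x * z
     divide x y d with ZD.∣ᵤ⇒∣ {x} {y} d
     ... | ZD.divides z e' = z , e' & Z.*-comm z x
     p∣a : suc (h N.+ h) ND.∣ ∣ a ∣
     p∣a = cancel-j (cancel-j (subst (suc (h N.+ h) ND.∣_) (ajj a) (ZD.∣⇒∣ᵤ (ZD.divides {+ suc (h N.+ h)} {a * (j * j)} (- (b * j + c * p)) (l1 a b c j p & cong (_- (b * j + c * p) * p) e & l2 (b * j + c * p) p))))) where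
      l1 : ∀ a b c j p -> a * (j * j) ≡ a * (j * j) + b * (j * p) + c * (p * p) - (b * j + c * p) * p
      l1 = ring
      l2 : ∀ x p -> 0# - x * p ≡ (- x) * p
      l2 = ring
      ajj : ∀ a -> ∣ a * (j * j) ∣ ≡ suc j' N.* (suc j' N.* ∣ a ∣)
      ajj a = (cong ∣_∣ (l3 a j)) & Z.abs-* j (j * a) & cong (suc j' N.*_) (Z.abs-* j a) where
       l3 : ∀ a j -> a * (j * j) ≡ j * (j * a)
       l3 = ring
      cancel-j : ∀ {m} -> suc (h N.+ h) ND.∣ suc j' N.* m -> suc (h N.+ h) ND.∣ m
      cancel-j = CP.coprime-divisor (CP.sym co)
     j∣c : suc j' ND.∣ ∣ c ∣
     j∣c = cancel-p (cancel-p (subst (suc j' ND.∣_) cpp (ZD.∣⇒∣ᵤ (ZD.divides {+ suc j'} {c * (p * p)} (- (a * j + b * p)) (l1 a b c j p & cong (_- (a * j + b * p) * j) e & l2 (a * j + b * p) j))))) where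
      l1 : ∀ a b c j p -> c * (p * p) ≡ a * (j * j) + b * (j * p) + c * (p * p) - (a * j + b * p) * j
      l1 = ring
      l2 : ∀ x p -> 0# - x * p ≡ (- x) * p
      l2 = ring
      cpp : ∣ c * (p * p) ∣ ≡ suc (h N.+ h) N.* (suc (h N.+ h) N.* ∣ c ∣)
      cpp = (cong ∣_∣ (l3 c p)) & Z.abs-* p (p * c) & cong (suc (h N.+ h) N.*_) (Z.abs-* p c) where
       l3 : ∀ a j -> a * (j * j) ≡ j * (j * a)
       l3 = ring
      cancel-p : ∀ {m} -> suc j' ND.∣ suc (h N.+ h) N.* m -> suc j' ND.∣ m
      cancel-p = CP.coprime-divisor co
     go : (∃ \ u -> a ≡ p * u) -> (∃ \ k -> c ≡ j * k) -> ∃ \ u -> ∃ \ k -> (a , b , c) ≡ (p * u , p * k - j * u , - (j * k))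
     go (u , ea) (k , ec) = u , - k , triple-≡ ea b-value (ec & l0 j k) where
      l0 : ∀ j k -> j * k ≡ - (j * (- k))
      l0 = ring
      l1 : ∀ b j p u k -> j * (p * b) ≡ p * u * (j * j) + b * (j * p) + j * k * (p * p) - j * (p * (u * j + k * p))
      l1 = ring
      l2 : ∀ j p u k -> 0# - j * (p * (u * j + k * p)) ≡ j * (p * (p * (- k) - j * u))
      l2 = ring
      b-value : b ≡ p * (- k) - j * u
      b-value = Z.*-cancelˡ-≡ p b (p * (- k) - j * u) (Z.*-cancelˡ-≡ j (p * b) (p * (p * (- k) - j * u)) (l1 b j p u k &
       cong (_- j * (p * (u * j + k * p))) (sym (cong2 (\ y z -> y * (j * j) + b * (j * p) + z * (p * p)) ea ec) & e) & l2 j p u k))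
    l4 : ∀ p j u k -> p * u - + 2 * (p * k - j * u) + + 4 * - (j * k) ≡ (p + + 2 * j) * (u - + 2 * k)
    l4 = ring
    l5 : ∀ p j u k -> p * k - j * u - + 4 * - (j * k) ≡ (p + + 2 * j) * k - j * (u - + 2 * k)
    l5 = ring
    g-factored : ∀ u k -> g (p * u , p * k - j * u , - (j * k)) ≡ Φ u k
    g-factored u k = triple-≡ (l4 p j u k & cong (_* (u - + 2 * k)) (sym P≡)) (l5 p j u k & cong (\ z -> z * k - j * (u - + 2 * k)) (sym P≡)) refl
    back : (∃ \ u -> ∃ \ k -> f Q ≡ (p * u , p * k - j * u , - (j * k))) -> ∃ \ u -> ∃ \ k -> Q ≡ Φ u k
    back (u , k , e) = u , k , sym (gf Q) & cong g e & g-factored u k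

-- Values of the character sums at coprime vectors.

module CharacterValues where
 open CharacterSums public

 private
  ψ-odd-ℤ : ∀ z -> ψ (+ 2 * z + 1#) ≡ sg z
  ψ-odd-ℤ (+ m)    = ψ-odd m
  ψ-odd-ℤ -[1+ m ] = cong ψ (cong (\ z -> + 2 * - z + 1#) (Z.pos-+ 1 m) & l (+ m)) & ψ-neg (+ 2 * + m + 1#) & cong -_ (ψ-odd m) where
   l : ∀ m -> + 2 * - (1# + m) + 1# ≡ - (+ 2 * m + 1#)
   l = ring

  odd-positive : ∀ z -> 0# < + 2 * z + 1# -> ∃ \ w -> z ≡ + w
  odd-positive (+ w)    _ = w , refl
  odd-positive -[1+ m ] q = ⊥-elim (absurd (0<≡ (cong (\ z -> + 2 * - z + 1#) (Z.pos-+ 1 m) & l (+ m) & cong -_ (sym (+odd m))) q)) where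
   l : ∀ m -> + 2 * - (1# + m) + 1# ≡ - (+ 2 * m + 1#)
   l = ring
   absurd : ¬ (0# < - (+ suc (m N.+ m)))
   absurd ()

  square-equal : ∀ x y -> x * x ≡ y * y -> x ≡ y ⊎ x ≡ - y
  square-equal x y e with Z.i*j≡0⇒i≡0∨j≡0 (x - y) {x + y} (l x y & cong (_- y * y) e & Z.+-inverseʳ (y * y)) where
   l : ∀ x y -> (x - y) * (x + y) ≡ x * x - y * y
   l = ring
  ... | inl h = inl (Z.i-j≡0⇒i≡j x y h)
  ... | inr h = inr (Z.i-j≡0⇒i≡j x (- y) (cong (_+_ x) (Z.neg-involutive y) & h))

  difference-negative : ∀ {x y} -> x < y -> x - y < 0#
  difference-negative {x} {y} x<y = subst (x - y <_) (Z.+-inverseʳ y) (Z.+-monoˡ-< (- y) x<y)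

  sgn-odd-* : ∀ h e -> sgn (suc (h N.+ h) N.* e) ≡ sgn e
  sgn-odd-* h e = cong sgn (l h e) & sgn-+ e (h N.* e N.+ h N.* e) & cong (_*_ (sgn e)) (sgn-+ (h N.* e) (h N.* e) & sgn² (h N.* e)) & Z.*-identityʳ (sgn e) where
   l : ∀ h e -> suc (h N.+ h) N.* e ≡ e N.+ (h N.* e N.+ h N.* e)
   l = ringN!

 ∑-sgn : ∀ N -> + 2 * ∑ (below N) sgn ≡ 1# - sgn N
 ∑-sgn zero    = cong (_*_ (+ 2)) (∑-below-zero sgn) & refl
 ∑-sgn (suc N) = cong (_*_ (+ 2)) (∑-below-last N sgn) & Z.*-distribˡ-+ (+ 2) (∑ (below N) sgn) (sgn N) & cong (_+ + 2 * sgn N) (∑-sgn N) & l (sgn N) where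
  l : ∀ s -> 1# - s + + 2 * s ≡ 1# - - s
  l = ring

 module CharacterValue (n : ℕ) (0<n : 0 N.< n) where
  open Character n 0<n public

  zeros-root : ∀ j' h -> Coprime (suc j') (suc (h N.+ h)) -> ∀ Q -> IsForm D4 (+ 1) (+ 2) Q -> val (Step.j j' h) (Step.P j' h) Q ≡ 0# -> ∃ \ t -> Root n t
  zeros-root j' h co Q (d , _) q = go (decode co Q q) where
   open Step j' h
   go : (∃ \ u -> ∃ \ k -> Q ≡ Φ u k) -> ∃ \ t -> Root n t
   go (u , k , e) = go2 (even-root m (+ n) mm) where
    m = j * u + p * k
    mm : m * m ≡ + 4 * + n
    mm = sym (disc-Φ u k) & cong disc (sym e) & d & Z.pos-* 4 n
    go2 : (∃ \ s -> m ≡ + 2 * s) -> ∃ \ t -> Root n t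
    go2 (s , e2) = ∣ s ∣ , nonzero ∣ s ∣ tt , tt where
     l : ∀ s -> + 4 * (s * s) ≡ + 2 * s * (+ 2 * s)
     l = ring
     ss : s * s ≡ + n
     ss = Z.*-cancelˡ-≡ (+ 4) (s * s) (+ n) (l s & sym (cong2 _*_ e2 e2) & mm)
     tt : ∣ s ∣ N.* ∣ s ∣ ≡ n
     tt = Z.+-injective (sym (square-abs s) & ss)
     nonzero : ∀ t -> t N.* t ≡ n -> 0 N.< t
     nonzero zero    e3 = ⊥-elim (N.<⇒≢ 0<n e3)
     nonzero (suc t) _  = s≤s z≤n

  -- A form that vanishes at a nonzero integral vector has a square discriminant; if n is no square,
  -- none of the steps changes the sum.
  nonsquare : (∀ t -> ¬ Root n t) -> ∀ h j -> Coprime j (suc (h N.+ h)) -> T j (h N.+ h) ≡ T 0 0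
  nonsquare none = odd-euclid (\ j h -> T j (h N.+ h) ≡ T 0 0) refl
   (\ j h e -> forms-shift D4 (\ a _ -> wt a) j (h N.+ h) & e)
   (\ i j h s e -> sym (forms-reflect D4 (\ a _ -> wt a) i j (h N.+ h) s) & e)
   (\ j' h co e -> Step.step j' h & cong (_-_ (T (suc j') (h N.+ h))) (∑-empty (Step.zeros j' h) (\ { Q (m , q) -> let t , r = zeros-root j' h co Q m q in none t r })) &
    Z.+-identityʳ (T (suc j') (h N.+ h)) & e)

  module Square (t : ℕ) (0<t : 0 N.< t) (t² : t N.* t ≡ n) where
   -- 2i + 1 is the odd solution y < 2p of j y ≡ 2t (mod p), and k is the cofactor of p.
   Good : ℕ -> ℕ -> ℕ -> ℤ -> Set
   Good j h i k = + j * (+ 2 * + i + 1#) + + suc (h N.+ h) * k ≡ + 2 * + t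
   Value : ℕ -> ℕ -> Set
   Value j h = ∀ i k -> i N.< suc (h N.+ h) -> Good j h i k -> + 2 * T j (h N.+ h) ≡ + 2 * T 0 0 + 1# - ψ (+ suc (h N.+ h)) * sgn i
   private
    base : Value 0 0
    base zero    k _ _ = l (+ 2 * T 0 0) where
     l : ∀ x -> x ≡ x + 1# - 1# * 1#
     l = ring
    base (suc i) k (s≤s ()) _
    shift : ∀ j h -> Value j h -> Value (j N.+ suc (h N.+ h)) h
    shift j h v i k i<p good = cong (_*_ (+ 2)) (forms-shift D4 (\ a _ -> wt a) j (h N.+ h)) &
     v i (k + (+ 2 * + i + 1#)) i<p (l (+ j) (+ suc (h N.+ h)) (+ 2 * + i + 1#) k & cong (\ z -> z * (+ 2 * + i + 1#) + + suc (h N.+ h) * k) (sym (Z.pos-+ j (suc (h N.+ h)))) & good) where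
     l : ∀ j p y k -> j * y + p * (k + y) ≡ (j + p) * y + p * k
     l = ring
    -- If y solves the congruence for j, then 2p - y solves it for p - j; the index 2h - i has the
    -- parity of i, so the sign is unchanged.
    reflect : ∀ i j h -> i N.+ j ≡ suc (h N.+ h) -> Value i h -> Value j h
    reflect i0 j h s v i k i<p good = cong (_*_ (+ 2)) (sym (forms-reflect D4 (\ a _ -> wt a) i0 j (h N.+ h) s)) &
     v e (k + (+ 2 * + i + 1#) - + 2 * + i0) e<p good' & cong (\ z -> + 2 * T 0 0 + 1# - ψ (+ suc (h N.+ h)) * z) sgn-e where
     e = h N.+ h N.∸ i
     e+i : e N.+ i ≡ h N.+ h
     e+i = N.m∸n+n≡m (N.≤-pred i<p)
     e<p : e N.< suc (h N.+ h)
     e<p = s≤s (N.m∸n≤m (h N.+ h) i)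
     sgn-e : sgn e ≡ sgn i
     sgn-e = sym (Z.*-identityʳ (sgn e)) & cong (_*_ (sgn e)) (sym (sgn² i)) & sym (Z.*-assoc (sgn e) (sgn i) (sgn i)) &
      cong (_* sgn i) (sym (sgn-+ e i) & cong sgn e+i & sgn-+ h h & sgn² h) & Z.*-identityˡ (sgn i)
     pe : + suc (h N.+ h) ≡ 1# + (+ e + + i)
     pe = Z.pos-+ 1 (h N.+ h) & cong (_+_ 1#) (cong +_ (sym e+i) & Z.pos-+ e i)
     pj : + j ≡ + suc (h N.+ h) - + i0
     pj = l0 (+ i0) (+ j) & cong (_- + i0) (sym (Z.pos-+ i0 j) & cong +_ s) where
      l0 : ∀ i j -> j ≡ i + j - i
      l0 = ring
     good' : Good i0 h e (k + (+ 2 * + i + 1#) - + 2 * + i0)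
     good' = cong (\ z -> + i0 * (+ 2 * + e + 1#) + z * (k + (+ 2 * + i + 1#) - + 2 * + i0)) pe & l (+ i0) (+ e) (+ i) k &
      cong (\ z -> (z - + i0) * (+ 2 * + i + 1#) + z * k) (sym pe) & cong (\ z -> z * (+ 2 * + i + 1#) + + suc (h N.+ h) * k) (sym pj) & good where
      l : ∀ a e i k -> a * (+ 2 * e + 1#) + (1# + (e + i)) * (k + (+ 2 * i + 1#) - + 2 * a) ≡ (1# + (e + i) - a) * (+ 2 * i + 1#) + (1# + (e + i)) * k
      l = ring
    module Euclid (j' h : ℕ) (co : Coprime (suc j') (suc (h N.+ h))) (i' : ℕ) (k : ℤ)
      (i<P : i' N.< suc ((h N.+ suc j') N.+ (h N.+ suc j'))) (good : Good (suc j') (h N.+ suc j') i' k) where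
     open Step j' h
     -- A consequence of P = p + 2j. Its right side is positive, so i' + k is a natural number w;
     -- read modulo 4 it compares the signs of w and i' in `transfer`.
     Pw : P * (+ 2 * (+ i' + k) + 1#) ≡ p * (+ 2 * + i' + 1#) + + 4 * + t
     Pw = l1 P (+ i') k & cong (\ z -> z * (+ 2 * + i' + 1#) + + 2 * (P * k)) P≡ & l2 p j (+ 2 * + i' + 1#) (P * k) & cong (\ z -> p * (+ 2 * + i' + 1#) + + 2 * z) good & l3 (p * (+ 2 * + i' + 1#)) (+ t) where
      l1 : ∀ P i k -> P * (+ 2 * (i + k) + 1#) ≡ P * (+ 2 * i + 1#) + + 2 * (P * k)
      l1 = ring
      l2 : ∀ p j y x -> (p + + 2 * j) * y + + 2 * x ≡ p * y + + 2 * (j * y + x)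
      l2 = ring
      l3 : ∀ x t -> x + + 2 * (+ 2 * t) ≡ x + + 4 * t
      l3 = ring
     w-exists : ∃ \ w -> + i' + k ≡ + w
     w-exists = odd-positive (+ i' + k) (pos-*⁻ Pn (+ 2 * (+ i' + k) + 1#) 0<s
      (0<≡ (positive-form & sym Pw & Z.*-comm P (+ 2 * (+ i' + k) + 1#)) (+<+ 0<s))) where
      positive-form : + suc ((i' N.+ i') N.+ (h N.+ h) N.* suc (i' N.+ i') N.+ 4 N.* t) ≡ p * (+ 2 * + i' + 1#) + + 4 * + t
      positive-form = Z.pos-+ (suc ((i' N.+ i') N.+ (h N.+ h) N.* suc (i' N.+ i'))) (4 N.* t) &
       cong2 _+_ (Z.pos-* (suc (h N.+ h)) (suc (i' N.+ i')) & cong (_*_ p) (+odd i')) (Z.pos-* 4 t)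
     w : ℕ
     w = fst w-exists
     we : + i' + k ≡ + w
     we = snd w-exists
     pn : ℕ
     pn = suc (h N.+ h)
     -- `i0` is the index belonging to the vector (j , p), and `N` turns out to be the number of
     -- zeros with nonzero weight.
     i0 N : ℕ
     i0 = w % pn
     N = w / pn
     w-split : w ≡ i0 N.+ N N.* pn
     w-split = m≡m%n+[m/n]*n w pn
     good-w : j * (+ 2 * + w + 1#) + p * k ≡ + 2 * + t
     good-w = cong (\ z -> j * (+ 2 * z + 1#) + p * k) (sym we) & l j p (+ i') k & cong (\ z -> j * (+ 2 * + i' + 1#) + z * k) (sym P≡) & good where
      l : ∀ j p i k -> j * (+ 2 * (i + k) + 1#) + p * k ≡ j * (+ 2 * i + 1#) + (p + + 2 * j) * k
      l = ring
     good0 : Good (suc j') h i0 (k + + 2 * j * + N)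
     good0 = l j p (+ i0) (+ N) k & cong (\ z -> j * (+ 2 * z + 1#) + p * k) (sym (cong +_ w-split & Z.pos-+ i0 (N N.* pn) & cong (_+_ (+ i0)) (Z.pos-* N pn))) & good-w where
      l : ∀ j p i N k -> j * (+ 2 * i + 1#) + p * (k + + 2 * j * N) ≡ j * (+ 2 * (i + N * p) + 1#) + p * k
      l = ring
     u κ' : ℤ -> ℤ
     u e  = + 2 * (+ w - p * e) + 1#
     κ' e = k + + 2 * j * e
     on-line : ∀ e -> j * u e + p * κ' e ≡ + 2 * + t
     on-line e = l j p (+ w) k e & good-w where
      l : ∀ j p w k e -> j * (+ 2 * (w - p * e) + 1#) + p * (k + + 2 * j * e) ≡ j * (+ 2 * w + 1#) + p * k
      l = ring
     slack : ∀ e -> u e - + 2 * κ' e ≡ + 2 * + i' + 1# - + 2 * P * e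
     slack e = cong (\ z -> + 2 * (z - p * e) + 1# - + 2 * (k + + 2 * j * e)) (sym we) & l j p (+ i') k e & cong (\ z -> + 2 * + i' + 1# - + 2 * z * e) (sym P≡) where
      l : ∀ j p i k e -> + 2 * (i + k - p * e) + 1# - + 2 * (k + + 2 * j * e) ≡ + 2 * i + 1# - + 2 * (p + + 2 * j) * e
      l = ring
     wt-Φ : ∀ v k1 -> disc (Φ v k1) ≡ + D4 -> wt (fst (Φ v k1)) ≡ - (ψ p * ψ v)
     wt-Φ v k1 d = sym (wt-α (Φ v k1) d) & cong -_ (cong ψ (α-Φ v k1) & ψ-* p v)
     disc-2t : ∀ v k1 -> j * v + p * k1 ≡ + 2 * + t -> disc (Φ v k1) ≡ + D4
     disc-2t v k1 e = disc-Φ v k1 & cong2 _*_ e e & l (+ t) & cong (_*_ (+ 4)) (sym (Z.pos-* t t) & cong +_ t²) & sym (Z.pos-* 4 n) where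
      l : ∀ t -> + 2 * t * (+ 2 * t) ≡ + 4 * (t * t)
      l = ring
     ψ-u : ∀ e -> ψ (u (+ e)) ≡ sgn w * sgn e
     ψ-u e = ψ-odd-ℤ (+ w - p * + e) & sg-+ (+ w) (- (p * + e)) & cong (_*_ (sgn w)) (sg-neg (p * + e) & cong sg (sym (Z.pos-* pn e)) & sgn-odd-* h e)
     -- The line j u + p k = 2t through (u 0 , κ′ 0) meets the region u > 0, 2k > u in the points e = 1, …, N.
     odd-zeros : Enum (\ Q -> (IsForm D4 (+ 1) (+ 2) Q × val j P Q ≡ 0#) × wt (fst Q) ≢ 0#)
     odd-zeros = zeros ↾ (\ Q -> ¬? (wt (fst Q) ≟ 0#))
     φ' : ℕ -> Triple
     φ' i = Φ (u (+ suc i)) (κ' (+ suc i))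
     wt-φ : ∀ i -> wt (fst (φ' i)) ≡ - (ψ p * (sgn w * sgn (suc i)))
     wt-φ i = wt-Φ (u (+ suc i)) (κ' (+ suc i)) (disc-2t (u (+ suc i)) (κ' (+ suc i)) (on-line (+ suc i))) & cong (\ z -> - (ψ p * z)) (ψ-u (suc i))
     nonzero-sign : ∀ x y z -> x * x ≡ 1# -> y * y ≡ 1# -> z * z ≡ 1# -> - (x * (y * z)) ≢ 0#
     nonzero-sign x y z ex ey ez e = contra (sym (l x y z & cong2 _*_ ex (cong2 _*_ ey ez) & refl) & cong (\ s -> s * s) e) where
      l : ∀ x y z -> - (x * (y * z)) * - (x * (y * z)) ≡ x * x * (y * y * (z * z))
      l = ring
      contra : 1# ≢ 0# * 0#
      contra ()
     to : ∀ i -> i N.< N -> (IsForm D4 (+ 1) (+ 2) (φ' i) × val j P (φ' i) ≡ 0#) × wt (fst (φ' i)) ≢ 0#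
     to i i<N = ((disc-2t (u (+ suc i)) (κ' (+ suc i)) (on-line (+ suc i)) , negative , positive) , val-Φ (u (+ suc i)) (κ' (+ suc i)))
       , (\ e -> nonzero-sign (ψ p) (sgn w) (sgn (suc i)) (ψ-square h) (sgn² w) (sgn² (suc i)) (sym (wt-φ i) & e)) where
      below-2P : suc (i' N.+ i') N.< 2 N.* Pn N.* suc i
      below-2P = N.<-≤-trans (N.≤-trans (N.≤-reflexive (cong suc (sym (N.+-suc i' i')))) (N.≤-trans (N.+-mono-≤ i<P i<P) (N.≤-reflexive (l Pn)))) (N.m≤m*n (2 N.* Pn) (suc i)) where
       l : ∀ P -> P N.+ P ≡ 2 N.* P
       l = ringN!
      2Pe : + (2 N.* Pn N.* suc i) ≡ + 2 * P * + suc i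
      2Pe = Z.pos-* (2 N.* Pn) (suc i) & cong (_* + suc i) (Z.pos-* 2 Pn)
      difference : u (+ suc i) - + 2 * κ' (+ suc i) < 0#
      difference = ≡<0 (sym (slack (+ suc i) & cong2 _-_ (sym (+odd i')) (sym 2Pe))) (difference-negative (+<+ below-2P))
      negative : P * (u (+ suc i) - + 2 * κ' (+ suc i)) < 0#
      negative = ≡<0 (Z.*-comm (u (+ suc i) - + 2 * κ' (+ suc i)) P) (neg-*⁺ Pn 0<s difference)
      pe≤w : pn N.* suc i N.≤ w
      pe≤w = N.≤-trans (N.≤-reflexive (N.*-comm pn (suc i))) (N.≤-trans (N.*-monoˡ-≤ pn i<N) (N.≤-trans (N.m≤n+m (N N.* pn) i0) (N.≤-reflexive (sym w-split))))
      r : ℕ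
      r = w N.∸ pn N.* suc i
      u-value : u (+ suc i) ≡ + suc (r N.+ r)
      u-value = cong (\ z -> + 2 * z + 1#) (cong (_-_ (+ w)) (sym (Z.pos-* pn (suc i))) & cong (_- + (pn N.* suc i)) (cong +_ (sym (N.m∸n+n≡m pe≤w)) & Z.pos-+ r (pn N.* suc i)) & l (+ r) (+ (pn N.* suc i))) & sym (+odd r) where
       l : ∀ r x -> r + x - x ≡ r
       l = ring
      positive : 0# < val (+ 1) (+ 2) (φ' i)
      positive = 0<≡ (sym (α-val (φ' i) & α-Φ (u (+ suc i)) (κ' (+ suc i)) & Z.*-comm p (u (+ suc i)) & cong (_* p) u-value)) (pos-*⁺ pn {+ suc (r N.+ r)} 0<s (+<+ 0<s))
     inj : ∀ i i1 -> φ' i ≡ φ' i1 -> i ≡ i1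
     inj i i1 e = N.suc-injective (Z.+-injective (Z.*-cancelˡ-≡ p (+ suc i) (+ suc i1) (Z.*-cancelˡ-≡ (+ 2) (p * + suc i) (p * + suc i1) (l (+ w) (p * + suc i) & cong (\ z -> + 2 * + w + 1# - z) u-eq & sym (l (+ w) (p * + suc i1)))))) where
      l : ∀ w x -> + 2 * x ≡ + 2 * w + 1# - (+ 2 * (w - x) + 1#)
      l = ring
      u-eq : u (+ suc i) ≡ u (+ suc i1)
      u-eq = Z.*-cancelˡ-≡ p (u (+ suc i)) (u (+ suc i1)) (sym (α-Φ (u (+ suc i)) (κ' (+ suc i))) & cong α e & α-Φ (u (+ suc i1)) (κ' (+ suc i1)))
     onto : ∀ Q -> (IsForm D4 (+ 1) (+ 2) Q × val j P Q ≡ 0#) × wt (fst Q) ≢ 0# -> ∃ \ i -> i N.< N × φ' i ≡ Q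
     onto Q ((m , q) , nz) = from-decoded (decode co Q q) m nz where
      from-decoded : (∃ \ v -> ∃ \ k1 -> Q ≡ Φ v k1) -> IsForm D4 (+ 1) (+ 2) Q -> wt (fst Q) ≢ 0# -> ∃ \ i -> i N.< N × φ' i ≡ Q
      from-decoded (v , k1 , refl) (d , a<0 , q') nz = split-parity (parity v) where
       0<v : 0# < v
       0<v = pos-*⁻ pn v 0<s (0<≡ (α-val (Φ v k1) & α-Φ v k1 & Z.*-comm p v) q')
       0<gap : 0# < + 2 * k1 - v
       0<gap = 0<≡ (l v k1) (0<- (neg-*⁻ Pn (v - + 2 * k1) 0<s (≡<0 (Z.*-comm P (v - + 2 * k1)) a<0))) where
        l : ∀ v k -> - (v - + 2 * k) ≡ + 2 * k - v
        l = ring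
       0<m : 0# < j * v + p * k1
       0<m = pos-*⁻ 2 (j * v + p * k1) 0<s (0<≡ (l j p v k1) (Z.+-mono-< (Z.+-mono-< (pos-*⁺ (suc (h N.+ h)) 0<s 0<gap) (pos-*⁺ (suc (h N.+ h)) 0<s 0<v)) (Z.+-mono-< (pos-*⁺ (suc j') 0<s 0<v) (pos-*⁺ (suc j') 0<s 0<v)))) where
        l : ∀ j p v k -> ((+ 2 * k - v) * p + v * p) + (v * j + v * j) ≡ (j * v + p * k) * + 2
        l = ring
       on-2t : j * v + p * k1 ≡ + 2 * + t
       on-2t = choose (square-equal (j * v + p * k1) (+ 2 * + t) (sym (disc-Φ v k1) & d & Z.pos-* 4 n & cong (_*_ (+ 4)) (cong +_ (sym t²) & Z.pos-* t t) & l (+ t))) where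
        l : ∀ t -> + 4 * (t * t) ≡ + 2 * t * (+ 2 * t)
        l = ring
        absurd : ∀ t -> ¬ (0# < - (+ (2 N.* t)))
        absurd zero    (+<+ ())
        absurd (suc t) ()
        choose : j * v + p * k1 ≡ + 2 * + t ⊎ j * v + p * k1 ≡ - (+ 2 * + t) -> j * v + p * k1 ≡ + 2 * + t
        choose (inl e) = e
        choose (inr e) = ⊥-elim (absurd t (0<≡ (e & cong -_ (sym (Z.pos-* 2 t))) 0<m))
       split-parity : (∃ \ s -> v ≡ + 2 * s) ⊎ (∃ \ s -> v ≡ + 2 * s + 1#) -> ∃ \ i -> i N.< N × φ' i ≡ Φ v k1
       split-parity (inl (s , e)) = ⊥-elim (nz (wt-Φ v k1 d & cong (\ z -> - (ψ p * z)) (cong ψ e & ψ-even s) & cong -_ (Z.*-zeroʳ (ψ p))))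
       split-parity (inr (s , e)) = found (divides-p (ZD.∣ᵤ⇒∣ {p} {+ 2 * (+ w - s)} p∣)) where
        jx : j * (+ 2 * (+ w - s)) ≡ (k1 - k) * p
        jx = l1 j p (+ w) s k & cong (_- (j * (+ 2 * s + 1#) + p * k)) good-w & cong (_- (j * (+ 2 * s + 1#) + p * k)) (sym on-2t & cong (\ z -> j * z + p * k1) e) & l2 j p s k1 k where
         l1 : ∀ j p w s k -> j * (+ 2 * (w - s)) ≡ j * (+ 2 * w + 1#) + p * k - (j * (+ 2 * s + 1#) + p * k)
         l1 = ring
         l2 : ∀ j p s k1 k -> j * (+ 2 * s + 1#) + p * k1 - (j * (+ 2 * s + 1#) + p * k) ≡ (k1 - k) * p
         l2 = ring
        p∣ : pn ND.∣ ∣ + 2 * (+ w - s) ∣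
        p∣ = CP.coprime-divisor (CP.sym co) (subst (pn ND.∣_) (Z.abs-* j (+ 2 * (+ w - s))) (ZD.∣⇒∣ᵤ (ZD.divides {p} {j * (+ 2 * (+ w - s))} (k1 - k) jx)))
        divides-p : p ZD.∣ + 2 * (+ w - s) -> ∃ \ e -> s ≡ + w - p * e
        divides-p (ZD.divides c ec) = (+ w - s) - + h * c , l1 (+ w) s & cong (_-_ (+ w)) (l2 (+ h) (+ w - s) & cong (\ z -> (+ 2 * + h + 1#) * (+ w - s) - + h * z) ec & cong (\ z -> z * (+ w - s) - + h * (c * p)) (sym (+odd h)) & l3 p (+ w - s) (+ h) c) where
         l1 : ∀ w s -> s ≡ w - (w - s)
         l1 = ring
         l2 : ∀ h x -> x ≡ (+ 2 * h + 1#) * x - h * (+ 2 * x)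
         l2 = ring
         l3 : ∀ p x h c -> p * x - h * (c * p) ≡ p * (x - h * c)
         l3 = ring
        found : (∃ \ e -> s ≡ + w - p * e) -> ∃ \ i -> i N.< N × φ' i ≡ Φ v k1
        found (x , es) = natural x 0<x v-eq k-eq where
         v-eq : v ≡ u x
         v-eq = e & cong (\ z -> + 2 * z + 1#) es
         k-eq : k1 ≡ κ' x
         k-eq = Z.*-cancelˡ-≡ p k1 (κ' x) (l (j * v) (p * k1) & cong2 _-_ on-2t (cong (_*_ j) v-eq) & cong (_- j * u x) (sym (on-line x)) & sym (l (j * u x) (p * κ' x))) where
          l : ∀ a b -> b ≡ a + b - a
          l = ring
         0<x : 0# < x
         0<x = pos-*⁻ (2 N.* Pn) x 0<s (0<≡ (cong (\ z -> + 2 * k1 - v + z) (+odd i') & gap-eq & Z.*-comm (+ 2 * P) x & cong (_*_ x) (sym (Z.pos-* 2 Pn)))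
          (Z.+-mono-< 0<gap (+<+ 0<s))) where
          l1 : ∀ v k y -> + 2 * k - v + y ≡ y - (v - + 2 * k)
          l1 = ring
          l2 : ∀ y z -> y - (y - z) ≡ z
          l2 = ring
          gap-eq : + 2 * k1 - v + (+ 2 * + i' + 1#) ≡ + 2 * P * x
          gap-eq = l1 v k1 (+ 2 * + i' + 1#) & cong (_-_ (+ 2 * + i' + 1#)) (cong2 (\ y z -> y - + 2 * z) v-eq k-eq & slack x) & l2 (+ 2 * + i' + 1#) (+ 2 * P * x)
         natural : ∀ x -> 0# < x -> v ≡ u x -> k1 ≡ κ' x -> ∃ \ i -> i N.< N × φ' i ≡ Φ v k1
         natural (+ zero)  (+<+ ()) _ _
         natural (+ suc i) _ ev ek = i , i<N (odd-positive (+ w - p * + suc i) (0<≡ ev 0<v)) , cong2 Φ (sym ev) (sym ek) where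
          i<N : (∃ \ r -> + w - p * + suc i ≡ + r) -> i N.< N
          i<N (r , er) = N.≤-pred (N.*-cancelʳ-< pn (suc i) (suc N) (N.≤-<-trans (N.m+n≤o⇒n≤o r (N.≤-reflexive (Z.+-injective (Z.pos-+ r (suc i N.* pn) & cong2 _+_ (sym er) (Z.pos-* (suc i) pn) & l (+ w) p (+ suc i)))))
           (subst (N._< suc N N.* pn) (sym w-split) (N.+-monoˡ-< (N N.* pn) (m%n<n w pn))))) where
           l : ∀ w p x -> w - p * x + x * p ≡ w
           l = ring
     -- Forms with even u have weight zero. Along the remaining points of the line each step changes
     -- u by 2p with p odd, so u changes by 2 modulo 4 and the signs alternate.
     zeros-sum : ∑ zeros (\ Q -> wt (fst Q)) ≡ ψ p * sgn w * ∑ (below N) sgn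
     zeros-sum = ∑-drop zeros (\ Q -> ¬? (wt (fst Q) ≟ 0#)) (\ Q _ nn -> decidable-stable (wt (fst Q) ≟ 0#) nn) &
      sym (∑-bij (below N) odd-zeros φ' {\ i -> ψ p * sgn w * sgn i} {\ Q -> wt (fst Q)} to inj onto (\ i _ -> wt-φ i & l (ψ p) (sgn w) (sgn i))) &
       ∑-* (below N) (ψ p * sgn w) sgn where
      l : ∀ a b c -> - (a * (b * - c)) ≡ a * b * c
      l = ring
     sgn-w : sgn w ≡ sgn i0 * sgn N
     sgn-w = cong sgn w-split & sgn-+ i0 (N N.* pn) & cong (_*_ (sgn i0)) (cong sgn (N.*-comm N pn) & sgn-odd-* h N)
     transfer : ψ p * sgn w ≡ ψ P * sgn i'
     transfer = sym (Z.*-identityˡ (ψ p * sgn w)) & cong (_* (ψ p * sgn w)) (sym (ψ-square (h N.+ suc j'))) & l1 (ψ P) (ψ p) (sgn w) & cong (\ z -> ψ P * (ψ p * z)) Pψ & l2 (ψ P) (ψ p) (sgn i') & cong (_* (ψ P * sgn i')) (ψ-square h) & Z.*-identityˡ (ψ P * sgn i') where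
      l1 : ∀ P p s -> P * P * (p * s) ≡ P * (p * (P * s))
      l1 = ring
      l2 : ∀ P p s -> P * (p * (p * s)) ≡ p * p * (P * s)
      l2 = ring
      Pψ : ψ P * sgn w ≡ ψ p * sgn i'
      Pψ = cong (_*_ (ψ P)) (sym (ψ-odd w)) & sym (ψ-* P (+ 2 * + w + 1#)) & cong ψ (cong (\ z -> P * (+ 2 * z + 1#)) (sym we) & Pw & cong (_+_ (p * (+ 2 * + i' + 1#))) (Z.*-comm (+ 4) (+ t))) &
       ψ-periodic (p * (+ 2 * + i' + 1#)) (+ t) & ψ-* p (+ 2 * + i' + 1#) & cong (_*_ (ψ p)) (ψ-odd i')
     -- The alternating sum over N terms is (1 - sgn N)/2. With sgn w = sgn i0 · sgn N its
     -- contribution replaces ψ(p) sgn i0 by ψ(p) sgn w, which `transfer` turns into ψ(P) sgn i'.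
     result : Value (suc j') h -> + 2 * T (suc j') ((h N.+ suc j') N.+ (h N.+ suc j')) ≡ + 2 * T 0 0 + 1# - ψ P * sgn i'
     result v = cong (_*_ (+ 2)) (step & cong (_-_ (T (suc j') (h N.+ h))) zeros-sum) & l1 (T (suc j') (h N.+ h)) (ψ p * sgn w) (∑ (below N) sgn) &
      cong2 (\ y z -> y - ψ p * sgn w * z) (v i0 (k + + 2 * j * + N) (m%n<n w pn) good0) (∑-sgn N) & cong (\ z -> + 2 * T 0 0 + 1# - ψ p * sgn i0 - ψ p * z * (1# - sgn N)) sgn-w &
      l2 (+ 2 * T 0 0 + 1#) (ψ p) (sgn i0) (sgn N) & cong (\ z -> + 2 * T 0 0 + 1# - ψ p * (sgn i0 * sgn N) - ψ p * sgn i0 * (1# - z)) (sgn² N) &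
      l3 (+ 2 * T 0 0 + 1#) (ψ p * (sgn i0 * sgn N)) (ψ p * sgn i0) & cong (_-_ (+ 2 * T 0 0 + 1#)) (cong (_*_ (ψ p)) (sym sgn-w) & transfer) where
      l1 : ∀ T x s -> + 2 * (T - x * s) ≡ + 2 * T - x * (+ 2 * s)
      l1 = ring
      l2 : ∀ a p i N -> a - p * i - p * (i * N) * (1# - N) ≡ a - p * (i * N) - p * i * (1# - N * N)
      l2 = ring
      l3 : ∀ a x y -> a - x - y * (1# - 1#) ≡ a - x
      l3 = ring
   value : ∀ h j -> Coprime j (suc (h N.+ h)) -> Value j h
   value = odd-euclid Value base shift reflect (\ j' h co v i k i<P good -> Euclid.result j' h co i k i<P good v)

-- The Hecke relation for the weight χ₋₄(a).

module HeckeCharacter where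
 open CharacterValues public

 -- For n > 0, half the number of representations of n by three squares (see `θ³-value`); the second
 -- sum is the boundary term at squares.
 H0 : ℕ -> ℤ
 H0 n = + 2 * A wt 0 (4 N.* n) + ∑ (rootsN n) (\ _ -> 1#)

 square-injective : ∀ a b -> a N.* a ≡ b N.* b -> a ≡ b
 square-injective a b e = N.≤-antisym (le a b (N.≤-reflexive e)) (le b a (N.≤-reflexive (sym e))) where
  le : ∀ a b -> a N.* a N.≤ b N.* b -> a N.≤ b
  le a b q = N.≮⇒≥ (\ b<a -> N.<⇒≱ (N.*-mono-< b<a b<a) q)

 root-dec : ∀ n -> (∃ \ t -> Root n t) ⊎ (∀ t -> ¬ Root n t)
 root-dec n = go (N.anyUpTo? (\ t -> (0 N.<? t) ×-dec (t N.* t N.≟ n)) (suc n)) where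
  go : Dec (∃ \ t -> t N.< suc n × Root n t) -> (∃ \ t -> Root n t) ⊎ (∀ t -> ¬ Root n t)
  go (yes (t , _ , r)) = inl (t , r)
  go (no none)         = inr \ { (suc t) (q , e) -> none (suc t , s≤s (subst (suc t N.≤_) e (N.m≤m*n (suc t) (suc t))) , q , e) }

 module HeckeChar (h : ℕ) (prime : Prime (suc (h N.+ h))) (odd-p : suc (h N.+ h) ≢ 2) (n : ℕ) (0<n : 0 N.< n) (p∤n : ¬ Zero (suc (h N.+ h)) (+ n)) where
  open Average (h N.+ h) prime odd-p n p∤n
  open CharacterValue n 0<n
  open Congruence p using (≡C; Cong-sym; _>>_; Cong-*; Cong-+)

  private
   P ρ A0 ΣG : ℤ
   P = + p
   ρ = roots (+ D4) - 1#
   A0 = A wt 0 D4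
   ΣG = ∑ (below p) (\ j -> G wt 0 D4 j (h N.+ h))
   p∤4 : ¬ Zero p (+ 4)
   p∤4 z = ¬zero-* (+ 2) (+ 2) ¬zero-2 ¬zero-2 z
   p∤D4 : ¬ Zero p (+ D4)
   p∤D4 z = ¬zero-* (+ 4) (+ n) p∤4 p∤n (subst (Zero p) (Z.pos-* 4 n) z)
   G-T : ∀ j p' -> G wt 0 D4 j p' ≡ T j p'
   G-T j p' = ∑-cong (forms D4 j p') (\ Q _ -> Z.*-identityʳ (wt (fst Q)))
   coprime : ∀ j -> j N.< h N.+ h -> Coprime (suc j) p
   coprime j j<p = CP.sym (prime⇒coprime prime (s≤s j<p))
   ΣG-split : ΣG ≡ A0 + ∑ (below (h N.+ h)) (\ j -> T (suc j) (h N.+ h))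
   ΣG-split = ∑-below-suc (h N.+ h) (\ j -> G wt 0 D4 j (h N.+ h)) & cong2 _+_ (G-at-zero wt 0 D4 (h N.+ h) & Z.*-identityˡ A0) (∑-cong (below (h N.+ h)) (\ j _ -> G-T (suc j) (h N.+ h)))
   P≡ : P ≡ 1# + + (h N.+ h)
   P≡ = Z.pos-+ 1 (h N.+ h)
   module NonSquare (none : ∀ t -> ¬ Root n t) where
    ΣG-value : ΣG ≡ P * A0
    ΣG-value = ΣG-split & cong (_+_ A0) (∑-cong (below (h N.+ h)) (\ j j<p -> nonsquare none h (suc j) (coprime j j<p) & sym (G-T 0 0)) & ∑-const (h N.+ h) A0) &
     l A0 (+ (h N.+ h)) & cong (_* A0) (sym P≡) where
     l : ∀ a x -> a + x * a ≡ (1# + x) * a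
     l = ring
   module IsSquare (t : ℕ) (0<t : 0 N.< t) (t² : t N.* t ≡ n) where
    open Square t 0<t t²
    τ : ℤ
    τ = + 2 * + t
    p∤τ : ¬ Zero p τ
    p∤τ = ¬zero-* (+ 2) (+ t) ¬zero-2 (∤-root t (0<t , t²))
    ρ≡1 : ρ ≡ 1#
    ρ≡1 = cong (_- 1#) (roots-two (+ D4) τ p∤τ (≡C (l (+ t) & cong (_*_ (+ 4)) (sym (Z.pos-* t t) & cong +_ t²) & sym (Z.pos-* 4 n)))) where
     l : ∀ t -> + 2 * t * (+ 2 * t) ≡ + 4 * (t * t)
     l = ring
    Line : ℕ -> ℕ -> Set
    Line j i = Cong p (+ j * (+ 2 * + i + 1#)) τ
    line-j : ∀ j i -> Line j i -> ¬ Zero p (+ j)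
    line-j j i e z = p∤τ (Cong-sym e >> zero1 (+ 2 * + i + 1#) (Z.*-comm (+ j) (+ 2 * + i + 1#)) z)
    line-i : ∀ j i -> Line j i -> ¬ Zero p (+ 2 * + i + 1#)
    line-i j i e z = p∤τ (Cong-sym e >> zero1 (+ j) refl z)
    unique-i : ∀ j i i1 -> i N.< p -> i1 N.< p -> Line j i -> Line j i1 -> i ≡ i1
    unique-i j i i1 a b e e1 = small-unique i i1 a b (minus-zero (euclid-¬ (+ 2) (+ i - + i1) ¬zero-2 (euclid-¬ (+ j) (+ 2 * (+ i - + i1)) (line-j j i e)
     (≡C (l (+ j) (+ i) (+ i1)) >> zero-minus (e >> Cong-sym e1))))) where
     l : ∀ j i k -> j * (+ 2 * (i - k)) ≡ j * (+ 2 * i + 1#) - j * (+ 2 * k + 1#)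
     l = ring
    unique-j : ∀ j j1 i -> j N.< p -> j1 N.< p -> Line j i -> Line j1 i -> j ≡ j1
    unique-j j j1 i a b e e1 = small-unique j j1 a b (minus-zero (euclid-¬ (+ 2 * + i + 1#) (+ j - + j1) (line-i j i e)
     (≡C (l (+ j) (+ j1) (+ 2 * + i + 1#)) >> zero-minus (e >> Cong-sym e1)))) where
     l : ∀ j k y -> y * (j - k) ≡ j * y - k * y
     l = ring
    solve-i : ∀ j -> ¬ Zero p (+ j) -> ∃ \ i -> i N.< p × Line j i
    solve-i j nz = res z , res< z , Cong-* (≡C {+ j} refl) (Cong-+ (Cong-* (≡C {+ 2} refl) (Cong-sym (res-cong z))) (≡C {1#} refl)) >>
     ≡C (l (+ j) half v τ) >> Cong-+ (Cong-* (≡C {+ j} refl) (Cong-+ (Cong-* half-law (≡C {τ * v - 1#} refl)) (≡C {1#} refl))) (≡C {0#} refl) >>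
     ≡C (l2 (+ j) v τ) >> Cong-* (≡C {τ} refl) v-law >> ≡C (Z.*-identityʳ τ) where
     half = fst (inverse (+ 2) ¬zero-2)
     half-law = snd (inverse (+ 2) ¬zero-2)
     v = fst (inverse (+ j) nz)
     v-law = snd (inverse (+ j) nz)
     z = half * (τ * v - 1#)
     l : ∀ j h v t -> j * (+ 2 * (h * (t * v - 1#)) + 1#) ≡ j * (h * + 2 * (t * v - 1#) + 1#) + 0#
     l = ring
     l2 : ∀ j v t -> j * (1# * (t * v - 1#) + 1#) + 0# ≡ t * (v * j)
     l2 = ring
    solve-j : ∀ i -> ¬ Zero p (+ 2 * + i + 1#) -> ∃ \ j -> j N.< p × Line j i
    solve-j i nz = res (τ * v) , res< (τ * v) , Cong-* (Cong-sym (res-cong (τ * v))) (≡C {+ 2 * + i + 1#} refl) >>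
     ≡C (Z.*-assoc τ v (+ 2 * + i + 1#)) >> Cong-* (≡C {τ} refl) v-law >> ≡C (Z.*-identityʳ τ) where
     v = fst (inverse (+ 2 * + i + 1#) nz)
     v-law = snd (inverse (+ 2 * + i + 1#) nz)
    attempt-i : ∀ j -> Dec (Zero p (+ j)) -> ℕ
    attempt-i j (yes _) = 0
    attempt-i j (no nz) = fst (solve-i j nz)
    attempt-i-law : ∀ j d -> ¬ Zero p (+ j) -> attempt-i j d N.< p × Line j (attempt-i j d)
    attempt-i-law j (yes z) nz = ⊥-elim (nz z)
    attempt-i-law j (no nz) _  = snd (solve-i j nz)
    attempt-j : ∀ i -> Dec (Zero p (+ 2 * + i + 1#)) -> ℕ
    attempt-j i (yes _) = 0
    attempt-j i (no nz) = fst (solve-j i nz)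
    attempt-j-law : ∀ i d -> ¬ Zero p (+ 2 * + i + 1#) -> attempt-j i d N.< p × Line (attempt-j i d) i
    attempt-j-law i (yes z) nz = ⊥-elim (nz z)
    attempt-j-law i (no nz) _  = snd (solve-j i nz)
    i-of j-of : ℕ -> ℕ
    i-of j = attempt-i (suc j) (zero? p (+ suc j))
    j-of i = N.pred (attempt-j i (zero? p (+ 2 * + i + 1#)))
    small-nonzero : ∀ j -> j N.< h N.+ h -> ¬ Zero p (+ suc j)
    small-nonzero j j<p z = N.<⇒≱ (s≤s j<p) (ND.∣⇒≤ (zero⇒∣ z))
    i-law : ∀ j -> j N.< h N.+ h -> i-of j N.< p × Line (suc j) (i-of j)
    i-law j j<p = attempt-i-law (suc j) (zero? p (+ suc j)) (small-nonzero j j<p)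
    odd-nonzero : ∀ i -> i N.< p -> i ≢ h -> ¬ Zero p (+ 2 * + i + 1#)
    odd-nonzero i i<p i≢h z = i≢h (small-unique i h i<p (s≤s (N.m≤m+n h h)) (minus-zero (euclid-¬ (+ 2) (+ i - + h) ¬zero-2
     (zero2 1# (- 1#) (l (+ i) (+ h) & cong (\ z -> 1# * (+ 2 * + i + 1#) + - 1# * z) (sym (+odd h))) z (zero-by 1# (sym (Z.*-identityˡ P))))))) where
     l : ∀ i h -> + 2 * (i - h) ≡ 1# * (+ 2 * i + 1#) + - 1# * (+ 2 * h + 1#)
     l = ring
    j-law : ∀ i -> i N.< p -> i ≢ h -> j-of i N.< h N.+ h × Line (suc (j-of i)) i
    j-law i i<p i≢h = positive (attempt-j i (zero? p (+ 2 * + i + 1#))) (attempt-j-law i (zero? p (+ 2 * + i + 1#)) (odd-nonzero i i<p i≢h)) where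
     positive : ∀ j -> j N.< p × Line j i -> N.pred j N.< h N.+ h × Line (suc (N.pred j)) i
     positive zero    (_ , e) = ⊥-elim (line-j 0 i e (zero-by 0# refl))
     positive (suc j) (a , e) = N.≤-pred a , e
    i≢h : ∀ j -> j N.< h N.+ h -> i-of j ≢ h
    i≢h j j<p e = line-i (suc j) (i-of j) (snd (i-law j j<p)) (zero-by 1# (cong (\ z -> + 2 * + z + 1#) e & sym (+odd h) & sym (Z.*-identityˡ P)))
    -- As j runs through the nonzero residues, 2i + 1 runs through all of them too, so i omits only
    -- h, where 2h + 1 = p. The alternating sum over all i < p is 1, and the omitted sign is ψ(p).
    ∑-sgn-i : ∑ (below (h N.+ h)) (\ j -> sgn (i-of j)) ≡ 1# - ψ P
    ∑-sgn-i = ∑-reindex (below (h N.+ h)) (below p ↾ (\ i -> ¬? (i N.≟ h))) i-of j-of {\ j -> sgn (i-of j)} {sgn}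
      (\ j j<p -> fst (i-law j j<p) , i≢h j j<p) (\ { i (i<p , ne) -> fst (j-law i i<p ne) })
      (\ j j<p -> let i<p , e = i-law j j<p ; j'<p , e' = j-law (i-of j) i<p (i≢h j j<p) in N.suc-injective (unique-j (suc (j-of (i-of j))) (suc j) (i-of j) (s≤s j'<p) (s≤s j<p) e' e))
      (\ { i (i<p , ne) -> let j<p , e = j-law i i<p ne ; i'<p , e' = i-law (j-of i) j<p in unique-i (suc (j-of i)) (i-of (j-of i)) i i'<p i<p e' e })
      (\ _ _ -> refl) &
     l (sgn h) (∑ (below p ↾ (\ i -> ¬? (i N.≟ h))) sgn) & cong2 _-_ (cong (_+ ∑ (below p ↾ (\ i -> ¬? (i N.≟ h))) sgn) (sym (∑-single (below p ↾ (N._≟ h)) {sgn} h (s≤s (N.m≤m+n h h) , refl) (\ { i (_ , e) -> e }))) &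
      sym (∑-split (below p) (N._≟ h)) & total) (sym (χ-odd h)) where
     l : ∀ s x -> x ≡ s + x - s
     l = ring
     total : ∑ (below p) sgn ≡ 1#
     total = Z.*-cancelˡ-≡ (+ 2) (∑ (below p) sgn) 1# (∑-sgn p & cong (\ z -> 1# - - z) (sgn-+ h h & sgn² h))
    T-value : ∀ j -> j N.< h N.+ h -> + 2 * T (suc j) (h N.+ h) ≡ + 2 * A0 + 1# - ψ P * sgn (i-of j)
    T-value j j<p = use (zero-quotient (zero-minus (snd (i-law j j<p)))) & cong (\ z -> + 2 * z + 1# - ψ P * sgn (i-of j)) (sym (G-T 0 0)) where
     l : ∀ x τ q p -> x - τ ≡ q * p -> x + p * (- q) ≡ τ
     l x τ q p e = l1 x τ (q * p) p q & cong (\ z -> z + τ - q * p) e & l2 (q * p) τ where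
      l1 : ∀ x τ y p q -> x + p * (- q) ≡ x - τ + τ - q * p
      l1 = ring
      l2 : ∀ y τ -> y + τ - y ≡ τ
      l2 = ring
     use : (∃ \ q -> + suc j * (+ 2 * + i-of j + 1#) - τ ≡ q * P) -> + 2 * T (suc j) (h N.+ h) ≡ + 2 * T 0 0 + 1# - ψ P * sgn (i-of j)
     use (q , e) = value h (suc j) (coprime j j<p) (i-of j) (- q) (fst (i-law j j<p)) (l (+ suc j * (+ 2 * + i-of j + 1#)) τ q P e)
    ΣG-value : + 2 * ΣG ≡ + 2 * P * A0 + P - ψ P
    ΣG-value = cong (_*_ (+ 2)) ΣG-split & Z.*-distribˡ-+ (+ 2) A0 (∑ (below (h N.+ h)) (\ j -> T (suc j) (h N.+ h))) & cong (_+_ (+ 2 * A0)) (sym (∑-* (below (h N.+ h)) (+ 2) (\ j -> T (suc j) (h N.+ h))) &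
     ∑-cong (below (h N.+ h)) T-value & ∑-- (below (h N.+ h)) (\ _ -> + 2 * A0 + 1#) (\ j -> ψ P * sgn (i-of j)) & cong2 _-_ (∑-const (h N.+ h) (+ 2 * A0 + 1#))
      (∑-* (below (h N.+ h)) (ψ P) (\ j -> sgn (i-of j)) & cong (_*_ (ψ P)) ∑-sgn-i)) &
     l A0 (+ (h N.+ h)) (ψ P) & cong (\ z -> + 2 * (1# + + (h N.+ h)) * A0 + + (h N.+ h) - ψ P + z) (ψ-square h) & l2 A0 (+ (h N.+ h)) (ψ P) & cong (\ z -> + 2 * z * A0 + z - ψ P) (sym P≡) where
     l : ∀ a x s -> + 2 * a + (x * (+ 2 * a + 1#) - s * (1# - s)) ≡ + 2 * (1# + x) * a + x - s + s * s
     l = ring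
     l2 : ∀ a x s -> + 2 * (1# + x) * a + x - s + 1# ≡ + 2 * (1# + x) * a + (1# + x) - s
     l2 = ring

  private
   hecke' : A wt 0 (4 N.* D') + ρ * (ψ P * 1# * A0) ≡ A0 + ΣG
   hecke' = cong (\ z -> A wt 0 z + ρ * (ψ P * 1# * A0)) (l p n) & Hecke.hecke (h N.+ h) prime odd-p wt 0 (ψ P)
    (\ a -> wt-* a (P * P) & cong (_* wt a) (ψ-* P P & ψ-square h) & Z.*-identityˡ (wt a)) (\ a -> wt-* a P) D4 p∤D4 where
    l : ∀ p n -> 4 N.* (p N.* p N.* n) ≡ p N.* p N.* (4 N.* n)
    l = ringN!
   combine : ∀ a' a s ρ x y c -> a' + ρ * (c * 1# * a) ≡ a + s -> + 2 * s ≡ + 2 * P * a + x -> x + y ≡ (1# + P - c * ρ) * y -> + 2 * a' + y ≡ (1# + P - c * ρ) * (+ 2 * a + y)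
   combine a' a s ρ x y c e1 e2 e3 = l1 a' (ρ * (c * 1# * a)) y & cong (\ z -> + 2 * z - + 2 * (ρ * (c * 1# * a)) + y) e1 & l2 a s (ρ * (c * 1# * a)) y &
    cong (\ z -> + 2 * a + z - + 2 * (ρ * (c * 1# * a)) + y) e2 & l3 a P x ρ c y & cong (_+_ ((1# + P - c * ρ) * (+ 2 * a))) e3 & sym (Z.*-distribˡ-+ (1# + P - c * ρ) (+ 2 * a) y) where
    l1 : ∀ a r y -> + 2 * a + y ≡ + 2 * (a + r) - + 2 * r + y
    l1 = ring
    l2 : ∀ a s r y -> + 2 * (a + s) - + 2 * r + y ≡ + 2 * a + + 2 * s - + 2 * r + y
    l2 = ring
    l3 : ∀ a P x ρ c y -> + 2 * a + (+ 2 * P * a + x) - + 2 * (ρ * (c * 1# * a)) + y ≡ (1# + P - c * ρ) * (+ 2 * a) + (x + y)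
    l3 = ring

  -- ψ(p) times the symbol of n is the symbol of -n. For square n the surplus P - ψ(P) of the
  -- averaged sum is absorbed by the root count in `H0`.
  character : H0 D' ≡ (1# + P - ψ P * ρ) * H0 n
  character = cong (_+_ (+ 2 * A wt 0 (4 N.* D'))) (∑-roots (\ _ -> 1#)) & go (root-dec n) where
   go : (∃ \ t -> Root n t) ⊎ (∀ t -> ¬ Root n t) -> + 2 * A wt 0 (4 N.* D') + ∑ (rootsN n) (\ _ -> 1#) ≡ (1# + P - ψ P * ρ) * H0 n
   go (inr none) = combine (A wt 0 (4 N.* D')) A0 ΣG ρ 0# (∑ (rootsN n) (\ _ -> 1#)) (ψ P) hecke'
    (cong (_*_ (+ 2)) (NonSquare.ΣG-value none) & l P A0) (cong (_+_ 0#) empty & l2 (1# + P - ψ P * ρ) & cong (_*_ (1# + P - ψ P * ρ)) (sym empty)) where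
    empty : ∑ (rootsN n) (\ _ -> 1#) ≡ 0#
    empty = ∑-empty (rootsN n) none
    l : ∀ P a -> + 2 * (P * a) ≡ + 2 * P * a + 0#
    l = ring
    l2 : ∀ x -> 0# + 0# ≡ x * 0#
    l2 = ring
   go (inl (t , 0<t , t²)) = combine (A wt 0 (4 N.* D')) A0 ΣG ρ (P - ψ P) (∑ (rootsN n) (\ _ -> 1#)) (ψ P) hecke'
    (IsSquare.ΣG-value t 0<t t² & Z.+-assoc (+ 2 * P * A0) P (- ψ P))
    (cong (_+_ (P - ψ P)) one-root & l P (ψ P) & cong2 (\ y z -> (1# + P - ψ P * y) * z) (sym (IsSquare.ρ≡1 t 0<t t²)) (sym one-root)) where
    one-root : ∑ (rootsN n) (\ _ -> 1#) ≡ 1#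
    one-root = ∑-single (rootsN n) t (0<t , t²) (\ { f (_ , e) -> square-injective f t (e & sym t²) })
    l : ∀ P c -> P - c + 1# ≡ (1# + P - c * 1#) * 1#
    l = ring

-- Coefficients of θE as sums over forms.

module ThetaForms where
 open HeckeCharacter public
 open HeckeOddWeights public
 open Identification public hiding (parity; E; x; y)
 open Identification public using () renaming (x to ξ)

 private
  half-double : ∀ s -> (+ 2 * s) /ℕ 2 ≡ s
  half-double s = go ((+ 2 * s) %ℕ 2) (n%ℕd<d (+ 2 * s) 2) (a≡a%ℕn+[a/ℕn]*n (+ 2 * s) 2) where
   h = (+ 2 * s) /ℕ 2
   go : ∀ r -> r N.< 2 -> + 2 * s ≡ + r + h * + 2 -> h ≡ s
   go 0 _ e = Z.*-cancelˡ-≡ (+ 2) h s (Z.*-comm (+ 2) h & sym (Z.+-identityˡ (h * + 2)) & sym e)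
   go 1 _ e = ⊥-elim (odd≢even h s (l h & sym e)) where
    l : ∀ h -> + 2 * h + 1# ≡ 1# + h * + 2
    l = ring
   go (suc (suc r)) (s≤s (s≤s ())) _

  Conv : ℕ -> ℕ × ℤ × (ℕ × ℕ) -> Set
  Conv n (k , s , z) = k N.< suc n × Sqrt k s × Divs (n N.∸ k) z

  conv-equation : ∀ n k s d e -> Conv n (k , s , (d , e)) -> s * s + + d * + e ≡ + n
  conv-equation n k s d e (k<n , ss , (_ , _ , de)) = cong2 _+_ ss (sym (Z.pos-* d e) & cong +_ de) & sym (Z.pos-+ k (n N.∸ k)) & cong +_ (N.m+[n∸m]≡n (N.≤-pred k<n))

  conv-intro : ∀ n s d e -> 0 N.< d -> 0 N.< e -> s * s + + d * + e ≡ + n -> Conv n (∣ s ∣ N.* ∣ s ∣ , s , (d , e))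
  conv-intro n s d e 0<d 0<e eq = s≤s (subst (∣ s ∣ N.* ∣ s ∣ N.≤_) total (N.m≤m+n (∣ s ∣ N.* ∣ s ∣) (d N.* e))) , square-abs s , 0<d , 0<e ,
    sym (N.m+n∸m≡n (∣ s ∣ N.* ∣ s ∣) (d N.* e)) & cong (N._∸ ∣ s ∣ N.* ∣ s ∣) total where
   total : ∣ s ∣ N.* ∣ s ∣ N.+ d N.* e ≡ n
   total = Z.+-injective (Z.pos-+ (∣ s ∣ N.* ∣ s ∣) (d N.* e) & cong2 _+_ (sym (square-abs s)) (Z.pos-* d e) & eq)

  conv-k : ∀ n k s z -> Conv n (k , s , z) -> ∣ s ∣ N.* ∣ s ∣ ≡ k
  conv-k n k s z (_ , ss , _) = Z.+-injective (sym (square-abs s) & ss)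

  Convolved : ∀ n -> Enum _
  Convolved n = below (suc n) ▹ (\ k _ -> sqrts k ▹ (\ _ _ -> divs (n N.∸ k)))

  abs-neg : ∀ d -> ∣ - + d ∣ ≡ d
  abs-neg d = Z.∣-i∣≡∣i∣ (+ d)

  negated : ∀ {a} -> a < 0# -> - + ∣ a ∣ ≡ a × 0 N.< ∣ a ∣
  negated { -[1+ n ]} _ = refl , s≤s z≤n
  negated {+ n} (+<+ ())

  positive : ∀ {c} -> 0# < c -> + ∣ c ∣ ≡ c × 0 N.< ∣ c ∣
  positive {+ suc n} _ = refl , s≤s z≤n
  positive {+ zero} (+<+ ())

  neg-lt : ∀ {d} -> 0 N.< d -> - + d < 0#
  neg-lt {suc d} _ = -<+

 -- A splitting n = s² + de corresponds to the form (-d , 2s , e) of discriminant 4n; no form is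
 -- missed, since a discriminant divisible by 4 forces an even middle coefficient.
 θ-forms : ∀ (w : ℤ -> ℤ) r n -> (θ ⊛ lam (\ d e -> w (- + d) * (+ e) ^ r)) n ≡ A w r (4 N.* n)
 θ-forms w r n = (⊛-∑∑ sqrts divs (\ _ -> 1#) (\ z -> w (- + fst z) * (+ snd z) ^ r) n) &
  ∑-reindex (Convolved n) (forms (4 N.* n) 0 0) f g {\ z -> 1# * (w (- + fst (snd (snd z))) * (+ snd (snd (snd z))) ^ r)} to from gf fg value where
  f : ℕ × ℤ × (ℕ × ℕ) -> Triple
  f (k , s , (d , e)) = - + d , + 2 * s , + e
  g : Triple -> ℕ × ℤ × (ℕ × ℕ)
  g (a , b , c) = ∣ b /ℕ 2 ∣ N.* ∣ b /ℕ 2 ∣ , b /ℕ 2 , (∣ a ∣ , ∣ c ∣)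
  value : ∀ z -> Conv n z -> w (fst (f z)) * val 0# 1# (f z) ^ r ≡ 1# * (w (- + fst (snd (snd z))) * (+ snd (snd (snd z))) ^ r)
  value z@(k , s , (d , e)) _ = cong (\ v -> w (- + d) * v ^ r) (val01 (f z)) & sym (Z.*-identityˡ (w (- + d) * (+ e) ^ r))
  to : ∀ z -> Conv n z -> IsForm (4 N.* n) 0# 1# (f z)
  to z@(k , s , (d , e)) c@(_ , _ , (0<d , 0<e , _)) = l s (+ d) (+ e) & cong (_*_ (+ 4)) (conv-equation n k s d e c) & sym (Z.pos-* 4 n)
    , neg-lt 0<d , 0<≡ (sym (val01 (f z))) (+<+ 0<e) where
   l : ∀ s d e -> + 2 * s * (+ 2 * s) - + 4 * ((- d) * e) ≡ + 4 * (s * s + d * e)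
   l = ring
  from' : ∀ a b c -> (∃ \ s -> b ≡ + 2 * s) -> IsForm (4 N.* n) 0# 1# (a , b , c) -> Conv n (g (a , b , c)) × f (g (a , b , c)) ≡ (a , b , c)
  from' a .(+ 2 * s) c (s , refl) (d , a<0 , q) =
    subst (\ h -> Conv n (∣ h ∣ N.* ∣ h ∣ , h , (∣ a ∣ , ∣ c ∣))) (sym (half-double s)) (conv-intro n s ∣ a ∣ ∣ c ∣ (snd (negated a<0)) (snd (positive 0<c))
     (Z.*-cancelˡ-≡ (+ 4) (s * s + + ∣ a ∣ * + ∣ c ∣) (+ n) (l s (+ ∣ a ∣) (+ ∣ c ∣) & cong2 (\ y z -> + 2 * s * (+ 2 * s) - + 4 * (y * z)) (fst (negated a<0)) (fst (positive 0<c)) & d & Z.pos-* 4 n)))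
   , triple-≡ (fst (negated a<0)) (cong (_*_ (+ 2)) (half-double s)) (fst (positive 0<c)) where
   0<c : 0# < c
   0<c = 0<≡ (val01 (a , + 2 * s , c)) q
   l : ∀ s d e -> + 4 * (s * s + d * e) ≡ + 2 * s * (+ 2 * s) - + 4 * ((- d) * e)
   l = ring
  both : ∀ Q -> IsForm (4 N.* n) 0# 1# Q -> Conv n (g Q) × f (g Q) ≡ Q
  both (a , b , c) m@(d , _) = from' a b c (even-root b (a * c + + n) (l1 a b c & cong (_+ + 4 * (a * c)) (d & Z.pos-* 4 n) & l2 (+ n) (a * c))) m where
   l1 : ∀ a b c -> b * b ≡ b * b - + 4 * (a * c) + + 4 * (a * c)
   l1 = ring
   l2 : ∀ n x -> + 4 * n + + 4 * x ≡ + 4 * (x + n)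
   l2 = ring
  from : ∀ Q -> IsForm (4 N.* n) 0# 1# Q -> Conv n (g Q)
  from Q m = fst (both Q m)
  fg : ∀ Q -> IsForm (4 N.* n) 0# 1# Q -> f (g Q) ≡ Q
  fg Q m = snd (both Q m)
  gf : ∀ z -> Conv n z -> g (f z) ≡ z
  gf (k , s , (d , e)) c = cong2 _,_ (cong (\ h -> ∣ h ∣ N.* ∣ h ∣) (half-double s) & conv-k n k s (d , e) c) (cong2 _,_ (half-double s) (cong (_, e) (abs-neg d)))

 -- Here n = s² + 4de is itself the discriminant of (-d , s , e). The dilated series is rewritten as
 -- a Lambert series supported on first factors divisible by 4, whence the quotients d / 4.
 θ-forms4 : ∀ (w : ℤ -> ℤ) r n -> (θ ⊛ dil (dil (lam (\ d e -> w (- + d) * (+ e) ^ r)))) n ≡ A w r n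
 θ-forms4 w r n = (⊛-cong≐ {θ} {θ} (\ _ -> refl) (\ k -> dil-cong (dil-cong (lam-ext (\ d e -> cong (\ z -> w (- + z) * (+ e) ^ r) (sym (quarter d))))) k & sym (lam-four (\ d e -> w (- + (d / 4)) * (+ e) ^ r) k)) n) &
  (⊛-∑∑ sqrts divs (\ _ -> 1#) (\ z -> v (fst z) (snd z)) n) & ∑-drop (Convolved n) (\ z -> ¬? (four (fst (snd (snd z))) ≟ 0#)) drop &
  ∑-reindex (Convolved n ↾ (\ z -> ¬? (four (fst (snd (snd z))) ≟ 0#))) (forms n 0 0) f g {\ z -> 1# * v (fst (snd (snd z))) (snd (snd (snd z)))} to from gf fg value where
  v : ℕ -> ℕ -> ℤ
  v d e = four d * (w (- + (d / 4)) * (+ e) ^ r)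
  quarter : ∀ d -> 4 N.* d / 4 ≡ d
  quarter d = cong (_/ 4) (N.*-comm 4 d) & m*n/n≡m d 4
  four-multiple : ∀ q -> four (4 N.* q) ≡ 1#
  four-multiple zero    = refl
  four-multiple (suc q) = cong four (N.*-suc 4 q) & four-multiple q
  multiple : ∀ d -> four d ≡ 0# ⊎ ∃ \ q -> d ≡ 4 N.* q
  multiple 0 = inr (0 , refl)
  multiple 1 = inl refl
  multiple 2 = inl refl
  multiple 3 = inl refl
  multiple (suc (suc (suc (suc d)))) with multiple d
  ... | inl e       = inl e
  ... | inr (q , e) = inr (suc q , cong (4 N.+_) e & sym (N.*-suc 4 q))
  Kept : ℕ × ℤ × (ℕ × ℕ) -> Set
  Kept z = Conv n z × four (fst (snd (snd z))) ≢ 0#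
  quartered : ∀ d -> four d ≢ 0# -> 4 N.* (d / 4) ≡ d
  quartered d nz with multiple d
  ... | inl e          = ⊥-elim (nz e)
  ... | inr (q , refl) = cong (4 N.*_) (quarter q)
  drop : ∀ z -> Conv n z -> ¬ (four (fst (snd (snd z))) ≢ 0#) -> 1# * v (fst (snd (snd z))) (snd (snd (snd z))) ≡ 0#
  drop (k , s , (d , e)) _ nn = Z.*-identityˡ (v d e) & zero-* (four d) (w (- + (d / 4)) * (+ e) ^ r) (decidable-stable (four d ≟ 0#) nn) where
   zero-* : ∀ a b -> a ≡ 0# -> a * b ≡ 0#
   zero-* .0# b refl = Z.*-zeroˡ b
  f : ℕ × ℤ × (ℕ × ℕ) -> Triple
  f (k , s , (d , e)) = - + (d / 4) , s , + e
  g : Triple -> ℕ × ℤ × (ℕ × ℕ)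
  g (a , b , c) = ∣ b ∣ N.* ∣ b ∣ , b , (4 N.* ∣ a ∣ , ∣ c ∣)
  value : ∀ z -> Kept z -> w (fst (f z)) * val 0# 1# (f z) ^ r ≡ 1# * v (fst (snd (snd z))) (snd (snd (snd z)))
  value z@(k , s , (d , e)) (_ , nz) = cong (\ v -> w (- + (d / 4)) * v ^ r) (val01 (f z)) & sym (Z.*-identityˡ (w (- + (d / 4)) * (+ e) ^ r)) &
   cong (_* (w (- + (d / 4)) * (+ e) ^ r)) (sym (cong four (sym (quartered d nz)) & four-multiple (d / 4))) & sym (Z.*-identityˡ (v d e))
  to : ∀ z -> Kept z -> IsForm n 0# 1# (f z)
  to z@(k , s , (d , e)) (c@(_ , _ , (0<d , 0<e , _)) , nz) = l s (+ (d / 4)) (+ e) & cong (\ z -> s * s + z * + e) (sym (Z.pos-* 4 (d / 4)) & cong +_ (quartered d nz)) & conv-equation n k s d e c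
    , neg-lt (pos-quarter (d / 4) (subst (0 N.<_) (sym (quartered d nz)) 0<d)) , 0<≡ (sym (val01 (f z))) (+<+ 0<e) where
   l : ∀ s d e -> s * s - + 4 * ((- d) * e) ≡ s * s + + 4 * d * e
   l = ring
   pos-quarter : ∀ q -> 0 N.< 4 N.* q -> 0 N.< q
   pos-quarter (suc q) _ = s≤s z≤n
  from : ∀ Q -> IsForm n 0# 1# Q -> Kept (g Q)
  from Q@(a , b , c) (d , a<0 , q) = conv-intro n b (4 N.* ∣ a ∣) ∣ c ∣ (N.*-mono-< {0} {4} {0} 0<s (snd (negated a<0))) (snd (positive 0<c))
    (cong (\ z -> b * b + z * + ∣ c ∣) (Z.pos-* 4 ∣ a ∣) & l b (+ ∣ a ∣) (+ ∣ c ∣) & cong2 (\ y z -> b * b - + 4 * (y * z)) (fst (negated a<0)) (fst (positive 0<c)) & d)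
   , (\ e -> 1≢0 (sym (four-multiple ∣ a ∣) & e)) where
   1≢0 : 1# ≢ 0#
   1≢0 ()
   0<c : 0# < c
   0<c = 0<≡ (val01 Q) q
   l : ∀ s d e -> s * s + + 4 * d * e ≡ s * s - + 4 * ((- d) * e)
   l = ring
  fg : ∀ Q -> IsForm n 0# 1# Q -> f (g Q) ≡ Q
  fg Q@(a , b , c) (d , a<0 , q) = triple-≡ (cong (\ z -> - + z) (quarter ∣ a ∣) & fst (negated a<0)) refl (fst (positive (0<≡ (val01 Q) q)))
  gf : ∀ z -> Kept z -> g (f z) ≡ z
  gf (k , s , (d , e)) (c , nz) = cong2 _,_ (conv-k n k s (d , e) c) (cong (s ,_) (cong (_, e) (cong (4 N.*_) (abs-neg (d / 4)) & quartered d nz)))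

 private
  U-weight : U ≐ lam (\ d e -> one (- + d) * (+ e) ^ 1)
  U-weight n = lam-swap (\ d e -> + d) n & lam-ext (\ d e -> l (+ e)) n where
   l : ∀ e -> e ≡ 1# * (e * 1#)
   l = ring

  S-weight : S ≐ lam (\ d e -> one (- + d) * (+ e) ^ 3)
  S-weight n = lam-swap (\ d e -> + d * + d * + d) n & lam-ext (\ d e -> l (+ e)) n where
   l : ∀ e -> e * e * e ≡ 1# * (e * (e * (e * 1#)))
   l = ring

  X-weight : X ≐ lam (\ d e -> wt (- + d) * (+ e) ^ 0)
  X-weight = lam-ext (\ d e -> sym (Z.*-identityʳ (wt (- + d)) & cong -_ (ψ-neg (+ d)) & Z.neg-involutive (χ d)))

  θ-cong : ∀ {f g} -> f ≐ g -> θ ⊛ f ≐ θ ⊛ g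
  θ-cong = ⊛-cong≐ {θ} {θ} (\ _ -> refl)

 θ-U : ∀ n -> (θ ⊛ U) n ≡ A one 1 (4 N.* n)
 θ-U n = θ-cong U-weight n & θ-forms one 1 n

 θ-S : ∀ n -> (θ ⊛ S) n ≡ A one 3 (4 N.* n)
 θ-S n = θ-cong S-weight n & θ-forms one 3 n

 θ-X : ∀ n -> (θ ⊛ X) n ≡ A wt 0 (4 N.* n)
 θ-X n = θ-cong X-weight n & θ-forms wt 0 n

 θ-W : ∀ n -> (θ ⊛ W) n ≡ A one 1 n
 θ-W n = θ-cong (dil-cong (dil-cong U-weight)) n & θ-forms4 one 1 n

 θ-R3 : ∀ n -> (θ ⊛ R3) n ≡ A one 3 n
 θ-R3 n = θ-cong (dil-cong (dil-cong S-weight)) n & θ-forms4 one 3 n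

 rootcount : ℕ -> ℤ
 rootcount n = ∑ (rootsN n) (\ _ -> 1#)

 θ-roots : ∀ n -> 0 N.< n -> θ n ≡ + 2 * rootcount n
 θ-roots n 0<n = ∑-sign (sqrts n) id & cong2 _+_ (cong2 _+_
   (∑-reindex (sqrts n ↾ (0# <?_)) (rootsN n) ∣_∣ +_ {\ _ -> 1#} {\ _ -> 1#} (\ { s (e , q) -> snd (positive q) , nat s e }) (\ { f (q , e) -> int f e , +<+ q }) (\ { s (_ , q) -> fst (positive q) }) (\ _ _ -> refl) (\ _ _ -> refl))
   (∑-empty (sqrts n ↾ (_≟ 0#)) (\ { s (e , refl) -> N.<⇒≢ 0<n (Z.+-injective e) })))
   (∑-reindex (sqrts n ↾ (_<? 0#)) (rootsN n) ∣_∣ (\ f -> - + f) {\ _ -> 1#} {\ _ -> 1#} (\ { s (e , q) -> snd (negated q) , nat s e }) (\ { f (q , e) -> l (+ f) & int f e , neg-lt q }) (\ { s (_ , q) -> fst (negated q) }) (\ f _ -> abs-neg f) (\ _ _ -> refl)) &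
  l2 (rootcount n) where
  nat : ∀ s -> Sqrt n s -> ∣ s ∣ N.* ∣ s ∣ ≡ n
  nat s e = Z.+-injective (sym (square-abs s) & e)
  int : ∀ f -> f N.* f ≡ n -> + f * + f ≡ + n
  int f e = sym (Z.pos-* f f) & cong +_ e
  l : ∀ f -> (- f) * (- f) ≡ f * f
  l = ring
  l2 : ∀ r -> r + 0# + r ≡ + 2 * r
  l2 = ring

 ∑-roots-4 : ∀ n (w : ℕ -> ℤ) -> ∑ (rootsN (4 N.* n)) w ≡ ∑ (rootsN n) (\ f -> w (2 N.* f))
 ∑-roots-4 n w = sym (∑-bij (rootsN n) (rootsN (4 N.* n)) (2 N.*_) {\ f -> w (2 N.* f)} {w}
  (\ { f (0<f , e) -> N.*-mono-< {0} {2} {0} 0<s 0<f , l f & cong (4 N.*_) e }) (\ f g -> N.*-cancelˡ-≡ f g 2) onto (\ _ _ -> refl)) where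
  l : ∀ f -> 2 N.* f N.* (2 N.* f) ≡ 4 N.* (f N.* f)
  l = ringN!
  onto : ∀ g -> Root (4 N.* n) g -> ∃ \ f -> Root n f × 2 N.* f ≡ g
  onto g (0<g , e) with even-root (+ g) (+ n) (sym (Z.pos-* g g) & cong +_ e & Z.pos-* 4 n)
  ... | s , es = ∣ s ∣ , (nonzero ∣ s ∣ (subst (0 N.<_) (sym 2f) 0<g) , N.*-cancelˡ-≡ (∣ s ∣ N.* ∣ s ∣) n 4 (sym (l ∣ s ∣) & cong (\ z -> z N.* z) 2f & e)) , 2f where
   2f : 2 N.* ∣ s ∣ ≡ g
   2f = sym (Z.abs-* (+ 2) s) & (cong ∣_∣ (sym es))
   nonzero : ∀ f -> 0 N.< 2 N.* f -> 0 N.< f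
   nonzero (suc f) _ = s≤s z≤n

 private
  module R = CommutativeRing C0.seriesRing
  open C0.Solver
  open C0 using (#; _»_; ⊛-congˡ)

 expand3 : ∀ n -> (θ ⊛ ξ) n ≡ θ n + + 8 * (θ ⊛ U) n + - (+ 32) * (θ ⊛ W) n
 expand3 n = exact (solve 3 (\ t u w -> t :* (con 1# :+ # 8 :* u :+ con (- (+ 32)) :* w) := t :+ # 8 :* (t :* u) :+ con (- (+ 32)) :* (t :* w)) R.refl θ U W) n &
  cong2 (\ y z -> θ n + y + z) (κ-⊛ (+ 8) (θ ⊛ U) n) (κ-⊛ (- (+ 32)) (θ ⊛ W) n)

 expand5 : ∀ n -> (θ ⊛ (θ ⊛ θ)) n ≡ θ n + + 4 * (θ ⊛ X) n
 expand5 n = exact (⊛-congˡ θ θ²) n & exact (solve 2 (\ t x -> t :* (con 1# :+ # 4 :* x) := t :+ # 4 :* (t :* x)) R.refl θ X) n &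
  cong (_+_ (θ n)) (κ-⊛ (+ 4) (θ ⊛ X) n)

 -- The last term comes from Pθ = Dθ.
 expand7 : ∀ n -> (θ ⊛ Identify7.E7) n ≡ + 5 * (θ ⊛ U) n + + 6 * (θ ⊛ W) n + θ n + + 3 * (+ n * θ n)
 expand7 n = exact (solve 4 (\ t u w p -> t :* (# 5 :* u :+ # 6 :* w :+ con 1# :+ # 3 :* p) := # 5 :* (t :* u) :+ # 6 :* (t :* w) :+ t :+ # 3 :* (p :* t)) R.refl θ U W P) n &
  cong2 (\ y z -> y + θ n + z) (cong2 _+_ (κ-⊛ (+ 5) (θ ⊛ U) n) (κ-⊛ (+ 6) (θ ⊛ W) n)) (κ-⊛ (+ 3) (P ⊛ θ) n & cong (_*_ (+ 3)) (sym (exact Dθ n)))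

 expand11 : ∀ n -> (θ ⊛ Identify11.E11) n ≡ + 6 * (θ ⊛ S) n + + 3 * (θ ⊛ R3) n + θ n
 expand11 n = exact (solve 3 (\ t s r -> t :* (# 6 :* s :+ # 3 :* r :+ con 1#) := # 6 :* (t :* s) :+ # 3 :* (t :* r) :+ t) R.refl θ S R3) n &
  cong (_+ θ n) (cong2 _+_ (κ-⊛ (+ 6) (θ ⊛ S) n) (κ-⊛ (+ 3) (θ ⊛ R3) n))

-- The Legendre symbol and the quadratic character of -1.

module QuadraticResidues where
 open ThetaForms public
 open import Data.Unit using (tt)
 open import Data.Bool using (true; false; T)
 open import Data.Bool.ListAction using (any)
 open import Data.List using (List; []; _∷_; upTo)
 open import Data.List.Membership.Propositional using (_∈_; lose; find)
 open import Data.List.Membership.Propositional.Properties using (∈-upTo⁺)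
 open import Data.List.Relation.Unary.Any using (here; there)
 open import Data.List.Relation.Unary.Any.Properties using (any⁺; any⁻)
 open import Defs using (legendre)

 private
  sumL-nonneg : {B : Set} (xs : List B) (v : B -> ℤ) -> (∀ x -> x ∈ xs -> 0# Z.≤ v x) -> 0# Z.≤ sumL xs v
  sumL-nonneg []       v h = Z.≤-refl
  sumL-nonneg (x ∷ xs) v h = Z.+-mono-≤ (h x (here refl)) (sumL-nonneg xs v (\ y m -> h y (there m)))

  sumL-zero : {B : Set} (xs : List B) (v : B -> ℤ) -> (∀ x -> x ∈ xs -> 0# Z.≤ v x) -> sumL xs v ≡ 0# -> ∀ x -> x ∈ xs -> v x ≡ 0#
  sumL-zero (y ∷ xs) v h e x m = go m where
   rest = sumL xs v
   rest≥0 = sumL-nonneg xs v (\ z n -> h z (there n))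
   head≤0 : v y Z.≤ 0#
   head≤0 = subst2 Z._≤_ (Z.+-identityʳ (v y)) e (Z.+-monoʳ-≤ (v y) rest≥0)
   head≡0 : v y ≡ 0#
   head≡0 = Z.≤-antisym head≤0 (h y (here refl))
   go : x ∈ y ∷ xs -> v x ≡ 0#
   go (here refl) = head≡0
   go (there n)   = sumL-zero xs v (\ z k -> h z (there k)) (sym (Z.+-identityˡ rest) & cong (_+ rest) (sym head≡0) & e) x n

 ∑-nonneg-zero : {B : Set} {R : B -> Set} (F : Enum R) (v : B -> ℤ) -> (∀ x -> R x -> 0# Z.≤ v x) -> ∑ F v ≡ 0# -> ∀ x -> R x -> v x ≡ 0#
 ∑-nonneg-zero F v h e x r = sumL-zero (elems F) v (\ y m -> h y (sound F y m)) (sym (∑-elems F v) & e) x (complete F x r)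

 -- Descent: if k ≡ 3 (mod 4) divides y² + 1 with y even and y < k, so does the smaller cofactor of k, again ≡ 3 (mod 4).
 no-root-of-minus-one : ∀ k -> χ k ≡ - 1# -> ∀ x -> ¬ Zero k (+ x * + x + 1#)
 no-root-of-minus-one = <-rec (\ k -> χ k ≡ - 1# -> ∀ x -> ¬ Zero k (+ x * + x + 1#)) step where
  step : ∀ k -> (∀ {k'} -> k' N.< k -> χ k' ≡ - 1# -> ∀ x -> ¬ Zero k' (+ x * + x + 1#)) -> χ k ≡ - 1# -> ∀ x -> ¬ Zero k (+ x * + x + 1#)
  step 0 _ () _ _
  step 1 _ () _ _
  step k@(suc (suc k₋)) rec χk x z = from-even (even-representative (parity (+ xr)) (parity (+ k))) where
   xr = x % k
   xr<k : xr N.< k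
   xr<k = m%n<n x k
   z0 : Zero k (+ xr * + xr + 1#)
   z0 = zero2 1# (- (+ (x / k) * (+ 2 * + xr + + (x / k) * + k))) (l (+ xr) (+ (x / k)) (+ k) & cong (\ y -> 1# * (y * y + 1#) + - (+ (x / k) * (+ 2 * + xr + + (x / k) * + k)) * + k)
     (sym (cong +_ (m≡m%n+[m/n]*n x k) & Z.pos-+ xr (x / k N.* k) & cong (_+_ (+ xr)) (Z.pos-* (x / k) k))))
    z (zero-by 1# (sym (Z.*-identityˡ (+ k)))) where
    l : ∀ a q k -> a * a + 1# ≡ 1# * ((a + q * k) * (a + q * k) + 1#) + - (q * (+ 2 * a + q * k)) * k
    l = ring
   EvenRoot : Set
   EvenRoot = ∃ \ y -> y N.< k × (∃ \ s -> + y ≡ + 2 * s) × Zero k (+ y * + y + 1#)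
   even-representative : (∃ \ s -> + xr ≡ + 2 * s) ⊎ (∃ \ s -> + xr ≡ + 2 * s + 1#) -> (∃ \ t -> + k ≡ + 2 * t) ⊎ (∃ \ t -> + k ≡ + 2 * t + 1#) -> EvenRoot
   even-representative _ (inl (t , ek)) with () ← trans (sym χk) (cong ψ ek & ψ-even t)
   even-representative (inl e) _ = xr , xr<k , e , z0
   even-representative (inr (s , ex)) (inr (t , ek)) = k N.∸ xr , N.∸-monoʳ-< {k} {xr} {0} (nonzero xr s ex) (N.<⇒≤ xr<k) , (t - s , diff & cong2 _-_ ek ex & l t s) ,
     zero2 1# (+ k - + 2 * + xr) (cong (\ y -> y * y + 1#) diff & l2 (+ k) (+ xr)) z0 (zero-by 1# (sym (Z.*-identityˡ (+ k)))) where
    nonzero : ∀ x s -> + x ≡ + 2 * s + 1# -> 0 N.< x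
    nonzero zero    s e = ⊥-elim (odd≢even s 0# (sym e))
    nonzero (suc x) s e = s≤s z≤n
    diff : + (k N.∸ xr) ≡ + k - + xr
    diff = l3 (+ (k N.∸ xr)) (+ xr) & cong (_- + xr) (sym (Z.pos-+ (k N.∸ xr) xr) & cong +_ (N.m∸n+n≡m (N.<⇒≤ xr<k))) where
     l3 : ∀ a b -> a ≡ a + b - b
     l3 = ring
    l : ∀ t s -> (+ 2 * t + 1#) - (+ 2 * s + 1#) ≡ + 2 * (t - s)
    l = ring
    l2 : ∀ k x -> (k - x) * (k - x) + 1# ≡ 1# * (x * x + 1#) + (k - + 2 * x) * k
    l2 = ring
   from-even : EvenRoot -> ⊥
   from-even (y , y<k , (s , ey) , zy) = cofactor (fst (zero-quotient zy)) (snd (zero-quotient zy)) where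
    yn : + y * + y + 1# ≡ + suc (y N.* y)
    yn = Z.+-comm (+ y * + y) 1# & cong (_+_ 1#) (sym (Z.pos-* y y)) & sym (Z.pos-+ 1 (y N.* y))
    cofactor : ∀ q -> + y * + y + 1# ≡ q * + k -> ⊥
    cofactor (+ k') e = rec k'<k χk' y (zero-by (+ k) (e & Z.*-comm (+ k') (+ k))) where
     nat : suc (y N.* y) ≡ k' N.* k
     nat = Z.+-injective (sym yn & e & sym (Z.pos-* k' k))
     small : suc (y N.* y) N.< k N.* k
     small = bound y y<k where
      bound : ∀ y -> y N.< k -> suc (y N.* y) N.< k N.* k
      bound zero    _   = s≤s 0<s
      bound (suc y) y<k = N.<-≤-trans (N.≤-trans (s≤s (N.m≤m+n (suc (suc y N.* suc y)) (suc (y N.+ y)))) (N.≤-reflexive (l y))) (N.*-mono-≤ y<k y<k) where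
       l : ∀ y -> suc (suc (suc y N.* suc y) N.+ suc (y N.+ y)) ≡ suc (suc y) N.* suc (suc y)
       l = ringN!
     k'<k : k' N.< k
     k'<k = N.*-cancelʳ-< k k' k (subst (N._< k N.* k) nat small)
     χk' : χ k' ≡ - 1#
     χk' = l (χ k') & cong -_ (cong (_*_ (χ k')) (sym χk) & sym (ψ-* (+ k') (+ k)) & cong ψ (sym e) & cong ψ (cong (\ z -> z * z + 1#) ey & l2 s) & ψ-periodic 1# (s * s)) where
      l : ∀ a -> a ≡ - (a * - 1#)
      l = ring
      l2 : ∀ s -> + 2 * s * (+ 2 * s) + 1# ≡ 1# + s * s * + 4
      l2 = ring
    cofactor -[1+ q ] e with () ← trans (sym yn) e

 module Residues (h : ℕ) (prime : Prime (suc (h N.+ h))) (odd-p : suc (h N.+ h) ≢ 2) where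
  open ModPrime (h N.+ h) prime odd-p public
  open Congruence p using (≡C; Cong-sym; _>>_; Cong-*; Cong-+; Cong-neg)

  roots-cong : ∀ {a b} -> Cong p a b -> roots a ≡ roots b
  roots-cong {a} {b} e = count-iff (\ x -> root? a (+ x)) (\ x -> root? b (+ x)) (\ x r -> r >> e) (\ x r -> r >> Cong-sym e)

  roots-scale : ∀ u a b -> ¬ Zero p u -> (∀ x -> Cong p (u * x * (u * x)) b -> Cong p (x * x) a) -> (∀ x -> Cong p (x * x) a -> Cong p (u * x * (u * x)) b) -> roots a ≡ roots b
  roots-scale u a b nu f g = count-iff (\ x -> root? a (+ x)) (\ x -> root? b (u * + x + 0#))
    (\ x r -> ≡C (l (u * + x)) >> g (+ x) r) (\ x r -> f (+ x) (≡C (sym (l (u * + x))) >> r)) &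
   count-affine (root? b) (\ e r -> Cong-sym (Cong-* e e) >> r) u 0# nu where
   l : ∀ x -> (x + 0#) * (x + 0#) ≡ x * x
   l = ring

  roots-4 : ∀ n -> roots (+ (4 N.* n)) ≡ roots (+ n)
  roots-4 n = roots-cong (≡C (Z.pos-* 4 n)) & sym (roots-scale (+ 2) (+ n) (+ 4 * + n) ¬zero-2
   (\ x r -> minus-zero (euclid-¬ (+ 2) (x * x - + n) ¬zero-2 (euclid-¬ (+ 2) (+ 2 * (x * x - + n)) ¬zero-2 (≡C (l x (+ n)) >> zero-minus r))))
   (\ x r -> minus-zero (zero1 (+ 4) (l2 x (+ n)) (zero-minus r)))) where
   l : ∀ x n -> + 2 * (+ 2 * (x * x - n)) ≡ + 2 * x * (+ 2 * x) - + 4 * n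
   l = ring
   l2 : ∀ x n -> + 2 * x * (+ 2 * x) - + 4 * n ≡ + 4 * (x * x - n)
   l2 = ring

  root-search : ∀ a -> (∃ \ x -> x N.< p × Cong p (+ x * + x) a) ⊎ (∀ z -> ¬ Cong p (z * z) a)
  root-search a = go (N.anyUpTo? (\ x -> root? a (+ x)) p) where
   go : Dec (∃ \ x -> x N.< p × Cong p (+ x * + x) a) -> (∃ \ x -> x N.< p × Cong p (+ x * + x) a) ⊎ (∀ z -> ¬ Cong p (z * z) a)
   go (yes r)   = inl r
   go (no none) = inr (\ z e -> none (res z , res< z , Cong-* (Cong-sym (res-cong z)) (Cong-sym (res-cong z)) >> e))

  root-nonzero : ∀ {a} x -> ¬ Zero p a -> Cong p (x * x) a -> ¬ Zero p x
  root-nonzero x na e z = na (Cong-sym e >> zero1 x refl z)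

  legendre-roots : ∀ a -> ¬ Zero p a -> legendre a p ≡ roots a - 1#
  legendre-roots a na with a %ℕ p in eq
  ... | zero  = ⊥-elim (na (res-cong a >> ≡C (cong +_ eq)))
  ... | suc r with any (\ x -> ((x N.* x) % p) N.≡ᵇ suc r) (upTo p) in eq2
  ...   | true  = sym (cong (_- 1#) (found (find (any⁻ (\ x -> ((x N.* x) % p) N.≡ᵇ suc r) (upTo p) (subst T (sym eq2) tt))))) where
   found : (∃ \ x -> x ∈ upTo p × T (((x N.* x) % p) N.≡ᵇ suc r)) -> roots a ≡ + 2
   found (x , _ , t) = roots-two a (+ x) (root-nonzero (+ x) na square) square where
    square : Cong p (+ x * + x) a
    square = ≡C (sym (Z.pos-* x x)) >> res-cong (+ (x N.* x)) >> ≡C (cong +_ (N.≡ᵇ⇒≡ ((x N.* x) % p) (suc r) t & sym eq)) >> Cong-sym (res-cong a)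
  ...   | false = sym (cong (_- 1#) (roots-none a none)) where
   none : ∀ z -> ¬ Cong p (z * z) a
   none z e = subst T eq2 (any⁺ (\ x -> ((x N.* x) % p) N.≡ᵇ suc r) (lose (∈-upTo⁺ (res< z)) (N.≡⇒≡ᵇ ((res z N.* res z) % p) (suc r)
    (small-unique ((res z N.* res z) % p) (suc r) (m%n<n (res z N.* res z) p) (subst (N._< p) eq (res< a))
     (Cong-sym (res-cong (+ (res z N.* res z))) >> ≡C (Z.pos-* (res z) (res z)) >> Cong-* (Cong-sym (res-cong z)) (Cong-sym (res-cong z)) >> e >> res-cong a >> ≡C (cong +_ eq))))))

  -- Every x is a square root of exactly one class, so summing the root counts over all classes
  -- gives p; the involution `f` only permutes the classes.
  total-roots : (f : ℤ -> ℤ) -> (∀ a b -> Cong p a b -> Cong p (f a) (f b)) -> (∀ a -> f (f a) ≡ a) -> ∑ (below p) (\ a -> roots (f (+ a))) ≡ + p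
  total-roots f f-cong f² = ∑-swap (below p) (below p) (\ a x -> 𝟙 (root? (f (+ a)) (+ x))) & ∑-cong (below p) (\ x _ ->
    count-one (\ a -> root? (f (+ a)) (+ x)) (res (f (+ x * + x))) (res< (f (+ x * + x)))
     (Cong-sym (f-cong _ _ (Cong-sym (res-cong (f (+ x * + x)))) >> ≡C (f² (+ x * + x))))
     (\ a a<p e -> sym (res-unique (f (+ x * + x)) a a<p (f-cong _ _ e >> ≡C (f² (+ a)))))) &
   ∑-const p 1# & Z.*-identityʳ (+ p)

  ratio : ∀ s t a -> ¬ Zero p t -> Cong p (s * s) (- a) -> Cong p (t * t) a -> ∃ \ z -> Cong p (z * z) (- 1#)
  ratio s t a nt es et = s * u , ≡C (l1 s u) >> Cong-* es (≡C {u * u} refl) >> ≡C (l2 a (u * u)) >>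
    Cong-neg (Cong-* (Cong-sym et) (≡C {u * u} refl)) >> ≡C (l3 t u) >> Cong-neg (Cong-* ut ut) where
   u = fst (inverse t nt)
   ut = snd (inverse t nt)
   l1 : ∀ s u -> s * u * (s * u) ≡ s * s * (u * u)
   l1 = ring
   l2 : ∀ a u -> (- a) * u ≡ - (a * u)
   l2 = ring
   l3 : ∀ t u -> - (t * t * (u * u)) ≡ - (u * t * (u * t))
   l3 = ring

  -- By `θ²` the number of representations of p as s² + t² is 4(χ(1) + χ(p)) = 8, so one exists. If
  -- p divided t, it would divide s too and p² would divide p; hence s/t is defined, and its square
  -- is -1.
  minus-one-square : ψ (+ p) ≡ 1# -> ∃ \ z -> Cong p (z * z) (- 1#)
  minus-one-square χp = go (root-search (- 1#)) where
   pairs = below (suc p) ▹ (\ k _ -> sqrts k ▹ (\ _ _ -> sqrts (p N.∸ k)))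
   θ²p : (θ ⊛ θ) p ≡ + 8
   θ²p = exact θ² p & (Z.+-identityˡ ((κ (+ 4) ⊛ X) p) & κ-⊛ (+ 4) X p) & cong (_*_ (+ 4)) Xp where
    open import Data.Nat.Primality using (prime⇒irreducible)
    Xp : X p ≡ + 2
    Xp = ∑-split (divs p) (\ z -> fst z N.≟ 1) & cong2 _+_
      (∑-single (divs p ↾ (\ z -> fst z N.≟ 1)) {\ z -> χ (fst z)} (1 , p) ((s≤s z≤n , s≤s z≤n , N.*-identityˡ p) , refl) (\ { (d , e) ((_ , _ , de) , refl) -> cong (1 ,_) (sym (N.*-identityˡ e) & de) }))
      (∑-single (divs p ↾ (\ z -> ¬? (fst z N.≟ 1))) {\ z -> χ (fst z)} (p , 1) ((s≤s z≤n , s≤s z≤n , N.*-identityʳ p) , \ e -> N.<⇒≢ p>1 (sym e)) other & χp) where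
     other : ∀ z -> Divs p z × ¬ (fst z ≡ 1) -> z ≡ (p , 1)
     other (d , e) ((_ , _ , de) , ne) with prime⇒irreducible prime (ND.divides {d} {p} e (sym de & N.*-comm d e))
     ... | inl d≡1  = ⊥-elim (ne d≡1)
     ... | inr refl = cong (p ,_) (N.*-cancelˡ-≡ e 1 p (de & sym (N.*-identityʳ p)))
   go : (∃ \ x -> x N.< p × Cong p (+ x * + x) (- 1#)) ⊎ (∀ z -> ¬ Cong p (z * z) (- 1#)) -> ∃ \ z -> Cong p (z * z) (- 1#)
   go (inl (x , _ , e)) = + x , e
   go (inr none) = ⊥-elim (8≢0 (sym θ²p & (⊛-∑∑ sqrts sqrts (\ _ -> 1#) (\ _ -> 1#) p) & ∑-empty pairs impossible)) where
    8≢0 : + 8 ≢ 0#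
    8≢0 ()
    impossible : ∀ z -> ¬ (fst z N.< suc p × Sqrt (fst z) (fst (snd z)) × Sqrt (p N.∸ fst z) (snd (snd z)))
    impossible (k , s , t) (k<p , ss , st) = split (zero? p t) where
     sum : s * s + t * t ≡ + p
     sum = cong2 _+_ ss st & sym (Z.pos-+ k (p N.∸ k)) & cong +_ (N.m+[n∸m]≡n (N.≤-pred k<p))
     ss≡ : Cong p (s * s) (- (t * t))
     ss≡ = minus-zero (zero-by 1# (l (s * s) (t * t) & sum & sym (Z.*-identityˡ (+ p)))) where
      l : ∀ a b -> a - - b ≡ a + b
      l = ring
     split : Dec (Zero p t) -> ⊥
     split (no nt) = let z , e = ratio s t (t * t) nt ss≡ (≡C refl) in none z e
     split (yes zt) = both (zero-quotient zs) (zero-quotient zt) where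
      dedup : Zero p s ⊎ Zero p s -> Zero p s
      dedup (inl z) = z
      dedup (inr z) = z
      zs : Zero p s
      zs = dedup (euclid s s (ss≡ >> Cong-neg (zero1 t refl zt)))
      both : (∃ \ a -> s ≡ a * + p) -> (∃ \ b -> t ≡ b * + p) -> ⊥
      both (a , ea) (b , eb) = ¬zero-1 (zero-by (a * a + b * b) (Z.*-cancelʳ-≡ 1# ((a * a + b * b) * + p) (+ p) (Z.*-identityˡ (+ p) & sym sum & cong2 (\ y z -> y * y + z * z) ea eb & l a b (+ p)))) where
       l : ∀ a b p -> a * p * (a * p) + b * p * (b * p) ≡ (a * a + b * b) * p * p
       l = ring

  minus-one-nonsquare : ψ (+ p) ≡ - 1# -> ∀ z -> ¬ Cong p (z * z) (- 1#)
  minus-one-nonsquare χp z e = no-root-of-minus-one p χp (res z) (Cong-+ (Cong-* (Cong-sym (res-cong z)) (Cong-sym (res-cong z)) >> e) (≡C {1#} refl) >> ≡C refl)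

  roots-zero : ∀ a -> Zero p a -> roots a ≡ 1#
  roots-zero a za = count-one (\ x -> root? a (+ x)) 0 0<s (Cong-sym za) (\ j j<p e -> small-unique j 0 j<p 0<s (dedup (euclid (+ j) (+ j) (e >> za)))) where
   dedup : ∀ {j} -> Zero p j ⊎ Zero p j -> Zero p j
   dedup (inl z) = z
   dedup (inr z) = z

  -- As -1 is not a square, a and -a are not both nonzero squares, so 2 minus the joint root count
  -- is never negative. Summed over all residues it is 2p - 2p = 0, hence it vanishes everywhere.
  complementary : ψ (+ p) ≡ - 1# -> ∀ a -> roots a + roots (- a) ≡ + 2
  complementary χp a = cong2 _+_ (roots-cong (res-cong a)) (roots-cong (Cong-neg (res-cong a))) & l (roots (+ res a)) (roots (- + res a)) &
    cong (_-_ (+ 2)) (∑-nonneg-zero (below p) deficit (\ b _ -> nonneg b) total (res a) (res< a)) & refl where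
   deficit : ℕ -> ℤ
   deficit b = + 2 - (roots (+ b) + roots (- + b))
   l : ∀ x y -> x + y ≡ + 2 - (+ 2 - (x + y))
   l = ring
   nonneg : ∀ b -> 0# Z.≤ deficit b
   nonneg b = by-zero (zero? p (+ b)) where
    value : ∀ {x y} -> roots (+ b) ≡ x -> roots (- + b) ≡ y -> 0# Z.≤ + 2 - (x + y) -> 0# Z.≤ deficit b
    value refl refl q = q
    by-search : ¬ Zero p (+ b) -> (∃ \ x -> x N.< p × Cong p (+ x * + x) (+ b)) ⊎ (∀ z -> ¬ Cong p (z * z) (+ b)) ->
     (∃ \ x -> x N.< p × Cong p (+ x * + x) (- + b)) ⊎ (∀ z -> ¬ Cong p (z * z) (- + b)) -> 0# Z.≤ deficit b
    by-search nb (inl (t , _ , et)) (inl (s , _ , es)) = ⊥-elim (let z , e = ratio (+ s) (+ t) (+ b) (root-nonzero (+ t) nb et) es et in minus-one-nonsquare χp z e)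
    by-search nb (inl (t , _ , et)) (inr none) = value (roots-two (+ b) (+ t) (root-nonzero (+ t) nb et) et) (roots-none (- + b) none) (Z.+≤+ z≤n)
    by-search nb (inr none) (inl (s , _ , es)) = value (roots-none (+ b) none) (roots-two (- + b) (+ s) (root-nonzero (+ s) (\ z -> nb (zero1 (- 1#) (l2 (+ b)) z)) es) es) (Z.+≤+ z≤n) where
     l2 : ∀ b -> b ≡ - 1# * - b
     l2 = ring
    by-search nb (inr none) (inr none') = value (roots-none (+ b) none) (roots-none (- + b) none') (Z.+≤+ z≤n)
    by-zero : Dec (Zero p (+ b)) -> 0# Z.≤ deficit b
    by-zero (yes zb) = value (roots-zero (+ b) zb) (roots-zero (- + b) (zero1 (- 1#) (sym (Z.-1*i≡-i (+ b))) zb)) (Z.+≤+ z≤n)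
    by-zero (no nb)  = by-search nb (root-search (+ b)) (root-search (- + b))
   total : ∑ (below p) deficit ≡ 0#
   total = ∑-- (below p) (\ _ -> + 2) (\ b -> roots (+ b) + roots (- + b)) & cong2 _-_ (∑-const p (+ 2)) (∑-+ (below p) (\ b -> roots (+ b)) (\ b -> roots (- + b)) &
    cong2 _+_ (total-roots id (\ _ _ e -> e) (\ _ -> refl)) (total-roots -_ (\ _ _ -> Cong-neg) Z.neg-involutive)) & l3 (+ p) where
    l3 : ∀ p -> p * + 2 - (p + p) ≡ 0#
    l3 = ring

  -- If ψ(p) = 1, multiplication by a square root of -1 matches the roots of -a with those of a; if
  -- ψ(p) = -1, `complementary` applies.
  roots-negate : ∀ a -> roots (- a) - 1# ≡ ψ (+ p) * (roots a - 1#)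
  roots-negate a = go (sign (χ-odd h) (sgn-cases h)) where
   sgn-cases : ∀ h -> sgn h ≡ 1# ⊎ sgn h ≡ - 1#
   sgn-cases zero    = inl refl
   sgn-cases (suc h) with sgn-cases h
   ... | inl e = inr (cong -_ e)
   ... | inr e = inl (cong -_ e)
   sign : ∀ {x y} -> x ≡ y -> y ≡ 1# ⊎ y ≡ - 1# -> x ≡ 1# ⊎ x ≡ - 1#
   sign refl c = c
   go : ψ (+ p) ≡ 1# ⊎ ψ (+ p) ≡ - 1# -> roots (- a) - 1# ≡ ψ (+ p) * (roots a - 1#)
   go (inl χp) = cong (_- 1#) (equal (minus-one-square χp)) & sym (Z.*-identityˡ (roots a - 1#)) & cong (_* (roots a - 1#)) (sym χp) where
    equal : (∃ \ z -> Cong p (z * z) (- 1#)) -> roots (- a) ≡ roots a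
    equal (z , e) = roots-scale z (- a) a (root-nonzero z (\ w -> ¬zero-1 (zero1 (- 1#) refl w)) e)
     (\ x r -> ≡C (l1 (x * x)) >> Cong-neg (Cong-sym (Cong-* e (≡C {x * x} refl)) >> ≡C (l2 z x) >> r))
     (\ x r -> ≡C (sym (l2 z x)) >> Cong-* e r >> ≡C (l3 a)) where
     l1 : ∀ y -> y ≡ - (- 1# * y)
     l1 = ring
     l2 : ∀ z x -> z * z * (x * x) ≡ z * x * (z * x)
     l2 = ring
     l3 : ∀ a -> - 1# * - a ≡ a
     l3 = ring
   go (inr χp) = l (roots a) (roots (- a)) & cong (\ z -> z - 1# - roots a) (complementary χp a) & l2 (roots a) & cong (_* (roots a - 1#)) (sym χp) where
    l : ∀ x y -> y - 1# ≡ x + y - 1# - x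
    l = ring
    l2 : ∀ x -> + 2 - 1# - x ≡ - 1# * (x - 1#)
    l2 = ring

-- Hecke eigenvalues and the four congruences.

module Conclusion where
 open QuadraticResidues public hiding (P)
 open import Defs

 rootcount-4 : ∀ n -> rootcount (4 N.* n) ≡ rootcount n
 rootcount-4 n = ∑-roots-4 n (\ _ -> 1#)

 H1-value : ∀ n -> H1 n ≡ + 12 * A one 1 n + (+ 6 * + n - 1#) * rootcount n
 H1-value n = cong (_+_ (+ 12 * A one 1 n)) (∑-cong (rootsN n) (\ { f (_ , e) -> cong (\ z -> + 6 * z - 1#) (sym (Z.pos-* f f) & cong +_ e) & sym (Z.*-identityʳ (+ 6 * + n - 1#)) }) &
  ∑-* (rootsN n) (+ 6 * + n - 1#) (\ _ -> 1#))

 H1-value-4 : ∀ n -> H1 (4 N.* n) ≡ + 12 * A one 1 (4 N.* n) + (+ 24 * + n - 1#) * rootcount n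
 H1-value-4 n = H1-value (4 N.* n) & cong2 (\ y z -> + 12 * A one 1 (4 N.* n) + (y - 1#) * z) (cong (_*_ (+ 6)) (Z.pos-* 4 n) & l (+ n)) (rootcount-4 n) where
  l : ∀ n -> + 6 * (+ 4 * n) ≡ + 24 * n
  l = ring

 -- The boundary terms fit exactly: 8(24n - 1) - 32(6n - 1) = 24, which is 12 times the 2
 -- contributed by θ.
 θξ-value : ∀ n -> 0 N.< n -> + 12 * (θ ⊛ ξ) n ≡ + 8 * H1 (4 N.* n) - + 32 * H1 n
 θξ-value n 0<n = cong (_*_ (+ 12)) (expand3 n & cong2 (\ y z -> y + z) (cong2 (\ y z -> y + + 8 * z) (θ-roots n 0<n) (θ-U n)) (cong (_*_ (- (+ 32))) (θ-W n))) &
  l (rootcount n) (A one 1 (4 N.* n)) (A one 1 n) (+ n) & sym (cong2 (\ y z -> + 8 * y - + 32 * z) (H1-value-4 n) (H1-value n)) where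
  l : ∀ r a b n -> + 12 * (+ 2 * r + + 8 * a + - (+ 32) * b) ≡ + 8 * (+ 12 * a + (+ 24 * n - 1#) * r) - + 32 * (+ 12 * b + (+ 6 * n - 1#) * r)
  l = ring

 θ³-value : ∀ n -> 0 N.< n -> (θ ⊛ (θ ⊛ θ)) n ≡ + 2 * H0 n
 θ³-value n 0<n = expand5 n & cong2 (\ y z -> y + + 4 * z) (θ-roots n 0<n) (θ-X n) & l (rootcount n) (A wt 0 (4 N.* n)) where
  l : ∀ r a -> + 2 * r + + 4 * a ≡ + 2 * (+ 2 * a + r)
  l = ring

 -- The term 3Dθ in `E7` provides the part of the boundary terms proportional to n; the remaining
 -- discrepancy is a multiple of 7.
 θE7-value : ∀ n -> 0 N.< n -> + 12 * (θ ⊛ Identify7.E7) n ≡ + 5 * H1 (4 N.* n) + + 6 * H1 n + (+ 5 - + 12 * + n) * rootcount n * + 7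
 θE7-value n 0<n = cong (_*_ (+ 12)) (expand7 n & cong2 (\ y z -> y + z + + 3 * (+ n * z)) (cong2 (\ y z -> + 5 * y + + 6 * z) (θ-U n) (θ-W n)) (θ-roots n 0<n)) &
  l (rootcount n) (A one 1 (4 N.* n)) (A one 1 n) (+ n) & sym (cong2 (\ y z -> + 5 * y + + 6 * z + (+ 5 - + 12 * + n) * rootcount n * + 7) (H1-value-4 n) (H1-value n)) where
  l : ∀ r a b n -> + 12 * (+ 5 * a + + 6 * b + + 2 * r + + 3 * (n * (+ 2 * r))) ≡ + 5 * (+ 12 * a + (+ 24 * n - 1#) * r) + + 6 * (+ 12 * b + (+ 6 * n - 1#) * r) + (+ 5 - + 12 * n) * r * + 7
  l = ring

 θE11-value : ∀ n -> 0 N.< n -> + 120 * (θ ⊛ Identify11.E11) n ≡ + 6 * H3 (4 N.* n) + + 3 * H3 n + + 21 * rootcount n * + 11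
 θE11-value n 0<n = cong (_*_ (+ 120)) (expand11 n & cong2 _+_ (cong2 (\ y z -> + 6 * y + + 3 * z) (θ-S n) (θ-R3 n)) (θ-roots n 0<n)) &
  l (rootcount n) (A one 3 (4 N.* n)) (A one 3 n) & cong (\ z -> + 6 * (+ 120 * A one 3 (4 N.* n) + z) + + 3 * H3 n + + 21 * rootcount n * + 11) (sym (rootcount-4 n)) where
  l : ∀ r a b -> + 120 * (+ 6 * a + + 3 * b + + 2 * r) ≡ + 6 * (+ 120 * a + r) + + 3 * (+ 120 * b + r) + + 21 * r * + 11
  l = ring

 module Multiplier (h : ℕ) (prime : Prime (suc (h N.+ h))) (odd-p : suc (h N.+ h) ≢ 2) (n : ℕ) (0<n : 0 N.< n) (p∤n : ¬ Zero (suc (h N.+ h)) (+ n)) where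
  open Residues h prime odd-p

  N : ℕ
  N = p N.* p N.* n

  private
   P : ℤ
   P = + p
   p∤4n : ¬ Zero p (+ (4 N.* n))
   p∤4n z = ¬zero-* (+ 2) (+ 2 * + n) ¬zero-2 (¬zero-* (+ 2) (+ n) ¬zero-2 p∤n) (subst (Zero p) (Z.pos-* 4 n & l (+ n)) z) where
    l : ∀ n -> + 4 * n ≡ + 2 * (+ 2 * n)
    l = ring
   0<4n : 0 N.< 4 N.* n
   0<4n = N.*-mono-< {0} {4} {0} 0<s 0<n
   4N : 4 N.* N ≡ p N.* p N.* (4 N.* n)
   4N = l p n where
    l : ∀ p n -> 4 N.* (p N.* p N.* n) ≡ p N.* p N.* (4 N.* n)
    l = ringN!
   module H  = HeckeOdd (h N.+ h) prime odd-p n 0<n p∤n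
   module H4 = HeckeOdd (h N.+ h) prime odd-p (4 N.* n) 0<4n p∤4n

  0<N : 0 N.< N
  0<N = N.*-mono-< {0} {p N.* p} {0} 0<s 0<n

  linear-4 : H1 (4 N.* N) ≡ (1# + P * P * P - P * (roots (+ n) - 1#)) * H1 (4 N.* n)
  linear-4 = cong H1 4N & H4.linear & cong (\ z -> (1# + P * P * P - P * (z - 1#)) * H1 (4 N.* n)) (roots-4 n)

  cubic-4 : H3 (4 N.* N) ≡ (1# + P * P * P * (P * P * P) * P - P * P * P * (roots (+ n) - 1#)) * H3 (4 N.* n)
  cubic-4 = cong H3 4N & H4.cubic & cong (\ z -> (1# + P * P * P * (P * P * P) * P - P * P * P * (z - 1#)) * H3 (4 N.* n)) (roots-4 n)

  -- 12 is not invertible modulo 3, so the relation for θ⁵ is proved over ℤ by cancelling 12, and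
  -- only then reduced.
  zero3 : Zero 3 (1# + P * P * P - P * (roots (+ n) - 1#)) -> Zero 3 ((θ ⊛ ξ) N)
  zero3 = zero1 ((θ ⊛ ξ) n) (Z.*-cancelˡ-≡ (+ 12) ((θ ⊛ ξ) N) ((θ ⊛ ξ) n * m) (θξ-value N 0<N & cong2 (\ y z -> + 8 * y - + 32 * z) linear-4 H.linear &
   l m (H1 (4 N.* n)) (H1 n) & cong (_* m) (sym (θξ-value n 0<n)) & Z.*-assoc (+ 12) ((θ ⊛ ξ) n) m)) where
   m = 1# + P * P * P - P * (roots (+ n) - 1#)
   l : ∀ m a b -> + 8 * (m * a) - + 32 * (m * b) ≡ (+ 8 * a - + 32 * b) * m
   l = ring

  zero5 : Zero 5 (1# + P - (roots (- + n) - 1#)) -> Zero 5 ((θ ⊛ (θ ⊛ θ)) N)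
  zero5 = zero1 (+ 2 * H0 n) (θ³-value N 0<N & cong (_*_ (+ 2)) (HeckeChar.character h prime odd-p n 0<n p∤n & cong (\ z -> (1# + P - z) * H0 n)
   (cong (\ z -> ψ P * (z - 1#)) (roots-4 n) & sym (roots-negate (+ n)))) & l (1# + P - (roots (- + n) - 1#)) (H0 n)) where
   l : ∀ m a -> + 2 * (m * a) ≡ + 2 * a * m
   l = ring

  -- 3 · 12 = 1 + 5 · 7, so the factor 3 undoes the 12.
  zero7 : Zero 7 (1# + P * P * P - P * (roots (+ n) - 1#)) -> Zero 7 ((θ ⊛ Identify7.E7) N)
  zero7 hm = zero2 (+ 3 * (+ 5 * H1 (4 N.* n) + + 6 * H1 n)) (+ 3 * ((+ 5 - + 12 * + N) * rootcount N) - + 5 * (θ ⊛ Identify7.E7) N)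
   (l1 ((θ ⊛ Identify7.E7) N) & cong (\ z -> + 3 * z - + 5 * (θ ⊛ Identify7.E7) N * + 7) (θE7-value N 0<N & cong2 (\ y z -> + 5 * y + + 6 * z + (+ 5 - + 12 * + N) * rootcount N * + 7) linear-4 H.linear) &
    l2 m (H1 (4 N.* n)) (H1 n) ((+ 5 - + 12 * + N) * rootcount N) ((θ ⊛ Identify7.E7) N)) hm (zero-by 1# refl) where
   m = 1# + P * P * P - P * (roots (+ n) - 1#)
   l1 : ∀ c -> c ≡ + 3 * (+ 12 * c) - + 5 * c * + 7
   l1 = ring
   l2 : ∀ m a b r c -> + 3 * (+ 5 * (m * a) + + 6 * (m * b) + r * + 7) - + 5 * c * + 7 ≡ + 3 * (+ 5 * a + + 6 * b) * m + (+ 3 * r - + 5 * c) * + 7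
   l2 = ring

  -- 120 = 11 · 11 - 1, so a change of sign undoes the 120.
  zero11 : Zero 11 (1# + P * P * P * (P * P * P) * P - P * P * P * (roots (+ n) - 1#)) -> Zero 11 ((θ ⊛ Identify11.E11) N)
  zero11 hm = zero2 (- (+ 6 * H3 (4 N.* n) + + 3 * H3 n)) (+ 11 * (θ ⊛ Identify11.E11) N - + 21 * rootcount N)
   (l1 ((θ ⊛ Identify11.E11) N) & cong (\ z -> - z + + 11 * (θ ⊛ Identify11.E11) N * + 11) (θE11-value N 0<N & cong2 (\ y z -> + 6 * y + + 3 * z + + 21 * rootcount N * + 11) cubic-4 H.cubic) &
    l2 m (H3 (4 N.* n)) (H3 n) (+ 21 * rootcount N) ((θ ⊛ Identify11.E11) N)) hm (zero-by 1# refl) where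
   m = 1# + P * P * P * (P * P * P) * P - P * P * P * (roots (+ n) - 1#)
   l1 : ∀ c -> c ≡ - (+ 120 * c) + + 11 * c * + 11
   l1 = ring
   l2 : ∀ m a b r c -> - (+ 6 * (m * a) + + 3 * (m * b) + r * + 11) + + 11 * c * + 11 ≡ - (+ 6 * a + + 3 * b) * m + (+ 11 * c - r) * + 11
   l2 = ring

 Q-zero : ∀ m k -> Zero m (Q k) -> m ND.∣ overpartition k
 Q-zero m k z = let q , e = zero-quotient (zero1 (sgn k) (sym (Z.*-identityˡ (pbar k)) & cong (_* pbar k) (sym (sgn² k)) & Z.*-assoc (sgn k) (sgn k) (pbar k) & cong (_*_ (sgn k)) (sym (tw-sgn pbar k))) z) in
  ZD.∣⇒∣ᵤ (ZD.divides {+ m} {+ overpartition k} q e)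

 hypothesis-zero : ∀ m a b {z} -> (+ m) Zu.∣ (a - b) -> z ≡ a - b -> Zero m z
 hypothesis-zero m a b d refl with ZD.∣ᵤ⇒∣ {+ m} {a - b} d
 ... | ZD.divides q e = zero-by q e

 odd-half : ∀ ℓ -> ℓ % 2 ≡ 1 -> ∃ \ h -> ℓ ≡ suc (h N.+ h)
 odd-half ℓ e = ℓ / 2 , (m≡m%n+[m/n]*n ℓ 2) & cong (N._+ ℓ / 2 N.* 2) e & l (ℓ / 2) where
  l : ∀ h -> 1 N.+ h N.* 2 ≡ suc (h N.+ h)
  l = ringN!

 odd≢2 : ∀ h -> suc (h N.+ h) ≢ 2
 odd≢2 (suc h) e with () ← trans (sym (N.+-suc h h)) (N.suc-injective (N.suc-injective e))

 module Cases (h : ℕ) (prime : Prime (suc (h N.+ h))) (ε : ℤ) (n : ℕ) (0<n : 0 N.< n) (co : Coprime n (suc (h N.+ h))) where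
  open Residues h prime (odd≢2 h)

  private
   P : ℤ
   P = + p
   p∤n : ¬ Zero p (+ n)
   p∤n z = N.<⇒≢ p>1 (sym (co (zero⇒∣ z , ND.∣-refl)))
   module M = Multiplier h prime (odd≢2 h) n 0<n p∤n
   positive-sign : legendre (1# * + n) p ≡ ε -> roots (+ n) - 1# ≡ ε
   positive-sign e = sym (legendre-roots (+ n) p∤n) & cong (\ z -> legendre z p) (sym (Z.*-identityˡ (+ n))) & e
   negative-sign : legendre (- 1# * + n) p ≡ ε -> roots (- + n) - 1# ≡ ε
   negative-sign e = sym (legendre-roots (- + n) (\ z -> p∤n (zero1 (- 1#) (l (+ n)) z))) & cong (\ z -> legendre z p) (sym (Z.-1*i≡-i (+ n))) & e where
    l : ∀ n -> n ≡ - 1# * - n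
    l = ring
   argument : ∀ m -> m N.* p N.^ 2 N.* n ≡ m N.* M.N
   argument m = l m p n where
    l : ∀ m p n -> m N.* (p N.* (p N.* 1)) N.* n ≡ m N.* (p N.* p N.* n)
    l = ringN!
   finish : ∀ m {c} -> Cong m (Q (m N.* M.N)) c -> Zero m c -> m ND.∣ overpartition (m N.* p N.^ 2 N.* n)
   finish m e z = subst (\ k -> m ND.∣ overpartition k) (sym (argument m)) (Q-zero m (m N.* M.N) (Congruence.Cong-trans m e z))

  case3 : (+ 3) Zu.∣ (P ^ 3 - (-[1+ 0 ] + ε * P ^ 1)) -> legendre (1# * + n) p ≡ ε -> 3 ND.∣ overpartition (3 N.* p N.^ 2 N.* n)
  case3 d e = finish 3 (Identify3.overpartition-mod M.N) (M.zero3 (hypothesis-zero 3 (P ^ 3) (-[1+ 0 ] + ε * P ^ 1) d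
   (cong (\ z -> 1# + P * P * P - P * z) (positive-sign e) & l P ε))) where
   l : ∀ P ε -> 1# + P * P * P - P * ε ≡ P * (P * (P * 1#)) - (- 1# + ε * (P * 1#))
   l = ring

  case5 : (+ 5) Zu.∣ (P ^ 1 - (-[1+ 0 ] + ε * P ^ 0)) -> legendre (- 1# * + n) p ≡ ε -> 5 ND.∣ overpartition (5 N.* p N.^ 2 N.* n)
  case5 d e = finish 5 (Identify5.overpartition-mod M.N) (M.zero5 (hypothesis-zero 5 (P ^ 1) (-[1+ 0 ] + ε * P ^ 0) d
   (cong (\ z -> 1# + P - z) (negative-sign e) & l P ε))) where
   l : ∀ P ε -> 1# + P - ε ≡ P * 1# - (- 1# + ε * 1#)
   l = ring

  case7 : (+ 7) Zu.∣ (P ^ 3 - (-[1+ 0 ] + ε * P ^ 1)) -> legendre (1# * + n) p ≡ ε -> 7 ND.∣ overpartition (7 N.* p N.^ 2 N.* n)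
  case7 d e = finish 7 (Identify7.overpartition-mod M.N) (M.zero7 (hypothesis-zero 7 (P ^ 3) (-[1+ 0 ] + ε * P ^ 1) d
   (cong (\ z -> 1# + P * P * P - P * z) (positive-sign e) & l P ε))) where
   l : ∀ P ε -> 1# + P * P * P - P * ε ≡ P * (P * (P * 1#)) - (- 1# + ε * (P * 1#))
   l = ring

  case11 : (+ 11) Zu.∣ (P ^ 7 - (-[1+ 0 ] + ε * P ^ 3)) -> legendre (1# * + n) p ≡ ε -> 11 ND.∣ overpartition (11 N.* p N.^ 2 N.* n)
  case11 d e = finish 11 (Identify11.overpartition-mod M.N) (M.zero11 (hypothesis-zero 11 (P ^ 7) (-[1+ 0 ] + ε * P ^ 3) d
   (cong (\ z -> 1# + P * P * P * (P * P * P) * P - P * P * P * z) (positive-sign e) & l P ε))) where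
   l : ∀ P ε -> 1# + P * P * P * (P * P * P) * P - P * P * P * ε ≡ P * (P * (P * (P * (P * (P * (P * 1#)))))) - (- 1# + ε * (P * (P * (P * 1#))))
   l = ring

open import Defs
open import Data.Nat using (ℕ; _∸_; _<_; _*_; _^_)
open import Data.Nat.DivMod using (_/_; _%_)
open import Data.Nat.Primality using (Prime)
open import Data.Nat.Coprimality using (Coprime)
open import Data.Nat.Divisibility using (_∣_)
open import Data.Integer as ℤ using (ℤ; +_; -[1+_])
open import Data.Integer.Divisibility as ℤD using ()
open import Data.Sum using (_⊎_)
open import Relation.Binary.PropositionalEquality using (_≡_)
open import Data.Sum using (inj₁; inj₂)
open import Data.Product using (_,_)
open import Relation.Binary.PropositionalEquality using (refl)
open Conclusion using (odd-half; module Cases)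

theorem1p3 : (m ℓ : ℕ) (ε : ℤ) →
    (m ≡ 3 ⊎ m ≡ 5 ⊎ m ≡ 7 ⊎ m ≡ 11) →
    Prime ℓ → ℓ % 2 ≡ 1 →
    (ε ≡ + 1 ⊎ ε ≡ -[1+ 0 ]) →
    (+ m) ℤD.∣ ((+ ℓ) ℤ.^ (kOf m ∸ 2) ℤ.- (-[1+ 0 ] ℤ.+ ε ℤ.* (+ ℓ) ℤ.^ ((kOf m ∸ 3) / 2))) →
    (n : ℕ) → 0 < n → Coprime n ℓ →
    legendre ((-[1+ 0 ] ℤ.^ ((kOf m ∸ 1) / 2)) ℤ.* (+ n)) ℓ ≡ ε →
    m ∣ overpartition (m * ℓ ^ 2 * n)
theorem1p3 m ℓ ε m-cases ℓ-prime ℓ-odd _ condition n 0<n coprime symbol with odd-half ℓ ℓ-odd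
-- Once m is a numeral, `kOf m` computes: the exponents of ℓ become 3 and 1, 1 and 0, 3 and 1, 7 and
-- 3, and the sign before n is negative only for m = 5. The hypotheses then match the four cases
-- literally.
theorem1p3 _ _ ε (inj₁ refl) ℓ-prime _ _ condition n 0<n coprime symbol | h , refl = Cases.case3 h ℓ-prime ε n 0<n coprime condition symbol
theorem1p3 _ _ ε (inj₂ (inj₁ refl)) ℓ-prime _ _ condition n 0<n coprime symbol | h , refl = Cases.case5 h ℓ-prime ε n 0<n coprime condition symbol
theorem1p3 _ _ ε (inj₂ (inj₂ (inj₁ refl))) ℓ-prime _ _ condition n 0<n coprime symbol | h , refl = Cases.case7 h ℓ-prime ε n 0<n coprime condition symbol
theorem1p3 _ _ ε (inj₂ (inj₂ (inj₂ refl))) ℓ-prime _ _ condition n 0<n coprime symbol | h , refl = Cases.case11 h ℓ-prime ε n 0<n coprime condition symbol
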